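{- Let $p$ be a prime, let $F$ be an algebraic field extension of $\mathbb{F}_p$, let $S=\{s_1,\dots,s_\nu\}$ be a finite set of irreducible elements of $\mathbb{F}_p[z]$ which remain irreducible in $F[z]$, let $R=F[z,s_1^{ -1},\dots,s_\nu^{ -1}]\subseteq F(z)$, and let $\mathcal{R}$ be the $\mathcal{L}_p(z)^e$-structure with universe $R$ described in the context. Then: (1) The $\mathcal{L}_p(z)^e$-theory of $\mathcal{R}$ is effectively model-complete. (2) Every $\mathcal{L}_p(z)^e$-sentence is equivalent in $\mathcal{R}$ to a sentence of the form $P_\sigma$, where $\sigma$ is a sentence of $\mathcal{L}_p$.
   Context: Languages and structures. $\mathcal{L}_p=\{+,\ x\mapsto x^p,\ =,\ 0,\ 1\}$, with $+$ interpreted as addition, $x\mapsto x^p$ as the Frobenius map, and constants $0,1$; the field $F$ is regarded as an $\mathcal{L}_p$-structure in the obvious way. $\mathcal{L}_p(z)=\mathcal{L}_p\cup\{\,\in F,\ x\mapsto zx\}$, where $x\mapsto zx$ is a unary function symbol interpreted as multiplication by $z$ and $\in F$ is a unary predicate interpreted as membership in $F$. $\mathcal{L}_p(z)^e$ is the extension of $\mathcal{L}_p(z)$ by predicate symbols $P_\sigma$, one for each $\mathcal{L}_p$-formula $\sigma(a_1,\dots,a_n)$ (all free variables of $\sigma$ being among $a_1,\dots,a_n$); $P_\sigma$ is interpreted as the $n$-ary relation "$a_1,\dots,a_n\in F$ and $\sigma(a_1,\dots,a_n)$ is true in the $\mathcal{L}_p$-structure $F$". In particular, if $\sigma$ is a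 sentence, $P_\sigma$ is a $0$-ary predicate which holds iff $F\models\sigma$. $\mathcal{R}$ is the $\mathcal{L}_p(z)^e$-structure with universe $R$ and these interpretations. Effectively model-complete means: there is an algorithm which, given any $\mathcal{L}_p(z)^e$-formula, produces an existential $\mathcal{L}_p(z)^e$-formula in the same free variables that is equivalent to it in $\mathcal{R}$ (equivalently, an algorithm which converts any existential formula into a universal formula equivalent to it in $\mathcal{R}$). -}

module Defs where

open import Algebra.Bundles using (RawRing; RawSemiring; CommutativeRing)
open import Algebra.Definitions.RawSemiring using (Irreducible)
open import Algebra.Morphism.Structures using (module RingMorphisms)
open import Axiom.ExcludedMiddle using (ExcludedMiddle)
open import Data.Fin.Base using (Fin)
import Data.Integer.Base as ℤ
import Data.Integer.Divisibility.Signed as ℤ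
open import Data.List.Base as List using (List; []; _∷_)
open import Data.List.Membership.Propositional using (_∈_)
open import Data.Nat.Base using (ℕ; zero; suc)
open import Data.Product.Base using (Σ; Σ-syntax; ∃-syntax; _×_; _,_; proj₁; proj₂)
open import Data.Sum.Base using (_⊎_)
open import Data.Vec.Base as Vec using (Vec; []; _∷_)
open import Data.Vec.Relation.Binary.Pointwise.Inductive using (Pointwise)
open import Function.Bundles using (_⇔_)
open import Level using (Level; 0ℓ) renaming (suc to lsuc)
open import Relation.Nullary.Negation.Core using (¬_)

private variable
  a : Level
  n k : ℕ

record Signature : Set₁ where
  field
    Fun : ℕ → Set
    Rel : ℕ → Set

module _ (L : Signature) where
  open Signature L

  -- Formula n: free variables among n de Bruijn variables.

  data Term (n : ℕ) : Set where
    var : Fin n → Term n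
    app : Fun k → Vec (Term n) k → Term n

  infix  7 _≐_
  infixr 6 _∧_
  infixr 5 _∨_
  infixr 4 _⇒_

  data Formula (n : ℕ) : Set where
    _≐_         : Term n → Term n → Formula n
    rel         : Rel k → Vec (Term n) k → Formula n
    neg         : Formula n → Formula n
    _∧_ _∨_ _⇒_ : Formula n → Formula n → Formula n
    all ex      : Formula (suc n) → Formula n

  Sentence : Set
  Sentence = Formula 0

  -- "=" is interpreted by the setoid equality _≈_ of the structure; the
  -- elements of the mathematical universe are the ≈-classes.

  record Structure (a : Level) : Set (lsuc a) where
    infix 4 _≈_
    field
      Carrier : Set a
      _≈_     : Carrier → Carrier → Set a
      ⟦_⟧ᶠ    : Fun k → Vec Carrier k → Carrier
      ⟦_⟧ʳ    : Rel k → Vec Carrier k → Set a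

module _ {L : Signature} where

  data QuantifierFree {n : ℕ} : Formula L n → Set where
    eq  : ∀ {s t} → QuantifierFree (s ≐ t)
    rel : ∀ {r : Signature.Rel L k} {ts} → QuantifierFree (rel r ts)
    neg : ∀ {φ} → QuantifierFree φ → QuantifierFree (neg φ)
    and : ∀ {φ ψ} → QuantifierFree φ → QuantifierFree ψ → QuantifierFree (φ ∧ ψ)
    or  : ∀ {φ ψ} → QuantifierFree φ → QuantifierFree ψ → QuantifierFree (φ ∨ ψ)
    imp : ∀ {φ ψ} → QuantifierFree φ → QuantifierFree ψ → QuantifierFree (φ ⇒ ψ)

  data Existential {n : ℕ} : Formula L n → Set where
    qf : ∀ {φ} → QuantifierFree φ → Existential φ
    ex : ∀ {φ} → Existential φ → Existential (ex φ)

  open Structure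

  eval  : (M : Structure L a) → Vec (Carrier M) n → Term L n → Carrier M
  evals : (M : Structure L a) → Vec (Carrier M) n → Vec (Term L n) k → Vec (Carrier M) k
  eval M v (var i)    = Vec.lookup v i
  eval M v (app f ts) = ⟦_⟧ᶠ M f (evals M v ts)
  evals M v []        = []
  evals M v (t ∷ ts)  = eval M v t ∷ evals M v ts

  infix 3 _⊨_[_]

  _⊨_[_] : (M : Structure L a) → Formula L n → Vec (Carrier M) n → Set a
  M ⊨ s ≐ t    [ v ] = _≈_ M (eval M v s) (eval M v t)
  M ⊨ rel r ts [ v ] = ⟦_⟧ʳ M r (evals M v ts)
  M ⊨ neg φ    [ v ] = ¬ (M ⊨ φ [ v ])
  M ⊨ φ ∧ ψ    [ v ] = (M ⊨ φ [ v ]) × (M ⊨ ψ [ v ])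
  M ⊨ φ ∨ ψ    [ v ] = (M ⊨ φ [ v ]) ⊎ (M ⊨ ψ [ v ])
  M ⊨ φ ⇒ ψ    [ v ] = (M ⊨ φ [ v ]) → (M ⊨ ψ [ v ])
  M ⊨ all φ    [ v ] = (x : Carrier M) → M ⊨ φ [ x ∷ v ]
  M ⊨ ex φ     [ v ] = Σ[ x ∈ Carrier M ] (M ⊨ φ [ x ∷ v ])

  -- The truth definition is the usual classical one only in the presence
  -- of excluded middle, so equivalence in M is asserted under it.

  Equivalent : Structure L a → Formula L n → Formula L n → Set (lsuc a)
  Equivalent {a} M φ ψ =
    ExcludedMiddle a → ∀ v → (M ⊨ φ [ v ]) ⇔ (M ⊨ ψ [ v ])

  -- "There is an algorithm" is rendered as a type-theoretic function.  It
  -- is given before excluded middle is assumed, so that only the proof of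
  -- correctness, not the construction of alg φ, may be classical.

  EffectivelyModelComplete : Structure L a → Set (lsuc a)
  EffectivelyModelComplete M =
    Σ[ alg ∈ (∀ {n} → Formula L n → Formula L n) ]
      (∀ {n} (φ : Formula L n) → Existential (alg φ) × Equivalent M φ (alg φ))

record Field (a : Level) : Set (lsuc a) where
  field
    commutativeRing : CommutativeRing a a
  open CommutativeRing commutativeRing public
  field
    1≉0     : ¬ 1# ≈ 0#
    inverse : ∀ x → ¬ x ≈ 0# → ∃[ y ] x * y ≈ 1#

-- ℤ / pℤ: the carrier is ℤ, the equality is congruence modulo p.

𝔽 : ℕ → RawRing 0ℓ 0ℓ
𝔽 p = record
  { Carrier = ℤ.ℤ
  ; _≈_     = λ x y → ℤ.+ p ℤ.∣ x ℤ.- y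
  ; _+_     = ℤ._+_
  ; _*_     = ℤ._*_
  ; -_      = ℤ.-_
  ; 0#      = ℤ.0ℤ
  ; 1#      = ℤ.1ℤ
  }

-- A polynomial is its list of coefficients, constant term first; two
-- lists are equal when they agree up to trailing zeros.

module Polynomial {a ℓ} (A : RawRing a ℓ) where
  open RawRing A

  Poly : Set a
  Poly = List Carrier

  coeff : Poly → ℕ → Carrier
  coeff []      n       = 0#
  coeff (c ∷ f) zero    = c
  coeff (c ∷ f) (suc n) = coeff f n

  infixl 6 _+ᴾ_
  infixl 7 _*ᴾ_

  _+ᴾ_ : Poly → Poly → Poly
  []      +ᴾ g       = g
  (c ∷ f) +ᴾ []      = c ∷ f
  (c ∷ f) +ᴾ (d ∷ g) = (c + d) ∷ (f +ᴾ g)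

  _*ᴾ_ : Poly → Poly → Poly
  []      *ᴾ g = []
  (c ∷ f) *ᴾ g = List.map (c *_) g +ᴾ (0# ∷ (f *ᴾ g))

  polyRing : RawRing a ℓ
  polyRing = record
    { Carrier = Poly
    ; _≈_     = λ f g → ∀ n → coeff f n ≈ coeff g n
    ; _+_     = _+ᴾ_
    ; _*_     = _*ᴾ_
    ; -_      = List.map -_
    ; 0#      = []
    ; 1#      = 1# ∷ []
    }

  IrreduciblePoly : Poly → Set _
  IrreduciblePoly = Irreducible (RawRing.rawSemiring polyRing)

  indeterminate : Poly
  indeterminate = 0# ∷ 1# ∷ []

  evaluate : Poly → Carrier → Carrier
  evaluate f x = List.foldr (λ c y → c + x * y) 0# f

open Polynomial using (Poly; polyRing; IrreduciblePoly; evaluate)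

record AlgebraicExtension (p : ℕ) (F : Field a) : Set a where
  open Field F using (Carrier; _≈_; rawRing; 0#)
  open RingMorphisms (𝔽 p) rawRing using (IsRingHomomorphism)
  field
    ι         : ℤ.ℤ → Carrier
    ι-homo    : IsRingHomomorphism ι
    algebraic : ∀ x → Σ[ f ∈ Poly (𝔽 p) ]
                  (¬ RawRing._≈_ (polyRing (𝔽 p)) f []
                   × evaluate rawRing (List.map ι f) x ≈ 0#)

  extend : Poly (𝔽 p) → Poly rawRing
  extend = List.map ι

module RationalFunctions (F : Field a) where
  open Field F hiding (zero)
  open Polynomial rawRing using (coeff; _+ᴾ_; _*ᴾ_; indeterminate)
  open import Relation.Binary.Reasoning.Setoid setoid

  infix 4 _≈ᴾ_
  _≈ᴾ_ : Poly rawRing → Poly rawRing → Set a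
  _≈ᴾ_ = RawRing._≈_ (polyRing rawRing)

  coeff-+ : ∀ f g n → coeff (f +ᴾ g) n ≈ coeff f n + coeff g n
  coeff-+ []      g       n       = sym (+-identityˡ _)
  coeff-+ (c ∷ f) []      n       = sym (+-identityʳ _)
  coeff-+ (c ∷ f) (d ∷ g) zero    = refl
  coeff-+ (c ∷ f) (d ∷ g) (suc n) = coeff-+ f g n

  coeff-scale : ∀ c f n → coeff (List.map (c *_) f) n ≈ c * coeff f n
  coeff-scale c []      n       = sym (zeroʳ c)
  coeff-scale c (d ∷ f) zero    = refl
  coeff-scale c (d ∷ f) (suc n) = coeff-scale c f n

  shiftˡ : ∀ {c} f g → c ≈ 0# → (c ∷ f) *ᴾ g ≈ᴾ 0# ∷ (f *ᴾ g)
  shiftˡ {c} f g c≈0 n = begin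
    coeff ((c ∷ f) *ᴾ g) n                                 ≈⟨ coeff-+ (List.map (c *_) g) _ n ⟩
    coeff (List.map (c *_) g) n + coeff (0# ∷ (f *ᴾ g)) n  ≈⟨ +-congʳ (coeff-scale c g n) ⟩
    c * coeff g n + coeff (0# ∷ (f *ᴾ g)) n                ≈⟨ +-congʳ (*-congʳ c≈0) ⟩
    0# * coeff g n + coeff (0# ∷ (f *ᴾ g)) n               ≈⟨ +-congʳ (zeroˡ _) ⟩
    0# + coeff (0# ∷ (f *ᴾ g)) n                           ≈⟨ +-identityˡ _ ⟩
    coeff (0# ∷ (f *ᴾ g)) n                                ∎

  shiftʳ : ∀ {d} f g → d ≈ 0# → f *ᴾ (d ∷ g) ≈ᴾ 0# ∷ (f *ᴾ g)
  shiftʳ []          g d≈0 zero    = refl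
  shiftʳ []          g d≈0 (suc n) = refl
  shiftʳ {d} (c ∷ f) g d≈0 zero    = begin
    c * d + 0#  ≈⟨ +-identityʳ _ ⟩
    c * d       ≈⟨ *-congˡ d≈0 ⟩
    c * 0#      ≈⟨ zeroʳ c ⟩
    0#          ∎
  shiftʳ {d} (c ∷ f) g d≈0 (suc n) = begin
    coeff (List.map (c *_) g +ᴾ (f *ᴾ (d ∷ g))) n          ≈⟨ coeff-+ (List.map (c *_) g) _ n ⟩
    coeff (List.map (c *_) g) n + coeff (f *ᴾ (d ∷ g)) n   ≈⟨ +-congˡ (shiftʳ f g d≈0 n) ⟩
    coeff (List.map (c *_) g) n + coeff (0# ∷ (f *ᴾ g)) n  ≈⟨ coeff-+ (List.map (c *_) g) _ n ⟨
    coeff ((c ∷ f) *ᴾ g) n                                 ∎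

  ∷-≈0 : ∀ {c f} → c ≈ 0# → f ≈ᴾ [] → c ∷ f ≈ᴾ []
  ∷-≈0 c≈0 f≈0 zero    = c≈0
  ∷-≈0 c≈0 f≈0 (suc n) = f≈0 n

  cancel : ∀ c d → ¬ c ≈ 0# → c * d ≈ 0# → d ≈ 0#
  cancel c d c≉0 cd≈0 = let e , ce≈1 = inverse c c≉0 in begin
    d            ≈⟨ *-identityˡ d ⟨
    1# * d       ≈⟨ *-congʳ ce≈1 ⟨
    (c * e) * d  ≈⟨ *-congʳ (*-comm c e) ⟩
    (e * c) * d  ≈⟨ *-assoc e c d ⟩
    e * (c * d)  ≈⟨ *-congˡ cd≈0 ⟩
    e * 0#       ≈⟨ zeroʳ e ⟩
    0#           ∎

  *ᴾ-≉0 : ∀ f g → ¬ f ≈ᴾ [] → ¬ g ≈ᴾ [] → ¬ f *ᴾ g ≈ᴾ []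
  *ᴾ-≉0 []      g       f≉0 g≉0 fg≈0 = f≉0 λ _ → refl
  *ᴾ-≉0 (c ∷ f) []      f≉0 g≉0 fg≈0 = g≉0 λ _ → refl
  *ᴾ-≉0 (c ∷ f) (d ∷ g) f≉0 g≉0 fg≈0 = *ᴾ-≉0 (c ∷ f) g f≉0
    (λ g≈0 → g≉0 (∷-≈0 d≈0 g≈0))
    (λ n → trans (sym (shiftʳ (c ∷ f) g d≈0 (suc n))) (fg≈0 (suc n)))
    where
    c≉0 : ¬ c ≈ 0#
    c≉0 c≈0 = *ᴾ-≉0 f (d ∷ g) (λ f≈0 → f≉0 (∷-≈0 c≈0 f≈0)) g≉0
      (λ n → trans (sym (shiftˡ f (d ∷ g) c≈0 (suc n))) (fg≈0 (suc n)))
    d≈0 : d ≈ 0#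
    d≈0 = cancel c d c≉0 (trans (sym (+-identityʳ _)) (fg≈0 zero))

  record Fraction : Set a where
    constructor _/_⟨_⟩
    field
      num   : Poly rawRing
      den   : Poly rawRing
      den≉0 : ¬ den ≈ᴾ []

  open Fraction

  1≉0ᴾ : ¬ 1# ∷ [] ≈ᴾ []
  1≉0ᴾ 1≈0 = 1≉0 (1≈0 zero)

  fromPoly : Poly rawRing → Fraction
  fromPoly f = f / 1# ∷ [] ⟨ 1≉0ᴾ ⟩

  constant : Carrier → Fraction
  constant c = fromPoly (c ∷ [])

  reciprocal : (f : Poly rawRing) → ¬ f ≈ᴾ [] → Fraction
  reciprocal f f≉0 = (1# ∷ []) / f ⟨ f≉0 ⟩

  rationalFunctions : RawSemiring a a
  rationalFunctions = record
    { Carrier = Fraction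
    ; _≈_     = λ x y → num x *ᴾ den y ≈ᴾ num y *ᴾ den x
    ; _+_     = λ x y → (num x *ᴾ den y +ᴾ num y *ᴾ den x) / den x *ᴾ den y
                          ⟨ *ᴾ-≉0 (den x) (den y) (den≉0 x) (den≉0 y) ⟩
    ; _*_     = λ x y → (num x *ᴾ num y) / den x *ᴾ den y
                          ⟨ *ᴾ-≉0 (den x) (den y) (den≉0 x) (den≉0 y) ⟩
    ; 0#      = constant 0#
    ; 1#      = constant 1#
    }

  open RawSemiring rationalFunctions
    using () renaming (_≈_ to _≈ᶠ_; _+_ to _+ᶠ_; _*_ to _*ᶠ_)

  -- F[z, s⁻¹ : s ∈ S] as the subset of F(z) generated by F, z and the
  -- s⁻¹ under + and * (negatives come from the constant -1).

  data Generated (S : List (Poly rawRing)) : Fraction → Set a where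
    const : ∀ c → Generated S (constant c)
    z     : Generated S (fromPoly indeterminate)
    recip : ∀ {s} → s ∈ S → (s≉0 : ¬ s ≈ᴾ []) → Generated S (reciprocal s s≉0)
    add   : ∀ {x y} → Generated S x → Generated S y → Generated S (x +ᶠ y)
    mul   : ∀ {x y} → Generated S x → Generated S y → Generated S (x *ᶠ y)
    resp  : ∀ {x y} → x ≈ᶠ y → Generated S x → Generated S y

  subring : List (Poly rawRing) → RawSemiring a a
  subring S = record
    { Carrier = Σ Fraction (Generated S)
    ; _≈_     = λ x y → proj₁ x ≈ᶠ proj₁ y
    ; _+_     = λ (x , x∈R) (y , y∈R) → x +ᶠ y , add x∈R y∈R
    ; _*_     = λ (x , x∈R) (y , y∈R) → x *ᶠ y , mul x∈R y∈R
    ; 0#      = constant 0# , const 0#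
    ; 1#      = constant 1# , const 1#
    }

data FunLp : ℕ → Set where
  add     : FunLp 2
  frob    : FunLp 1
  nil one : FunLp 0

data NoRel : ℕ → Set where

Lp : Signature
Lp = record { Fun = FunLp ; Rel = NoRel }

data FunLpz : ℕ → Set where
  base   : FunLp n → FunLpz n
  z-mult : FunLpz 1

data RelLpz : ℕ → Set where
  inF : RelLpz 1

Lpz : Signature
Lpz = record { Fun = FunLpz ; Rel = RelLpz }

data RelLpzᵉ : ℕ → Set where
  base : RelLpz n → RelLpzᵉ n
  P    : Formula Lp n → RelLpzᵉ n

Lpzᵉ : Signature
Lpzᵉ = record { Fun = FunLpz ; Rel = RelLpzᵉ }

⟦_⟧Lp : FunLp n → ℕ → (A : RawSemiring a a) →
        Vec (RawSemiring.Carrier A) n → RawSemiring.Carrier A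
⟦ add  ⟧Lp p A (x ∷ y ∷ []) = RawSemiring._+_ A x y
⟦ frob ⟧Lp p A (x ∷ [])     = x ^ p
  where open import Algebra.Definitions.RawSemiring A using (_^_)
⟦ nil  ⟧Lp p A []           = RawSemiring.0# A
⟦ one  ⟧Lp p A []           = RawSemiring.1# A

fieldStructure : ℕ → Field a → Structure Lp a
fieldStructure p F = record
  { Carrier = Carrier
  ; _≈_     = _≈_
  ; ⟦_⟧ᶠ    = λ f → ⟦ f ⟧Lp p (RawRing.rawSemiring rawRing)
  ; ⟦_⟧ʳ    = λ ()
  }
  where open Field F

module _ (p : ℕ) (F : Field a) (S : List (Poly (Field.rawRing F))) where
  open RationalFunctions F
  open RawSemiring (subring S) using (Carrier; _≈_; _*_)

  funR : FunLpz n → Vec Carrier n → Carrier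
  funR (base f) v      = ⟦ f ⟧Lp p (subring S) v
  funR z-mult (x ∷ []) = (fromPoly (Polynomial.indeterminate (Field.rawRing F)) , z) * x

  IsConstant : Carrier → Field.Carrier F → Set _
  IsConstant x c = x ≈ (constant c , const c)

  relR : RelLpzᵉ n → Vec Carrier n → Set _
  relR (base inF) (x ∷ []) = Σ[ c ∈ Field.Carrier F ] IsConstant x c
  relR (P {n} σ)  v        = Σ[ c ∈ Vec (Field.Carrier F) n ]
    (Pointwise IsConstant v c × (fieldStructure p F ⊨ σ [ c ]))

  𝓡 : Structure Lpzᵉ a
  𝓡 = record { Carrier = Carrier ; _≈_ = _≈_ ; ⟦_⟧ᶠ = funR ; ⟦_⟧ʳ = relR }

P-sentence : Sentence Lp → Sentence Lpzᵉ
P-sentence σ = rel (P σ) []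

{-# OPTIONS --safe #-}

-- A relation on R is defined by homogeneous equations Σ a x^{p^k} = 0 (a in
-- 𝔽ₚ[z]) in its arguments and in auxiliary unknowns η in R and c in F, solvable
-- for all arguments, and a condition on the solution that involves only the c and
-- the vanishing of the η.  Relations of this kind are closed under connectives and
-- have existential definitions by means of the predicates P_σ.  A relation without
-- arguments can be tested at the zero solution, which leaves an 𝓛ₚ-sentence.
--
-- Quantifiers are eliminated as follows.  As F is perfect, R is free over its p^D-th
-- powers with basis 1, z, z², …, so the unknowns of an additive form can be brought
-- to a common degree p^D; a linear dependence between the vectors of leading
-- coefficients lowers a degree by a substitution.  If there is none, then each
-- element of R is a value of the form up to a bounded remainder, and bounded values
-- are taken at bounded arguments only.  Bounded elements of R are tuples of elements
-- of F, so a condition on them is a condition over F.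

module Submission where

open import Algebra.Bundles using (CommutativeRing; AbelianGroup; RawRing; RawSemiring)
import Algebra.Definitions.RawMagma as RawMagma
import Algebra.Definitions.RawSemiring as RawSemiringDefinitions
import Algebra.Properties.Ring
import Algebra.Properties.Semiring.Exp
import Algebra.Solver.Ring as RingSolver
open import Algebra.Solver.Ring.AlmostCommutativeRing using (fromCommutativeRing; _-Raw-AlmostCommutative⟶_)
open import Algebra.Structures using (IsCommutativeRing; IsAbelianGroup)
open import Data.Bool.Base using (Bool; true; false; if_then_else_)
open import Data.Empty using (⊥-elim; ⊥)
open import Data.Fin.Base as Fin using (Fin; toℕ; fromℕ<; funToFin; finToFun; zero; suc; _↑ˡ_; _↑ʳ_; splitAt)
import Data.Fin.Properties as Fin
import Data.Integer.Base as ℤ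
import Data.Integer.DivMod as ℤ
import Data.Integer.Divisibility.Signed as ℤ
import Data.Integer.Properties as ℤ
import Data.Integer.Tactic.RingSolver as ℤ
open import Data.List.Base as List using (List; []; _∷_; _++_; map; concatMap; allFin; tabulate; length; replicate; take; drop; foldr)
open import Data.List.Membership.Propositional using (_∈_)
import Data.List.Membership.Propositional.Properties as ∈
open import Data.List.Properties using (map-tabulate; length-++; length-replicate; length-take; ++-identityʳ; length-tabulate)
open import Data.List.Relation.Unary.All as All using (All; []; _∷_)
import Data.List.Relation.Unary.All.Properties as All
open import Data.List.Relation.Unary.Any as Any using (Any; here; there)
open import Data.Maybe.Base using (Maybe; just; nothing)
open import Data.Nat.Base as ℕ using (ℕ; zero; suc; _≤_; z≤n; s≤s; pred)
open import Data.Nat.Combinatorics using (_C_; k![n∸k]!∣n!; nCk≡n!/k![n-k]!; nCn≡1; nCk≡nC[n∸k])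
open import Data.Nat.DivMod using (m/n*n≡m)
open import Data.Nat.Divisibility as ℕ∣ using (_∣_; ∣⇒≤; divides)
open import Data.Nat.Primality using (Prime; euclidsLemma; prime⇒nonZero; prime⇒nonTrivial)
import Data.Nat.Properties as ℕ
open import Data.Nat.Tactic.RingSolver using (solve-∀)
open import Data.Product.Base using (_×_; _,_; proj₁; proj₂; Σ-syntax; ∃-syntax; Σ)
open import Data.Sum.Base using (inj₁; inj₂; _⊎_; [_,_]′)
open import Data.Unit.Base using (⊤; tt)
open import Defs using (module Polynomial; Field; module RationalFunctions; AlgebraicExtension; 𝔽)
open import Function.Base using (_∘_; id)
open import Level as Level using (Level; _⊔_; 0ℓ)
  renaming (suc to lsuc)
open import Relation.Binary.PropositionalEquality as ≡ using (_≡_)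
import Relation.Binary.Reasoning.Setoid as SetoidReasoning
open import Relation.Nullary using (yes; no; does; ¬_; Dec)
open import Relation.Nullary.Decidable using (dec-true; dec-false; map′; ¬?; decidable-stable)

-- That the equations of a definition are solvable for all arguments makes negation free of cost:
-- every solution decides the relation, so a complement only negates the condition. The cost falls
-- on the existential quantifier, after which such a system has to be found anew. A particular
-- approximate solution `x₀` serves: each true solution differs from it by a bounded `d`, so only
-- elements of F remain to be quantified. Whether a given element of R is bounded must then also be
-- read off an equation that is always solvable; division with remainder by 1 + s z^L does this, as
-- it is prime to s and its degree is at least the strict degree bound of the numerators in
-- question.
--
-- Bounds shrink because the lower terms of a normal form have exponents at most p^(D-1) while the
-- leading ones have exponent p^D: each pass gains a factor p against fixed losses.
--
-- Effectiveness shapes the rest. F has no decidable equality while formulas are built, so forms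
-- have coefficients in 𝔽ₚ[z], where every case distinction and every bound is computed; excluded
-- middle enters only with a `Model`.

-- Commutative rings: integer coefficients, finite sums, Frobenius powers, homomorphisms.

-- ℤ as the coefficient ring of the ring solver over an arbitrary
-- commutative ring.

module IntegerSolver {c ℓ} (R : CommutativeRing c ℓ) where
  open CommutativeRing R
  open import Relation.Binary.Reasoning.Setoid setoid
  open import Algebra.Properties.Ring ring
  open import Algebra.Properties.Semiring.Mult semiring using (×1-homo-*; ×-homo-+; ×-congˡ)
    renaming (_×_ to _·_)

  fromℕ : ℕ → Carrier
  fromℕ n = n · 1#

  fromℤ : ℤ.ℤ → Carrier
  fromℤ (ℤ.+ n)      = fromℕ n
  fromℤ (ℤ.-[1+ n ]) = - fromℕ (suc n)

  private
    cancelʳ : ∀ a x y → (a + x) + - (a + y) ≈ x + - y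
    cancelʳ a x y = begin
      (a + x) + - (a + y)      ≈⟨ +-congˡ (sym (-‿+-comm a y)) ⟩
      (a + x) + (- a + - y)    ≈⟨ +-congʳ (+-comm a x) ⟩
      (x + a) + (- a + - y)    ≈⟨ +-assoc x a _ ⟩
      x + (a + (- a + - y))    ≈⟨ +-congˡ (sym (+-assoc a _ _)) ⟩
      x + ((a + - a) + - y)    ≈⟨ +-congˡ (+-congʳ (-‿inverseʳ a)) ⟩
      x + (0# + - y)           ≈⟨ +-congˡ (+-identityˡ _) ⟩
      x + - y                  ∎

  fromℤ-⊖ : ∀ m n → fromℤ (m ℤ.⊖ n) ≈ fromℕ m + - fromℕ n
  fromℤ-⊖ m       zero    = sym (trans (+-congˡ -0#≈0#) (+-identityʳ _))
  fromℤ-⊖ zero    (suc n) = sym (+-identityˡ _)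
  fromℤ-⊖ (suc m) (suc n) = begin
    fromℤ (suc m ℤ.⊖ suc n)           ≡⟨ ≡.cong fromℤ (ℤ.[1+m]⊖[1+n]≡m⊖n m n) ⟩
    fromℤ (m ℤ.⊖ n)                   ≈⟨ fromℤ-⊖ m n ⟩
    fromℕ m + - fromℕ n               ≈⟨ cancelʳ 1# _ _ ⟨
    fromℕ (suc m) + - fromℕ (suc n)   ∎

  fromℤ-+ : ∀ i j → fromℤ (i ℤ.+ j) ≈ fromℤ i + fromℤ j
  fromℤ-+ (ℤ.+ m)      (ℤ.+ n)      = ×-homo-+ 1# m n
  fromℤ-+ (ℤ.+ m)      (ℤ.-[1+ n ]) = fromℤ-⊖ m (suc n)
  fromℤ-+ (ℤ.-[1+ m ]) (ℤ.+ n)      = trans (fromℤ-⊖ n (suc m)) (+-comm _ _)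
  fromℤ-+ (ℤ.-[1+ m ]) (ℤ.-[1+ n ]) = begin
    - fromℕ (suc (suc (m ℕ.+ n)))        ≡⟨ ≡.cong (λ k → - fromℕ (suc k)) (ℕ.+-suc m n) ⟨
    - fromℕ (suc m ℕ.+ suc n)            ≈⟨ -‿cong (×-homo-+ 1# (suc m) (suc n)) ⟩
    - (fromℕ (suc m) + fromℕ (suc n))    ≈⟨ -‿+-comm _ _ ⟨
    - fromℕ (suc m) + - fromℕ (suc n)    ∎

  fromℤ-neg : ∀ i → fromℤ (ℤ.- i) ≈ - fromℤ i
  fromℤ-neg (ℤ.+ zero)   = sym -0#≈0#
  fromℤ-neg (ℤ.+ suc n)  = refl
  fromℤ-neg (ℤ.-[1+ n ]) = sym (-‿involutive _)

  fromℤ-* : ∀ i j → fromℤ (i ℤ.* j) ≈ fromℤ i * fromℤ j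
  fromℤ-* (ℤ.+ m) (ℤ.+ n) = begin
    fromℤ (ℤ.+ m ℤ.* ℤ.+ n)  ≡⟨ ≡.cong fromℤ (ℤ.pos-* m n) ⟨
    fromℕ (m ℕ.* n)          ≈⟨ ×1-homo-* m n ⟩
    fromℕ m * fromℕ n        ∎
  fromℤ-* (ℤ.+ m) (ℤ.-[1+ n ]) = begin
    fromℤ (ℤ.+ m ℤ.* ℤ.- (ℤ.+ suc n))    ≡⟨ ≡.cong fromℤ (ℤ.neg-distribʳ-* (ℤ.+ m) (ℤ.+ suc n)) ⟨
    fromℤ (ℤ.- (ℤ.+ m ℤ.* ℤ.+ suc n))    ≈⟨ fromℤ-neg (ℤ.+ m ℤ.* ℤ.+ suc n) ⟩
    - fromℤ (ℤ.+ m ℤ.* ℤ.+ suc n)        ≈⟨ -‿cong (fromℤ-* (ℤ.+ m) (ℤ.+ suc n)) ⟩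
    - (fromℕ m * fromℕ (suc n))          ≈⟨ -‿distribʳ-* _ _ ⟩
    fromℕ m * - fromℕ (suc n)            ∎
  fromℤ-* (ℤ.-[1+ m ]) j = begin
    fromℤ (ℤ.- (ℤ.+ suc m) ℤ.* j)    ≡⟨ ≡.cong fromℤ (ℤ.neg-distribˡ-* (ℤ.+ suc m) j) ⟨
    fromℤ (ℤ.- (ℤ.+ suc m ℤ.* j))    ≈⟨ fromℤ-neg (ℤ.+ suc m ℤ.* j) ⟩
    - fromℤ (ℤ.+ suc m ℤ.* j)        ≈⟨ -‿cong (pos j) ⟩
    - (fromℕ (suc m) * fromℤ j)      ≈⟨ -‿distribˡ-* _ _ ⟩
    - fromℕ (suc m) * fromℤ j        ∎
    where
    pos : ∀ j → fromℤ (ℤ.+ suc m ℤ.* j) ≈ fromℕ (suc m) * fromℤ j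
    pos (ℤ.+ n)      = trans (reflexive (≡.cong fromℤ (≡.sym (ℤ.pos-* (suc m) n)))) (×1-homo-* (suc m) n)
    pos (ℤ.-[1+ n ]) = begin
      fromℤ (ℤ.+ suc m ℤ.* ℤ.- (ℤ.+ suc n))  ≡⟨ ≡.cong fromℤ (ℤ.neg-distribʳ-* (ℤ.+ suc m) (ℤ.+ suc n)) ⟨
      fromℤ (ℤ.- (ℤ.+ suc m ℤ.* ℤ.+ suc n))  ≈⟨ fromℤ-neg (ℤ.+ suc m ℤ.* ℤ.+ suc n) ⟩
      - fromℤ (ℤ.+ suc m ℤ.* ℤ.+ suc n)      ≡⟨ ≡.cong (λ i → - fromℤ i) (ℤ.pos-* (suc m) (suc n)) ⟨
      - fromℕ (suc m ℕ.* suc n)              ≈⟨ -‿cong (×1-homo-* (suc m) (suc n)) ⟩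
      - (fromℕ (suc m) * fromℕ (suc n))      ≈⟨ -‿distribʳ-* _ _ ⟩
      fromℕ (suc m) * - fromℕ (suc n)        ∎

  fromℤ-1 : fromℤ (ℤ.+ 1) ≈ 1#
  fromℤ-1 = +-identityʳ 1#

  private
    morphism : ℤ.+-*-rawRing -Raw-AlmostCommutative⟶ fromCommutativeRing R
    morphism = record
      { ⟦_⟧    = fromℤ
      ; +-homo = fromℤ-+
      ; *-homo = fromℤ-*
      ; -‿homo = fromℤ-neg
      ; 0-homo = refl
      ; 1-homo = fromℤ-1
      }

    _coeff≟_ : ∀ i j → Maybe (fromℤ i ≈ fromℤ j)
    i coeff≟ j with i ℤ.≟ j
    ... | yes ≡.refl = just refl
    ... | no  _      = nothing

  open RingSolver ℤ.+-*-rawRing (fromCommutativeRing R) morphism _coeff≟_ public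
    using (solve; _:=_; _:+_; _:*_; :-_; _:-_; con; Polynomial)

  infix 10 :1 :0
  :1 :0 : ∀ {n} → Polynomial n
  :1 = con (ℤ.+ 1)
  :0 = con (ℤ.+ 0)

module FiniteSums {c ℓ} (R : CommutativeRing c ℓ) where
  open CommutativeRing R
  open import Relation.Binary.Reasoning.Setoid setoid
  open import Algebra.Properties.Ring ring using (-0#≈0#; -‿+-comm)
  open import Algebra.Properties.CommutativeSemigroup +-commutativeSemigroup using (interchange)

  private variable
    i j : Level
    I : Set i
    J : Set j

  infix 5 ∑
  ∑ : List I → (I → Carrier) → Carrier
  ∑ []       g = 0#
  ∑ (x ∷ xs) g = g x + ∑ xs g

  ∑-cong : ∀ (xs : List I) {g h} → (∀ x → g x ≈ h x) → ∑ xs g ≈ ∑ xs h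
  ∑-cong []       eq = refl
  ∑-cong (x ∷ xs) eq = +-cong (eq x) (∑-cong xs eq)

  ∑-zero : ∀ (xs : List I) {g} → (∀ x → g x ≈ 0#) → ∑ xs g ≈ 0#
  ∑-zero []       eq = refl
  ∑-zero (x ∷ xs) eq = trans (+-cong (eq x) (∑-zero xs eq)) (+-identityˡ 0#)

  ∑-+ : ∀ (xs : List I) g h → ∑ xs (λ x → g x + h x) ≈ ∑ xs g + ∑ xs h
  ∑-+ []       g h = sym (+-identityˡ 0#)
  ∑-+ (x ∷ xs) g h = trans (+-congˡ (∑-+ xs g h)) (interchange _ _ _ _)

  ∑-*ˡ : ∀ a (xs : List I) g → a * ∑ xs g ≈ ∑ xs (λ x → a * g x)
  ∑-*ˡ a []       g = zeroʳ a
  ∑-*ˡ a (x ∷ xs) g = trans (distribˡ a _ _) (+-congˡ (∑-*ˡ a xs g))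

  ∑-*ʳ : ∀ a (xs : List I) g → ∑ xs g * a ≈ ∑ xs (λ x → g x * a)
  ∑-*ʳ a xs g = trans (*-comm _ a) (trans (∑-*ˡ a xs g) (∑-cong xs λ x → *-comm a (g x)))

  ∑-neg : ∀ (xs : List I) g → - ∑ xs g ≈ ∑ xs (λ x → - g x)
  ∑-neg []       g = -0#≈0#
  ∑-neg (x ∷ xs) g = trans (sym (-‿+-comm _ _)) (+-congˡ (∑-neg xs g))

  ∑-++ : ∀ (xs ys : List I) g → ∑ (xs ++ ys) g ≈ ∑ xs g + ∑ ys g
  ∑-++ []       ys g = sym (+-identityˡ _)
  ∑-++ (x ∷ xs) ys g = trans (+-congˡ (∑-++ xs ys g)) (sym (+-assoc _ _ _))

  ∑-map : ∀ (f : I → J) xs g → ∑ (map f xs) g ≈ ∑ xs (λ x → g (f x))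
  ∑-map f []       g = refl
  ∑-map f (x ∷ xs) g = +-congˡ (∑-map f xs g)

  ∑-concatMap : ∀ (f : I → List J) xs g → ∑ (concatMap f xs) g ≈ ∑ xs (λ x → ∑ (f x) g)
  ∑-concatMap f []       g = refl
  ∑-concatMap f (x ∷ xs) g = trans (∑-++ (f x) _ g) (+-congˡ (∑-concatMap f xs g))

  ∑-swap : ∀ (xs : List I) (ys : List J) (g : I → J → Carrier) →
           ∑ xs (λ x → ∑ ys (g x)) ≈ ∑ ys (λ y → ∑ xs (λ x → g x y))
  ∑-swap []       ys g = sym (∑-zero ys λ _ → refl)
  ∑-swap (x ∷ xs) ys g = trans (+-congˡ (∑-swap xs ys g)) (sym (∑-+ ys (g x) (λ y → ∑ xs λ x′ → g x′ y)))

  ∑-allFin-suc : ∀ n (g : Fin (suc n) → Carrier) →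
                 ∑ (allFin (suc n)) g ≈ g Fin.zero + ∑ (allFin n) (λ k → g (Fin.suc k))
  ∑-allFin-suc n g = +-congˡ (begin
    ∑ (tabulate Fin.suc) g              ≡⟨ ≡.cong (λ xs → ∑ xs g) (map-tabulate (λ k → k) Fin.suc) ⟨
    ∑ (map Fin.suc (allFin n)) g        ≈⟨ ∑-map Fin.suc (allFin n) g ⟩
    ∑ (allFin n) (λ k → g (Fin.suc k))  ∎)

  ∑-single : ∀ {n} (k : Fin n) (g : Fin n → Carrier) → (∀ l → ¬ l ≡ k → g l ≈ 0#) → ∑ (allFin n) g ≈ g k
  ∑-single {suc n} Fin.zero g g≈0 = begin
    ∑ (allFin (suc n)) g                            ≈⟨ ∑-allFin-suc n g ⟩
    g Fin.zero + ∑ (allFin n) (λ k → g (Fin.suc k))  ≈⟨ +-congˡ (∑-zero (allFin n) λ l → g≈0 _ λ ()) ⟩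
    g Fin.zero + 0#                                  ≈⟨ +-identityʳ _ ⟩
    g Fin.zero                                       ∎
  ∑-single {suc n} (Fin.suc k) g g≈0 = begin
    ∑ (allFin (suc n)) g                             ≈⟨ ∑-allFin-suc n g ⟩
    g Fin.zero + ∑ (allFin n) (λ k → g (Fin.suc k))  ≈⟨ +-cong (g≈0 _ λ ()) (∑-single k _ λ l l≢k → g≈0 _ λ { ≡.refl → l≢k ≡.refl }) ⟩
    0# + g (Fin.suc k)                               ≈⟨ +-identityˡ _ ⟩
    g (Fin.suc k)                                    ∎

  only : ∀ {a} {A : Set a} → Dec A → Carrier → Carrier
  only d x = if does d then x else 0#

  only-yes : ∀ {a} {A : Set a} (d : Dec A) x → A → only d x ≈ x
  only-yes d x a rewrite dec-true d a = refl

  only-no : ∀ {a} {A : Set a} (d : Dec A) x → ¬ A → only d x ≈ 0#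
  only-no d x ¬a rewrite dec-false d ¬a = refl

  ∑-only : ∀ {n} (k : Fin n) (g : Fin n → Carrier) → ∑ (allFin n) (λ l → only (l Fin.≟ k) (g l)) ≈ g k
  ∑-only k g = trans (∑-single k _ λ l l≢k → only-no (l Fin.≟ k) (g l) l≢k) (only-yes (k Fin.≟ k) (g k) ≡.refl)

  -- Each `g k` is written as a sum of indicators over the preimages of `k`, of which there is at
  -- most one; exchanging the two sums leaves the values at the positions.
  ∑-injection : ∀ {n q} (pos : Fin n → Fin q) → (∀ {i j} → pos i ≡ pos j → i ≡ j) →
                ∀ g → (∀ k → (∀ i → ¬ pos i ≡ k) → g k ≈ 0#) →
                ∑ (allFin q) g ≈ ∑ (allFin n) (λ i → g (pos i))
  ∑-injection {n} {q} pos inj g g≈0 = begin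
    ∑ (allFin q) g
      ≈⟨ ∑-cong (allFin q) pointwise ⟩
    ∑ (allFin q) (λ k → ∑ (allFin n) λ i → only (k Fin.≟ pos i) (g k))
      ≈⟨ ∑-swap (allFin q) (allFin n) (λ k i → only (k Fin.≟ pos i) (g k)) ⟩
    ∑ (allFin n) (λ i → ∑ (allFin q) λ k → only (k Fin.≟ pos i) (g k))
      ≈⟨ ∑-cong (allFin n) (λ i → ∑-only (pos i) g) ⟩
    ∑ (allFin n) (λ i → g (pos i)) ∎
    where
    pointwise : ∀ k → g k ≈ ∑ (allFin n) λ i → only (k Fin.≟ pos i) (g k)
    pointwise k with Fin.any? (λ i → pos i Fin.≟ k)
    ... | yes (i , ≡.refl) = sym (trans
      (∑-single i _ λ l l≢i → only-no (pos i Fin.≟ pos l) (g (pos i)) λ eq → l≢i (≡.sym (inj eq)))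
      (only-yes (pos i Fin.≟ pos i) (g (pos i)) ≡.refl))
    ... | no ∄i = trans (g≈0 k λ i eq → ∄i (i , eq))
      (sym (∑-zero (allFin n) λ i → only-no (k Fin.≟ pos i) (g k) λ eq → ∄i (i , ≡.sym eq)))

module Frobenius {c ℓ} (R : CommutativeRing c ℓ) (p : ℕ) (p-prime : Prime p)
  (char : CommutativeRing._≈_ R (IntegerSolver.fromℕ R p) (CommutativeRing.0# R)) where
  open CommutativeRing R
  open FiniteSums R
  open IntegerSolver R using (fromℕ)
  open import Relation.Binary.Reasoning.Setoid setoid
  open import Algebra.Properties.Ring ring
  open import Algebra.Properties.Semiring.Mult semiring using (×-assoc-*; ×-congʳ; ×1-homo-*)
    renaming (_×_ to _·_)
  open import Algebra.Properties.Semiring.Exp semiring public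
    using (_^_; ^-congˡ; ^-homo-*; ^-assocʳ)
  open import Algebra.Properties.CommutativeSemiring.Exp commutativeSemiring public using (^-distrib-*)
  open import Algebra.Properties.CommutativeSemiring.Binomial commutativeSemiring
    using (binomialTerm) renaming (theorem to binomial)
  open import Algebra.Properties.CommutativeMonoid.Sum +-commutativeMonoid using (sum; sum-cong-≋; sum-init-last)

  private
    p∤k! : ∀ k → k ℕ.< p → ¬ p ∣ k ℕ.!
    p∤k! zero    k<p p∣ = ℕ.<⇒≱ (ℕ.nonTrivial⇒n>1 p {{prime⇒nonTrivial p-prime}}) (∣⇒≤ p∣)
    p∤k! (suc k) k<p p∣ with euclidsLemma (suc k) (k ℕ.!) p-prime p∣
    ... | inj₁ p∣1+k = ℕ.<⇒≱ k<p (∣⇒≤ p∣1+k)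
    ... | inj₂ p∣k!  = p∤k! k (ℕ.<-trans (ℕ.n<1+n k) k<p) p∣k!

    n∣n! : ∀ n → .{{ℕ.NonZero n}} → n ∣ n ℕ.!
    n∣n! (suc n) = divides (n ℕ.!) (ℕ.*-comm (suc n) (n ℕ.!))

    -- The product of `p C k` with k! (p - k)! is p!, which p divides; by primality p divides one of
    -- the factors, and neither of the two smaller factorials qualifies.
    p∣pCk : ∀ k → 0 ℕ.< k → k ℕ.< p → p ∣ (p C k)
    p∣pCk k 0<k k<p with euclidsLemma (p C k) (k ℕ.! ℕ.* (p ℕ.∸ k) ℕ.!) p-prime p∣product
      where
      instance
        _ = k ℕ.!* (p ℕ.∸ k) !≢0
        _ = prime⇒nonZero p-prime
      p∣product : p ∣ (p C k) ℕ.* (k ℕ.! ℕ.* (p ℕ.∸ k) ℕ.!)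
      p∣product = ≡.subst (p ∣_) (≡.sym (≡.trans (≡.cong (ℕ._* (k ℕ.! ℕ.* (p ℕ.∸ k) ℕ.!)) (nCk≡n!/k![n-k]! (ℕ.<⇒≤ k<p)))
        (m/n*n≡m (k![n∸k]!∣n! (ℕ.<⇒≤ k<p))))) (n∣n! p)
    ... | inj₁ p∣C = p∣C
    ... | inj₂ p∣k!r! with euclidsLemma (k ℕ.!) ((p ℕ.∸ k) ℕ.!) p-prime p∣k!r!
    ...   | inj₁ p∣k! = ⊥-elim (p∤k! k k<p p∣k!)
    ...   | inj₂ p∣r! = ⊥-elim (p∤k! (p ℕ.∸ k) (ℕ.∸-monoʳ-< 0<k (ℕ.<⇒≤ k<p)) p∣r!)

    multiple≈0 : ∀ {n} x → p ∣ n → n · x ≈ 0#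
    multiple≈0 {n} x (divides m ≡.refl) = begin
      (m ℕ.* p) · x            ≈⟨ ×-congʳ (m ℕ.* p) (*-identityˡ x) ⟨
      (m ℕ.* p) · (1# * x)     ≈⟨ ×-assoc-* (m ℕ.* p) 1# x ⟨
      ((m ℕ.* p) · 1#) * x     ≈⟨ *-congʳ (×1-homo-* m p) ⟩
      (m · 1# * (p · 1#)) * x  ≈⟨ *-congʳ (*-congˡ char) ⟩
      (m · 1# * 0#) * x        ≈⟨ *-congʳ (zeroʳ _) ⟩
      0# * x                   ≈⟨ zeroˡ x ⟩
      0#                       ∎

    sum-zero : ∀ n {g : Fin n → Carrier} → (∀ k → g k ≈ 0#) → sum g ≈ 0#
    sum-zero zero    eq = refl
    sum-zero (suc n) eq = trans (+-cong (eq Fin.zero) (sum-zero n λ k → eq (Fin.suc k))) (+-identityˡ 0#)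

    binomial-outer : ∀ m x y → (∀ k → 0 ℕ.< k → k ℕ.< suc m → p ∣ (suc m C k)) →
                     (x + y) ^ suc m ≈ x ^ suc m + y ^ suc m
    binomial-outer m x y p∣ = begin
      (x + y) ^ suc m                              ≈⟨ binomial (suc m) x y ⟩
      t Fin.zero + sum (λ k → t (Fin.suc k))       ≈⟨ +-congˡ (sum-init-last {m} (λ k → t (Fin.suc k))) ⟩
      t Fin.zero + (sum inner + t (Fin.suc (Fin.fromℕ m)))
                                                   ≈⟨ +-cong first (+-cong (sum-zero m inner≈0) final) ⟩
      y ^ suc m + (0# + x ^ suc m)                 ≈⟨ +-congˡ (+-identityˡ _) ⟩
      y ^ suc m + x ^ suc m                        ≈⟨ +-comm _ _ ⟩
      x ^ suc m + y ^ suc m                        ∎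
      where
      t = binomialTerm x y (suc m)
      inner : Fin m → Carrier
      inner k = t (Fin.suc (Fin.inject₁ k))
      inner≈0 : ∀ k → inner k ≈ 0#
      inner≈0 k rewrite Fin.toℕ-inject₁ k =
        multiple≈0 _ (p∣ (suc (Fin.toℕ k)) (ℕ.s≤s ℕ.z≤n) (ℕ.s≤s (Fin.toℕ<n k)))
      first : t Fin.zero ≈ y ^ suc m
      first = trans (reflexive (≡.cong (_· (1# * y ^ suc m)) (≡.trans (nCk≡nC[n∸k] {0} {suc m} ℕ.z≤n) (nCn≡1 (suc m)))))
                    (trans (+-identityʳ _) (*-identityˡ _))
      final : t (Fin.suc (Fin.fromℕ m)) ≈ x ^ suc m
      final = at (Fin.toℕ-fromℕ m)
        where
        at : ∀ {k} → k ≡ m → (suc m C suc k) · (x ^ suc k * y ^ (suc m ℕ.∸ suc k)) ≈ x ^ suc m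
        at ≡.refl = begin
          (suc m C suc m) · (x ^ suc m * y ^ (m ℕ.∸ m))
            ≡⟨ ≡.cong₂ (λ c r → c · (x ^ suc m * y ^ r)) (nCn≡1 (suc m)) (ℕ.n∸n≡0 m) ⟩
          1 · (x ^ suc m * 1#)
            ≈⟨ trans (+-identityʳ _) (*-identityʳ _) ⟩
          x ^ suc m ∎

  frobenius-+ : ∀ x y → (x + y) ^ p ≈ x ^ p + y ^ p
  frobenius-+ x y = outer p p∣pCk (prime⇒nonZero p-prime)
    where
    outer : ∀ m → (∀ k → 0 ℕ.< k → k ℕ.< m → p ∣ (m C k)) → ℕ.NonZero m →
            (x + y) ^ m ≈ x ^ m + y ^ m
    outer (suc m) p∣ _ = binomial-outer m x y p∣

  0^p≈0 : 0# ^ p ≈ 0#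
  0^p≈0 = x+x≈x⇒x≈0 _ (trans (sym (frobenius-+ 0# 0#)) (^-congˡ p (+-identityˡ 0#)))

  -- Iterated p-th powers by recursion rather than a single power p^k: one Frobenius step unfolds by
  -- definition, as in the terms `frobᵗ`. `φ≈^` gives the closed form.
  infixr 8 _^p^_
  _^p^_ : Carrier → ℕ → Carrier
  x ^p^ zero  = x
  x ^p^ suc k = (x ^ p) ^p^ k

  φ-cong : ∀ k {x y} → x ≈ y → x ^p^ k ≈ y ^p^ k
  φ-cong zero    eq = eq
  φ-cong (suc k) eq = φ-cong k (^-congˡ p eq)

  φ-+ : ∀ k x y → (x + y) ^p^ k ≈ x ^p^ k + y ^p^ k
  φ-+ zero    x y = refl
  φ-+ (suc k) x y = trans (φ-cong k (frobenius-+ x y)) (φ-+ k _ _)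

  φ-0 : ∀ k → 0# ^p^ k ≈ 0#
  φ-0 zero    = refl
  φ-0 (suc k) = trans (φ-cong k 0^p≈0) (φ-0 k)

  φ-* : ∀ k x y → (x * y) ^p^ k ≈ x ^p^ k * y ^p^ k
  φ-* zero    x y = refl
  φ-* (suc k) x y = trans (φ-cong k (^-distrib-* x y p)) (φ-* k _ _)

  -- By uniqueness of additive inverses, so that p = 2 needs no separate case.
  φ-neg : ∀ k x → (- x) ^p^ k ≈ - x ^p^ k
  φ-neg k x = +-inverseʳ-unique _ _ (trans (sym (φ-+ k x (- x))) (trans (φ-cong k (-‿inverseʳ x)) (φ-0 k)))

  φ-∑ : ∀ k {i} {I : Set i} (xs : List I) g → (∑ xs g) ^p^ k ≈ ∑ xs (λ x → g x ^p^ k)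
  φ-∑ k []       g = φ-0 k
  φ-∑ k (x ∷ xs) g = trans (φ-+ k _ _) (+-congˡ (φ-∑ k xs g))

  φ-φ : ∀ j k x → (x ^p^ j) ^p^ k ≈ x ^p^ (j ℕ.+ k)
  φ-φ zero    k x = refl
  φ-φ (suc j) k x = φ-φ j k (x ^ p)

  φ-suc : ∀ k x → x ^p^ suc k ≈ (x ^p^ k) ^ p
  φ-suc zero    x = refl
  φ-suc (suc k) x = φ-suc k (x ^ p)

  φ≈^ : ∀ k x → x ^p^ k ≈ x ^ (p ℕ.^ k)
  φ≈^ zero    x = sym (*-identityʳ x)
  φ≈^ (suc k) x = trans (φ≈^ k (x ^ p)) (^-assocʳ x p (p ℕ.^ k))

record RingHom {a b c d} (K : CommutativeRing a b) (R : CommutativeRing c d) : Set (a ⊔ b ⊔ c ⊔ d) where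
  private
    module K = CommutativeRing K
    module R = CommutativeRing R
  field
    to     : K.Carrier → R.Carrier
    to-cong : ∀ {x y} → x K.≈ y → to x R.≈ to y
    to-+   : ∀ x y → to (x K.+ y) R.≈ to x R.+ to y
    to-*   : ∀ x y → to (x K.* y) R.≈ to x R.* to y
    to-1   : to K.1# R.≈ R.1#

  to-0 : to K.0# R.≈ R.0#
  to-0 = x+x≈x⇒x≈0 _ (R.trans (R.sym (to-+ _ _)) (to-cong (K.+-identityˡ _)))
    where open import Algebra.Properties.Ring R.ring

  to-neg : ∀ x → to (K.- x) R.≈ R.- to x
  to-neg x = +-inverseʳ-unique _ _ (R.trans (R.sym (to-+ _ _)) (R.trans (to-cong (K.-‿inverseʳ x)) to-0))
    where open import Algebra.Properties.Ring R.ring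

  open import Algebra.Properties.Semiring.Exp K.semiring using () renaming (_^_ to _^ᴷ_)
  open import Algebra.Properties.Semiring.Exp R.semiring using () renaming (_^_ to _^ᴿ_)

  to-^ : ∀ x n → to (x ^ᴷ n) R.≈ to x ^ᴿ n
  to-^ x zero    = to-1
  to-^ x (suc n) = R.trans (to-* _ _) (R.*-congˡ (to-^ x n))

  private
    module ∑K = FiniteSums K
    module ∑R = FiniteSums R

  to-∑ : ∀ {i} {I : Set i} (xs : List I) g → to (∑K.∑ xs g) R.≈ ∑R.∑ xs (λ x → to (g x))
  to-∑ []       g = to-0
  to-∑ (x ∷ xs) g = R.trans (to-+ _ _) (R.+-congˡ (to-∑ xs g))

_∘ʰ_ : ∀ {a b c d e f} {K : CommutativeRing a b} {L : CommutativeRing c d} {M : CommutativeRing e f} →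
       RingHom L M → RingHom K L → RingHom K M
_∘ʰ_ {M = M} g f = record
  { to      = λ x → G.to (F.to x)
  ; to-cong = λ eq → G.to-cong (F.to-cong eq)
  ; to-+    = λ x y → M.trans (G.to-cong (F.to-+ x y)) (G.to-+ _ _)
  ; to-*    = λ x y → M.trans (G.to-cong (F.to-* x y)) (G.to-* _ _)
  ; to-1    = M.trans (G.to-cong F.to-1) G.to-1
  }
  where
  module M = CommutativeRing M
  module F = RingHom f
  module G = RingHom g

-- Polynomials over a commutative ring: ring laws, evaluation, degrees, division.

module PolynomialRing {a ℓ} (K : CommutativeRing a ℓ) where
  open CommutativeRing K hiding (zero; _-_)
  open Polynomial rawRing public using (Poly; coeff; _+ᴾ_; _*ᴾ_; polyRing; indeterminate)
  open import Algebra.Properties.Ring ring using (-0#≈0#)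

  -- Abstract copies of the operations, which do not unfold during unification.
  infixl 6 _⊕_
  infixl 7 _⊗_
  abstract
    _⊕_ _⊗_ : Poly → Poly → Poly
    _⊕_ = _+ᴾ_
    _⊗_ = _*ᴾ_

    ⊝_ : Poly → Poly
    ⊝_ = map (λ c → - c)

    scale : Carrier → Poly → Poly
    scale c = map (c *_)

    ⊕≡+ᴾ : ∀ f g → f ⊕ g ≡ f +ᴾ g
    ⊕≡+ᴾ f g = ≡.refl

    ⊗≡*ᴾ : ∀ f g → f ⊗ g ≡ f *ᴾ g
    ⊗≡*ᴾ f g = ≡.refl

    coeff-⊕ : ∀ f g n → coeff (f ⊕ g) n ≈ coeff f n + coeff g n
    coeff-⊕ []      g       n       = sym (+-identityˡ _)
    coeff-⊕ (c ∷ f) []      n       = sym (+-identityʳ _)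
    coeff-⊕ (c ∷ f) (d ∷ g) zero    = refl
    coeff-⊕ (c ∷ f) (d ∷ g) (suc n) = coeff-⊕ f g n

    coeff-scale : ∀ c f n → coeff (scale c f) n ≈ c * coeff f n
    coeff-scale c []      n       = sym (zeroʳ c)
    coeff-scale c (d ∷ f) zero    = refl
    coeff-scale c (d ∷ f) (suc n) = coeff-scale c f n

    coeff-⊝ : ∀ f n → coeff (⊝ f) n ≈ - coeff f n
    coeff-⊝ []      n       = sym -0#≈0#
    coeff-⊝ (d ∷ f) zero    = refl
    coeff-⊝ (d ∷ f) (suc n) = coeff-⊝ f n

  coeff-≥ : ∀ f n → length f ℕ.≤ n → coeff f n ≡ 0#
  coeff-≥ []      n       _           = ≡.refl
  coeff-≥ (c ∷ f) (suc n) (ℕ.s≤s len) = coeff-≥ f n len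

  -- A record, so that unification can see the polynomials compared.
  infix 4 _≈ᴾ_
  record _≈ᴾ_ (f g : Poly) : Set ℓ where
    constructor coeffwise
    field at : ∀ n → coeff f n ≈ coeff g n
  open _≈ᴾ_ public

  abstract
    isAbelianGroup-poly : IsAbelianGroup _≈ᴾ_ _⊕_ [] ⊝_
    isAbelianGroup-poly = record
      { isGroup = record
        { isMonoid = record
          { isSemigroup = record
            { isMagma = record
              { isEquivalence = record
                { refl = coeffwise λ n → refl
                ; sym = λ eq → coeffwise λ n → sym (at eq n)
                ; trans = λ eq eq′ → coeffwise λ n → trans (at eq n) (at eq′ n) }
              ; ∙-cong = λ {f} {f′} {g} {g′} eq eq′ → coeffwise λ n →
                  trans (coeff-⊕ f g n) (trans (+-cong (at eq n) (at eq′ n)) (sym (coeff-⊕ f′ g′ n))) }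
            ; assoc = λ f g h → coeffwise λ n →
                trans (trans (coeff-⊕ (f ⊕ g) h n) (+-congʳ (coeff-⊕ f g n))) (trans (+-assoc _ _ _)
                (sym (trans (coeff-⊕ f (g ⊕ h) n) (+-congˡ (coeff-⊕ g h n))))) }
          ; identity = (λ f → coeffwise λ n → trans (coeff-⊕ [] f n) (+-identityˡ _))
                     , (λ f → coeffwise λ n → trans (coeff-⊕ f [] n) (+-identityʳ _)) }
        ; inverse = (λ f → coeffwise λ n → trans (coeff-⊕ (⊝ f) f n) (trans (+-congʳ (coeff-⊝ f n)) (-‿inverseˡ _)))
                  , (λ f → coeffwise λ n → trans (coeff-⊕ f (⊝ f) n) (trans (+-congˡ (coeff-⊝ f n)) (-‿inverseʳ _)))
        ; ⁻¹-cong = λ {f} {g} eq → coeffwise λ n → trans (coeff-⊝ f n) (trans (-‿cong (at eq n)) (sym (coeff-⊝ g n))) }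
      ; comm = λ f g → coeffwise λ n → trans (coeff-⊕ f g n) (trans (+-comm _ _) (sym (coeff-⊕ g f n))) }

  additive : AbelianGroup a ℓ
  additive = record { isAbelianGroup = isAbelianGroup-poly }

  private
    module A = AbelianGroup additive
    open import Algebra.Properties.CommutativeSemigroup A.commutativeSemigroup using (interchange; x∙yz≈y∙xz)
    open import Relation.Binary.Reasoning.Setoid A.setoid

  ∷-cong : ∀ {c d f g} → c ≈ d → f ≈ᴾ g → c ∷ f ≈ᴾ d ∷ g
  ∷-cong eq eq′ = coeffwise λ { zero → eq ; (suc n) → at eq′ n }

  scale-cong : ∀ {c d f g} → c ≈ d → f ≈ᴾ g → scale c f ≈ᴾ scale d g
  scale-cong {c} {d} {f} {g} eq eq′ = coeffwise λ n →
    trans (coeff-scale c f n) (trans (*-cong eq (at eq′ n)) (sym (coeff-scale d g n)))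

  abstract
    private
      scale-⊕ : ∀ c f g → scale c (f ⊕ g) ≈ᴾ scale c f ⊕ scale c g
      scale-⊕ c f g = coeffwise λ n → trans (coeff-scale c (f ⊕ g) n) (trans (*-congˡ (coeff-⊕ f g n)) (trans (distribˡ c _ _)
        (sym (trans (coeff-⊕ (scale c f) (scale c g) n) (+-cong (coeff-scale c f n) (coeff-scale c g n))))))

      scale-scale : ∀ c d f → scale c (scale d f) ≈ᴾ scale (c * d) f
      scale-scale c d f = coeffwise λ n → trans (coeff-scale c (scale d f) n) (trans (*-congˡ (coeff-scale d f n))
        (trans (sym (*-assoc c d _)) (sym (coeff-scale (c * d) f n))))

      scale-∷0 : ∀ c f → scale c (0# ∷ f) ≈ᴾ 0# ∷ scale c f
      scale-∷0 c f = ∷-cong (zeroʳ c) A.refl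

      ∷0-⊕ : ∀ f g → 0# ∷ (f ⊕ g) ≈ᴾ (0# ∷ f) ⊕ (0# ∷ g)
      ∷0-⊕ f g = ∷-cong (sym (+-identityˡ 0#)) A.refl

      0∷[] : (0# ∷ []) ≈ᴾ []
      0∷[] = coeffwise λ { zero → refl ; (suc n) → refl }

      ∷-⊕ : ∀ c d f g → (c + d) ∷ (f ⊕ g) ≈ᴾ (c ∷ f) ⊕ (d ∷ g)
      ∷-⊕ c d f g = A.refl

      ∷-⊗ : ∀ c f g → (c ∷ f) ⊗ g ≈ᴾ scale c g ⊕ (0# ∷ (f ⊗ g))
      ∷-⊗ c f g = A.refl

      zeroˡᴾ : ∀ f → [] ⊗ f ≈ᴾ []
      zeroˡᴾ f = A.refl

  private
    zeroʳᴾ : ∀ f → f ⊗ [] ≈ᴾ []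
    zeroʳᴾ []      = zeroˡᴾ []
    zeroʳᴾ (c ∷ f) = begin
      (c ∷ f) ⊗ []                  ≈⟨ ∷-⊗ c f [] ⟩
      scale c [] ⊕ (0# ∷ (f ⊗ []))  ≈⟨ A.∙-cong (coeffwise λ n → trans (coeff-scale c [] n) (zeroʳ c)) (∷-cong refl (zeroʳᴾ f)) ⟩
      [] ⊕ (0# ∷ [])                ≈⟨ A.trans (A.identityˡ _) 0∷[] ⟩
      []                            ∎

    scale-∷ : ∀ c d f → scale c (d ∷ f) ≈ᴾ (c * d) ∷ scale c f
    scale-∷ c d f = coeffwise λ { zero → coeff-scale c (d ∷ f) 0
                                ; (suc n) → trans (coeff-scale c (d ∷ f) (suc n)) (sym (coeff-scale c f n)) }

    -- The product recurses on its left factor. This expansion along the right factor gives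
    -- commutativity, from which congruence on the left and right distributivity are then deduced.
    ⊗-∷ : ∀ f d g → f ⊗ (d ∷ g) ≈ᴾ scale d f ⊕ (0# ∷ (f ⊗ g))
    ⊗-∷ []      d g = begin
      [] ⊗ (d ∷ g)                   ≈⟨ zeroˡᴾ (d ∷ g) ⟩
      []                             ≈⟨ A.trans (A.identityˡ _) 0∷[] ⟨
      [] ⊕ (0# ∷ [])                 ≈⟨ A.∙-cong (coeffwise λ n → trans (coeff-scale d [] n) (zeroʳ d)) (∷-cong refl (zeroˡᴾ g)) ⟨
      scale d [] ⊕ (0# ∷ ([] ⊗ g))   ∎
    ⊗-∷ (c ∷ f) d g = begin
      (c ∷ f) ⊗ (d ∷ g)
        ≈⟨ ∷-⊗ c f (d ∷ g) ⟩
      scale c (d ∷ g) ⊕ (0# ∷ (f ⊗ (d ∷ g)))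
        ≈⟨ A.∙-cong (scale-∷ c d g) (∷-cong refl (⊗-∷ f d g)) ⟩
      (c * d ∷ scale c g) ⊕ (0# ∷ (scale d f ⊕ (0# ∷ (f ⊗ g))))
        ≈⟨ ∷-⊕ (c * d) 0# (scale c g) _ ⟨
      (c * d + 0#) ∷ (scale c g ⊕ (scale d f ⊕ (0# ∷ (f ⊗ g))))
        ≈⟨ ∷-cong (+-congʳ (*-comm c d)) (x∙yz≈y∙xz _ _ _) ⟩
      (d * c + 0#) ∷ (scale d f ⊕ (scale c g ⊕ (0# ∷ (f ⊗ g))))
        ≈⟨ ∷-cong refl (A.∙-congˡ (∷-⊗ c f g)) ⟨
      (d * c + 0#) ∷ (scale d f ⊕ ((c ∷ f) ⊗ g))
        ≈⟨ ∷-⊕ (d * c) 0# (scale d f) _ ⟩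
      (d * c ∷ scale d f) ⊕ (0# ∷ ((c ∷ f) ⊗ g))
        ≈⟨ A.∙-congʳ (scale-∷ d c f) ⟨
      scale d (c ∷ f) ⊕ (0# ∷ ((c ∷ f) ⊗ g)) ∎

    ⊗-comm : ∀ f g → f ⊗ g ≈ᴾ g ⊗ f
    ⊗-comm []      g = A.trans (zeroˡᴾ g) (A.sym (zeroʳᴾ g))
    ⊗-comm (c ∷ f) g = begin
      (c ∷ f) ⊗ g                    ≈⟨ ∷-⊗ c f g ⟩
      scale c g ⊕ (0# ∷ (f ⊗ g))     ≈⟨ A.∙-congˡ (∷-cong refl (⊗-comm f g)) ⟩
      scale c g ⊕ (0# ∷ (g ⊗ f))     ≈⟨ ⊗-∷ g c f ⟨
      g ⊗ (c ∷ f)                    ∎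

    ⊗-congˡ : ∀ f {g g′} → g ≈ᴾ g′ → f ⊗ g ≈ᴾ f ⊗ g′
    ⊗-congˡ []      {g} {g′} eq = A.trans (zeroˡᴾ g) (A.sym (zeroˡᴾ g′))
    ⊗-congˡ (c ∷ f) {g} {g′} eq = begin
      (c ∷ f) ⊗ g                    ≈⟨ ∷-⊗ c f g ⟩
      scale c g ⊕ (0# ∷ (f ⊗ g))     ≈⟨ A.∙-cong (scale-cong refl eq) (∷-cong refl (⊗-congˡ f eq)) ⟩
      scale c g′ ⊕ (0# ∷ (f ⊗ g′))   ≈⟨ ∷-⊗ c f g′ ⟨
      (c ∷ f) ⊗ g′                   ∎

    ⊗-cong : ∀ {f f′ g g′} → f ≈ᴾ f′ → g ≈ᴾ g′ → f ⊗ g ≈ᴾ f′ ⊗ g′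
    ⊗-cong {f} {f′} {g} {g′} eq eq′ = begin
      f ⊗ g     ≈⟨ ⊗-congˡ f eq′ ⟩
      f ⊗ g′    ≈⟨ ⊗-comm f g′ ⟩
      g′ ⊗ f    ≈⟨ ⊗-congˡ g′ eq ⟩
      g′ ⊗ f′   ≈⟨ ⊗-comm g′ f′ ⟩
      f′ ⊗ g′   ∎

    ⊗-distribˡ : ∀ f g h → f ⊗ (g ⊕ h) ≈ᴾ f ⊗ g ⊕ f ⊗ h
    ⊗-distribˡ []      g h = begin
      [] ⊗ (g ⊕ h)       ≈⟨ zeroˡᴾ _ ⟩
      []                 ≈⟨ A.identityˡ [] ⟨
      [] ⊕ []            ≈⟨ A.∙-cong (zeroˡᴾ g) (zeroˡᴾ h) ⟨
      [] ⊗ g ⊕ [] ⊗ h    ∎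
    ⊗-distribˡ (c ∷ f) g h = begin
      (c ∷ f) ⊗ (g ⊕ h)
        ≈⟨ ∷-⊗ c f _ ⟩
      scale c (g ⊕ h) ⊕ (0# ∷ (f ⊗ (g ⊕ h)))
        ≈⟨ A.∙-cong (scale-⊕ c g h) (A.trans (∷-cong refl (⊗-distribˡ f g h)) (∷0-⊕ _ _)) ⟩
      (scale c g ⊕ scale c h) ⊕ ((0# ∷ (f ⊗ g)) ⊕ (0# ∷ (f ⊗ h)))
        ≈⟨ interchange _ _ _ _ ⟩
      (scale c g ⊕ (0# ∷ (f ⊗ g))) ⊕ (scale c h ⊕ (0# ∷ (f ⊗ h)))
        ≈⟨ A.∙-cong (∷-⊗ c f g) (∷-⊗ c f h) ⟨
      (c ∷ f) ⊗ g ⊕ (c ∷ f) ⊗ h ∎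

    ⊗-distribʳ : ∀ f g h → (g ⊕ h) ⊗ f ≈ᴾ g ⊗ f ⊕ h ⊗ f
    ⊗-distribʳ f g h = A.trans (⊗-comm _ f) (A.trans (⊗-distribˡ f g h) (A.∙-cong (⊗-comm f g) (⊗-comm f h)))

    scale-⊗ : ∀ c f g → scale c f ⊗ g ≈ᴾ scale c (f ⊗ g)
    scale-⊗ c []      g = begin
      scale c [] ⊗ g    ≈⟨ ⊗-cong (coeffwise λ n → trans (coeff-scale c [] n) (zeroʳ c)) A.refl ⟩
      [] ⊗ g            ≈⟨ zeroˡᴾ g ⟩
      []                ≈⟨ coeffwise (λ n → trans (coeff-scale c [] n) (zeroʳ c)) ⟨
      scale c []        ≈⟨ scale-cong refl (zeroˡᴾ g) ⟨
      scale c ([] ⊗ g)  ∎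
    scale-⊗ c (d ∷ f) g = begin
      scale c (d ∷ f) ⊗ g                           ≈⟨ ⊗-cong (scale-∷ c d f) A.refl ⟩
      ((c * d) ∷ scale c f) ⊗ g                     ≈⟨ ∷-⊗ (c * d) (scale c f) g ⟩
      scale (c * d) g ⊕ (0# ∷ (scale c f ⊗ g))      ≈⟨ A.∙-cong (A.sym (scale-scale c d g))
                                                         (A.trans (∷-cong refl (scale-⊗ c f g)) (A.sym (scale-∷0 c (f ⊗ g)))) ⟩
      scale c (scale d g) ⊕ scale c (0# ∷ (f ⊗ g))  ≈⟨ scale-⊕ c _ _ ⟨
      scale c (scale d g ⊕ (0# ∷ (f ⊗ g)))          ≈⟨ scale-cong refl (∷-⊗ d f g) ⟨
      scale c ((d ∷ f) ⊗ g)                         ∎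

    scale-0 : ∀ g → scale 0# g ≈ᴾ []
    scale-0 g = coeffwise λ n → trans (coeff-scale 0# g n) (zeroˡ _)

    ∷0-⊗ : ∀ f g → (0# ∷ f) ⊗ g ≈ᴾ 0# ∷ (f ⊗ g)
    ∷0-⊗ f g = A.trans (∷-⊗ 0# f g) (A.trans (A.∙-congʳ (scale-0 g)) (A.identityˡ _))

    ⊗-assoc : ∀ f g h → (f ⊗ g) ⊗ h ≈ᴾ f ⊗ (g ⊗ h)
    ⊗-assoc []      g h = A.trans (⊗-cong (zeroˡᴾ g) A.refl) (A.trans (zeroˡᴾ h) (A.sym (zeroˡᴾ (g ⊗ h))))
    ⊗-assoc (c ∷ f) g h = begin
      ((c ∷ f) ⊗ g) ⊗ h                              ≈⟨ ⊗-cong (∷-⊗ c f g) A.refl ⟩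
      (scale c g ⊕ (0# ∷ (f ⊗ g))) ⊗ h               ≈⟨ ⊗-distribʳ h _ _ ⟩
      scale c g ⊗ h ⊕ (0# ∷ (f ⊗ g)) ⊗ h             ≈⟨ A.∙-cong (scale-⊗ c g h)
                                                          (A.trans (∷0-⊗ (f ⊗ g) h) (∷-cong refl (⊗-assoc f g h))) ⟩
      scale c (g ⊗ h) ⊕ (0# ∷ (f ⊗ (g ⊗ h)))         ≈⟨ ∷-⊗ c f (g ⊗ h) ⟨
      (c ∷ f) ⊗ (g ⊗ h)                              ∎

    ⊗-identityˡ : ∀ f → (1# ∷ []) ⊗ f ≈ᴾ f
    ⊗-identityˡ f = begin
      (1# ∷ []) ⊗ f                 ≈⟨ ∷-⊗ 1# [] f ⟩
      scale 1# f ⊕ (0# ∷ ([] ⊗ f))  ≈⟨ A.∙-cong (coeffwise λ n → trans (coeff-scale 1# f n) (*-identityˡ _))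
                                         (A.trans (∷-cong refl (zeroˡᴾ f)) 0∷[]) ⟩
      f ⊕ []                        ≈⟨ A.identityʳ f ⟩
      f                             ∎

  abstract
    isCommutativeRing-poly : IsCommutativeRing _≈ᴾ_ _⊕_ _⊗_ ⊝_ [] (1# ∷ [])
    isCommutativeRing-poly = record
      { isRing = record
        { +-isAbelianGroup = A.isAbelianGroup
        ; *-cong = ⊗-cong
        ; *-assoc = ⊗-assoc
        ; *-identity = ⊗-identityˡ , λ f → A.trans (⊗-comm f _) (⊗-identityˡ f)
        ; distrib = ⊗-distribˡ , ⊗-distribʳ }
      ; *-comm = ⊗-comm }

  polynomialRing : CommutativeRing a ℓ
  polynomialRing = record { isCommutativeRing = isCommutativeRing-poly }

  abstract
    isCommutativeRing-transparent : IsCommutativeRing _≈ᴾ_ _+ᴾ_ _*ᴾ_ (map (λ c → - c)) [] (1# ∷ [])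
    isCommutativeRing-transparent = isCommutativeRing-poly

  -- The operations of this ring are those of the statement, as the fractions require. Inside the
  -- `abstract` block they agree with the abstract copies by definition, so the proof of the laws is
  -- shared.
  transparentRing : CommutativeRing a ℓ
  transparentRing = record { isCommutativeRing = isCommutativeRing-transparent }

  module PR = CommutativeRing polynomialRing
  open import Algebra.Properties.Semiring.Exp PR.semiring public using () renaming (_^_ to _^ᴾ_)

  const : Carrier → Poly
  const c = c ∷ []

  X : Poly
  X = indeterminate

  X*-≈ : ∀ f → X ⊗ f ≈ᴾ 0# ∷ f
  X*-≈ f = A.trans (∷0-⊗ (1# ∷ []) f) (∷-cong refl (⊗-identityˡ f))

  const-*-≈ : ∀ c f → const c ⊗ f ≈ᴾ scale c f
  const-*-≈ c f = A.trans (∷-⊗ c [] f) (A.trans (A.∙-congˡ (A.trans (∷-cong refl (zeroˡᴾ f)) 0∷[])) (A.identityʳ _))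

  ∷-≈′ : ∀ c f → c ∷ f ≈ᴾ const c ⊕ (0# ∷ f)
  ∷-≈′ c f = A.trans (∷-cong (sym (+-identityʳ c)) (A.sym (A.identityˡ f))) (∷-⊕ c 0# [] f)

  ∷-≈ : ∀ c f → c ∷ f ≈ᴾ const c ⊕ X ⊗ f
  ∷-≈ c f = PR.trans (∷-≈′ c f) (PR.+-congˡ (PR.sym (X*-≈ f)))

  const-cong : ∀ {c d} → c ≈ d → const c ≈ᴾ const d
  const-cong eq = ∷-cong eq PR.refl

  coeff-X*-suc : ∀ f n → coeff (X ⊗ f) (suc n) ≈ coeff f n
  coeff-X*-suc f n = at (X*-≈ f) (suc n)

  coeff-X^* : ∀ m f n → coeff (X ^ᴾ m ⊗ f) (m ℕ.+ n) ≈ coeff f n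
  coeff-X^* zero    f n = at (PR.*-identityˡ f) n
  coeff-X^* (suc m) f n = trans (at (PR.*-assoc X (X ^ᴾ m) f) (suc m ℕ.+ n))
    (trans (coeff-X*-suc (X ^ᴾ m ⊗ f) (m ℕ.+ n)) (coeff-X^* m f n))

  abstract
    length-⊕ : ∀ f g → length (f ⊕ g) ≡ length f ℕ.⊔ length g
    length-⊕ []      g       = ≡.refl
    length-⊕ (c ∷ f) []      = ≡.refl
    length-⊕ (c ∷ f) (d ∷ g) = ≡.cong suc (length-⊕ f g)

    length-⊕-≤ : ∀ f g {n} → length f ℕ.≤ n → length g ℕ.≤ n → length (f ⊕ g) ℕ.≤ n
    length-⊕-≤ f g f≤n g≤n = ≡.subst (ℕ._≤ _) (≡.sym (length-⊕ f g)) (ℕ.⊔-lub f≤n g≤n)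

module Evaluation {a ℓ b ℓ′} {K : CommutativeRing a ℓ} {R : CommutativeRing b ℓ′}
  (κ : RingHom K R) (z : CommutativeRing.Carrier R) where
  private module K = CommutativeRing K
  open CommutativeRing R hiding (zero)
  open PolynomialRing K
  open RingHom κ
  open IntegerSolver R
  open import Relation.Binary.Reasoning.Setoid setoid

  ev : Poly → Carrier
  ev []      = 0#
  ev (c ∷ f) = to c + z * ev f

  private
    ev-≋[] : ∀ f → (∀ n → coeff f n K.≈ K.0#) → ev f ≈ 0#
    ev-≋[] []      eq = refl
    ev-≋[] (c ∷ f) eq = begin
      to c + z * ev f    ≈⟨ +-cong (trans (to-cong (eq 0)) to-0) (*-congˡ (ev-≋[] f λ n → eq (suc n))) ⟩
      0# + z * 0#        ≈⟨ trans (+-identityˡ _) (zeroʳ z) ⟩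
      0#                 ∎

    ev-≋ : ∀ f g → (∀ n → coeff f n K.≈ coeff g n) → ev f ≈ ev g
    ev-≋ []      g       eq = sym (ev-≋[] g λ n → K.sym (eq n))
    ev-≋ (c ∷ f) []      eq = ev-≋[] (c ∷ f) eq
    ev-≋ (c ∷ f) (d ∷ g) eq = +-cong (to-cong (eq 0)) (*-congˡ (ev-≋ f g λ n → eq (suc n)))

  ev-cong : ∀ {f g} → f ≈ᴾ g → ev f ≈ ev g
  ev-cong {f} {g} eq = ev-≋ f g (at eq)

  private
    ev-+ᴾ : ∀ f g → ev (f +ᴾ g) ≈ ev f + ev g
    ev-+ᴾ []      g       = sym (+-identityˡ _)
    ev-+ᴾ (c ∷ f) []      = sym (+-identityʳ _)
    ev-+ᴾ (c ∷ f) (d ∷ g) = begin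
      to (c K.+ d) + z * ev (f +ᴾ g)           ≈⟨ +-cong (to-+ c d) (*-congˡ (ev-+ᴾ f g)) ⟩
      (to c + to d) + z * (ev f + ev g)        ≈⟨ solve 5 (λ c d z f g → (c :+ d) :+ z :* (f :+ g) := (c :+ z :* f) :+ (d :+ z :* g)) refl _ _ _ _ _ ⟩
      (to c + z * ev f) + (to d + z * ev g)    ∎

    ev-map* : ∀ c f → ev (map (c K.*_) f) ≈ to c * ev f
    ev-map* c []      = sym (zeroʳ _)
    ev-map* c (d ∷ f) = begin
      to (c K.* d) + z * ev (map (c K.*_) f)  ≈⟨ +-cong (to-* c d) (*-congˡ (ev-map* c f)) ⟩
      to c * to d + z * (to c * ev f)         ≈⟨ solve 4 (λ c d z f → c :* d :+ z :* (c :* f) := c :* (d :+ z :* f)) refl _ _ _ _ ⟩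
      to c * (to d + z * ev f)                ∎

    ev-*ᴾ : ∀ f g → ev (f *ᴾ g) ≈ ev f * ev g
    ev-*ᴾ []      g = sym (zeroˡ _)
    ev-*ᴾ (c ∷ f) g = begin
      ev (map (c K.*_) g +ᴾ (K.0# ∷ (f *ᴾ g)))     ≈⟨ ev-+ᴾ (map (c K.*_) g) (K.0# ∷ (f *ᴾ g)) ⟩
      ev (map (c K.*_) g) + (to K.0# + z * ev (f *ᴾ g)) ≈⟨ +-cong (ev-map* c g) (+-cong to-0 (*-congˡ (ev-*ᴾ f g))) ⟩
      to c * ev g + (0# + z * (ev f * ev g))       ≈⟨ solve 4 (λ c z f g → c :* g :+ (:0 :+ z :* (f :* g)) := (c :+ z :* f) :* g) refl _ _ _ _ ⟩
      (to c + z * ev f) * ev g                     ∎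

  ev-+ : ∀ f g → ev (f ⊕ g) ≈ ev f + ev g
  ev-+ f g = trans (reflexive (≡.cong ev (⊕≡+ᴾ f g))) (ev-+ᴾ f g)

  ev-* : ∀ f g → ev (f ⊗ g) ≈ ev f * ev g
  ev-* f g = trans (reflexive (≡.cong ev (⊗≡*ᴾ f g))) (ev-*ᴾ f g)

  ev-const : ∀ c → ev (const c) ≈ to c
  ev-const c = trans (+-congˡ (zeroʳ z)) (+-identityʳ _)

  evaluation : RingHom polynomialRing R
  evaluation = record
    { to = ev ; to-cong = ev-cong ; to-+ = ev-+ ; to-* = ev-*
    ; to-1 = trans (ev-const K.1#) to-1 }

  ev-X : ev X ≈ z
  ev-X = trans (+-cong to-0 (*-congˡ (trans (ev-const K.1#) to-1))) (trans (+-identityˡ _) (*-identityʳ z))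

Fin-bound : ∀ n (f : Fin n → ℕ) → ∃[ M ] ∀ i → f i ≤ M
Fin-bound zero    f = 0 , λ ()
Fin-bound (suc n) f with Fin-bound n (λ i → f (Fin.suc i))
... | M , f≤M = f Fin.zero ℕ.⊔ M , λ where
  Fin.zero    → ℕ.m≤m⊔n _ _
  (Fin.suc i) → ℕ.≤-trans (f≤M i) (ℕ.m≤n⊔m (f Fin.zero) M)

module Degree {a ℓ} (K : CommutativeRing a ℓ) where
  open CommutativeRing K hiding (zero; _-_)
  open PolynomialRing K
  open import Algebra.Properties.Ring ring using (-0#≈0#; x∙y⁻¹≈ε⇒x≈y)
  open import Relation.Binary.Reasoning.Setoid setoid
  private
    module S = IntegerSolver polynomialRing
    module P∑ = FiniteSums polynomialRing

  -- A strict bound instead of a degree: it makes sense over any commutative ring, without deciding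
  -- whether a coefficient vanishes, and is used again for coefficients in 𝔽ₚ[z].
  Deg< : ℕ → Poly → Set ℓ
  Deg< n f = ∀ k → n ≤ k → coeff f k ≈ 0#

  deg-length : ∀ f {n} → length f ≤ n → Deg< n f
  deg-length f len k n≤k = reflexive (coeff-≥ f k (ℕ.≤-trans len n≤k))

  deg-cong : ∀ {n f g} → f ≈ᴾ g → Deg< n f → Deg< n g
  deg-cong eq deg k n≤k = trans (sym (at eq k)) (deg k n≤k)

  deg-mono : ∀ {m n} f → m ≤ n → Deg< m f → Deg< n f
  deg-mono f m≤n deg k n≤k = deg k (ℕ.≤-trans m≤n n≤k)

  deg-⊕ : ∀ {n} f g → Deg< n f → Deg< n g → Deg< n (f ⊕ g)
  deg-⊕ f g deg-f deg-g k n≤k = trans (coeff-⊕ f g k) (trans (+-cong (deg-f k n≤k) (deg-g k n≤k)) (+-identityˡ 0#))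

  deg-⊝ : ∀ {n} f → Deg< n f → Deg< n (⊝ f)
  deg-⊝ f deg k n≤k = trans (coeff-⊝ f k) (trans (-‿cong (deg k n≤k)) -0#≈0#)

  deg-scale : ∀ {n} c f → Deg< n f → Deg< n (scale c f)
  deg-scale c f deg k n≤k = trans (coeff-scale c f k) (trans (*-congˡ (deg k n≤k)) (zeroʳ c))

  deg-0 : ∀ {f} → Deg< 0 f → f ≈ᴾ []
  deg-0 deg = coeffwise λ n → deg n z≤n

  deg-[] : ∀ {n f} → f ≈ᴾ [] → Deg< n f
  deg-[] eq k _ = at eq k

  coeff-∷-⊗ : ∀ c f g n → coeff ((c ∷ f) ⊗ g) (suc n) ≈ c * coeff g (suc n) + coeff (f ⊗ g) n
  coeff-∷-⊗ c f g n = begin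
    coeff ((c ∷ f) ⊗ g) (suc n)                              ≈⟨ at (PR.*-congʳ {g} (∷-≈ c f)) (suc n) ⟩
    coeff ((const c ⊕ X ⊗ f) ⊗ g) (suc n)                    ≈⟨ at (S.solve 4 (λ c x f g → (c S.:+ x S.:* f) S.:* g S.:= c S.:* g S.:+ x S.:* (f S.:* g)) PR.refl (const c) X f g) (suc n) ⟩
    coeff (const c ⊗ g ⊕ X ⊗ (f ⊗ g)) (suc n)                ≈⟨ coeff-⊕ (const c ⊗ g) _ (suc n) ⟩
    coeff (const c ⊗ g) (suc n) + coeff (X ⊗ (f ⊗ g)) (suc n) ≈⟨ +-cong (trans (at (const-*-≈ c g) (suc n)) (coeff-scale c g (suc n))) (coeff-X*-suc (f ⊗ g) n) ⟩
    c * coeff g (suc n) + coeff (f ⊗ g) n                    ∎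

  [c]-⊗ : ∀ c f g → f ≈ᴾ [] → (c ∷ f) ⊗ g ≈ᴾ scale c g
  [c]-⊗ c f g f≈0 = PR.trans (PR.*-congʳ (∷-cong refl f≈0)) (const-*-≈ c g)

  deg-⊗ : ∀ {m n} f g → Deg< m f → Deg< n g → Deg< (m ℕ.+ n) (f ⊗ g)
  deg-⊗ {zero}  f       g deg-f deg-g = deg-[] (PR.trans (PR.*-congʳ (deg-0 {f} deg-f)) (PR.zeroˡ g))
  deg-⊗ {suc m} []      g deg-f deg-g = deg-[] (PR.zeroˡ g)
  deg-⊗ {suc m} (c ∷ f) g deg-f deg-g (suc k) (s≤s le) = begin
    coeff ((c ∷ f) ⊗ g) (suc k)              ≈⟨ coeff-∷-⊗ c f g k ⟩
    c * coeff g (suc k) + coeff (f ⊗ g) k    ≈⟨ +-cong (*-congˡ (deg-g (suc k) (ℕ.m≤n⇒m≤1+n (ℕ.≤-trans (ℕ.m≤n+m _ m) le))))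
                                                  (deg-⊗ {m} f g (λ l m≤l → deg-f (suc l) (s≤s m≤l)) deg-g k le) ⟩
    c * 0# + 0#                              ≈⟨ trans (+-identityʳ _) (zeroʳ c) ⟩
    0#                                       ∎

  take-≈ : ∀ d f → Deg< d f → take d f ≈ᴾ f
  take-≈ d f deg = coeffwise (go d f deg)
    where
    go : ∀ d f → Deg< d f → ∀ n → coeff (take d f) n ≈ coeff f n
    go zero    f       deg n       = sym (deg n z≤n)
    go (suc d) []      deg n       = refl
    go (suc d) (c ∷ f) deg zero    = refl
    go (suc d) (c ∷ f) deg (suc n) = go d f (λ k d≤k → deg (suc k) (s≤s d≤k)) n

  record Monic (d : ℕ) (m : Poly) : Set ℓ where
    field
      leading : coeff m d ≈ 1#
      degree  : Deg< (suc d) m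
  open Monic public

  private
    monic-tail : ∀ {d c m} → Monic (suc d) (c ∷ m) → Monic d m
    monic-tail mm = record { leading = leading mm ; degree = λ k le → degree mm (suc k) (s≤s le) }

    monic-0 : ∀ {c m} g → Monic 0 (c ∷ m) → (c ∷ m) ⊗ g ≈ᴾ g
    monic-0 {c} {m} g mm = PR.trans ([c]-⊗ c m g (deg-0 λ k _ → degree mm (suc k) (s≤s z≤n)))
      (coeffwise λ n → trans (coeff-scale c g n) (trans (*-congʳ (leading mm)) (*-identityˡ _)))

    -- The zero polynomial is monic only over the zero ring, where every equation holds.
    monic-[] : ∀ {d} → Monic d [] → ∀ x → x ≈ 0#
    monic-[] mm x = trans (sym (*-identityˡ x)) (trans (*-congʳ (sym (leading mm))) (zeroˡ x))

  monic-top : ∀ {d m n} g → Monic d m → Deg< (suc n) g → coeff (m ⊗ g) (d ℕ.+ n) ≈ coeff g n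
  monic-top {zero}  {[]}    g mm deg = trans (monic-[] mm _) (sym (monic-[] mm _))
  monic-top {zero}  {c ∷ m} g mm deg = at (monic-0 g mm) _
  monic-top {suc d} {[]}    g mm deg = trans (monic-[] mm _) (sym (monic-[] mm _))
  monic-top {suc d} {c ∷ m} {n} g mm deg = begin
    coeff ((c ∷ m) ⊗ g) (suc (d ℕ.+ n))                          ≈⟨ coeff-∷-⊗ c m g (d ℕ.+ n) ⟩
    c * coeff g (suc (d ℕ.+ n)) + coeff (m ⊗ g) (d ℕ.+ n)        ≈⟨ +-cong (*-congˡ (deg _ (s≤s (ℕ.m≤n+m n d)))) (monic-top g (monic-tail mm) deg) ⟩
    c * 0# + coeff g n                                           ≈⟨ trans (+-congʳ (zeroʳ c)) (+-identityˡ _) ⟩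
    coeff g n                                                    ∎

  deg-monic : ∀ {d m n} g → Monic d m → Deg< n g → Deg< (d ℕ.+ n) (m ⊗ g)
  deg-monic {d} {m} {zero} g mm deg = deg-[] (PR.trans (PR.*-congˡ (deg-0 {g} deg)) (PR.zeroʳ m))
  deg-monic {d} {m} {suc n} g mm deg = deg-mono (m ⊗ g) (ℕ.≤-reflexive (≡.sym (ℕ.+-suc d n))) (go m mm)
    where
    go : ∀ {d} m → Monic d m → Deg< (suc (d ℕ.+ n)) (m ⊗ g)
    go {zero}  []      mm k le = monic-[] mm _
    go {zero}  (c ∷ m) mm = deg-cong (PR.sym (monic-0 g mm)) deg
    go {suc d} []      mm k le = monic-[] mm _
    go {suc d} (c ∷ m) mm (suc k) (s≤s le) = begin
      coeff ((c ∷ m) ⊗ g) (suc k)              ≈⟨ coeff-∷-⊗ c m g k ⟩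
      c * coeff g (suc k) + coeff (m ⊗ g) k    ≈⟨ +-cong (*-congˡ (deg (suc k) (ℕ.m≤n⇒m≤1+n (ℕ.≤-trans (s≤s (ℕ.m≤n+m n d)) le))))
                                                    (go m (monic-tail mm) k le) ⟩
      c * 0# + 0#                              ≈⟨ trans (+-identityʳ _) (zeroʳ c) ⟩
      0#                                       ∎

  monic-⊗ : ∀ {d e m n} → Monic d m → Monic e n → Monic (d ℕ.+ e) (m ⊗ n)
  monic-⊗ {d} {e} {m} {n} mm mn = record
    { leading = trans (monic-top n mm (degree mn)) (leading mn)
    ; degree  = deg-mono (m ⊗ n) (ℕ.≤-reflexive (ℕ.+-suc d e)) (deg-monic n mm (degree mn)) }

  monic-1 : Monic 0 (1# ∷ [])
  monic-1 = record { leading = refl ; degree = deg-length (1# ∷ []) ℕ.≤-refl }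

  monic-^ : ∀ {d m} → Monic d m → ∀ n → Monic (n ℕ.* d) (m ^ᴾ n)
  monic-^ mm zero    = monic-1
  monic-^ mm (suc n) = monic-⊗ mm (monic-^ mm n)

  monic-X : Monic 1 X
  monic-X = record { leading = refl ; degree = deg-length X ℕ.≤-refl }

  -- The coefficient of `g` at the current bound n is the one of `m ⊗ g` at d + n. A bound above L
  -- can therefore be lowered by one, and no coefficient has to be tested for zero.
  deg-cancel : ∀ {d m} L g → Monic d m → Deg< (d ℕ.+ L) (m ⊗ g) → Deg< L g
  deg-cancel {d} {m} L g mm deg = go (length g) (deg-length g ℕ.≤-refl)
    where
    go : ∀ n → Deg< n g → Deg< L g
    go zero    deg-g = deg-[] (deg-0 {g} deg-g)
    go (suc n) deg-g with L ℕ.≤? n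
    ... | no  L≰n = deg-mono g (ℕ.≰⇒> L≰n) deg-g
    ... | yes L≤n = go n lower
      where
      lower : Deg< n g
      lower k n≤k with n ℕ.≟ k
      ... | yes ≡.refl = trans (sym (monic-top g mm deg-g)) (deg (d ℕ.+ n) (ℕ.+-monoʳ-≤ d L≤n))
      ... | no  n≢k    = deg-g k (ℕ.≤∧≢⇒< n≤k n≢k)

  record Division (m g : Poly) (d : ℕ) : Set (a ⊔ ℓ) where
    field
      quotient remainder : Poly
      remainder-degree   : length remainder ≤ d
      division           : g ≈ᴾ quotient ⊗ m ⊕ remainder

  -- Horner's scheme: with g = q m + r, the polynomial a + X r has degree at most d, and subtracting
  -- `t` times m removes its coefficient `t` at d.
  divide : ∀ {d m} → Monic d m → ∀ g → Division m g d
  divide {d} {m} mm [] = record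
    { quotient = [] ; remainder = [] ; remainder-degree = z≤n
    ; division = PR.sym (PR.trans (PR.+-identityʳ _) (PR.zeroˡ m)) }
  divide {d} {m} mm (a ∷ g) = record
    { quotient = X ⊗ q ⊕ const t
    -- The list is cut so that the bound holds for its length and not only up to trailing zeros.
    ; remainder = take d r′
    ; remainder-degree = ℕ.≤-trans (ℕ.≤-reflexive (length-take d r′)) (ℕ.m⊓n≤m d _)
    ; division = P.begin
        a ∷ g                                         P.≈⟨ ∷-≈ a g ⟩
        const a ⊕ X ⊗ g                               P.≈⟨ PR.+-congˡ (PR.*-congˡ (Division.division D)) ⟩
        const a ⊕ X ⊗ (q ⊗ m ⊕ r)                     P.≈⟨ S.solve 6 (λ a x q m r t → a S.:+ x S.:* (q S.:* m S.:+ r)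
                                                             S.:= (x S.:* q S.:+ t) S.:* m S.:+ ((a S.:+ x S.:* r) S.:+ S.:- (t S.:* m))) PR.refl (const a) X q m r (const t) ⟩
        (X ⊗ q ⊕ const t) ⊗ m ⊕ ((const a ⊕ X ⊗ r) ⊕ ⊝ (const t ⊗ m))
                                                      P.≈⟨ PR.+-congˡ (PR.+-congʳ (∷-≈ a r)) ⟨
        (X ⊗ q ⊕ const t) ⊗ m ⊕ r′                    P.≈⟨ PR.+-congˡ (take-≈ d r′ r′-degree) ⟨
        (X ⊗ q ⊕ const t) ⊗ m ⊕ take d r′             P.∎
    }
    where
    module P where
      open import Relation.Binary.Reasoning.Setoid PR.setoid public
    D = divide mm g
    q = Division.quotient D
    r = Division.remainder D
    t = coeff (a ∷ r) d
    r′ = (a ∷ r) ⊕ ⊝ (const t ⊗ m)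
    coeff-tm : ∀ k → coeff (const t ⊗ m) k ≈ t * coeff m k
    coeff-tm k = trans (at (const-*-≈ t m) k) (coeff-scale t m k)
    r′-degree : Deg< d r′
    r′-degree k d≤k = trans (coeff-⊕ (a ∷ r) _ k) (trans (+-congˡ (trans (coeff-⊝ (const t ⊗ m) k) (-‿cong (coeff-tm k)))) (vanish k d≤k))
      where
      vanish : ∀ k → d ≤ k → coeff (a ∷ r) k + - (t * coeff m k) ≈ 0#
      vanish k d≤k with d ℕ.≟ k
      ... | yes ≡.refl = trans (+-congˡ (-‿cong (trans (*-congˡ (leading mm)) (*-identityʳ t)))) (-‿inverseʳ t)
      ... | no  d≢k    = begin
        coeff (a ∷ r) k + - (t * coeff m k)  ≈⟨ +-cong (deg-length (a ∷ r) (s≤s (Division.remainder-degree D)) k d<k) (-‿cong (trans (*-congˡ (degree mm k d<k)) (zeroʳ t))) ⟩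
        0# + - 0#                            ≈⟨ -‿inverseʳ 0# ⟩
        0#                                   ∎
        where d<k = ℕ.≤∧≢⇒< d≤k d≢k

  -- A block of q coefficients followed by `h` shifted by X^q: the shape in which one layer of the
  -- Frobenius basis is split off.
  tabulate-++-≈ : ∀ q (d : Fin q → Carrier) h →
    tabulate d ++ h ≈ᴾ P∑.∑ (allFin q) (λ e → X ^ᴾ toℕ e ⊗ const (d e)) ⊕ X ^ᴾ q ⊗ h
  tabulate-++-≈ zero    d h = PR.sym (PR.trans (PR.+-identityˡ _) (PR.*-identityˡ h))
  tabulate-++-≈ (suc q) d h = P.begin
    d Fin.zero ∷ (tabulate (λ k → d (Fin.suc k)) ++ h)
      P.≈⟨ ∷-≈ _ _ ⟩
    const (d Fin.zero) ⊕ X ⊗ (tabulate (λ k → d (Fin.suc k)) ++ h)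
      P.≈⟨ PR.+-congˡ (PR.*-congˡ (tabulate-++-≈ q (λ k → d (Fin.suc k)) h)) ⟩
    const (d Fin.zero) ⊕ X ⊗ (P∑.∑ (allFin q) (λ e → X ^ᴾ toℕ e ⊗ const (d (Fin.suc e))) ⊕ X ^ᴾ q ⊗ h)
      P.≈⟨ S.solve 5 (λ c x s y h → c S.:+ x S.:* (s S.:+ y S.:* h) S.:= (S.:1 S.:* c S.:+ x S.:* s) S.:+ (x S.:* y) S.:* h) PR.refl (const (d Fin.zero)) X _ (X ^ᴾ q) h ⟩
    ((fromℤ′ ⊗ const (d Fin.zero)) ⊕ X ⊗ P∑.∑ (allFin q) (λ e → X ^ᴾ toℕ e ⊗ const (d (Fin.suc e)))) ⊕ (X ⊗ X ^ᴾ q) ⊗ h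
      P.≈⟨ PR.+-congʳ (PR.+-cong (PR.*-congʳ (S.fromℤ-1)) (PR.trans (P∑.∑-*ˡ X (allFin q) _) (P∑.∑-cong (allFin q) λ e → PR.sym (PR.*-assoc X _ _)))) ⟩
    (PR.1# ⊗ const (d Fin.zero) ⊕ P∑.∑ (allFin q) (λ e → (X ⊗ X ^ᴾ toℕ e) ⊗ const (d (Fin.suc e)))) ⊕ (X ⊗ X ^ᴾ q) ⊗ h
      P.≈⟨ PR.+-congʳ (P∑.∑-allFin-suc q _) ⟨
    P∑.∑ (allFin (suc q)) (λ e → X ^ᴾ toℕ e ⊗ const (d e)) ⊕ (X ⊗ X ^ᴾ q) ⊗ h P.∎
    where
    fromℤ′ = S.fromℕ 1
    module P where
      open import Relation.Binary.Reasoning.Setoid PR.setoid public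

  coeff-tabulate-++ : ∀ q (d : Fin q → Carrier) h k → coeff (tabulate d ++ h) (toℕ k) ≡ d k
  coeff-tabulate-++ (suc q) d h Fin.zero    = ≡.refl
  coeff-tabulate-++ (suc q) d h (Fin.suc k) = coeff-tabulate-++ q _ h k

  coeff-tabulate-++-≥ : ∀ q (d : Fin q → Carrier) h n → coeff (tabulate d ++ h) (q ℕ.+ n) ≡ coeff h n
  coeff-tabulate-++-≥ zero    d h n = ≡.refl
  coeff-tabulate-++-≥ (suc q) d h n = coeff-tabulate-++-≥ q _ h n

  drop-≈ : ∀ q f → tabulate {n = q} (λ k → coeff f (toℕ k)) ++ drop q f ≈ᴾ f
  drop-≈ q f = coeffwise (go q f)
    where
    go : ∀ q f n → coeff (tabulate {n = q} (λ k → coeff f (toℕ k)) ++ drop q f) n ≈ coeff f n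
    go zero    f       n       = refl
    go (suc q) []      zero    = refl
    go (suc q) []      (suc n) = trans (reflexive (≡.cong (λ h → coeff (tabulate {n = q} (λ _ → 0#) ++ h) n) (≡.sym (drop-[] q)))) (go q [] n)
      where
      drop-[] : ∀ q → drop q [] ≡ ([] {A = Carrier})
      drop-[] zero    = ≡.refl
      drop-[] (suc q) = ≡.refl
    go (suc q) (c ∷ f) zero    = refl
    go (suc q) (c ∷ f) (suc n) = go q f n

  deg-drop : ∀ q n f → Deg< (q ℕ.+ n) f → Deg< n (drop q f)
  deg-drop q n f deg k n≤k = trans (trans (reflexive (≡.sym (coeff-tabulate-++-≥ q (λ k → coeff f (toℕ k)) (drop q f) k))) (at (drop-≈ q f) (q ℕ.+ k)))
    (deg (q ℕ.+ k) (ℕ.+-monoʳ-≤ q n≤k))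

  ++-congʳ : ∀ q (d : Fin q → Carrier) {h h′} → h ≈ᴾ h′ → tabulate d ++ h ≈ᴾ tabulate d ++ h′
  ++-congʳ q d {h} {h′} eq = PR.trans (tabulate-++-≈ q d h) (PR.trans (PR.+-congˡ (PR.*-congˡ eq)) (PR.sym (tabulate-++-≈ q d h′)))

  tabulate-≈ : ∀ d f → Deg< d f → tabulate {n = d} (λ k → coeff f (toℕ k)) ≈ᴾ f
  tabulate-≈ d f deg = PR.trans (PR.reflexive (≡.sym (++-identityʳ _)))
    (PR.trans (++-congʳ d (λ k → coeff f (toℕ k)) (PR.sym (deg-0 (deg-drop d 0 f (deg-mono f (ℕ.≤-reflexive (≡.sym (ℕ.+-identityʳ d))) deg)))))
      (drop-≈ d f))

-- Polynomials over a field and the Frobenius basis.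

record DecidableField a ℓ : Set (lsuc (a ⊔ ℓ)) where
  field
    ring : CommutativeRing a ℓ
  open CommutativeRing ring using (Carrier; _≈_; _*_; 0#; 1#)
  field
    _≟_     : ∀ (x y : Carrier) → Dec (x ≈ y)
    1≉0     : ¬ 1# ≈ 0#
    inverse : ∀ x → ¬ x ≈ 0# → ∃[ y ] x * y ≈ 1#

module FieldPolynomials {a ℓ} (𝕂 : DecidableField a ℓ) where
  open DecidableField 𝕂 using (_≟_; 1≉0; inverse) renaming (ring to K)
  open CommutativeRing K hiding (zero; _-_)
  open PolynomialRing K
  open Degree K

  cancel : ∀ {c d} → ¬ c ≈ 0# → c * d ≈ 0# → d ≈ 0#
  cancel {c} {d} c≉0 cd≈0 = let e , ce≈1 = inverse c c≉0 in begin
    d            ≈⟨ *-identityˡ d ⟨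
    1# * d       ≈⟨ *-congʳ (trans (*-comm e c) ce≈1) ⟨
    (e * c) * d  ≈⟨ *-assoc e c d ⟩
    e * (c * d)  ≈⟨ *-congˡ cd≈0 ⟩
    e * 0#       ≈⟨ zeroʳ e ⟩
    0#           ∎
    where open import Relation.Binary.Reasoning.Setoid setoid

  data Leading (f : Poly) : Set (a ⊔ ℓ) where
    vanishes : f ≈ᴾ [] → Leading f
    has-leading : ∀ d m u → Monic d m → ¬ u ≈ 0# → f ≈ᴾ const u ⊗ m → Leading f

  private
    top : ∀ f → f ≈ᴾ [] ⊎ ∃[ d ] (¬ coeff f d ≈ 0# × Deg< (suc d) f)
    top [] = inj₁ PR.refl
    top (c ∷ f) with top f
    ... | inj₂ (d , f≉0 , deg) = inj₂ (suc d , f≉0 , λ { (suc k) (s≤s le) → deg k le })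
    ... | inj₁ f≈0 with c ≟ 0#
    ...   | yes c≈0 = inj₁ (coeffwise λ { zero → c≈0 ; (suc n) → at f≈0 n })
    ...   | no  c≉0 = inj₂ (0 , c≉0 , λ { (suc k) le → at f≈0 k })

  abstract
    leading? : ∀ f → Leading f
    leading? f with top f
    ... | inj₁ f≈0 = vanishes f≈0
    ... | inj₂ (d , u≉0 , deg) =
      let v , uv≈1 = inverse (coeff f d) u≉0
          m-coeff = λ k → trans (at (const-*-≈ v f) k) (coeff-scale v f k)
      in has-leading d (const v ⊗ f) (coeff f d)
        (record { leading = trans (m-coeff d) (trans (*-comm v _) uv≈1)
                ; degree = λ k le → trans (m-coeff k) (trans (*-congˡ (deg k le)) (zeroʳ v)) })
        u≉0
        (PR.sym (PR.trans (PR.sym (PR.*-assoc _ _ f)) (PR.trans (PR.*-congʳ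
          (PR.trans (const-*-≈ _ (const v)) (coeffwise λ { zero → trans (coeff-scale _ (const v) 0) uv≈1
                                                         ; (suc n) → trans (coeff-scale _ (const v) (suc n)) (zeroʳ _) })))
          (PR.*-identityˡ f))))

    _≟0 : ∀ f → Dec (f ≈ᴾ [])
    f ≟0 with leading? f
    ... | vanishes f≈0 = yes f≈0
    ... | has-leading d m u mm u≉0 f≈um = no λ f≈0 → u≉0 (trans (sym (trans (at f≈um d)
          (trans (at (const-*-≈ u m) d) (trans (coeff-scale u m d) (trans (*-congˡ (leading mm)) (*-identityʳ u))))))
          (at f≈0 d))

  deg-cancel-≉0 : ∀ {d m u f} L g → Monic d m → ¬ u ≈ 0# → f ≈ᴾ const u ⊗ m → Deg< (d ℕ.+ L) (f ⊗ g) → Deg< L g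
  deg-cancel-≉0 {d} {m} {u} {f} L g mm u≉0 f≈um deg = deg-cancel L g mm λ k le → cancel u≉0
    (trans (sym (trans (at (const-*-≈ u (m ⊗ g)) k) (coeff-scale u (m ⊗ g) k)))
      (trans (at (PR.sym (PR.*-assoc (const u) m g)) k) (trans (at (PR.*-congʳ {g} (PR.sym f≈um)) k) (deg k le))))

  ⊗-cancel : ∀ {f g} → ¬ f ≈ᴾ [] → f ⊗ g ≈ᴾ [] → g ≈ᴾ []
  ⊗-cancel {f} {g} f≉0 fg≈0 with leading? f
  ... | vanishes f≈0 = ⊥-elim (f≉0 f≈0)
  ... | has-leading d m u mm u≉0 f≈um = deg-0 (deg-cancel-≉0 0 g mm u≉0 f≈um (deg-[] fg≈0))

  ⊗-≉0 : ∀ {f g} → ¬ f ≈ᴾ [] → ¬ g ≈ᴾ [] → ¬ f ⊗ g ≈ᴾ []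
  ⊗-≉0 f≉0 g≉0 fg≈0 = g≉0 (⊗-cancel f≉0 fg≈0)

  monic-≉0 : ∀ {d m} → Monic d m → ¬ m ≈ᴾ []
  monic-≉0 mm m≈0 = 1≉0 (trans (sym (leading mm)) (at m≈0 _))

-- A polynomial over a perfect field is uniquely Σ_{e<q} X^e G_e^q for q = p^D.

module FrobeniusBasis {a ℓ} (𝕂 : DecidableField a ℓ) (p : ℕ) (p-prime : Prime p)
  (char : CommutativeRing._≈_ (DecidableField.ring 𝕂) (IntegerSolver.fromℕ (DecidableField.ring 𝕂) p)
            (CommutativeRing.0# (DecidableField.ring 𝕂))) where
  open DecidableField 𝕂 using (_≟_; 1≉0; inverse) renaming (ring to K)
  open CommutativeRing K hiding (zero; _-_)
  open PolynomialRing K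
  open Degree K
  open FieldPolynomials 𝕂
  open Frobenius K p p-prime char using (_^_; _^p^_; φ-0)

  abstract
    char-poly : IntegerSolver.fromℕ polynomialRing p ≈ᴾ []
    char-poly = PR.trans (go p) (coeffwise λ { zero → char ; (suc n) → refl })
      where
      go : ∀ n → IntegerSolver.fromℕ polynomialRing n ≈ᴾ const (IntegerSolver.fromℕ K n)
      go zero    = coeffwise λ { zero → refl ; (suc n) → refl }
      go (suc n) = PR.trans (PR.+-congˡ (go n))
        (coeffwise λ { zero → coeff-⊕ (1# ∷ []) (const _) 0 ; (suc k) → trans (coeff-⊕ (1# ∷ []) (const _) (suc k)) (+-identityˡ 0#) })

  module P = Frobenius polynomialRing p p-prime char-poly
  open FiniteSums polynomialRing
  private module S = IntegerSolver polynomialRing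

  const-^ : ∀ c n → const c P.^ n ≈ᴾ const (c ^ n)
  const-^ c zero    = PR.refl
  const-^ c (suc n) = PR.trans (PR.*-congˡ (const-^ c n)) (PR.trans (const-*-≈ c (const (c ^ n)))
    (coeffwise λ { zero → coeff-scale c (const (c ^ n)) 0 ; (suc k) → trans (coeff-scale c (const (c ^ n)) (suc k)) (zeroʳ c) }))

  const-φ : ∀ k c → const c P.^p^ k ≈ᴾ const (c ^p^ k)
  const-φ zero    c = PR.refl
  const-φ (suc k) c = PR.trans (P.φ-cong k (const-^ c p)) (const-φ k (c ^ p))

  ^-≈0 : ∀ {c} n → c ^ n ≈ 0# → c ≈ 0#
  ^-≈0 zero    1≈0 = ⊥-elim (1≉0 1≈0)
  ^-≈0 {c} (suc n) eq with c ≟ 0#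
  ... | yes c≈0 = c≈0
  ... | no  c≉0 = ^-≈0 n (cancel c≉0 eq)

  φ-≈0 : ∀ k {c} → c ^p^ k ≈ 0# → c ≈ 0#
  φ-≈0 zero    eq = eq
  φ-≈0 (suc k) eq = ^-≈0 p (φ-≈0 k eq)

  tail : Poly → Poly
  tail = drop 1

  head-tail : ∀ f → f ≈ᴾ const (coeff f 0) ⊕ X ⊗ tail f
  head-tail []      = PR.sym (PR.trans (PR.+-cong (coeffwise λ { zero → refl ; (suc n) → refl }) (PR.zeroʳ X)) (PR.+-identityˡ []))
  head-tail (c ∷ f) = ∷-≈ c f

  deg-tail : ∀ n f → Deg< (suc n) f → Deg< n (tail f)
  deg-tail n f deg = deg-drop 1 n f deg

  basis-∑ : ∀ D → (Fin (p ℕ.^ D) → Poly) → Poly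
  basis-∑ D G = ∑ (allFin (p ℕ.^ D)) (λ e → X ^ᴾ toℕ e ⊗ (G e P.^p^ D))

  private
    -- One block of q coefficients is split off all the G_e at once.
    block : ∀ D (G H : Fin (p ℕ.^ D) → Poly) (c d : Fin (p ℕ.^ D) → Carrier) →
            (∀ e → G e ≈ᴾ const (c e) ⊕ X ⊗ H e) → (∀ e → c e ^p^ D ≈ d e) →
            basis-∑ D G ≈ᴾ tabulate d ++ basis-∑ D H
    block D G H c d G≈ c^≈d = begin
      basis-∑ D G
        ≈⟨ ∑-cong (allFin q) (λ e → PR.*-congˡ (PR.trans (P.φ-cong D (G≈ e)) (P.φ-+ D _ _))) ⟩
      ∑ (allFin q) (λ e → X ^ᴾ toℕ e ⊗ (const (c e) P.^p^ D ⊕ (X ⊗ H e) P.^p^ D))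
        ≈⟨ ∑-cong (allFin q) (λ e → PR.*-congˡ (PR.+-cong (PR.trans (const-φ D (c e)) (const-cong (c^≈d e)))
             (PR.trans (P.φ-* D X (H e)) (PR.*-congʳ (P.φ≈^ D X))))) ⟩
      ∑ (allFin q) (λ e → X ^ᴾ toℕ e ⊗ (const (d e) ⊕ X ^ᴾ q ⊗ (H e P.^p^ D)))
        ≈⟨ ∑-cong (allFin q) (λ e → S.solve 4 (λ x c y h → x S.:* (c S.:+ y S.:* h) S.:= x S.:* c S.:+ y S.:* (x S.:* h))
             PR.refl (X ^ᴾ toℕ e) (const (d e)) (X ^ᴾ q) (H e P.^p^ D)) ⟩
      ∑ (allFin q) (λ e → X ^ᴾ toℕ e ⊗ const (d e) ⊕ X ^ᴾ q ⊗ (X ^ᴾ toℕ e ⊗ (H e P.^p^ D)))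
        ≈⟨ ∑-+ (allFin q) (λ e → X ^ᴾ toℕ e ⊗ const (d e)) (λ e → X ^ᴾ q ⊗ (X ^ᴾ toℕ e ⊗ (H e P.^p^ D))) ⟩
      ∑ (allFin q) (λ e → X ^ᴾ toℕ e ⊗ const (d e)) ⊕ ∑ (allFin q) (λ e → X ^ᴾ q ⊗ (X ^ᴾ toℕ e ⊗ (H e P.^p^ D)))
        ≈⟨ PR.+-congˡ (∑-*ˡ (X ^ᴾ q) (allFin q) (λ e → X ^ᴾ toℕ e ⊗ (H e P.^p^ D))) ⟨
      ∑ (allFin q) (λ e → X ^ᴾ toℕ e ⊗ const (d e)) ⊕ X ^ᴾ q ⊗ basis-∑ D H
        ≈⟨ tabulate-++-≈ q d (basis-∑ D H) ⟨
      tabulate d ++ basis-∑ D H ∎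
      where
      q = p ℕ.^ D
      open import Relation.Binary.Reasoning.Setoid PR.setoid

  abstract
    -- By `block` the first q coefficients of the sum are the p^D-th powers of the constant terms of
    -- the `G e`, so these vanish; what follows is the same sum for the tails, with a smaller degree
    -- bound.
    basis-independent : ∀ D G → basis-∑ D G ≈ᴾ [] → ∀ e → G e ≈ᴾ []
    basis-independent D G eq = let L , len = Fin-bound (p ℕ.^ D) (λ e → length (G e))
                               in go L G (λ e → deg-length (G e) (len e)) eq
      where
      go : ∀ L G → (∀ e → Deg< L (G e)) → basis-∑ D G ≈ᴾ [] → ∀ e → G e ≈ᴾ []
      go zero    G deg eq e = deg-0 (deg e)
      go (suc L) G deg eq e = PR.trans (head-tail (G e)) (PR.trans (PR.+-cong
          (coeffwise λ { zero → φ-≈0 D (trans (reflexive (≡.sym (coeff-tabulate-++ _ d h e))) (at eq′ (toℕ e))) ; (suc n) → refl })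
          (PR.trans (PR.*-congˡ (go L (λ e → tail (G e)) (λ e → deg-tail L (G e) (deg e)) h≈0 e)) (PR.zeroʳ X)))
          (PR.+-identityˡ []))
        where
        d : Fin (p ℕ.^ D) → Carrier
        d e = coeff (G e) 0 ^p^ D
        h : Poly
        h = basis-∑ D (λ e → tail (G e))
        eq′ : tabulate d ++ h ≈ᴾ []
        eq′ = PR.trans (PR.sym (block D G (λ e → tail (G e)) (λ e → coeff (G e) 0) d (λ e → head-tail (G e)) (λ e → refl))) eq
        h≈0 : h ≈ᴾ []
        h≈0 = coeffwise λ n → trans (reflexive (≡.sym (coeff-tabulate-++-≥ _ d h n))) (at eq′ _)

  module _ (root : ∀ c → ∃[ d ] d ^ p ≈ c) where
    roots : ∀ D c → ∃[ d ] d ^p^ D ≈ c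
    roots zero    c = c , refl
    roots (suc D) c = let e , eq = roots D c ; d , eq′ = root e in d , trans (φ-cong D eq′) eq
      where open Frobenius K p p-prime char using (φ-cong)

    abstract
      -- The polynomial is consumed in L blocks of p^D coefficients; each block supplies, through
      -- p^D-th roots, the next coefficient of every `G e`. The bound L on the `G e` is exact, so
      -- that bounds can later be divided by p^D without loss.
      basis-spans : ∀ D L g → Deg< (L ℕ.* p ℕ.^ D) g → Σ[ G ∈ (Fin (p ℕ.^ D) → Poly) ] ((∀ e → Deg< L (G e)) × g ≈ᴾ basis-∑ D G)
      basis-spans D zero    g deg = (λ _ → []) , (λ e k _ → refl) , PR.trans (deg-0 deg) (PR.sym
        (∑-zero (allFin (p ℕ.^ D)) λ e → PR.trans (PR.*-congˡ (P.φ-0 D)) (PR.zeroʳ _)))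
      basis-spans D (suc L) g deg =
        let q = p ℕ.^ D
            H , degH , eq = basis-spans D L (drop q g) (deg-drop q (L ℕ.* q) g deg)
            d = λ (e : Fin q) → coeff g (toℕ e)
            c = λ e → proj₁ (roots D (d e))
        in (λ e → c e ∷ H e) , (λ { e (suc k) (s≤s le) → degH e k le })
         , PR.trans (PR.sym (drop-≈ q g)) (PR.trans (++-congʳ q d eq)
             (PR.sym (block D _ H c d (λ e → ∷-≈ (c e) (H e)) (λ e → proj₂ (roots D (d e))))))

-- The prime field.

module PrimeField (p : ℕ) (p-prime : Prime p) where
  open import Data.Integer.Base using (ℤ; +_; -[1+_])

  -- A record instead of bare divisibility keeps both sides visible to unification.
  infix 4 _≈_
  record _≈_ (x y : ℤ) : Set where
    constructor congruent
    field divisible : + p ℤ.∣ x ℤ.- y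
  open _≈_ public

  private
    by : ∀ {x y d} → x ℤ.- y ≡ d → + p ℤ.∣ d → x ≈ y
    by eq p∣d = congruent (≡.subst (+ p ℤ.∣_) (≡.sym eq) p∣d)

    reflexive : ∀ {x y} → x ≡ y → x ≈ y
    reflexive {x} ≡.refl = by (ℤ.+-inverseʳ x) (ℤ.divides (+ 0) ≡.refl)

  𝔽ₚ : CommutativeRing 0ℓ 0ℓ
  𝔽ₚ = record
    { Carrier = ℤ ; _≈_ = _≈_ ; _+_ = ℤ._+_ ; _*_ = ℤ._*_ ; -_ = ℤ.-_ ; 0# = + 0 ; 1# = + 1
    ; isCommutativeRing = record
      { isRing = record
        { +-isAbelianGroup = record
          { isGroup = record
            { isMonoid = record
              { isSemigroup = record
                { isMagma = record
                  { isEquivalence = record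
                    { refl = reflexive ≡.refl
                    ; sym = λ {x} {y} eq → by (swap x y) (ℤ.∣m⇒∣-m (divisible eq))
                    ; trans = λ {x} {y} {w} eq eq′ → by (chain x y w) (ℤ.∣m∣n⇒∣m+n (divisible eq) (divisible eq′)) }
                  ; ∙-cong = λ {x} {y} {u} {v} eq eq′ → by (add x y u v) (ℤ.∣m∣n⇒∣m+n (divisible eq) (divisible eq′)) }
                ; assoc = λ x y w → reflexive (ℤ.+-assoc x y w) }
              ; identity = (λ x → reflexive (ℤ.+-identityˡ x)) , λ x → reflexive (ℤ.+-identityʳ x) }
            ; inverse = (λ x → reflexive (ℤ.+-inverseˡ x)) , λ x → reflexive (ℤ.+-inverseʳ x)
            ; ⁻¹-cong = λ {x} {y} eq → by (negate x y) (ℤ.∣m⇒∣-m (divisible eq)) }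
          ; comm = λ x y → reflexive (ℤ.+-comm x y) }
        ; *-cong = λ {x} {y} {u} {v} eq eq′ → by (mul x y u v)
            (ℤ.∣m∣n⇒∣m+n (ℤ.∣m⇒∣m*n u (divisible eq)) (ℤ.∣n⇒∣m*n y (divisible eq′)))
        ; *-assoc = λ x y w → reflexive (ℤ.*-assoc x y w)
        ; *-identity = (λ x → reflexive (ℤ.*-identityˡ x)) , λ x → reflexive (ℤ.*-identityʳ x)
        ; distrib = (λ x y w → reflexive (ℤ.*-distribˡ-+ x y w)) , λ x y w → reflexive (ℤ.*-distribʳ-+ x y w) }
      ; *-comm = λ x y → reflexive (ℤ.*-comm x y) } }
    where
    swap : ∀ x y → y ℤ.- x ≡ ℤ.- (x ℤ.- y)
    swap = ℤ.solve-∀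
    chain : ∀ x y w → x ℤ.- w ≡ (x ℤ.- y) ℤ.+ (y ℤ.- w)
    chain = ℤ.solve-∀
    add : ∀ x y u v → (x ℤ.+ u) ℤ.- (y ℤ.+ v) ≡ (x ℤ.- y) ℤ.+ (u ℤ.- v)
    add = ℤ.solve-∀
    negate : ∀ x y → (ℤ.- x) ℤ.- (ℤ.- y) ≡ ℤ.- (x ℤ.- y)
    negate = ℤ.solve-∀
    mul : ∀ x y u v → (x ℤ.* u) ℤ.- (y ℤ.* v) ≡ (x ℤ.- y) ℤ.* u ℤ.+ y ℤ.* (u ℤ.- v)
    mul = ℤ.solve-∀

  private
    module F = CommutativeRing 𝔽ₚ

  fromℕ≡+ : ∀ n → IntegerSolver.fromℕ 𝔽ₚ n ≡ + n
  fromℕ≡+ zero    = ≡.refl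
  fromℕ≡+ (suc n) = ≡.cong (λ x → + 1 ℤ.+ x) (fromℕ≡+ n)

  char : IntegerSolver.fromℕ 𝔽ₚ p ≈ + 0
  char = by (≡.trans (≡.cong (ℤ._- + 0) (fromℕ≡+ p)) (ℤ.+-identityʳ (+ p))) ℤ.∣-refl

  open Frobenius 𝔽ₚ p p-prime char using (_^_; frobenius-+; 0^p≈0; ^-congˡ; φ-neg)

  1^n≈1 : ∀ n → (+ 1) ^ n ≈ + 1
  1^n≈1 zero    = F.refl
  1^n≈1 (suc n) = F.trans (F.*-identityˡ _) (1^n≈1 n)

  private
    -- Induction on n, by additivity of the p-th power in characteristic p.
    fermat-ℕ : ∀ n → (+ n) ^ p ≈ + n
    fermat-ℕ zero    = 0^p≈0
    fermat-ℕ (suc n) = F.trans (frobenius-+ (+ 1) (+ n)) (F.+-cong (1^n≈1 p) (fermat-ℕ n))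

  fermat : ∀ x → x ^ p ≈ x
  fermat (+ n)      = fermat-ℕ n
  fermat (-[1+ n ]) = F.trans (φ-neg 1 (+ suc n)) (F.-‿cong (fermat-ℕ (suc n)))

  _≟ₚ_ : ∀ x y → Dec (x ≈ y)
  x ≟ₚ y = map′ congruent divisible (+ p ℤ.∣? (x ℤ.- y))

  private
    to∣ : ∀ {x} → x ≈ + 0 → + p ℤ.∣ x
    to∣ {x} eq = ≡.subst (+ p ℤ.∣_) (ℤ.+-identityʳ x) (divisible eq)
    from∣ : ∀ {x} → + p ℤ.∣ x → x ≈ + 0
    from∣ {x} = by (ℤ.+-identityʳ x)

    domain : ∀ x y → x ℤ.* y ≈ + 0 → x ≈ + 0 ⊎ y ≈ + 0
    domain x y xy≈0 with euclidsLemma (ℤ.∣ x ∣) (ℤ.∣ y ∣) p-prime (≡.subst (p ℕ∣.∣_) (ℤ.abs-* x y) (ℤ.∣⇒∣ᵤ (to∣ xy≈0)))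
    ... | inj₁ p∣x = inj₁ (from∣ (ℤ.∣ᵤ⇒∣ p∣x))
    ... | inj₂ p∣y = inj₂ (from∣ (ℤ.∣ᵤ⇒∣ p∣y))

    1<p : 1 ℕ.< p
    1<p = ℕ.nonTrivial⇒n>1 p {{prime⇒nonTrivial p-prime}}

    -- x (x^{p-1} - 1) = 0 by Fermat.
    inverse : ∀ x → ¬ x ≈ + 0 → ∃[ y ] x ℤ.* y ≈ + 1
    inverse x x≉0 = go p 1<p (fermat x)
      where
      go : ∀ n → 1 ℕ.< n → x ^ n ≈ x → ∃[ y ] x ℤ.* y ≈ + 1
      go (suc (suc n)) _ eq = x ^ n , finish (domain x (x ℤ.* x ^ n ℤ.- + 1) (by (arrange x (x ^ n)) (divisible eq)))
        where
        arrange : ∀ x w → x ℤ.* (x ℤ.* w ℤ.- + 1) ℤ.- + 0 ≡ x ℤ.* (x ℤ.* w) ℤ.- x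
        arrange = ℤ.solve-∀
        finish : x ≈ + 0 ⊎ x ℤ.* x ^ n ℤ.- + 1 ≈ + 0 → x ℤ.* x ^ n ≈ + 1
        finish (inj₁ x≈0) = ⊥-elim (x≉0 x≈0)
        finish (inj₂ eq′) = congruent (to∣ eq′)
      go (suc zero) (s≤s ())

  field-𝔽ₚ : DecidableField 0ℓ 0ℓ
  field-𝔽ₚ = record
    { ring = 𝔽ₚ ; _≟_ = _≟ₚ_
    ; 1≉0 = λ 1≈0 → ℕ.<⇒≱ 1<p (∣⇒≤ (ℤ.∣⇒∣ᵤ (to∣ 1≈0)))
    ; inverse = inverse }

  private
    instance
      p-nonZero = prime⇒nonZero p-prime

  residue : ℤ → Fin p
  residue x = fromℕ< (ℤ.n%ℕd<d x p)

  residue-≈ : ∀ x → + toℕ (residue x) ≈ x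
  residue-≈ x = F.sym (by (≡.trans (≡.cong₂ (λ a b → a ℤ.- + b) (ℤ.a≡a%ℕn+[a/ℕn]*n x p) (Fin.toℕ-fromℕ< (ℤ.n%ℕd<d x p)))
      (shift (+ (x ℤ.%ℕ p)) ((x ℤ./ℕ p) ℤ.* + p)))
    (ℤ.∣n⇒∣m*n (x ℤ./ℕ p) ℤ.∣-refl))
    where
    shift : ∀ r m → (r ℤ.+ m) ℤ.- r ≡ m
    shift = ℤ.solve-∀

  open PolynomialRing 𝔽ₚ
  open Degree 𝔽ₚ

  -- Pigeonhole: modulo a monic m of degree d there are p^d remainders, encoded by d residues, so
  -- among p^d + 1 polynomials two agree modulo m. The form `suc (i ℕ.+ k)` of the second index
  -- records that it is strictly larger.
  repetition : ∀ {d m} → Monic d m → ∀ (h : ℕ → Poly) →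
               ∃[ i ] ∃[ k ] Σ[ u ∈ Poly ] h i ≈ᴾ h (suc (i ℕ.+ k)) ⊕ u ⊗ m
  repetition {d} {m} mm h with Fin.pigeonhole (ℕ.n<1+n (p ℕ.^ d)) code
    where
    code : Fin (suc (p ℕ.^ d)) → Fin (p ℕ.^ d)
    code i = funToFin {m = d} (λ k → residue (coeff (Division.remainder (divide mm (h (toℕ i)))) (toℕ k)))
  ... | i , j , i<j , same = toℕ i , toℕ j ℕ.∸ suc (toℕ i) , Q i ⊕ ⊝ (Q j) , ≡.subst (λ l → h (toℕ i) ≈ᴾ h l ⊕ (Q i ⊕ ⊝ (Q j)) ⊗ m)
      (≡.sym (ℕ.m+[n∸m]≡n i<j)) (begin
        h (toℕ i)                                  ≈⟨ Division.division (div i) ⟩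
        Q i ⊗ m ⊕ R i                              ≈⟨ PR.+-congˡ R≈ ⟩
        Q i ⊗ m ⊕ R j                              ≈⟨ S.solve 4 (λ a b m r → a S.:* m S.:+ r S.:= (b S.:* m S.:+ r) S.:+ (a S.:+ S.:- b) S.:* m) PR.refl (Q i) (Q j) m (R j) ⟩
        (Q j ⊗ m ⊕ R j) ⊕ (Q i ⊕ ⊝ (Q j)) ⊗ m      ≈⟨ PR.+-congʳ (Division.division (div j)) ⟨
        h (toℕ j) ⊕ (Q i ⊕ ⊝ (Q j)) ⊗ m            ∎)
    where
    module S = IntegerSolver polynomialRing
    open import Relation.Binary.Reasoning.Setoid PR.setoid
    div : ∀ (i : Fin (suc (p ℕ.^ d))) → Division m (h (toℕ i)) d
    div i = divide mm (h (toℕ i))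
    Q = λ i → Division.quotient (div i)
    R = λ i → Division.remainder (div i)
    digit : Fin (suc (p ℕ.^ d)) → Fin d → Fin p
    digit i k = residue (coeff (R i) (toℕ k))
    R≈ : R i ≈ᴾ R j
    R≈ = coeffwise coefficient
      where
      low : ∀ (k : Fin d) → coeff (R i) (toℕ k) ≈ coeff (R j) (toℕ k)
      low k = F.trans (F.sym (residue-≈ _)) (F.trans (reflexive (≡.cong (λ r → + toℕ r) digits)) (residue-≈ _))
        where
        digits : digit i k ≡ digit j k
        digits = ≡.trans (≡.sym (Fin.finToFun-funToFin (digit i) k)) (≡.trans (≡.cong (λ c → finToFun {p} {d} c k) same) (Fin.finToFun-funToFin (digit j) k))
      coefficient : ∀ n → coeff (R i) n ≈ coeff (R j) n
      coefficient n with n ℕ.<? d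
      ... | yes n<d = ≡.subst (λ l → coeff (R i) l ≈ coeff (R j) l) (Fin.toℕ-fromℕ< n<d) (low (fromℕ< n<d))
      ... | no  n≮d = F.trans (deg-length (R i) (Division.remainder-degree (div i)) n (ℕ.≮⇒≥ n≮d))
                        (F.sym (deg-length (R j) (Division.remainder-degree (div j)) n (ℕ.≮⇒≥ n≮d)))

  -- Terms of the language express multiplication by an element of 𝔽ₚ as a repeated sum, for which a
  -- representative in ℕ is required.
  natural : ℤ → ℕ
  natural x = toℕ (residue x)

  natural-≈ : ∀ x → IntegerSolver.fromℕ 𝔽ₚ (natural x) ≈ x
  natural-≈ x = F.trans (reflexive (fromℕ≡+ (natural x))) (residue-≈ x)

-- An interface to 𝔽ₚ, so that integer arithmetic does not unfold in what follows.
record PrimeCoefficients {p : ℕ} (p-prime : Prime p) : Set₁ where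
  field
    field-𝔽ₚ : DecidableField 0ℓ 0ℓ
  𝔽ₚ : CommutativeRing 0ℓ 0ℓ
  𝔽ₚ = DecidableField.ring field-𝔽ₚ
  open CommutativeRing 𝔽ₚ using (Carrier; _≈_; 0#; semiring)
  open Algebra.Properties.Semiring.Exp semiring using (_^_)
  open PolynomialRing 𝔽ₚ using (Poly; _≈ᴾ_; _⊕_; _⊗_)
  open Degree 𝔽ₚ using (Monic)
  field
    char       : IntegerSolver.fromℕ 𝔽ₚ p ≈ 0#
    fermat     : ∀ x → x ^ p ≈ x
    natural    : Carrier → ℕ
    natural-≈  : ∀ x → IntegerSolver.fromℕ 𝔽ₚ (natural x) ≈ x
    repetition : ∀ {d m} → Monic d m → ∀ (h : ℕ → Poly) →
                 ∃[ i ] ∃[ k ] Σ[ u ∈ Poly ] h i ≈ᴾ h (suc (i ℕ.+ k)) ⊕ u ⊗ m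

-- The ring R, abstractly and as a ring of fractions.

-- The ring R = F[z, 1/s] with F perfect.

record Model {p : ℕ} {p-prime : Prime p} (𝕜 : PrimeCoefficients p-prime) (s : List (CommutativeRing.Carrier (PrimeCoefficients.𝔽ₚ 𝕜))) (a : Level) : Set (lsuc a) where
  open PrimeCoefficients 𝕜 using (𝔽ₚ)
  field
    field-F : DecidableField a a
  F : CommutativeRing a a
  F = DecidableField.ring field-F
  private
    module F = CommutativeRing F
    module F^ = Algebra.Properties.Semiring.Exp F.semiring
  field
    ι    : RingHom 𝔽ₚ F
    root : ∀ c → ∃[ d ] d F^.^ p F.≈ c
    R    : CommutativeRing a a
    κ    : RingHom F R
    z    : CommutativeRing.Carrier R
  open CommutativeRing R hiding (zero; _-_; ring)
  open Algebra.Properties.Semiring.Exp semiring using (_^_)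
  private
    module EF = Evaluation κ z
    module EP = Evaluation (κ ∘ʰ ι) z
  field
    -- Excluded middle is part of the model, so that formulas, which are built without a model,
    -- cannot depend on it.
    em             : ∀ (Q : Set a) → Dec Q
    s⁻¹            : Carrier
    s-inverse      : EP.ev s * s⁻¹ ≈ 1#
    generated      : ∀ x → ∃[ N ] ∃[ g ] EP.ev s ^ N * x ≈ EF.ev g
    transcendental : ∀ g → EF.ev g ≈ 0# → PolynomialRing._≈ᴾ_ F g []

module _ {a ℓ} (A : RawRing a ℓ) where
  open RawRing A
  open Polynomial A

  *ᴾ-[] : ∀ q n → coeff (q *ᴾ []) n ≡ 0#
  *ᴾ-[] []      n       = ≡.refl
  *ᴾ-[] (c ∷ q) zero    = ≡.refl
  *ᴾ-[] (c ∷ q) (suc n) = *ᴾ-[] q n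

  -- If f were zero then f = 0 · 0, and irreducibility would make 0 a unit.
  irreducible-≉0 : ¬ 0# ≈ 1# → ∀ {f} → IrreduciblePoly f → ¬ RawRing._≈_ polyRing f []
  irreducible-≉0 0≉1 irreducible f≈0 = [ zero-divides , zero-divides ]′ (RawSemiringDefinitions.Irreducible.split-∣1 irreducible {[]} {[]} f≈0)
    where
    zero-divides : ¬ RawMagma._∣ʳ_ (RawSemiring.*-rawMagma (RawRing.rawSemiring polyRing)) [] (1# ∷ [])
    zero-divides (q RawMagma., eq) = 0≉1 (≡.subst (_≈ 1#) (*ᴾ-[] q 0) (eq 0))

module FractionRing {a} (F : Field a) (_≟_ : ∀ x y → Dec (Field._≈_ F x y)) where
  open RationalFunctions F
  open Fraction
  private
    module F = Field F

  field-F : DecidableField a a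
  field-F = record { ring = F.commutativeRing ; _≟_ = _≟_ ; 1≉0 = F.1≉0 ; inverse = F.inverse }

  private
    module Q where
      open PolynomialRing F.commutativeRing public
      open FieldPolynomials field-F public
    module T = CommutativeRing Q.transparentRing
    module S = IntegerSolver Q.transparentRing
    open import Relation.Binary.Reasoning.Setoid T.setoid

  open RawSemiring rationalFunctions public using () renaming (_≈_ to _≈ᶠ_; _+_ to _+ᶠ_; _*_ to _*ᶠ_)

  private
    wrap : ∀ {f g} → f ≈ᴾ g → f Q.≈ᴾ g
    wrap = Q.coeffwise

    cancelᴾ : ∀ f g → ¬ f ≈ᴾ [] → f T.* g Q.≈ᴾ [] → g Q.≈ᴾ []
    cancelᴾ f g f≉0 fg≈0 = Q.⊗-cancel {f} {g} (λ f≈0 → f≉0 (Q.at f≈0)) (≡.subst (Q._≈ᴾ []) (≡.sym (Q.⊗≡*ᴾ f g)) fg≈0)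

    0∷[]≈[] : (F.0# ∷ []) Q.≈ᴾ []
    0∷[]≈[] = Q.coeffwise λ { zero → F.refl ; (suc n) → F.refl }

  -- The ring laws for fractions, stated for variables so that +ᴾ and *ᴾ do not unfold.
  private
    trans-poly : ∀ a b c d e f → a T.* d Q.≈ᴾ c T.* b → c T.* f Q.≈ᴾ e T.* d → d T.* (a T.* f T.+ T.- (e T.* b)) Q.≈ᴾ []
    trans-poly a b c d e f eq eq′ = begin
      d T.* (a T.* f T.+ T.- (e T.* b))                ≈⟨ S.solve 5 (λ a b d e f → d S.:* (a S.:* f S.:+ S.:- (e S.:* b)) S.:= (a S.:* d) S.:* f S.:+ S.:- ((e S.:* d) S.:* b)) T.refl a b d e f ⟩
      (a T.* d) T.* f T.+ T.- ((e T.* d) T.* b)        ≈⟨ T.+-cong (T.*-congʳ eq) (T.-‿cong (T.*-congʳ (T.sym eq′))) ⟩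
      (c T.* b) T.* f T.+ T.- ((c T.* f) T.* b)        ≈⟨ S.solve 3 (λ b c f → (c S.:* b) S.:* f S.:+ S.:- ((c S.:* f) S.:* b) S.:= S.:0) T.refl b c f ⟩
      []                                               ∎

    difference : ∀ x y → x T.+ T.- y Q.≈ᴾ [] → x Q.≈ᴾ y
    difference x y eq = T.trans (S.solve 2 (λ x y → x S.:= (x S.:+ S.:- y) S.:+ y) T.refl x y) (T.trans (T.+-congʳ eq) (T.+-identityˡ y))

    +-cong-poly : ∀ a b a′ b′ c d c′ d′ → a T.* b′ Q.≈ᴾ a′ T.* b → c T.* d′ Q.≈ᴾ c′ T.* d →
      (a T.* d T.+ c T.* b) T.* (b′ T.* d′) Q.≈ᴾ (a′ T.* d′ T.+ c′ T.* b′) T.* (b T.* d)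
    +-cong-poly a b a′ b′ c d c′ d′ eq eq′ = begin
      (a T.* d T.+ c T.* b) T.* (b′ T.* d′)
        ≈⟨ S.solve 6 (λ a b b′ c d d′ → (a S.:* d S.:+ c S.:* b) S.:* (b′ S.:* d′) S.:= (a S.:* b′) S.:* (d S.:* d′) S.:+ (c S.:* d′) S.:* (b S.:* b′)) T.refl a b b′ c d d′ ⟩
      (a T.* b′) T.* (d T.* d′) T.+ (c T.* d′) T.* (b T.* b′)
        ≈⟨ T.+-cong (T.*-congʳ eq) (T.*-congʳ eq′) ⟩
      (a′ T.* b) T.* (d T.* d′) T.+ (c′ T.* d) T.* (b T.* b′)
        ≈⟨ S.solve 6 (λ a′ b b′ c′ d d′ → (a′ S.:* b) S.:* (d S.:* d′) S.:+ (c′ S.:* d) S.:* (b S.:* b′) S.:= (a′ S.:* d′ S.:+ c′ S.:* b′) S.:* (b S.:* d)) T.refl a′ b b′ c′ d d′ ⟩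
      (a′ T.* d′ T.+ c′ T.* b′) T.* (b T.* d) ∎

    *-cong-poly : ∀ a b a′ b′ c d c′ d′ → a T.* b′ Q.≈ᴾ a′ T.* b → c T.* d′ Q.≈ᴾ c′ T.* d →
      (a T.* c) T.* (b′ T.* d′) Q.≈ᴾ (a′ T.* c′) T.* (b T.* d)
    *-cong-poly a b a′ b′ c d c′ d′ eq eq′ = begin
      (a T.* c) T.* (b′ T.* d′)  ≈⟨ S.solve 4 (λ a b′ c d′ → (a S.:* c) S.:* (b′ S.:* d′) S.:= (a S.:* b′) S.:* (c S.:* d′)) T.refl a b′ c d′ ⟩
      (a T.* b′) T.* (c T.* d′)  ≈⟨ T.*-cong eq eq′ ⟩
      (a′ T.* b) T.* (c′ T.* d)  ≈⟨ S.solve 4 (λ a′ b c′ d → (a′ S.:* b) S.:* (c′ S.:* d) S.:= (a′ S.:* c′) S.:* (b S.:* d)) T.refl a′ b c′ d ⟩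
      (a′ T.* c′) T.* (b T.* d)  ∎

    assoc-poly : ∀ a b c d e f → ((a T.* d T.+ c T.* b) T.* f T.+ e T.* (b T.* d)) T.* (b T.* (d T.* f)) Q.≈ᴾ
      (a T.* (d T.* f) T.+ (c T.* f T.+ e T.* d) T.* b) T.* ((b T.* d) T.* f)
    assoc-poly = S.solve 6 (λ a b c d e f → ((a S.:* d S.:+ c S.:* b) S.:* f S.:+ e S.:* (b S.:* d)) S.:* (b S.:* (d S.:* f)) S.:=
      (a S.:* (d S.:* f) S.:+ (c S.:* f S.:+ e S.:* d) S.:* b) S.:* ((b S.:* d) S.:* f)) T.refl

    comm-poly : ∀ a b c d → (a T.* d T.+ c T.* b) T.* (d T.* b) Q.≈ᴾ (c T.* b T.+ a T.* d) T.* (b T.* d)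
    comm-poly = S.solve 4 (λ a b c d → (a S.:* d S.:+ c S.:* b) S.:* (d S.:* b) S.:= (c S.:* b S.:+ a S.:* d) S.:* (b S.:* d)) T.refl

    identity-poly : ∀ o e a b → o Q.≈ᴾ [] → e Q.≈ᴾ T.1# → (o T.* b T.+ a T.* e) T.* b Q.≈ᴾ a T.* (e T.* b)
    identity-poly o e a b o≈0 e≈1 = T.trans (T.*-congʳ (T.+-congʳ (T.*-congʳ o≈0)))
      (S.solve 3 (λ a b e → (S.:0 S.:* b S.:+ a S.:* e) S.:* b S.:= a S.:* (e S.:* b)) T.refl a b e)

    inverse-poly : ∀ n e o a b → T.- e Q.≈ᴾ n → o Q.≈ᴾ [] → ((n T.* a) T.* b T.+ a T.* (e T.* b)) T.* e Q.≈ᴾ o T.* ((e T.* b) T.* b)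
    inverse-poly n e o a b n≈ o≈0 = T.trans (T.*-congʳ (T.+-congʳ (T.*-congʳ (T.*-congʳ (T.sym n≈)))))
      (T.trans (S.solve 3 (λ e a b → (((S.:- e) S.:* a) S.:* b S.:+ a S.:* (e S.:* b)) S.:* e S.:= S.:0 S.:* ((e S.:* b) S.:* b)) T.refl e a b)
        (T.*-congʳ (T.sym o≈0)))

    *-assoc-poly : ∀ a b c d e f → ((a T.* c) T.* e) T.* (b T.* (d T.* f)) Q.≈ᴾ (a T.* (c T.* e)) T.* ((b T.* d) T.* f)
    *-assoc-poly = S.solve 6 (λ a b c d e f → ((a S.:* c) S.:* e) S.:* (b S.:* (d S.:* f)) S.:= (a S.:* (c S.:* e)) S.:* ((b S.:* d) S.:* f)) T.refl

    *-comm-poly : ∀ a b c d → (a T.* c) T.* (d T.* b) Q.≈ᴾ (c T.* a) T.* (b T.* d)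
    *-comm-poly = S.solve 4 (λ a b c d → (a S.:* c) S.:* (d S.:* b) S.:= (c S.:* a) S.:* (b S.:* d)) T.refl

    *-identity-poly : ∀ e a b → (e T.* a) T.* b Q.≈ᴾ a T.* (e T.* b)
    *-identity-poly = S.solve 3 (λ e a b → (e S.:* a) S.:* b S.:= a S.:* (e S.:* b)) T.refl

    distrib-poly : ∀ a b c d e f → (a T.* (c T.* f T.+ e T.* d)) T.* ((b T.* d) T.* (b T.* f)) Q.≈ᴾ
      ((a T.* c) T.* (b T.* f) T.+ (a T.* e) T.* (b T.* d)) T.* (b T.* (d T.* f))
    distrib-poly = S.solve 6 (λ a b c d e f → (a S.:* (c S.:* f S.:+ e S.:* d)) S.:* ((b S.:* d) S.:* (b S.:* f)) S.:=
      ((a S.:* c) S.:* (b S.:* f) S.:+ (a S.:* e) S.:* (b S.:* d)) S.:* (b S.:* (d S.:* f))) T.refl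

  abstract
    -- The only law that is not a ring identity: the nonzero middle denominator has to be cancelled,
    -- which uses that F[z] is a domain.
    ≈-trans : ∀ x y w → x ≈ᶠ y → y ≈ᶠ w → x ≈ᶠ w
    ≈-trans x y w eq eq′ = Q.at (difference (num x T.* den w) (num w T.* den x)
      (cancelᴾ (den y) (num x T.* den w T.+ T.- (num w T.* den x)) (den≉0 y) (trans-poly (num x) (den x) (num y) (den y) (num w) (den w) (wrap eq) (wrap eq′))))

    +-congᶠ : ∀ x x′ y y′ → x ≈ᶠ x′ → y ≈ᶠ y′ → x +ᶠ y ≈ᶠ x′ +ᶠ y′
    +-congᶠ x x′ y y′ eq eq′ = Q.at (+-cong-poly (num x) (den x) (num x′) (den x′) (num y) (den y) (num y′) (den y′) (wrap eq) (wrap eq′))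

    *-congᶠ : ∀ x x′ y y′ → x ≈ᶠ x′ → y ≈ᶠ y′ → x *ᶠ y ≈ᶠ x′ *ᶠ y′
    *-congᶠ x x′ y y′ eq eq′ = Q.at (*-cong-poly (num x) (den x) (num x′) (den x′) (num y) (den y) (num y′) (den y′) (wrap eq) (wrap eq′))

    +-assocᶠ : ∀ x y w → (x +ᶠ y) +ᶠ w ≈ᶠ x +ᶠ (y +ᶠ w)
    +-assocᶠ x y w = Q.at (assoc-poly (num x) (den x) (num y) (den y) (num w) (den w))

    +-commᶠ : ∀ x y → x +ᶠ y ≈ᶠ y +ᶠ x
    +-commᶠ x y = Q.at (comm-poly (num x) (den x) (num y) (den y))

    +-identityᶠ : ∀ x → constant F.0# +ᶠ x ≈ᶠ x
    +-identityᶠ x = Q.at (identity-poly (F.0# ∷ []) (F.1# ∷ []) (num x) (den x) 0∷[]≈[] T.refl)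

    -ᶠ-inverse : ∀ x → (constant (F.- F.1#) *ᶠ x) +ᶠ x ≈ᶠ constant F.0#
    -ᶠ-inverse x = Q.at (inverse-poly (F.- F.1# ∷ []) (F.1# ∷ []) (F.0# ∷ []) (num x) (den x) T.refl 0∷[]≈[])

    *-assocᶠ : ∀ x y w → (x *ᶠ y) *ᶠ w ≈ᶠ x *ᶠ (y *ᶠ w)
    *-assocᶠ x y w = Q.at (*-assoc-poly (num x) (den x) (num y) (den y) (num w) (den w))

    *-commᶠ : ∀ x y → x *ᶠ y ≈ᶠ y *ᶠ x
    *-commᶠ x y = Q.at (*-comm-poly (num x) (den x) (num y) (den y))

    *-identityᶠ : ∀ x → constant F.1# *ᶠ x ≈ᶠ x
    *-identityᶠ x = Q.at (*-identity-poly (F.1# ∷ []) (num x) (den x))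

    distribᶠ : ∀ x y w → x *ᶠ (y +ᶠ w) ≈ᶠ (x *ᶠ y) +ᶠ (x *ᶠ w)
    distribᶠ x y w = Q.at (distrib-poly (num x) (den x) (num y) (den y) (num w) (den w))

    fromPoly-cong : ∀ f g → f Q.≈ᴾ g → fromPoly f ≈ᶠ fromPoly g
    fromPoly-cong f g eq = Q.at (T.*-congʳ {T.1#} {f} {g} eq)

    fromPoly-+ : ∀ f g → fromPoly (f T.+ g) ≈ᶠ fromPoly f +ᶠ fromPoly g
    fromPoly-+ f g = Q.at (poly f g T.1#)
      where
      poly : ∀ f g e → (f T.+ g) T.* (e T.* e) Q.≈ᴾ (f T.* e T.+ g T.* e) T.* e
      poly = S.solve 3 (λ f g e → (f S.:+ g) S.:* (e S.:* e) S.:= (f S.:* e S.:+ g S.:* e) S.:* e) T.refl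

    fromPoly-* : ∀ f g → fromPoly (f T.* g) ≈ᶠ fromPoly f *ᶠ fromPoly g
    fromPoly-* f g = Q.at (poly f g T.1# T.refl)
      where
      poly : ∀ f g e → e Q.≈ᴾ T.1# → (f T.* g) T.* (e T.* e) Q.≈ᴾ (f T.* g) T.* e
      poly f g e e≈1 = T.*-congˡ {f T.* g} {e T.* e} {e} (T.trans (T.*-congʳ {e} {e} {T.1#} e≈1) (T.*-identityˡ e))

    fromPoly-injective : ∀ {f g} → fromPoly f ≈ᶠ fromPoly g → f Q.≈ᴾ g
    fromPoly-injective {f} {g} eq = T.trans (T.sym (T.*-identityʳ f)) (T.trans (wrap eq) (T.*-identityʳ g))

    fromPoly-0 : fromPoly [] ≈ᶠ constant F.0#
    fromPoly-0 = fromPoly-cong [] (F.0# ∷ []) (T.sym 0∷[]≈[])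

    fromPoly-∷ : ∀ c f → fromPoly (c ∷ f) ≈ᶠ constant c +ᶠ (fromPoly Q.X *ᶠ fromPoly f)
    fromPoly-∷ c f = ≈-trans (fromPoly (c ∷ f)) (fromPoly ((c ∷ []) T.+ Q.X T.* f)) (constant c +ᶠ (fromPoly Q.X *ᶠ fromPoly f))
      (fromPoly-cong (c ∷ f) ((c ∷ []) T.+ Q.X T.* f) (≡.subst (λ g → (c ∷ f) Q.≈ᴾ g) (≡.trans (≡.cong (Q.const c Q.⊕_) (Q.⊗≡*ᴾ Q.X f)) (Q.⊕≡+ᴾ (Q.const c) (Q.X T.* f))) (Q.∷-≈ c f)))
      (≈-trans (fromPoly ((c ∷ []) T.+ Q.X T.* f)) (constant c +ᶠ fromPoly (Q.X T.* f)) (constant c +ᶠ (fromPoly Q.X *ᶠ fromPoly f))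
        (fromPoly-+ (c ∷ []) (Q.X T.* f))
        (+-congᶠ (constant c) (constant c) (fromPoly (Q.X T.* f)) (fromPoly Q.X *ᶠ fromPoly f) (λ n → F.refl) (fromPoly-* Q.X f)))

    constant-* : ∀ c d → constant (c F.* d) ≈ᶠ constant c *ᶠ constant d
    constant-* c d = ≈-trans (constant (c F.* d)) (fromPoly ((c ∷ []) T.* (d ∷ []))) (constant c *ᶠ constant d)
      (fromPoly-cong (c F.* d ∷ []) ((c ∷ []) T.* (d ∷ [])) (Q.coeffwise λ { zero → F.sym (F.+-identityʳ _) ; (suc n) → F.refl }))
      (fromPoly-* (c ∷ []) (d ∷ []))

    fromPoly-reciprocal : ∀ f f≉0 → fromPoly f *ᶠ reciprocal f f≉0 ≈ᶠ constant F.1#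
    fromPoly-reciprocal f f≉0 = Q.at (poly f T.1#)
      where
      poly : ∀ f e → (f T.* e) T.* e Q.≈ᴾ e T.* (e T.* f)
      poly = S.solve 2 (λ f e → (f S.:* e) S.:* e S.:= e S.:* (e S.:* f)) T.refl

  module _ (S : List (Polynomial.Poly F.rawRing)) where
    private
      open module R = RawSemiring (subring S) using (Carrier; _≈_; _+_; _*_; 0#; 1#)
      constantᴿ : F.Carrier → Carrier
      constantᴿ c = constant c , const c

      refl : ∀ {x} → x ≈ x
      refl n = F.refl
      sym : ∀ {x y} → x ≈ y → y ≈ x
      sym eq n = F.sym (eq n)
      trans : ∀ {x y w} → x ≈ y → y ≈ w → x ≈ w
      trans {x , _} {y , _} {w , _} = ≈-trans x y w

    -- Negation is multiplication by the constant -1, because `Generated` has no rule for negatives.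
    subring-commutativeRing : CommutativeRing a a
    subring-commutativeRing = record
      { Carrier = Carrier ; _≈_ = _≈_ ; _+_ = _+_ ; _*_ = _*_ ; -_ = λ x → constantᴿ (F.- F.1#) * x ; 0# = 0# ; 1# = 1#
      ; isCommutativeRing = record
        { isRing = record
          { +-isAbelianGroup = record
            { isGroup = record
              { isMonoid = record
                { isSemigroup = record
                  { isMagma = record
                    { isEquivalence = record { refl = λ {x} → refl {x} ; sym = λ {x} {y} → sym {x} {y} ; trans = λ {x} {y} {w} → trans {x} {y} {w} }
                    ; ∙-cong = λ { {x , _} {x′ , _} {y , _} {y′ , _} → +-congᶠ x x′ y y′ } }
                  ; assoc = λ (x , _) (y , _) (w , _) → +-assocᶠ x y w }
                ; identity = (λ (x , _) → +-identityᶠ x)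
                           , λ (x , x∈R) → trans {(x , x∈R) + 0#} {0# + (x , x∈R)} {x , x∈R} (+-commᶠ x (constant F.0#)) (+-identityᶠ x) }
              ; inverse = (λ (x , _) → -ᶠ-inverse x)
                        , λ (x , x∈R) → let y = constantᴿ (F.- F.1#) * (x , x∈R) in
                            trans {(x , x∈R) + y} {y + (x , x∈R)} {0#} (+-commᶠ x (proj₁ y)) (-ᶠ-inverse x)
              ; ⁻¹-cong = λ { {x , _} {x′ , _} → *-congᶠ (constant (F.- F.1#)) (constant (F.- F.1#)) x x′ (refl {constantᴿ (F.- F.1#)}) } }
            ; comm = λ (x , _) (y , _) → +-commᶠ x y }
          ; *-cong = λ { {x , _} {x′ , _} {y , _} {y′ , _} → *-congᶠ x x′ y y′ }
          ; *-assoc = λ (x , _) (y , _) (w , _) → *-assocᶠ x y w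
          ; *-identity = (λ (x , _) → *-identityᶠ x)
                       , λ (x , x∈R) → trans {(x , x∈R) * 1#} {1# * (x , x∈R)} {x , x∈R} (*-commᶠ x (constant F.1#)) (*-identityᶠ x)
          ; distrib = (λ (x , _) (y , _) (w , _) → distribᶠ x y w)
                    , λ x y w → trans {(y + w) * x} {x * (y + w)} {y * x + w * x} (*-commᶠ (proj₁ (y + w)) (proj₁ x))
                        (trans {x * (y + w)} {x * y + x * w} {y * x + w * x} (distribᶠ (proj₁ x) (proj₁ y) (proj₁ w))
                          (+-congᶠ (proj₁ (x * y)) (proj₁ (y * x)) (proj₁ (x * w)) (proj₁ (w * x)) (*-commᶠ (proj₁ x) (proj₁ y)) (*-commᶠ (proj₁ x) (proj₁ w)))) }
        ; *-comm = λ (x , _) (y , _) → *-commᶠ x y } }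

module Localization {p : ℕ} {p-prime : Prime p} (𝕜 : PrimeCoefficients p-prime) {a b} {F : CommutativeRing a a} {R : CommutativeRing b b}
  (ι : RingHom (PrimeCoefficients.𝔽ₚ 𝕜) F) (κ : RingHom F R) (z : CommutativeRing.Carrier R) where
  open PrimeCoefficients 𝕜 using (𝔽ₚ; field-𝔽ₚ)
  open CommutativeRing R
  open Algebra.Properties.Semiring.Exp semiring using (_^_; ^-homo-*)
  private
    module F = CommutativeRing F
    module ι = RingHom ι
    module κ = RingHom κ
    module P where
      open PolynomialRing 𝔽ₚ public
      open FieldPolynomials field-𝔽ₚ public
    module Q = PolynomialRing F
    module E = IntegerSolver R
    module EF = Evaluation κ z
    module EP = Evaluation (κ ∘ʰ ι) z
    module pol = RingHom EF.evaluation
    module ⟪⟫ = RingHom EP.evaluation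

  ev-map : ∀ f → EF.ev (map ι.to f) ≡ EP.ev f
  ev-map []      = ≡.refl
  ev-map (c ∷ f) = ≡.cong (λ x → κ.to (ι.to c) + z * x) (ev-map f)

  product : List P.Poly → P.Poly
  product = foldr P._⊗_ P.PR.1#

  cofactor : ∀ {t} S → t ∈ S → Σ[ g ∈ P.Poly ] (g P.⊗ t) P.≈ᴾ product S
  cofactor (t ∷ S) (here ≡.refl) = product S , P.PR.*-comm _ _
  cofactor {t} (s ∷ S) (there t∈S) = let g , eq = cofactor S t∈S in s P.⊗ g , P.PR.trans (P.PR.*-assoc s g t) (P.PR.*-congˡ {s} eq)

  product-inverse : ∀ S → All (λ t → Σ[ y ∈ Carrier ] EP.ev t * y ≈ 1#) S → Σ[ y ∈ Carrier ] EP.ev (product S) * y ≈ 1#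
  product-inverse []      []             = 1# , trans (*-identityʳ _) ⟪⟫.to-1
  product-inverse (t ∷ S) ((y , eq) ∷ h) = let y′ , eq′ = product-inverse S h in
    y * y′ , trans (*-congʳ (EP.ev-* t (product S))) (trans
      (E.solve 4 (λ t y s y′ → (t E.:* s) E.:* (y E.:* y′) E.:= (t E.:* y) E.:* (s E.:* y′)) refl (EP.ev t) y (EP.ev (product S)) y′)
      (trans (*-cong eq eq′) (*-identityˡ 1#)))

  module Generation (S : List P.Poly) {s : P.Poly} {u : CommutativeRing.Carrier 𝔽ₚ} (u≉0 : ¬ CommutativeRing._≈_ 𝔽ₚ u (CommutativeRing.0# 𝔽ₚ))
    (normalized : product S P.≈ᴾ (P.const u P.⊗ s)) where
    private
      σ : Carrier
      σ = EP.ev s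

      v : CommutativeRing.Carrier 𝔽ₚ
      v = proj₁ (DecidableField.inverse field-𝔽ₚ u u≉0)

      s≈ : s P.≈ᴾ (P.const v P.⊗ product S)
      s≈ = P.PR.sym (P.PR.trans (P.PR.*-congˡ {P.const v} normalized) (P.PR.trans (P.PR.sym (P.PR.*-assoc (P.const v) (P.const u) s))
        (P.PR.trans (P.PR.*-congʳ {s} vu≈1) (P.PR.*-identityˡ s))))
        where
        module 𝔽ₚ = CommutativeRing 𝔽ₚ
        vu≈1 : (P.const v P.⊗ P.const u) P.≈ᴾ P.PR.1#
        vu≈1 = P.PR.trans (P.const-*-≈ v (P.const u)) (P.coeffwise λ where
          zero    → 𝔽ₚ.trans (P.coeff-scale v (P.const u) 0) (𝔽ₚ.trans (𝔽ₚ.*-comm v u) (proj₂ (DecidableField.inverse field-𝔽ₚ u u≉0)))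
          (suc n) → 𝔽ₚ.trans (P.coeff-scale v (P.const u) (suc n)) (𝔽ₚ.zeroʳ v))

    inverse : All (λ t → Σ[ y ∈ Carrier ] EP.ev t * y ≈ 1#) S → Σ[ y ∈ Carrier ] σ * y ≈ 1#
    inverse h = let y , eq = product-inverse S h in
      EP.ev (P.const u) * y , trans (E.solve 3 (λ s u y → s E.:* (u E.:* y) E.:= (u E.:* s) E.:* y) refl σ (EP.ev (P.const u)) y)
        (trans (*-congʳ (trans (sym (EP.ev-* (P.const u) s)) (EP.ev-cong (P.PR.sym normalized)))) eq)

    Generates : Carrier → Set (a Level.⊔ b)
    Generates x = Σ[ N ∈ ℕ ] Σ[ g ∈ Q.Poly ] σ ^ N * x ≈ EF.ev g

    generates-κ : ∀ c → Generates (κ.to c)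
    generates-κ c = 0 , Q.const c , trans (*-identityˡ _) (sym (EF.ev-const c))

    generates-z : Generates z
    generates-z = 0 , Q.X , trans (*-identityˡ z) (sym EF.ev-X)

    -- The element t divides the product of S and hence s, so 1/t is the polynomial s/t over s.
    generates-inverse : ∀ {t} → t ∈ S → ∀ y → EP.ev t * y ≈ 1# → Generates y
    generates-inverse {t} t∈S y eq = 1 , map ι.to h , trans (*-congʳ (trans (*-identityʳ σ) (trans (EP.ev-cong s≈h) (EP.ev-* h t))))
      (trans (*-assoc _ _ _) (trans (*-congˡ eq) (trans (*-identityʳ _) (reflexive (≡.sym (ev-map h))))))
      where
      g = proj₁ (cofactor S t∈S)
      h = P.const v P.⊗ g
      s≈h : s P.≈ᴾ (h P.⊗ t)
      s≈h = P.PR.trans s≈ (P.PR.trans (P.PR.*-congˡ {P.const v} (P.PR.sym (proj₂ (cofactor S t∈S)))) (P.PR.sym (P.PR.*-assoc (P.const v) g t)))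

    private
      σ^-pol : ∀ N g → σ ^ N * EF.ev g ≈ EF.ev (map ι.to s Q.^ᴾ N Q.⊗ g)
      σ^-pol N g = sym (trans (EF.ev-* _ g) (*-congʳ (trans (pol.to-^ (map ι.to s) N) (reflexive (≡.cong (_^ N) (ev-map s))))))

    generates-+ : ∀ {x y} → Generates x → Generates y → Generates (x + y)
    generates-+ {x} {y} (N , g , eq) (M , h , eq′) = N ℕ.+ M , (map ι.to s Q.^ᴾ M Q.⊗ g) Q.⊕ (map ι.to s Q.^ᴾ N Q.⊗ h) ,
      trans (*-congʳ (^-homo-* σ N M)) (trans
        (E.solve 4 (λ n m x y → (n E.:* m) E.:* (x E.:+ y) E.:= m E.:* (n E.:* x) E.:+ n E.:* (m E.:* y)) refl (σ ^ N) (σ ^ M) x y)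
        (trans (+-cong (trans (*-congˡ eq) (σ^-pol M g)) (trans (*-congˡ eq′) (σ^-pol N h))) (sym (EF.ev-+ _ _))))

    generates-* : ∀ {x y} → Generates x → Generates y → Generates (x * y)
    generates-* {x} {y} (N , g , eq) (M , h , eq′) = N ℕ.+ M , g Q.⊗ h ,
      trans (*-congʳ (^-homo-* σ N M)) (trans
        (E.solve 4 (λ n m x y → (n E.:* m) E.:* (x E.:* y) E.:= (n E.:* x) E.:* (m E.:* y)) refl (σ ^ N) (σ ^ M) x y)
        (trans (*-cong eq eq′) (sym (EF.ev-* g h))))

    generates-resp : ∀ {x y} → x ≈ y → Generates x → Generates y
    generates-resp eq (N , g , eq′) = N , g , trans (*-congˡ (sym eq)) eq′

-- An element algebraic over 𝔽ₚ has only finitely many powers, hence x^{p^i} = x^{p^{i+1+k}} for some i and k, and x = (x^{p^k})^p.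

module Perfect {p : ℕ} {p-prime : Prime p} (𝕜 : PrimeCoefficients p-prime) {a} (field-F : DecidableField a a)
  (ι : RingHom (PrimeCoefficients.𝔽ₚ 𝕜) (DecidableField.ring field-F)) where
  open PrimeCoefficients 𝕜 using (𝔽ₚ; field-𝔽ₚ; char; repetition)
  open CommutativeRing (DecidableField.ring field-F)
  private
    module P where
      open PolynomialRing 𝔽ₚ public
      open Degree 𝔽ₚ public
      open FieldPolynomials field-𝔽ₚ public
    module ι = RingHom ι

    fromℕ-ι : ∀ n → ι.to (IntegerSolver.fromℕ 𝔽ₚ n) ≈ IntegerSolver.fromℕ (DecidableField.ring field-F) n
    fromℕ-ι zero    = ι.to-0
    fromℕ-ι (suc n) = trans (ι.to-+ _ _) (+-cong ι.to-1 (fromℕ-ι n))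

  charF : IntegerSolver.fromℕ (DecidableField.ring field-F) p ≈ 0#
  charF = trans (sym (fromℕ-ι p)) (trans (ι.to-cong char) ι.to-0)

  open Frobenius (DecidableField.ring field-F) p p-prime charF
  open FrobeniusBasis field-F p p-prime charF using (φ-≈0)

  φ-injective : ∀ k {x y} → x ^p^ k ≈ y ^p^ k → x ≈ y
  φ-injective k {x} {y} eq = trans (E.solve 2 (λ x y → x E.:= (x E.:+ E.:- y) E.:+ y) refl x y)
    (trans (+-congʳ (φ-≈0 k (trans (φ-+ k x (- y)) (trans (+-cong eq (φ-neg k y)) (-‿inverseʳ _))))) (+-identityˡ y))
    where module E = IntegerSolver (DecidableField.ring field-F)

  algebraic-root : ∀ x f → ¬ f P.≈ᴾ [] → Evaluation.ev ι x f ≈ 0# → ∃[ d ] d ^ p ≈ x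
  algebraic-root x f f≉0 fx≈0 with P.leading? f
  ... | P.vanishes f≈0 = ⊥-elim (f≉0 f≈0)
  ... | P.has-leading d m u mm u≉0 f≈um with repetition mm (λ i → P.X P.^ᴾ (p ℕ.^ i))
  ...   | i , k , q , eq = x ^p^ k , trans (sym (φ-suc k x)) (sym (φ-injective i (begin
        x ^p^ i                                                     ≈⟨ ev-X^ i ⟨
        Ev.ev (P.X P.^ᴾ (p ℕ.^ i))                                  ≈⟨ Ev.ev-cong eq ⟩
        Ev.ev (P.X P.^ᴾ (p ℕ.^ suc (i ℕ.+ k)) P.⊕ q P.⊗ m)          ≈⟨ trans (Ev.ev-+ _ _) (+-cong (ev-X^ (suc (i ℕ.+ k))) (trans (Ev.ev-* q m) (trans (*-congˡ mx≈0) (zeroʳ _)))) ⟩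
        x ^p^ suc (i ℕ.+ k) + 0#                                    ≈⟨ +-identityʳ _ ⟩
        x ^p^ suc (i ℕ.+ k)                                         ≡⟨ ≡.cong (λ j → x ^p^ suc j) (ℕ.+-comm i k) ⟩
        x ^p^ (suc k ℕ.+ i)                                         ≈⟨ φ-φ (suc k) i x ⟨
        (x ^p^ suc k) ^p^ i                                         ∎)))
    where
    module Ev = Evaluation ι x
    open import Relation.Binary.Reasoning.Setoid setoid
    ev-X^ : ∀ i → Ev.ev (P.X P.^ᴾ (p ℕ.^ i)) ≈ x ^p^ i
    ev-X^ i = trans (RingHom.to-^ Ev.evaluation P.X (p ℕ.^ i)) (trans (^-congˡ (p ℕ.^ i) Ev.ev-X) (sym (φ≈^ i x)))
    mx≈0 : Ev.ev m ≈ 0#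
    mx≈0 = trans (sym (*-identityˡ _)) (trans (*-congʳ (sym vu≈1)) (trans (*-assoc _ _ _) (trans (*-congˡ
      (trans (*-congʳ (sym (Ev.ev-const u))) (trans (sym (Ev.ev-* (P.const u) m)) (trans (Ev.ev-cong (P.PR.sym f≈um)) fx≈0)))) (zeroʳ _))))
      where
      v = proj₁ (DecidableField.inverse field-𝔽ₚ u u≉0)
      vu≈1 : ι.to v * ι.to u ≈ 1#
      vu≈1 = trans (*-comm _ _) (trans (sym (ι.to-* u v)) (trans (ι.to-cong (proj₂ (DecidableField.inverse field-𝔽ₚ u u≉0))) ι.to-1))

module FractionModel {p : ℕ} {p-prime : Prime p} (𝕜 : PrimeCoefficients p-prime) {a} (F : Field a) (_≟_ : ∀ x y → Dec (Field._≈_ F x y))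
  (ι : RingHom (PrimeCoefficients.𝔽ₚ 𝕜) (Field.commutativeRing F))
  (S : List (PolynomialRing.Poly (PrimeCoefficients.𝔽ₚ 𝕜)))
  (nonzero : All (λ t → ¬ RawRing._≈_ (Polynomial.polyRing (Field.rawRing F)) (map (RingHom.to ι) t) []) S) where
  open PrimeCoefficients 𝕜 using (𝔽ₚ; field-𝔽ₚ)
  open FractionRing F _≟_
  open RationalFunctions F using (constant; const; z; recip; add; mul; resp; Generated; Fraction; fromPoly; reciprocal)
  private
    module F = Field F
    module P where
      open PolynomialRing 𝔽ₚ public
      open FieldPolynomials field-𝔽ₚ public
    module Q = PolynomialRing F.commutativeRing
    module ι = RingHom ι

  R : CommutativeRing a a
  R = subring-commutativeRing (map (map ι.to) S)

  private
    module R = CommutativeRing R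

  κ : RingHom F.commutativeRing R
  κ = record
    { to = λ c → constant c , const c
    ; to-cong = λ {c} {d} eq → fromPoly-cong (c ∷ []) (d ∷ []) (Q.const-cong eq)
    ; to-+ = λ c d → fromPoly-+ (c ∷ []) (d ∷ [])
    ; to-* = constant-*
    ; to-1 = R.refl {R.1#} }

  ζ : R.Carrier
  ζ = fromPoly Q.X , z

  private
    module EF = Evaluation κ ζ
    module EP = Evaluation (κ ∘ʰ ι) ζ
    module L = Localization 𝕜 ι κ ζ
    open Fraction

    -- Evaluation at z is the embedding of polynomials into fractions; transcendence of z thereby
    -- becomes injectivity of `fromPoly`.
    ev-fromPoly : ∀ g → proj₁ (EF.ev g) ≈ᶠ fromPoly g
    ev-fromPoly []      = R.sym {fromPoly [] , resp {x = constant F.0#} (λ n → F.sym (fromPoly-0 n)) (const F.0#)} {R.0#} fromPoly-0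
    ev-fromPoly (c ∷ g) = ≈-trans (proj₁ (EF.ev (c ∷ g))) (constant c +ᶠ (fromPoly Q.X *ᶠ fromPoly g)) (fromPoly (c ∷ g))
      (+-congᶠ (constant c) (constant c) (fromPoly Q.X *ᶠ proj₁ (EF.ev g)) (fromPoly Q.X *ᶠ fromPoly g) (λ n → F.refl)
        (*-congᶠ (fromPoly Q.X) (fromPoly Q.X) (proj₁ (EF.ev g)) (fromPoly g) (λ n → F.refl) (ev-fromPoly g)))
      (λ n → F.sym (fromPoly-∷ c g n))

    ev-reciprocal : ∀ t t≉0 → proj₁ (EP.ev t) *ᶠ reciprocal (map ι.to t) t≉0 ≈ᶠ constant F.1#
    ev-reciprocal t t≉0 = ≈-trans (proj₁ (EP.ev t) *ᶠ reciprocal (map ι.to t) t≉0) (fromPoly (map ι.to t) *ᶠ reciprocal (map ι.to t) t≉0) (constant F.1#)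
      (*-congᶠ (proj₁ (EP.ev t)) (fromPoly (map ι.to t)) (reciprocal (map ι.to t) t≉0) (reciprocal (map ι.to t) t≉0)
        (≡.subst (λ x → proj₁ x ≈ᶠ fromPoly (map ι.to t)) (L.ev-map t) (ev-fromPoly (map ι.to t))) (λ n → F.refl))
      (fromPoly-reciprocal (map ι.to t) t≉0)

  module _ (em : ∀ (Q : Set a) → Dec Q) (algebraic : ∀ x → Σ[ f ∈ P.Poly ] (¬ f P.≈ᴾ [] × Evaluation.ev ι x f F.≈ F.0#))
    {s : P.Poly} {u : CommutativeRing.Carrier 𝔽ₚ} (u≉0 : ¬ CommutativeRing._≈_ 𝔽ₚ u (CommutativeRing.0# 𝔽ₚ))
    (normalized : L.product S P.≈ᴾ (P.const u P.⊗ s)) where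
    private
      module G = L.Generation S {s} {u} u≉0 normalized

      inverses : All (λ t → Σ[ y ∈ R.Carrier ] EP.ev t R.* y R.≈ R.1#) S
      inverses = All.tabulate λ {t} t∈S → (reciprocal (map ι.to t) (All.lookup nonzero t∈S) , recip (∈.∈-map⁺ (map ι.to) t∈S) (All.lookup nonzero t∈S))
        , ev-reciprocal t (All.lookup nonzero t∈S)

      generates : ∀ {x} (x∈R : Generated (map (map ι.to) S) x) → G.Generates (x , x∈R)
      generates (const c)          = G.generates-κ c
      generates z                  = G.generates-z
      generates (recip s∈S s≉0) with ∈.∈-map⁻ (map ι.to) s∈S
      ... | t , t∈S , ≡.refl       = G.generates-inverse t∈S (reciprocal (map ι.to t) s≉0 , recip s∈S s≉0) (ev-reciprocal t s≉0)
      generates (add {x} {y} x∈R y∈R) = G.generates-+ {x , x∈R} {y , y∈R} (generates x∈R) (generates y∈R)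
      generates (mul {x} {y} x∈R y∈R) = G.generates-* {x , x∈R} {y , y∈R} (generates x∈R) (generates y∈R)
      generates (resp {x} {y} x≈y x∈R) = G.generates-resp {x , x∈R} {y , resp x≈y x∈R} x≈y (generates x∈R)

    model : Model 𝕜 s a
    model = record
      { field-F = field-F
      ; ι = ι
      ; root = λ c → let f , f≉0 , fc≈0 = algebraic c in Perfect.algebraic-root 𝕜 field-F ι c f f≉0 fc≈0
      ; R = R
      ; κ = κ
      ; z = ζ
      ; em = em
      ; s⁻¹ = proj₁ (G.inverse inverses)
      ; s-inverse = proj₂ (G.inverse inverses)
      ; generated = λ (x , x∈R) → generates x∈R
      ; transcendental = λ g eq → fromPoly-injective {g} {[]} (≈-trans (fromPoly g) (proj₁ (EF.ev g)) (fromPoly []) (λ n → F.sym (ev-fromPoly g n))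
          (≈-trans (proj₁ (EF.ev g)) (constant F.0#) (fromPoly []) eq (λ n → F.sym (fromPoly-0 n)))) }

-- Linear algebra without division.

-- Steinitz exchange over an integral domain, with denominators cleared.

module LinearAlgebra {c ℓ} (D : CommutativeRing c ℓ)
  (_≟0 : ∀ x → Dec (CommutativeRing._≈_ D x (CommutativeRing.0# D)))
  (1≉0 : ¬ CommutativeRing._≈_ D (CommutativeRing.1# D) (CommutativeRing.0# D))
  (*-≉0 : ∀ {x y} → ¬ CommutativeRing._≈_ D x (CommutativeRing.0# D) → ¬ CommutativeRing._≈_ D y (CommutativeRing.0# D) →
          ¬ CommutativeRing._≈_ D (CommutativeRing._*_ D x y) (CommutativeRing.0# D))
  where
  open CommutativeRing D hiding (zero)
  open FiniteSums D
  open import Relation.Binary.Reasoning.Setoid setoid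
  private module S = IntegerSolver D

  Vector : ℕ → Set c
  Vector q = Fin q → Carrier

  infix 7 _∙_
  _∙_ : ∀ {q} → Vector q → Vector q → Carrier
  _∙_ {q} w v = ∑ (allFin q) (λ e → w e * v e)

  record Dependent {n q} (v : Fin n → Vector q) : Set (c ⊔ ℓ) where
    field
      b        : Fin n → Carrier
      j        : Fin n
      bj≉0     : ¬ b j ≈ 0#
      relation : ∀ e → ∑ (allFin n) (λ i → b i * v i e) ≈ 0#

  -- The v i together with some unit vectors: a basis u with Δ u⁻¹ = w.
  record Completion {n q} (v : Fin n → Vector q) : Set (c ⊔ ℓ) where
    field
      position  : Fin n → Fin q
      injective : ∀ {i j} → position i ≡ position j → i ≡ j
      u w       : Fin q → Vector q
      Δ         : Carrier
      Δ≉0       : ¬ Δ ≈ 0#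
      dual      : ∀ k l → w k ∙ u l ≈ only (k Fin.≟ l) Δ
      spanning  : ∀ e e′ → ∑ (allFin q) (λ k → w k e * u k e′) ≈ only (e Fin.≟ e′) Δ
      u-position : ∀ i e → u (position i) e ≈ v i e
      u-unit    : ∀ k → (∀ i → ¬ position i ≡ k) → ∀ e → u k e ≈ only (e Fin.≟ k) 1#

  only-* : ∀ {a} {A : Set a} (d : Dec A) x y → x * only d y ≈ only d (x * y)
  only-* (yes _) x y = refl
  only-* (no _)  x y = zeroʳ x

  private
    unit : ∀ {q} → Fin q → Vector q
    unit k e = only (e Fin.≟ k) 1#

    empty : ∀ {q} (v : Fin 0 → Vector q) → Completion v
    empty {q} v = record
      { position = λ () ; injective = λ { {()} } ; u = unit ; w = unit ; Δ = 1# ; Δ≉0 = 1≉0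
      ; dual = λ k l → trans (∑-cong (allFin q) λ e → trans (*-comm _ _) (only-* (e Fin.≟ k) (unit l e) 1#))
          (trans (∑-only k (λ e → unit l e * 1#)) (*-identityʳ _))
      ; spanning = λ e e′ → trans (∑-single e _ λ k k≢e → trans (*-congʳ (only-no (e Fin.≟ k) 1# λ e≡k → k≢e (≡.sym e≡k))) (zeroˡ _))
          (trans (*-congʳ (only-yes (e Fin.≟ e) 1# ≡.refl)) (trans (*-identityˡ _) (flip e e′)))
      ; u-position = λ () ; u-unit = λ k _ e → refl }
      where
      flip : ∀ (e e′ : Fin q) → only (e′ Fin.≟ e) 1# ≈ only (e Fin.≟ e′) 1#
      flip e e′ with e Fin.≟ e′
      ... | yes ≡.refl = only-yes (e Fin.≟ e) 1# ≡.refl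
      ... | no  e≢e′   = only-no (e′ Fin.≟ e) 1# λ e′≡e → e≢e′ (≡.sym e′≡e)

    -- The `α k` are Δ times the coordinates of the new vector x in the basis u. If one of them is
    -- nonzero at a position still held by a unit vector, x takes that place; otherwise x depends on
    -- the vectors already placed.
    module Insert {n q} (v : Fin (suc n) → Vector q) (B : Completion (λ i → v (suc i))) where
      open Completion B
      x = v zero

      α : Fin q → Carrier
      α k = w k ∙ x

      expand : ∀ e → ∑ (allFin q) (λ k → α k * u k e) ≈ Δ * x e
      expand e = begin
        ∑ (allFin q) (λ k → (w k ∙ x) * u k e)
          ≈⟨ ∑-cong (allFin q) (λ k → trans (∑-*ʳ (u k e) (allFin q) _)
               (∑-cong (allFin q) λ e′ → S.solve 3 (λ a b c → (a S.:* b) S.:* c S.:= b S.:* (a S.:* c)) refl (w k e′) (x e′) (u k e))) ⟩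
        ∑ (allFin q) (λ k → ∑ (allFin q) λ e′ → x e′ * (w k e′ * u k e))
          ≈⟨ ∑-swap (allFin q) (allFin q) (λ k e′ → x e′ * (w k e′ * u k e)) ⟩
        ∑ (allFin q) (λ e′ → ∑ (allFin q) λ k → x e′ * (w k e′ * u k e))
          ≈⟨ ∑-cong (allFin q) (λ e′ → trans (sym (∑-*ˡ (x e′) (allFin q) _)) (trans (*-congˡ (spanning e′ e)) (only-* (e′ Fin.≟ e) (x e′) Δ))) ⟩
        ∑ (allFin q) (λ e′ → only (e′ Fin.≟ e) (x e′ * Δ))
          ≈⟨ ∑-only e (λ e′ → x e′ * Δ) ⟩
        x e * Δ
          ≈⟨ *-comm _ _ ⟩
        Δ * x e ∎

      free? : ∀ k → Dec ((∀ i → ¬ position i ≡ k) × ¬ α k ≈ 0#)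
      free? k with Fin.any? (λ i → position i Fin.≟ k) | α k ≟0
      ... | yes (i , eq) | _        = no λ (free , _) → free i eq
      ... | no  ∄i       | yes α≈0  = no λ (_ , α≉0) → α≉0 α≈0
      ... | no  ∄i       | no  α≉0  = yes ((λ i eq → ∄i (i , eq)) , α≉0)

      dependent : (∀ k → ¬ ((∀ i → ¬ position i ≡ k) × ¬ α k ≈ 0#)) → Dependent v
      dependent none = record
        { b = b ; j = zero ; bj≉0 = Δ≉0
        ; relation = λ e → trans (∑-allFin-suc n (λ i → b i * v i e)) (trans (+-congʳ (sym (first e)))
            (trans (sym (∑-+ (allFin n) (λ i → α (position i) * v (suc i) e) (λ i → b (suc i) * v (suc i) e)))
              (∑-zero (allFin n) λ i → S.solve 2 (λ a v → a S.:* v S.:+ (S.:- a) S.:* v S.:= S.:0) refl (α (position i)) (v (suc i) e)))) }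
        where
        b : Fin (suc n) → Carrier
        b zero    = Δ
        b (suc i) = - α (position i)
        first : ∀ e → ∑ (allFin n) (λ i → α (position i) * v (suc i) e) ≈ Δ * x e
        first e = begin
          ∑ (allFin n) (λ i → α (position i) * v (suc i) e)
            ≈⟨ ∑-cong (allFin n) (λ i → *-congˡ (u-position i e)) ⟨
          ∑ (allFin n) (λ i → α (position i) * u (position i) e)
            ≈⟨ ∑-injection position injective (λ k → α k * u k e) (λ k free → trans (*-congʳ
                 (decidable-stable (α k ≟0) λ α≉0 → none k (free , α≉0))) (zeroˡ _)) ⟨
          ∑ (allFin q) (λ k → α k * u k e)
            ≈⟨ expand e ⟩
          Δ * x e ∎

      -- A pivot step: row `k₀` of w is multiplied by Δ, every other row by the pivot `a` with a
      -- multiple of row `k₀` subtracted, and the common factor becomes a Δ. Nothing is divided.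
      module Exchange (k₀ : Fin q) (free : ∀ i → ¬ position i ≡ k₀) (α≉0 : ¬ α k₀ ≈ 0#) where
        a = α k₀

        u′ w′ : Fin q → Vector q
        u′ k e = if does (k Fin.≟ k₀) then x e else u k e
        w′ k e = if does (k Fin.≟ k₀) then Δ * w k₀ e else a * w k e + - (α k * w k₀ e)

        linear : ∀ k (y : Vector q) → (λ e → a * w k e + - (α k * w k₀ e)) ∙ y ≈ a * (w k ∙ y) + - (α k * (w k₀ ∙ y))
        linear k y = begin
          ∑ (allFin q) (λ e → (a * w k e + - (α k * w k₀ e)) * y e)
            ≈⟨ ∑-cong (allFin q) (λ e → S.solve 5 (λ a w b w′ y → (a S.:* w S.:+ S.:- (b S.:* w′)) S.:* y S.:= a S.:* (w S.:* y) S.:+ (S.:- b) S.:* (w′ S.:* y)) refl a (w k e) (α k) (w k₀ e) (y e)) ⟩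
          ∑ (allFin q) (λ e → a * (w k e * y e) + - α k * (w k₀ e * y e))
            ≈⟨ ∑-+ (allFin q) (λ e → a * (w k e * y e)) (λ e → - α k * (w k₀ e * y e)) ⟩
          ∑ (allFin q) (λ e → a * (w k e * y e)) + ∑ (allFin q) (λ e → - α k * (w k₀ e * y e))
            ≈⟨ +-cong (∑-*ˡ a (allFin q) _) (∑-*ˡ (- α k) (allFin q) _) ⟨
          a * (w k ∙ y) + - α k * (w k₀ ∙ y)
            ≈⟨ S.solve 3 (λ x b y → x S.:+ (S.:- b) S.:* y S.:= x S.:+ S.:- (b S.:* y)) refl _ (α k) (w k₀ ∙ y) ⟩
          a * (w k ∙ y) + - (α k * (w k₀ ∙ y)) ∎

        dual′ : ∀ k l → w′ k ∙ u′ l ≈ only (k Fin.≟ l) (a * Δ)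
        dual′ k l with k Fin.≟ k₀ | l Fin.≟ k₀
        ... | yes ≡.refl | yes ≡.refl = begin
          (λ e → Δ * w k₀ e) ∙ x       ≈⟨ trans (∑-cong (allFin q) λ e → *-assoc Δ (w k₀ e) (x e)) (sym (∑-*ˡ Δ (allFin q) _)) ⟩
          Δ * a                        ≈⟨ *-comm Δ a ⟩
          a * Δ                        ≈⟨ only-yes (k₀ Fin.≟ k₀) (a * Δ) ≡.refl ⟨
          only (k₀ Fin.≟ k₀) (a * Δ)   ∎
        ... | yes ≡.refl | no l≢ = begin
          (λ e → Δ * w k₀ e) ∙ u l     ≈⟨ trans (∑-cong (allFin q) λ e → *-assoc Δ (w k₀ e) (u l e)) (sym (∑-*ˡ Δ (allFin q) _)) ⟩
          Δ * (w k₀ ∙ u l)             ≈⟨ *-congˡ (trans (dual k₀ l) (only-no (k₀ Fin.≟ l) Δ λ eq → l≢ (≡.sym eq))) ⟩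
          Δ * 0#                       ≈⟨ zeroʳ Δ ⟩
          0#                           ≈⟨ only-no (k₀ Fin.≟ l) (a * Δ) (λ eq → l≢ (≡.sym eq)) ⟨
          only (k₀ Fin.≟ l) (a * Δ)    ∎
        ... | no k≢ | yes ≡.refl = begin
          (λ e → a * w k e + - (α k * w k₀ e)) ∙ x     ≈⟨ linear k x ⟩
          a * α k + - (α k * a)                        ≈⟨ S.solve 2 (λ a b → a S.:* b S.:+ S.:- (b S.:* a) S.:= S.:0) refl a (α k) ⟩
          0#                                           ≈⟨ only-no (k Fin.≟ k₀) (a * Δ) k≢ ⟨
          only (k Fin.≟ k₀) (a * Δ)                    ∎
        ... | no k≢ | no l≢ = begin
          (λ e → a * w k e + - (α k * w k₀ e)) ∙ u l   ≈⟨ linear k (u l) ⟩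
          a * (w k ∙ u l) + - (α k * (w k₀ ∙ u l))     ≈⟨ +-cong (*-congˡ (dual k l)) (-‿cong (*-congˡ
                                                           (trans (dual k₀ l) (only-no (k₀ Fin.≟ l) Δ λ eq → l≢ (≡.sym eq))))) ⟩
          a * only (k Fin.≟ l) Δ + - (α k * 0#)        ≈⟨ S.solve 2 (λ x b → x S.:+ S.:- (b S.:* S.:0) S.:= x) refl _ (α k) ⟩
          a * only (k Fin.≟ l) Δ                       ≈⟨ only-* (k Fin.≟ l) a Δ ⟩
          only (k Fin.≟ l) (a * Δ)                     ∎

        spanning′ : ∀ e e′ → ∑ (allFin q) (λ k → w′ k e * u′ k e′) ≈ only (e Fin.≟ e′) (a * Δ)
        spanning′ e e′ = begin
          ∑ (allFin q) (λ k → w′ k e * u′ k e′)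
            ≈⟨ ∑-cong (allFin q) pointwise ⟩
          ∑ (allFin q) (λ k → (a * (w k e * u k e′) + - w k₀ e * (α k * u k e′)) + only (k Fin.≟ k₀) (Δ * w k₀ e * x e′))
            ≈⟨ trans (∑-+ (allFin q) _ _) (+-cong (∑-+ (allFin q) (λ k → a * (w k e * u k e′)) (λ k → - w k₀ e * (α k * u k e′)))
                 (∑-only k₀ (λ _ → Δ * w k₀ e * x e′))) ⟩
          (∑ (allFin q) (λ k → a * (w k e * u k e′)) + ∑ (allFin q) (λ k → - w k₀ e * (α k * u k e′))) + Δ * w k₀ e * x e′
            ≈⟨ +-congʳ (+-cong (∑-*ˡ a (allFin q) _) (∑-*ˡ (- w k₀ e) (allFin q) _)) ⟨
          (a * ∑ (allFin q) (λ k → w k e * u k e′) + - w k₀ e * ∑ (allFin q) (λ k → α k * u k e′)) + Δ * w k₀ e * x e′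
            ≈⟨ +-congʳ (+-cong (trans (*-congˡ (spanning e e′)) (only-* (e Fin.≟ e′) a Δ)) (*-congˡ (expand e′))) ⟩
          (only (e Fin.≟ e′) (a * Δ) + - w k₀ e * (Δ * x e′)) + Δ * w k₀ e * x e′
            ≈⟨ S.solve 4 (λ o w d x → (o S.:+ (S.:- w) S.:* (d S.:* x)) S.:+ d S.:* w S.:* x S.:= o) refl _ (w k₀ e) Δ (x e′) ⟩
          only (e Fin.≟ e′) (a * Δ) ∎
          where
          pointwise : ∀ k → w′ k e * u′ k e′ ≈ (a * (w k e * u k e′) + - w k₀ e * (α k * u k e′)) + only (k Fin.≟ k₀) (Δ * w k₀ e * x e′)
          pointwise k with k Fin.≟ k₀
          ... | yes ≡.refl = S.solve 5 (λ d w x a u → (d S.:* w) S.:* x S.:= (a S.:* (w S.:* u) S.:+ (S.:- w) S.:* (a S.:* u)) S.:+ d S.:* w S.:* x)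
                               refl Δ (w k₀ e) (x e′) a (u k₀ e′)
          ... | no  _      = S.solve 5 (λ a w b w₀ u → (a S.:* w S.:+ S.:- (b S.:* w₀)) S.:* u S.:= (a S.:* (w S.:* u) S.:+ (S.:- w₀) S.:* (b S.:* u)) S.:+ S.:0)
                               refl a (w k e) (α k) (w k₀ e) (u k e′)

        completion : Completion v
        completion = record
          { position = position′ ; injective = injective′ ; u = u′ ; w = w′ ; Δ = a * Δ ; Δ≉0 = *-≉0 α≉0 Δ≉0
          ; dual = dual′ ; spanning = spanning′ ; u-position = at-position ; u-unit = at-unit }
          where
          position′ : Fin (suc n) → Fin q
          position′ zero    = k₀
          position′ (suc i) = position i
          injective′ : ∀ {i j} → position′ i ≡ position′ j → i ≡ j
          injective′ {zero}  {zero}  eq = ≡.refl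
          injective′ {zero}  {suc j} eq = ⊥-elim (free j (≡.sym eq))
          injective′ {suc i} {zero}  eq = ⊥-elim (free i eq)
          injective′ {suc i} {suc j} eq = ≡.cong suc (injective eq)
          at-position : ∀ i e → u′ (position′ i) e ≈ v i e
          at-position zero e with k₀ Fin.≟ k₀
          ... | yes _  = refl
          ... | no  ≢  = ⊥-elim (≢ ≡.refl)
          at-position (suc i) e with position i Fin.≟ k₀
          ... | yes eq = ⊥-elim (free i eq)
          ... | no  _  = u-position i e
          at-unit : ∀ k → (∀ i → ¬ position′ i ≡ k) → ∀ e → u′ k e ≈ only (e Fin.≟ k) 1#
          at-unit k off e with k Fin.≟ k₀
          ... | yes eq = ⊥-elim (off zero (≡.sym eq))
          ... | no  _  = u-unit k (λ i → off (suc i)) e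

  abstract
    dependent-or-complete : ∀ {n q} (v : Fin n → Vector q) → Dependent v ⊎ Completion v
    dependent-or-complete {zero}  v = inj₂ (empty v)
    dependent-or-complete {suc n} v with dependent-or-complete (λ i → v (suc i))
    ... | inj₁ dep = inj₁ (record
      { b = λ { zero → 0# ; (suc i) → b i } ; j = suc j ; bj≉0 = bj≉0
      ; relation = λ e → trans (∑-allFin-suc n _) (trans (+-cong (zeroˡ _) (relation e)) (+-identityˡ 0#)) })
      where open Dependent dep
    ... | inj₂ B with Fin.any? (Insert.free? v B)
    ...   | yes (k , free , α≉0) = inj₂ (Insert.Exchange.completion v B k free α≉0)
    ...   | no  none             = inj₁ (Insert.dependent v B λ k free → none (k , free))

-- Finite index sets.

total : ∀ {N} → (Fin N → ℕ) → ℕ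
total {zero}  w = 0
total {suc N} w = w zero ℕ.+ total (w ∘ suc)

-- Identifies the disjoint union of the `Fin (w i)` with `Fin (total w)`, so that vectors grouped by
-- variables form one family for the linear algebra.
encode : ∀ {N} (w : Fin N → ℕ) (i : Fin N) → Fin (w i) → Fin (total w)
encode w zero    l = l ↑ˡ _
encode w (suc i) l = w zero ↑ʳ encode (w ∘ suc) i l

data Encoded {N} (w : Fin N → ℕ) : Fin (total w) → Set where
  encoded : ∀ i l → Encoded w (encode w i l)

decode : ∀ {N} (w : Fin N → ℕ) k → Encoded w k
decode {suc N} w k with splitAt (w zero) k in eq
... | inj₁ l = ≡.subst (Encoded w) (Fin.splitAt⁻¹-↑ˡ eq) (encoded zero l)
... | inj₂ k′ with decode (w ∘ suc) k′
...   | encoded i l = ≡.subst (Encoded w) (Fin.splitAt⁻¹-↑ʳ eq) (encoded (suc i) l)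

-- `decode` is a view for case distinctions; this function is used to define families over
-- `Fin (total w)`, which are computed with `uncode-encode`.
uncode : ∀ {N} (w : Fin N → ℕ) → Fin (total w) → Σ[ i ∈ Fin N ] Fin (w i)
uncode {suc N} w k = [ (λ l → zero , l) , (λ k′ → let i , l = uncode (w ∘ suc) k′ in suc i , l) ]′ (splitAt (w zero) k)

uncode-encode : ∀ {N} (w : Fin N → ℕ) i l → uncode w (encode w i l) ≡ (i , l)
uncode-encode {suc N} w zero    l rewrite Fin.splitAt-↑ˡ (w zero) l (total (w ∘ suc)) = ≡.refl
uncode-encode {suc N} w (suc i) l rewrite Fin.splitAt-↑ʳ (w zero) (total (w ∘ suc)) (encode (w ∘ suc) i l) | uncode-encode (w ∘ suc) i l = ≡.refl

module _ {c ℓ} (A : CommutativeRing c ℓ) where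
  open CommutativeRing A using (Carrier; _≈_; +-congˡ; +-cong; +-assoc; sym; trans; refl; +-identityˡ)
  open FiniteSums A

  ∑-splitAt : ∀ m n (g : Fin (m ℕ.+ n) → Carrier) →
    ∑ (allFin (m ℕ.+ n)) g ≈ CommutativeRing._+_ A (∑ (allFin m) (λ k → g (k ↑ˡ n))) (∑ (allFin n) (λ k → g (m ↑ʳ k)))
  ∑-splitAt zero    n g = sym (+-identityˡ _)
  ∑-splitAt (suc m) n g = trans (∑-allFin-suc (m ℕ.+ n) g) (trans (+-congˡ (∑-splitAt m n (λ k → g (suc k))))
    (trans (sym (+-assoc _ _ _)) (sym (CommutativeRing.+-congʳ A (∑-allFin-suc m (λ k → g (k ↑ˡ n)))))))

  ∑-total : ∀ {N} (w : Fin N → ℕ) (g : Fin (total w) → Carrier) →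
    ∑ (allFin (total w)) g ≈ ∑ (allFin N) (λ i → ∑ (allFin (w i)) λ l → g (encode w i l))
  ∑-total {zero}  w g = refl
  ∑-total {suc N} w g = trans (∑-splitAt (w zero) (total (w ∘ suc)) g)
    (trans (+-congˡ (∑-total (w ∘ suc) (λ k → g (w zero ↑ʳ k)))) (sym (∑-allFin-suc N _)))

total-mono : ∀ {N} (f g : Fin N → ℕ) → (∀ i → f i ≤ g i) → total f ≤ total g
total-mono {zero}  f g le = z≤n
total-mono {suc N} f g le = ℕ.+-mono-≤ (le zero) (total-mono (f ∘ suc) (g ∘ suc) (λ i → le (suc i)))

total-strict : ∀ {N} (f g : Fin N → ℕ) → (∀ i → f i ≤ g i) → ∀ i → f i ℕ.< g i → total f ℕ.< total g
total-strict {suc N} f g le zero    lt = ℕ.+-mono-<-≤ lt (total-mono (f ∘ suc) (g ∘ suc) (λ i → le (suc i)))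
total-strict {suc N} f g le (suc i) lt = ℕ.+-mono-≤-< (le zero) (total-strict (f ∘ suc) (g ∘ suc) (λ i → le (suc i)) i lt)

-- A retract of `Fin cardinality` suffices for listing I and for quantifying over tuples indexed by
-- I: repetitions do no harm.
record Finite (I : Set) : Set where
  field
    cardinality : ℕ
    index       : I → Fin cardinality
    element     : Fin cardinality → I
    element-index : ∀ i → element (index i) ≡ i

finite-Fin : ∀ n → Finite (Fin n)
finite-Fin n = record { cardinality = n ; index = λ i → i ; element = λ i → i ; element-index = λ _ → ≡.refl }

finite-⊎ : ∀ {I J} → Finite I → Finite J → Finite (I ⊎ J)
finite-⊎ {I} {J} A B = record
  { cardinality = A.cardinality ℕ.+ B.cardinality
  ; index   = [ (λ i → A.index i ↑ˡ _) , (λ j → A.cardinality ↑ʳ B.index j) ]′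
  ; element = λ k → [ (λ i → inj₁ (A.element i)) , (λ j → inj₂ (B.element j)) ]′ (splitAt A.cardinality k)
  ; element-index = λ where
      (inj₁ i) → ≡.trans (≡.cong [ _ , _ ]′ (Fin.splitAt-↑ˡ A.cardinality (A.index i) B.cardinality)) (≡.cong inj₁ (A.element-index i))
      (inj₂ j) → ≡.trans (≡.cong [ _ , _ ]′ (Fin.splitAt-↑ʳ A.cardinality B.cardinality (B.index j))) (≡.cong inj₂ (B.element-index j)) }
  where
  module A = Finite A
  module B = Finite B

finite-× : ∀ {I J} → Finite I → Finite J → Finite (I × J)
finite-× A B = record
  { cardinality = A.cardinality ℕ.* B.cardinality
  ; index   = λ (i , j) → Fin.combine (A.index i) (B.index j)
  ; element = λ k → let i , j = Fin.remQuot B.cardinality k in A.element i , B.element j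
  ; element-index = λ (i , j) → ≡.trans (≡.cong (λ (i , j) → A.element i , B.element j) (Fin.remQuot-combine (A.index i) (B.index j)))
      (≡.cong₂ _,_ (A.element-index i) (B.element-index j)) }
  where
  module A = Finite A
  module B = Finite B

argmax : ∀ {N p} {P : Fin N → Set p} (P? : ∀ i → Dec (P i)) (f : Fin N → ℕ) → ∃[ i ] P i →
         ∃[ i ] P i × (∀ j → P j → f j ≤ f i)
argmax {zero}  P? f (() , _)
argmax {suc N} {P = P} P? f (i , Pi) with Fin.any? (λ i → P? (suc i))
... | no none = zero , at-zero i Pi , λ { zero _ → ℕ.≤-refl ; (suc j) Pj → ⊥-elim (none (j , Pj)) }
  where
  at-zero : ∀ i → P i → P zero
  at-zero zero    Pi = Pi
  at-zero (suc i) Pi = ⊥-elim (none (i , Pi))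
... | yes (j , Pj) with argmax (λ i → P? (suc i)) (λ i → f (suc i)) (j , Pj)
...   | k , Pk , max with P? zero | f zero ℕ.≤? f (suc k)
...     | no ¬P0 | _      = suc k , Pk , λ { zero P0 → ⊥-elim (¬P0 P0) ; (suc j) Pj → max j Pj }
...     | yes P0 | yes le = suc k , Pk , λ { zero _ → le ; (suc j) Pj → max j Pj }
...     | yes P0 | no ≰   = zero , P0 , λ { zero _ → ℕ.≤-refl ; (suc j) Pj → ℕ.≤-trans (max j Pj) (ℕ.<⇒≤ (ℕ.≰⇒> ≰)) }

open import Data.Bool.Base using (_∧_; not)
import Data.List.Relation.Unary.Any.Properties as Any
open import Data.Vec.Base as Vec using (Vec; []; _∷_)
import Data.Vec.Properties as Vec
open import Data.Vec.Relation.Binary.Pointwise.Inductive as Pointwise using (Pointwise; []; _∷_)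
open import Defs using (Formula; Lp; fieldStructure; _⊨_[_]; Signature; Term; var; app; _≐_; rel; neg; all; ex; Structure; eval; evals; Lpzᵉ; FunLp; FunLpz; RelLpzᵉ; add; frob; nil; one; base; z-mult; inF; P; ⟦_⟧Lp; QuantifierFree; module QuantifierFree; Existential; qf)
  renaming (_∧_ to _∧ᶠ_; _∨_ to _∨ᶠ_; _⇒_ to _⇒ᶠ_)
open import Level as Level using (Lift)

-- Finite connectives and renaming in first-order logic.

∀-finite : ∀ {i p} {I : Set i} {P : I → Set p} n (g : Fin n → I) → All P (map g (allFin n)) → ∀ k → P (g k)
∀-finite n g hs k = All.tabulate⁻ (All.map⁻ hs) k

finite-∀ : ∀ {i p} {I : Set i} {P : I → Set p} n (g : Fin n → I) → (∀ k → P (g k)) → All P (map g (allFin n))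
finite-∀ n g hs = All.map⁺ (All.tabulate⁺ hs)

-- Formulas have no constant for truth; the equation of a closed term with itself takes its place,
-- hence the parameter.
module Connectives {L : Signature} (nilᵗ : ∀ {n} → Term L n) where
  private variable
    i : Level
    I : Set i
    n : ℕ

  trueᶠ falseᶠ : Formula L n
  trueᶠ  = nilᵗ ≐ nilᵗ
  falseᶠ = neg trueᶠ

  conj disj : List I → (I → Formula L n) → Formula L n
  conj []       φ = trueᶠ
  conj (x ∷ xs) φ = φ x ∧ᶠ conj xs φ
  disj []       φ = falseᶠ
  disj (x ∷ xs) φ = φ x ∨ᶠ disj xs φ

  exs : ∀ m → Formula L (m ℕ.+ n) → Formula L n
  exs zero    φ = φ
  exs (suc m) φ = exs m (ex φ)

  exs-existential : ∀ m {φ : Formula L (m ℕ.+ n)} → Existential φ → Existential (exs m φ)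
  exs-existential zero    E = E
  exs-existential (suc m) E = exs-existential m (ex E)

  conj-qf : ∀ (xs : List I) {φ : I → Formula L n} → (∀ x → QuantifierFree (φ x)) → QuantifierFree (conj xs φ)
  conj-qf []       free = QuantifierFree.eq
  conj-qf (x ∷ xs) free = QuantifierFree.and (free x) (conj-qf xs free)

  disj-qf : ∀ (xs : List I) {φ : I → Formula L n} → (∀ x → QuantifierFree (φ x)) → QuantifierFree (disj xs φ)
  disj-qf []       free = neg QuantifierFree.eq
  disj-qf (x ∷ xs) free = QuantifierFree.or (free x) (disj-qf xs free)

  module Truth {a} (M : Structure L a) (≈-refl : ∀ {x} → Structure._≈_ M x x) where
    conj⁺ : ∀ (xs : List I) {φ : I → Formula L n} {v} → All (λ x → M ⊨ φ x [ v ]) xs → M ⊨ conj xs φ [ v ]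
    conj⁺ []       []       = ≈-refl
    conj⁺ (x ∷ xs) (h ∷ hs) = h , conj⁺ xs hs

    conj⁻ : ∀ (xs : List I) {φ : I → Formula L n} {v} → M ⊨ conj xs φ [ v ] → All (λ x → M ⊨ φ x [ v ]) xs
    conj⁻ []       _        = []
    conj⁻ (x ∷ xs) (h , hs) = h ∷ conj⁻ xs hs

    disj⁺ : ∀ (xs : List I) {φ : I → Formula L n} {v} → Any (λ x → M ⊨ φ x [ v ]) xs → M ⊨ disj xs φ [ v ]
    disj⁺ (x ∷ xs) (here h)  = inj₁ h
    disj⁺ (x ∷ xs) (there h) = inj₂ (disj⁺ xs h)

    disj⁻ : ∀ (xs : List I) {φ : I → Formula L n} {v} → M ⊨ disj xs φ [ v ] → Any (λ x → M ⊨ φ x [ v ]) xs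
    disj⁻ []       h        = ⊥-elim (h ≈-refl)
    disj⁻ (x ∷ xs) (inj₁ h) = here h
    disj⁻ (x ∷ xs) (inj₂ h) = there (disj⁻ xs h)

    exs⁺ : ∀ m {φ : Formula L (m ℕ.+ n)} {v} (w : Vec (Structure.Carrier M) m) → M ⊨ φ [ w Vec.++ v ] → M ⊨ exs m φ [ v ]
    exs⁺ zero    []      h = h
    exs⁺ (suc m) (x ∷ w) h = exs⁺ m w (x , h)

    exs⁻ : ∀ m {φ : Formula L (m ℕ.+ n)} {v} → M ⊨ exs m φ [ v ] → Σ[ w ∈ Vec (Structure.Carrier M) m ] M ⊨ φ [ w Vec.++ v ]
    exs⁻ zero    h = [] , h
    exs⁻ (suc m) h = let w , x , h′ = exs⁻ m h in x ∷ w , h′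

module Renaming {L : Signature} where
  private variable m n : ℕ

  lift-renaming : (Fin m → Fin n) → Fin (suc m) → Fin (suc n)
  lift-renaming r zero    = zero
  lift-renaming r (suc i) = suc (r i)

  rename-term  : (Fin m → Fin n) → Term L m → Term L n
  rename-terms : ∀ {k} → (Fin m → Fin n) → Vec (Term L m) k → Vec (Term L n) k
  rename-term  r (var i)    = var (r i)
  rename-term  r (app f ts) = app f (rename-terms r ts)
  rename-terms r []         = []
  rename-terms r (t ∷ ts)   = rename-term r t ∷ rename-terms r ts

  rename-formula : (Fin m → Fin n) → Formula L m → Formula L n
  rename-formula r (t ≐ u)    = rename-term r t ≐ rename-term r u
  rename-formula r (rel R ts) = rel R (rename-terms r ts)
  rename-formula r (neg φ)    = neg (rename-formula r φ)
  rename-formula r (φ ∧ᶠ ψ)   = rename-formula r φ ∧ᶠ rename-formula r ψ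
  rename-formula r (φ ∨ᶠ ψ)   = rename-formula r φ ∨ᶠ rename-formula r ψ
  rename-formula r (φ ⇒ᶠ ψ)   = rename-formula r φ ⇒ᶠ rename-formula r ψ
  rename-formula r (all φ)    = all (rename-formula (lift-renaming r) φ)
  rename-formula r (ex φ)     = ex (rename-formula (lift-renaming r) φ)

  module _ {a} (M : Structure L a) where
    open Structure M

    pull : (Fin m → Fin n) → Vec Carrier n → Vec Carrier m
    pull r v = Vec.tabulate (λ i → Vec.lookup v (r i))

    eval-rename  : ∀ (r : Fin m → Fin n) v t → eval M v (rename-term r t) ≡ eval M (pull r v) t
    evals-rename : ∀ {k} (r : Fin m → Fin n) v (ts : Vec (Term L m) k) → evals M v (rename-terms r ts) ≡ evals M (pull r v) ts
    eval-rename  r v (var i)    = ≡.sym (Vec.lookup∘tabulate (λ i → Vec.lookup v (r i)) i)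
    eval-rename  r v (app f ts) = ≡.cong (⟦_⟧ᶠ f) (evals-rename r v ts)
    evals-rename r v []         = ≡.refl
    evals-rename r v (t ∷ ts)   = ≡.cong₂ _∷_ (eval-rename r v t) (evals-rename r v ts)

    rename⁺ : ∀ (r : Fin m → Fin n) φ v → M ⊨ φ [ pull r v ] → M ⊨ rename-formula r φ [ v ]
    rename⁻ : ∀ (r : Fin m → Fin n) φ v → M ⊨ rename-formula r φ [ v ] → M ⊨ φ [ pull r v ]
    rename⁺ r (t ≐ u)    v h = ≡.subst₂ _≈_ (≡.sym (eval-rename r v t)) (≡.sym (eval-rename r v u)) h
    rename⁺ r (rel R ts) v h = ≡.subst (⟦_⟧ʳ R) (≡.sym (evals-rename r v ts)) h
    rename⁺ r (neg φ)    v h = λ h′ → h (rename⁻ r φ v h′)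
    rename⁺ r (φ ∧ᶠ ψ)   v (h , h′) = rename⁺ r φ v h , rename⁺ r ψ v h′
    rename⁺ r (φ ∨ᶠ ψ)   v (inj₁ h) = inj₁ (rename⁺ r φ v h)
    rename⁺ r (φ ∨ᶠ ψ)   v (inj₂ h) = inj₂ (rename⁺ r ψ v h)
    rename⁺ r (φ ⇒ᶠ ψ)   v h = λ h′ → rename⁺ r ψ v (h (rename⁻ r φ v h′))
    rename⁺ r (all φ)    v h = λ x → rename⁺ (lift-renaming r) φ (x ∷ v) (h x)
    rename⁺ r (ex φ)     v (x , h) = x , rename⁺ (lift-renaming r) φ (x ∷ v) h
    rename⁻ r (t ≐ u)    v h = ≡.subst₂ _≈_ (eval-rename r v t) (eval-rename r v u) h
    rename⁻ r (rel R ts) v h = ≡.subst (⟦_⟧ʳ R) (evals-rename r v ts) h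
    rename⁻ r (neg φ)    v h = λ h′ → h (rename⁺ r φ v h′)
    rename⁻ r (φ ∧ᶠ ψ)   v (h , h′) = rename⁻ r φ v h , rename⁻ r ψ v h′
    rename⁻ r (φ ∨ᶠ ψ)   v (inj₁ h) = inj₁ (rename⁻ r φ v h)
    rename⁻ r (φ ∨ᶠ ψ)   v (inj₂ h) = inj₂ (rename⁻ r ψ v h)
    rename⁻ r (φ ⇒ᶠ ψ)   v h = λ h′ → rename⁻ r ψ v (h (rename⁺ r φ v h′))
    rename⁻ r (all φ)    v h = λ x → rename⁻ (lift-renaming r) φ (x ∷ v) (h x)
    rename⁻ r (ex φ)     v (x , h) = x , rename⁻ (lift-renaming r) φ (x ∷ v) h

bit-vectors : ∀ n → List (Vec Bool n)
bit-vectors zero    = [] ∷ []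
bit-vectors (suc n) = map (true ∷_) (bit-vectors n) ++ map (false ∷_) (bit-vectors n)

any-bit-vector : ∀ {p} {n} {Q : Vec Bool n → Set p} v → Q v → Any Q (bit-vectors n)
any-bit-vector []          q = here q
any-bit-vector (true  ∷ v) q = Any.++⁺ˡ (Any.map⁺ (any-bit-vector v q))
any-bit-vector {n = suc n} (false ∷ v) q = Any.++⁺ʳ (map (true ∷_) (bit-vectors n)) (Any.map⁺ (any-bit-vector v q))

-- The data of the algorithm; moduli in 𝔽ₚ[z].

-- All that a constructed formula may depend on. F and R do not occur here; S is represented by its
-- product, normalized to be monic.
record Setup : Set₁ where
  field
    p       : ℕ
    p-prime : Prime p
    𝕜       : PrimeCoefficients p-prime
  open PrimeCoefficients 𝕜 using (𝔽ₚ)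
  field
    s       : List (CommutativeRing.Carrier 𝔽ₚ)
    ds      : ℕ
    s-monic : Degree.Monic 𝔽ₚ ds s

module QuantifierElimination (setup : Setup) where
  open Setup setup
  open PrimeCoefficients 𝕜 using (𝔽ₚ; field-𝔽ₚ; char; repetition; fermat; natural; natural-≈)
  module P where
    open PolynomialRing 𝔽ₚ public
    open Degree 𝔽ₚ public
    open FieldPolynomials field-𝔽ₚ public

  -- The degree allowance per unit of bound: an element bounded by N is g / s^N with deg g < N h.
  -- With one more than deg s, numerator and denominator may be multiplied by s while N grows by
  -- one, and constants have bound 1.
  h : ℕ
  h = suc ds

  -- Δ is invertible up to s and up to bounded remainders: modulo Δ, the power
  -- s^i equals s^i · s · t.
  record Modulus (Δ : P.Poly) : Set where
    field
      d i     : ℕ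
      m t Q   : P.Poly
      u v     : CommutativeRing.Carrier 𝔽ₚ
      m-monic : P.Monic d m
      uv≈1    : CommutativeRing._≈_ 𝔽ₚ (CommutativeRing._*_ 𝔽ₚ u v) (CommutativeRing.1# 𝔽ₚ)
      Δ≈um    : Δ P.≈ᴾ P.const u P.⊗ m
      periodic : s P.^ᴾ i P.≈ᴾ (s P.^ᴾ i) P.⊗ (s P.⊗ t) P.⊕ Q P.⊗ Δ

  abstract
    -- Two powers of s agree modulo m by `repetition`; the inverse v of u turns the multiple of m
    -- into a multiple of Δ.
    modulus : ∀ Δ → ¬ Δ P.≈ᴾ [] → Modulus Δ
    modulus Δ Δ≉0 with P.leading? Δ
    ... | P.vanishes Δ≈0 = Data.Empty.⊥-elim (Δ≉0 Δ≈0)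
      where import Data.Empty
    ... | P.has-leading d m u mm u≉0 Δ≈um with DecidableField.inverse field-𝔽ₚ u u≉0 | repetition mm (s P.^ᴾ_)
    ...   | v , uv≈1 | i , k , w , eq = record
      { d = d ; i = i ; m = m ; t = s P.^ᴾ k ; Q = w P.⊗ P.const v ; u = u ; v = v
      ; m-monic = mm ; uv≈1 = uv≈1 ; Δ≈um = Δ≈um
      ; periodic = begin
          s P.^ᴾ i                                                            ≈⟨ eq ⟩
          s P.^ᴾ suc (i ℕ.+ k) P.⊕ w P.⊗ m                                    ≈⟨ P.PR.+-cong power coprime ⟩
          s P.^ᴾ i P.⊗ (s P.⊗ s P.^ᴾ k) P.⊕ (w P.⊗ P.const v) P.⊗ Δ           ∎ }
      where
      open SetoidReasoning P.PR.setoid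
      module S = IntegerSolver P.polynomialRing
      open Algebra.Properties.Semiring.Exp P.PR.semiring using (^-homo-*)
      power : s P.^ᴾ suc (i ℕ.+ k) P.≈ᴾ s P.^ᴾ i P.⊗ (s P.⊗ s P.^ᴾ k)
      power = P.PR.trans (P.PR.*-congˡ {s} (^-homo-* s i k))
        (S.solve 3 (λ s x y → s S.:* (x S.:* y) S.:= x S.:* (s S.:* y)) P.PR.refl s (s P.^ᴾ i) (s P.^ᴾ k))
      module Fₚ = CommutativeRing 𝔽ₚ
      vu≈1 : P.const v P.⊗ P.const u P.≈ᴾ P.PR.1#
      vu≈1 = P.PR.trans (P.const-*-≈ v (P.const u)) (P.coeffwise λ where
        zero    → Fₚ.trans (P.coeff-scale v (P.const u) 0) (Fₚ.trans (Fₚ.*-comm v u) uv≈1)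
        (suc n) → Fₚ.trans (P.coeff-scale v (P.const u) (suc n)) (Fₚ.zeroʳ v))
      coprime : w P.⊗ m P.≈ᴾ (w P.⊗ P.const v) P.⊗ Δ
      coprime = begin
        w P.⊗ m                                        ≈⟨ P.PR.*-congˡ (P.PR.*-identityˡ m) ⟨
        w P.⊗ (P.PR.1# P.⊗ m)                          ≈⟨ P.PR.*-congˡ (P.PR.*-congʳ vu≈1) ⟨
        w P.⊗ ((P.const v P.⊗ P.const u) P.⊗ m)        ≈⟨ S.solve 4 (λ w v u m → w S.:* ((v S.:* u) S.:* m) S.:= (w S.:* v) S.:* (u S.:* m)) P.PR.refl w (P.const v) (P.const u) m ⟩
        (w P.⊗ P.const v) P.⊗ (P.const u P.⊗ m)        ≈⟨ P.PR.*-congˡ Δ≈um ⟨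
        (w P.⊗ P.const v) P.⊗ Δ                        ∎

  -- Modulo 1 + s X^L the inverse of s is -X^L, so the preperiod `i` is 0. With L positive the
  -- constant 1 stays below the leading term of s X^L, and the sum is monic.
  coprime-modulus : ∀ L → 1 ≤ L → Modulus (P.PR.1# P.⊕ s P.⊗ P.X P.^ᴾ L)
  coprime-modulus L 1≤L = record
    { d = ds ℕ.+ L ; i = 0 ; m = b ; t = P.⊝ (P.X P.^ᴾ L) ; Q = P.PR.1# ; u = Fₚ.1# ; v = Fₚ.1#
    ; m-monic = record
        { leading = Fₚ.trans (P.coeff-⊕ P.PR.1# sX (ds ℕ.+ L)) (Fₚ.trans (Fₚ.+-cong (P.deg-length P.PR.1# ℕ.≤-refl _ 1≤d) (P.Monic.leading sX-monic)) (Fₚ.+-identityˡ _))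
        ; degree = P.deg-⊕ P.PR.1# sX (P.deg-length P.PR.1# (s≤s z≤n)) (P.Monic.degree sX-monic) }
    ; uv≈1 = Fₚ.*-identityˡ _
    ; Δ≈um = P.PR.sym (P.PR.*-identityˡ b)
    ; periodic = P.PR.trans (P.PR.sym S.fromℤ-1) (P.PR.trans
        (S.solve 2 (λ s x → S.:1 S.:= S.:1 S.:* (s S.:* (S.:- x)) S.:+ S.:1 S.:* (S.:1 S.:+ s S.:* x)) P.PR.refl s (P.X P.^ᴾ L))
        (P.PR.+-cong (P.PR.*-congʳ S.fromℤ-1) (P.PR.*-cong S.fromℤ-1 (P.PR.+-congʳ S.fromℤ-1)))) }
    where
    module S = IntegerSolver P.polynomialRing
    module Fₚ = CommutativeRing 𝔽ₚ
    sX = s P.⊗ P.X P.^ᴾ L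
    b = P.PR.1# P.⊕ sX
    1≤d : 1 ≤ ds ℕ.+ L
    1≤d = ℕ.≤-trans 1≤L (ℕ.m≤n+m L ds)
    sX-monic : P.Monic (ds ℕ.+ L) sX
    sX-monic = ≡.subst (λ l → P.Monic (ds ℕ.+ l) sX) (ℕ.*-identityʳ L) (P.monic-⊗ s-monic (P.monic-^ P.monic-X L))

  private variable Var Var′ : Set

  open P using (Poly; X; _⊗_; _⊕_; ⊝_; _^ᴾ_; _≈ᴾ_) public
  module PB = FrobeniusBasis field-𝔽ₚ p p-prime char

  -- Additive forms and additive polynomials in one variable.

  -- The monomial a x_i^{p^k}; a form is additive in its variables.
  record Monomial (Var : Set) : Set where
    constructor mono
    field
      coef  : Poly
      index : Var
      exp   : ℕ

  Form : Set → Set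
  Form Var = List (Monomial Var)

  term : Poly → Var → ℕ → Form Var
  term a i k = mono a i k ∷ []

  variable-form : Var → Form Var
  variable-form i = term P.PR.1# i 0

  infixr 7 _·ᶠ_
  _·ᶠ_ : Poly → Form Var → Form Var
  a ·ᶠ φ = map (λ (mono b i k) → mono (a ⊗ b) i k) φ

  -ᶠ_ : Form Var → Form Var
  -ᶠ φ = map (λ (mono b i k) → mono (⊝ b) i k) φ

  frobᶠ : ℕ → Form Var → Form Var
  frobᶠ k φ = map (λ (mono a i j) → mono (a PB.P.^p^ k) i (j ℕ.+ k)) φ

  sub : (Var → Form Var′) → Form Var → Form Var′
  sub θ = concatMap (λ (mono a i k) → a ·ᶠ frobᶠ k (θ i))

  relabel : (Var → Var′) → Form Var → Form Var′
  relabel f = map (λ (mono a i k) → mono a (f i) k)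

  Exp≤ : ℕ → Form Var → Set
  Exp≤ T = All (λ m → Monomial.exp m ≤ T)

  -- Serves as an upper bound for the degrees of the coefficients, for which a sum of lengths is as
  -- good as their maximum.
  size : Form Var → ℕ
  size []               = 0
  size (mono a i k ∷ φ) = length a ℕ.+ size φ

  max-exp : (φ : Form Var) → ∃[ T ] Exp≤ T φ
  max-exp []               = 0 , []
  max-exp (mono a i k ∷ φ) = let T , le = max-exp φ in
    k ℕ.⊔ T , ℕ.m≤m⊔n k T ∷ All.map (λ le → ℕ.≤-trans le (ℕ.m≤n⊔m k T)) le

  -- The additive polynomial Σ_k a_k x^{p^k}, by its coefficients.
  Ore : Set
  Ore = List Poly

  module O where
    open PolynomialRing P.polynomialRing public using (_⊕_; _+ᴾ_; coeff; _≈ᴾ_; polynomialRing; coeff-⊕; length-⊕-≤; ⊕≡+ᴾ; module PR)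

    open Degree P.polynomialRing public using (Deg<; take-≈; deg-length)

  ore-form : Ore → Var → Form Var
  ore-form []      i = []
  ore-form (a ∷ f) i = mono a i 0 ∷ map (λ (mono a i k) → mono a i (suc k)) (ore-form f i)

  -- The additive polynomial f(b x).
  infix 8 _⟨_⟩
  _⟨_⟩ : Ore → Poly → Ore
  []      ⟨ b ⟩ = []
  (a ∷ f) ⟨ b ⟩ = (a ⊗ b) ∷ f ⟨ b PB.P.^ p ⟩

  -- The additive polynomial f(b x^{p^t}): the exponent t shifts all coefficients.
  comp : Ore → Poly → ℕ → Ore
  comp f b t = replicate t [] ++ f ⟨ b ⟩

  length-⟨⟩ : ∀ f b → length (f ⟨ b ⟩) ≡ length f
  length-⟨⟩ []      b = ≡.refl
  length-⟨⟩ (a ∷ f) b = ≡.cong suc (length-⟨⟩ f (b PB.P.^ p))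

  length-comp : ∀ f b t → length (comp f b t) ≡ t ℕ.+ length f
  length-comp f b t = ≡.trans (length-++ (replicate t [])) (≡.cong₂ ℕ._+_ (length-replicate t) (length-⟨⟩ f b))

  coeff-⟨⟩ : ∀ f b k → O.coeff (f ⟨ b ⟩) k ≈ᴾ O.coeff f k ⊗ (b PB.P.^p^ k)
  coeff-⟨⟩ []      b k       = P.PR.sym (P.PR.zeroˡ _)
  coeff-⟨⟩ (a ∷ f) b zero    = P.PR.refl
  coeff-⟨⟩ (a ∷ f) b (suc k) = coeff-⟨⟩ f (b PB.P.^ p) k

  coeff-comp : ∀ f b t k → O.coeff (comp f b t) (t ℕ.+ k) ≈ᴾ O.coeff f k ⊗ (b PB.P.^p^ k)
  coeff-comp f b zero    k = coeff-⟨⟩ f b k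
  coeff-comp f b (suc t) k = coeff-comp f b t k

  open LinearAlgebra P.polynomialRing P._≟0 (DecidableField.1≉0 field-𝔽ₚ ∘ λ eq → P.at eq 0) P.⊗-≉0
    using (Vector; Dependent; Completion; dependent-or-complete)
  private
    module P∑ = FiniteSums P.polynomialRing
    module O∑ = FiniteSums O.polynomialRing
    module PS = IntegerSolver P.polynomialRing

  abstract
    -- Coordinates in the basis 1, X, X^2, ... over the p^D-th powers. By Fermat every element of 𝔽ₚ
    -- is its own p-th root, and the length of A is a sufficient number of blocks.
    coords : ∀ D → Poly → Vector (p ℕ.^ D)
    coords D A = proj₁ (PB.basis-spans (λ c → c , fermat c) D (length A) A
      (P.deg-length A (ℕ.m≤m*n (length A) (p ℕ.^ D) {{ℕ.m^n≢0 p D {{prime⇒nonZero p-prime}}}})))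

    coords-≈ : ∀ D A → A ≈ᴾ PB.basis-∑ D (coords D A)
    coords-≈ D A = proj₂ (proj₂ (PB.basis-spans (λ c → c , fermat c) D (length A) A
      (P.deg-length A (ℕ.m≤m*n (length A) (p ℕ.^ D) {{ℕ.m^n≢0 p D {{prime⇒nonZero p-prime}}}}))))

  -- Read off the length, so the last entry may be zero. The vectors of such an entry vanish and are
  -- dependent, whence no completion exists before the reduction has removed it.
  deg : Ore → ℕ
  deg f = pred (length f)

  lead : Ore → Poly
  lead f = O.coeff f (deg f)

  -- Reduction of an additive form to a normal form.

  -- A substitution X i = `G i` in new variables that range over R and finitely many parameters,
  -- indexed by `C`, that range over F.
  record Reparametrization (N : ℕ) : Set₁ where
    field
      C        : Set
      finite-C : Finite C
      G        : Fin N → Form (Fin N ⊎ C)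

  identical : ∀ {N} → Reparametrization N
  identical = record { C = Fin 0 ; finite-C = finite-Fin 0 ; G = λ i → variable-form (inj₁ i) }

  module Compose {N} (A B : Reparametrization N) where
    module A = Reparametrization A
    module B = Reparametrization B

    right : Fin N ⊎ B.C → Fin N ⊎ (A.C ⊎ B.C)
    right = [ inj₁ , inj₂ ∘ inj₂ ]′

    θ : Fin N ⊎ A.C → Form (Fin N ⊎ (A.C ⊎ B.C))
    θ = [ (λ j → relabel right (B.G j)) , (λ l → variable-form (inj₂ (inj₁ l))) ]′

    composite : Reparametrization N
    composite = record { C = A.C ⊎ B.C ; finite-C = finite-⊎ A.finite-C B.finite-C ; G = λ i → sub θ (A.G i) }

  -- Writing each variable of degree d as Σ_l z^l x_l^{p^(D-d)} brings all of
  -- them to degree D; the leading coefficients become the vectors below.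

  module Family (D : ℕ) {N} (f : Fin N → Ore) (f≤D : ∀ i → length (f i) ≤ D) where
    q = p ℕ.^ D

    count : Ore → ℕ
    -- A variable with empty additive polynomial does not occur in the form: it has no leading
    -- vectors and stays free.
    count []      = 0
    count (a ∷ f) = p ℕ.^ (D ℕ.∸ deg (a ∷ f))

    -- The substitution of z^l y^{p^(D-d)} into the leading term a x^{p^d} gives a z^(l p^d) times
    -- y^{p^D}; these are the coordinates of that coefficient.
    lead-vector : ∀ f → Fin (count f) → Vector q
    lead-vector f l = coords D (lead f ⊗ X ^ᴾ (toℕ l ℕ.* p ℕ.^ deg f))

    counts : Fin N → ℕ
    counts i = count (f i)

    vector-at : Σ[ i ∈ Fin N ] Fin (counts i) → Vector q
    vector-at (i , l) = lead-vector (f i) l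

    vectors : Fin (total counts) → Vector q
    vectors j = vector-at (uncode counts j)

    t+d≡D : ∀ g → length g ≤ D → (D ℕ.∸ deg g) ℕ.+ deg g ≡ D
    t+d≡D g le = ℕ.m∸n+n≡m (ℕ.≤-trans (ℕ.pred[n]≤n {length g}) le)

  -- The coefficients of a dependence are assembled to elements `B i` such that the leading terms of
  -- the f i(B i x^{p^shift}) cancel in the sum. Among the i with nonzero `B i` one of maximal
  -- length is given the new variable x, and with it a shorter additive polynomial.
  module Reduce (D : ℕ) {N} (f : Fin N → Ore) (f≤D : ∀ i → length (f i) ≤ D)
    (dependence : Dependent (Family.vectors D f f≤D)) where
    open Family D f f≤D
    open Dependent dependence
    open SetoidReasoning P.PR.setoid
    open PB.P using (_^p^_; φ-cong; φ-∑; φ-*; φ-φ; φ-0; φ≈^)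
    open import Algebra.Properties.Semiring.Exp P.PR.semiring using (^-assocʳ)

    β : ∀ i → Fin (counts i) → Poly
    β i l = b (encode counts i l)

    combination : ∀ g → (Fin (count g) → Poly) → Poly
    combination []      γ = []
    combination (a ∷ g) γ = PB.basis-∑ (D ℕ.∸ deg (a ∷ g)) γ

    B : Fin N → Poly
    B i = combination (f i) (β i)

    -- The power p^d turns X^l into X^(l p^d) and the exponent D - d of the coefficients into D,
    -- which is the situation of `lead-vector`.
    combination-lead : ∀ g → length g ≤ D → (γ : Fin (count g) → Poly) →
      lead g ⊗ combination g γ ^p^ deg g ≈ᴾ P∑.∑ (allFin (count g)) (λ l → PB.basis-∑ D (λ e → lead-vector g l e ⊗ γ l))
    combination-lead []        le γ = P.PR.zeroˡ []
    combination-lead g@(_ ∷ _) le γ = begin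
      lead g ⊗ P∑.∑ (allFin (p ℕ.^ t)) (λ l → X ^ᴾ toℕ l ⊗ γ l ^p^ t) ^p^ d
        ≈⟨ P.PR.*-congˡ (φ-∑ d (allFin (p ℕ.^ t)) _) ⟩
      lead g ⊗ P∑.∑ (allFin (p ℕ.^ t)) (λ l → (X ^ᴾ toℕ l ⊗ γ l ^p^ t) ^p^ d)
        ≈⟨ P∑.∑-*ˡ (lead g) (allFin (p ℕ.^ t)) _ ⟩
      P∑.∑ (allFin (p ℕ.^ t)) (λ l → lead g ⊗ (X ^ᴾ toℕ l ⊗ γ l ^p^ t) ^p^ d)
        ≈⟨ P∑.∑-cong (allFin (p ℕ.^ t)) (λ l → each l) ⟩
      P∑.∑ (allFin (p ℕ.^ t)) (λ l → PB.basis-∑ D (λ e → lead-vector g l e ⊗ γ l)) ∎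
      where
      d = deg g
      t = D ℕ.∸ d
      each : ∀ l → lead g ⊗ (X ^ᴾ toℕ l ⊗ γ l ^p^ t) ^p^ d ≈ᴾ PB.basis-∑ D (λ e → lead-vector g l e ⊗ γ l)
      each l = begin
        lead g ⊗ (X ^ᴾ toℕ l ⊗ γ l ^p^ t) ^p^ d
          ≈⟨ P.PR.*-congˡ (P.PR.trans (φ-* d _ _) (P.PR.*-cong (P.PR.trans (φ≈^ d _) (^-assocʳ X (toℕ l) (p ℕ.^ d)))
               (P.PR.trans (φ-φ t d (γ l)) (P.PR.reflexive (≡.cong (γ l ^p^_) (t+d≡D g le)))))) ⟩
        lead g ⊗ (X ^ᴾ (toℕ l ℕ.* p ℕ.^ d) ⊗ γ l ^p^ D)
          ≈⟨ P.PR.*-assoc _ _ _ ⟨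
        (lead g ⊗ X ^ᴾ (toℕ l ℕ.* p ℕ.^ d)) ⊗ γ l ^p^ D
          ≈⟨ P.PR.*-congʳ (coords-≈ D _) ⟩
        PB.basis-∑ D (lead-vector g l) ⊗ γ l ^p^ D
          ≈⟨ P∑.∑-*ʳ _ (allFin q) _ ⟩
        P∑.∑ (allFin q) (λ e → (X ^ᴾ toℕ e ⊗ lead-vector g l e ^p^ D) ⊗ γ l ^p^ D)
          ≈⟨ P∑.∑-cong (allFin q) (λ e → P.PR.trans (P.PR.*-assoc _ _ _) (P.PR.*-congˡ (P.PR.sym (φ-* D _ _)))) ⟩
        PB.basis-∑ D (λ e → lead-vector g l e ⊗ γ l) ∎

    -- Once everything is written in the basis over the p^D-th powers, the Frobenius power can be
    -- taken outside the sum over all vectors, and each coordinate is the given linear relation.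
    cancellation : P∑.∑ (allFin N) (λ i → lead (f i) ⊗ B i ^p^ deg (f i)) ≈ᴾ []
    cancellation = begin
      P∑.∑ (allFin N) (λ i → lead (f i) ⊗ B i ^p^ deg (f i))
        ≈⟨ P∑.∑-cong (allFin N) (λ i → combination-lead (f i) (f≤D i) (β i)) ⟩
      P∑.∑ (allFin N) (λ i → P∑.∑ (allFin (counts i)) λ l → PB.basis-∑ D (λ e → lead-vector (f i) l e ⊗ β i l))
        ≈⟨ P∑.∑-cong (allFin N) (λ i → P∑.∑-cong (allFin (counts i)) λ l → P.PR.reflexive
             (≡.cong (λ v → PB.basis-∑ D (λ e → vector-at v e ⊗ β i l)) (≡.sym (uncode-encode counts i l)))) ⟩
      P∑.∑ (allFin N) (λ i → P∑.∑ (allFin (counts i)) λ l → PB.basis-∑ D (λ e → vectors (encode counts i l) e ⊗ β i l))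
        ≈⟨ ∑-total P.polynomialRing counts (λ j → PB.basis-∑ D (λ e → vectors j e ⊗ b j)) ⟨
      P∑.∑ (allFin (total counts)) (λ j → PB.basis-∑ D (λ e → vectors j e ⊗ b j))
        ≈⟨ P∑.∑-swap (allFin (total counts)) (allFin q) (λ j e → X ^ᴾ toℕ e ⊗ (vectors j e ⊗ b j) ^p^ D) ⟩
      P∑.∑ (allFin q) (λ e → P∑.∑ (allFin (total counts)) λ j → X ^ᴾ toℕ e ⊗ (vectors j e ⊗ b j) ^p^ D)
        ≈⟨ P∑.∑-zero (allFin q) (λ e → begin
             P∑.∑ (allFin (total counts)) (λ j → X ^ᴾ toℕ e ⊗ (vectors j e ⊗ b j) ^p^ D)
               ≈⟨ P∑.∑-*ˡ _ (allFin (total counts)) _ ⟨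
             X ^ᴾ toℕ e ⊗ P∑.∑ (allFin (total counts)) (λ j → (vectors j e ⊗ b j) ^p^ D)
               ≈⟨ P.PR.*-congˡ (φ-∑ D (allFin (total counts)) _) ⟨
             X ^ᴾ toℕ e ⊗ P∑.∑ (allFin (total counts)) (λ j → vectors j e ⊗ b j) ^p^ D
               ≈⟨ P.PR.*-congˡ (φ-cong D (P.PR.trans (P∑.∑-cong (allFin (total counts)) (λ j → P.PR.*-comm _ _)) (relation e))) ⟩
             X ^ᴾ toℕ e ⊗ [] ^p^ D
               ≈⟨ P.PR.trans (P.PR.*-congˡ (φ-0 D)) (P.PR.zeroʳ _) ⟩
             [] ∎) ⟩
      [] ∎

    -- By independence of the basis a single nonzero coefficient is enough.
    combination-≉0 : ∀ g (γ : Fin (count g) → Poly) l → ¬ γ l ≈ᴾ [] → ¬ combination g γ ≈ᴾ []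
    combination-≉0 (a ∷ g) γ l γ≉0 eq = γ≉0 (PB.basis-independent (D ℕ.∸ deg (a ∷ g)) γ eq l)

    some-B≉0 : ∃[ i ] ¬ B i ≈ᴾ []
    some-B≉0 with decode counts j | bj≉0
    ... | encoded i l | b≉0 = i , combination-≉0 (f i) (β i) l b≉0

    B≉0? : ∀ i → Dec (¬ B i ≈ᴾ [])
    B≉0? i with B i P.≟0
    ... | yes B≈0 = no λ B≉0 → B≉0 B≈0
    ... | no  B≉0 = yes B≉0

    choice = argmax B≉0? (λ i → length (f i)) some-B≉0
    i₀ = proj₁ choice
    B₀≉0 = proj₁ (proj₂ choice)
    maximal = proj₂ (proj₂ choice)

    nonempty : ∀ i → ¬ B i ≈ᴾ [] → length (f i) ≡ suc (deg (f i))
    nonempty i B≉0 = go (f i) (β i) B≉0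
      where
      go : ∀ g (γ : Fin (count g) → Poly) → ¬ combination g γ ≈ᴾ [] → length g ≡ suc (deg g)
      go []      γ C≉0 = ⊥-elim (C≉0 P.PR.refl)
      go (a ∷ g) γ C≉0 = ≡.refl

    d₀ = deg (f i₀)

    -- Raises every f i with nonzero `B i` to the length of f i₀; maximality of that length makes
    -- the subtraction exact.
    shift : Fin N → ℕ
    shift i = length (f i₀) ℕ.∸ length (f i)

    c : Fin N → Ore
    c i with B i P.≟0
    -- Here f i may be longer than f i₀ and the truncated `shift` meaningless, so the vanishing
    -- summand is dropped.
    ... | yes _ = []
    ... | no  _ = comp (f i) (B i) (shift i)

    c-length : ∀ i → length (c i) ≤ suc d₀
    c-length i with B i P.≟0
    ... | yes _   = z≤n
    ... | no  B≉0 = ℕ.≤-reflexive (≡.trans (length-comp (f i) (B i) (shift i))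
                      (≡.trans (ℕ.m∸n+n≡m (maximal i B≉0)) (nonempty i₀ B₀≉0)))

    c-coeff : ∀ i → O.coeff (c i) d₀ ≈ᴾ lead (f i) ⊗ B i ^p^ deg (f i)
    c-coeff i with B i P.≟0
    ... | yes B≈0 = P.PR.sym (P.PR.trans (P.PR.*-congˡ (P.PR.trans (φ-cong (deg (f i)) B≈0) (φ-0 (deg (f i))))) (P.PR.zeroʳ _))
    ... | no  B≉0 = P.PR.trans (P.PR.reflexive (≡.cong (O.coeff (comp (f i) (B i) (shift i))) d₀≡)) (coeff-comp (f i) (B i) (shift i) (deg (f i)))
      where
      d₀≡ : d₀ ≡ shift i ℕ.+ deg (f i)
      d₀≡ = ℕ.suc-injective (≡.trans (≡.sym (nonempty i₀ B₀≉0)) (≡.trans (≡.sym (ℕ.m∸n+n≡m (maximal i B≉0)))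
        (≡.trans (≡.cong (shift i ℕ.+_) (nonempty i B≉0)) (ℕ.+-suc (shift i) (deg (f i))))))

    C₀ : Ore
    C₀ = O∑.∑ (allFin N) c

    C₀-degree : O.Deg< d₀ C₀
    C₀-degree k d₀≤k with d₀ ℕ.≟ k
    ... | yes ≡.refl = P.PR.trans (coeff-∑ (allFin N)) (P.PR.trans (P∑.∑-cong (allFin N) c-coeff) cancellation)
      where
      coeff-∑ : ∀ is → O.coeff (O∑.∑ is c) d₀ ≈ᴾ P∑.∑ is (λ i → O.coeff (c i) d₀)
      coeff-∑ []       = P.PR.refl
      coeff-∑ (i ∷ is) = P.PR.trans (O.coeff-⊕ (c i) _ d₀) (P.PR.+-congˡ (coeff-∑ is))
    ... | no d₀≢k = O.deg-length C₀ (∑-length (allFin N)) k (ℕ.≤∧≢⇒< d₀≤k d₀≢k)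
      where
      ∑-length : ∀ is → length (O∑.∑ is c) ≤ suc d₀
      ∑-length []       = z≤n
      ∑-length (i ∷ is) = O.length-⊕-≤ (c i) _ (c-length i) (∑-length is)

    f₀ : Ore
    f₀ = take d₀ C₀

    f′ : Fin N → Ore
    f′ i = if does (i Fin.≟ i₀) then f₀ else f i

    f₀-shorter : length f₀ ℕ.< length (f i₀)
    f₀-shorter = ℕ.<-≤-trans (s≤s (ℕ.≤-trans (ℕ.≤-reflexive (length-take d₀ C₀)) (ℕ.m⊓n≤m d₀ _)))
      (ℕ.≤-reflexive (≡.sym (nonempty i₀ B₀≉0)))

    f′-≤ : ∀ i → length (f′ i) ≤ length (f i)
    f′-≤ i with i Fin.≟ i₀
    ... | yes ≡.refl = ℕ.<⇒≤ f₀-shorter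
    ... | no  _      = ℕ.≤-refl

    shorter : total (length ∘ f′) ℕ.< total (length ∘ f)
    shorter = total-strict (length ∘ f′) (length ∘ f) f′-≤ i₀ at-i₀
      where
      at-i₀ : length (f′ i₀) ℕ.< length (f i₀)
      at-i₀ with i₀ Fin.≟ i₀
      ... | yes _ = f₀-shorter
      ... | no  ≢ = ⊥-elim (≢ ≡.refl)

    mod = modulus (B i₀) B₀≉0
    open Modulus mod public using () renaming (d to dᵐ)

    remainder-form : Form (Fin N ⊎ Fin dᵐ)
    remainder-form = concatMap (λ l → term (X ^ᴾ toℕ l) (inj₂ l) 0) (allFin dᵐ)

    initial : Fin N → Form (Fin N ⊎ Fin dᵐ)
    initial i = if does (i Fin.≟ i₀) then remainder-form else variable-form (inj₁ i)

    -- The variable at i₀ is divided by `B i₀`, and the digits of the remainder become parameters in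
    -- F. In this way every value is reached, although `B i₀` need not be invertible.
    reparametrization : Reparametrization N
    reparametrization = record
      { C = Fin dᵐ ; finite-C = finite-Fin dᵐ
      ; G = λ i → initial i ++ term (B i) (inj₁ i₀) (shift i) }

  -- The history of the reduction is kept as data: it is replayed to build the substitution and
  -- again to prove it correct. A completion is taken at a positive level, so that D - 1 can bound
  -- the lower exponents.
  data Trace {N} (f : Fin N → Ore) : Set where
    complete : ∀ D (f≤D : ∀ i → length (f i) ≤ suc D) → Completion (Family.vectors (suc D) f f≤D) → Trace f
    reduce   : ∀ D (f≤D : ∀ i → length (f i) ≤ D) (dep : Dependent (Family.vectors D f f≤D)) →
               Trace (Reduce.f′ D f f≤D dep) → Trace f

  private
    -- The total length of the family drops with each reduction and bounds their number; it is
    -- passed as fuel because the recursive call is not on a subterm.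
    trace-fuel : ∀ {N} n (f : Fin N → Ore) → total (length ∘ f) ℕ.< n → Trace f
    trace-fuel {N} (suc n) f lt with Fin-bound N (length ∘ f)
    ... | D , f≤D with dependent-or-complete (Family.vectors (suc D) f (λ i → ℕ.m≤n⇒m≤1+n (f≤D i)))
    ...   | inj₂ completion = complete D (λ i → ℕ.m≤n⇒m≤1+n (f≤D i)) completion
    ...   | inj₁ dep = reduce (suc D) (λ i → ℕ.m≤n⇒m≤1+n (f≤D i)) dep
                         (trace-fuel n _ (ℕ.<-≤-trans (Reduce.shorter (suc D) f _ dep) (ℕ.≤-pred lt)))

  abstract
    trace : ∀ {N} (f : Fin N → Ore) → Trace f
    trace f = trace-fuel (suc (total (length ∘ f))) f ℕ.≤-refl

  last-family : ∀ {N} {f : Fin N → Ore} → Trace f → Fin N → Ore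
  last-family {f = f} (complete _ _ _) = f
  last-family (reduce _ _ _ t)         = last-family t

  level : ∀ {N} {f : Fin N → Ore} → Trace f → ℕ
  level (complete D _ _)   = D
  level (reduce _ _ _ t)   = level t

  last-bound : ∀ {N} {f : Fin N → Ore} (t : Trace f) i → length (last-family t i) ≤ suc (level t)
  last-bound (complete D f≤D _) = f≤D
  last-bound (reduce _ _ _ t)   = last-bound t

  last-completion : ∀ {N} {f : Fin N → Ore} (t : Trace f) → Completion (Family.vectors (suc (level t)) (last-family t) (last-bound t))
  last-completion (complete _ _ C) = C
  last-completion (reduce _ _ _ t) = last-completion t

  substitution : ∀ {N} {f : Fin N → Ore} → Trace f → Reparametrization N
  substitution (complete _ _ _)             = identical
  substitution {f = f} (reduce D f≤D dep t) = Compose.composite (Reduce.reparametrization D f f≤D dep) (substitution t)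

  module Split (D′ : ℕ) {N} (f : Fin N → Ore) (f≤D : ∀ i → length (f i) ≤ suc D′)
    (completion : Completion (Family.vectors (suc D′) f f≤D)) where
    D = suc D′
    open Family D f f≤D public
    open Completion completion public

    split : ∀ g → (Fin (count g) → Fin q) → Fin N → Form (Fin q ⊎ Fin N)
    split []        pos i = variable-form (inj₂ i)
    split g@(_ ∷ _) pos i = concatMap (λ l → term (X ^ᴾ toℕ l) (inj₁ (pos l)) (D ℕ.∸ deg g)) (allFin (count g))

    slot : ∀ i → Fin (counts i) → Fin q
    slot i l = position (encode counts i l)

    split-form : Fin N → Form (Fin q ⊎ Fin N)
    split-form i = split (f i) (slot i) i

    low-term : ∀ g → Fin (count g) → Fin q → Form (Fin q)
    low-term g l k = sub (λ _ → term (X ^ᴾ toℕ l) k (D ℕ.∸ deg g)) (ore-form (take (deg g) g) tt)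

    low-form : Form (Fin q)
    low-form = concatMap (λ i → concatMap (λ l → low-term (f i) l (slot i l)) (allFin (counts i))) (allFin N)

    lead-form : Form (Fin q)
    lead-form = concatMap (λ k → term (PB.basis-∑ D (u k)) k D) (allFin q)

    normal-form : Form (Fin q)
    normal-form = lead-form ++ low-form

    -- Positions filled by unit vectors. They make the matrix of leading coefficients square and
    -- invertible up to Δ; their variables do not stem from the form and will be required to vanish.
    Dummy : Fin q → Set
    Dummy k = ∀ i → ¬ position i ≡ k

    dummy? : ∀ k → Dec (Dummy k)
    dummy? k with Fin.any? (λ i → position i Fin.≟ k)
    ... | yes (i , eq) = no λ dummy → dummy i eq
    ... | no  ∄i       = yes λ i eq → ∄i (i , eq)

    private
      ore-exp : ∀ g {n} → length g ≤ n → All (λ m → Monomial.exp m ℕ.< n) (ore-form g tt)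
      ore-exp []      le = []
      ore-exp (a ∷ g) {suc n} (s≤s le) = s≤s z≤n ∷ All.map⁺ (All.map s≤s (ore-exp g le))

      sub-exp : ∀ b (k : Fin q) t n T φ → All (λ (m : Monomial ⊤) → Monomial.exp m ℕ.< n) φ → t ℕ.+ n ≤ suc T → Exp≤ T (sub (λ _ → term b k t) φ)
      sub-exp b k t n T []               []         le = []
      sub-exp b k t n T (mono a i j ∷ φ) (lt ∷ lts) le =
        ℕ.≤-pred (ℕ.≤-trans (ℕ.≤-trans (ℕ.≤-reflexive (≡.sym (ℕ.+-suc t j))) (ℕ.+-monoʳ-≤ t lt)) le) ∷ sub-exp b k t n T φ lts le

      concatMap-exp : ∀ {I J : Set} T (φ : I → Form J) xs → (∀ x → Exp≤ T (φ x)) → Exp≤ T (concatMap φ xs)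
      concatMap-exp T φ []       le = []
      concatMap-exp T φ (x ∷ xs) le = All.++⁺ (le x) (concatMap-exp T φ xs le)

      low-term-exp : ∀ g → length g ≤ D → ∀ l k → Exp≤ D′ (low-term g l k)
      low-term-exp g le l k = sub-exp (X ^ᴾ toℕ l) k (D ℕ.∸ deg g) (deg g) D′ (ore-form (take (deg g) g) tt)
        (ore-exp (take (deg g) g) (ℕ.≤-trans (ℕ.≤-reflexive (length-take (deg g) g)) (ℕ.m⊓n≤m (deg g) (length g))))
        (ℕ.≤-reflexive (t+d≡D g le))

    -- An entry before position deg g has exponent below deg g, and the substitution adds D - deg g.
    -- The factor p gained over the leading terms makes the bounds below contract.
    low-exp : Exp≤ D′ low-form
    low-exp = concatMap-exp D′ (λ i → concatMap (λ l → low-term (f i) l (slot i l)) (allFin (counts i))) (allFin N) λ i →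
      concatMap-exp D′ (λ l → low-term (f i) l (slot i l)) (allFin (counts i)) λ l → low-term-exp (f i) (f≤D i) l (slot i l)

    q′ = p ℕ.^ D′

    module _ where
      private
        W-bound = Fin-bound q (λ k → proj₁ (Fin-bound q (λ e → length (w k e))))

      W : ℕ
      W = proj₁ W-bound

      w≤W : ∀ k e → length (w k e) ≤ W
      w≤W k e = ℕ.≤-trans (proj₂ (Fin-bound q (λ e → length (w k e))) e) (proj₂ W-bound k)

    Z : ℕ
    Z = proj₁ (Fin-bound q (λ e → length (X ^ᴾ toℕ e)))

    mod-Δ : Modulus Δ
    mod-Δ = modulus Δ Δ≉0
    open Modulus mod-Δ public using () renaming (i to iΔ; d to dΔ)

    -- Read off `approximate`: `K` is the loss from the digits of y to x, by division by Δ and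
    -- multiplication by w; `A` is the part of the error independent of y, from remainders modulo Δ
    -- and coefficients of the low form.
    A K : ℕ
    A = (Z ℕ.+ q ℕ.* dΔ) ℕ.+ size low-form
    K = W ℕ.+ (iΔ ℕ.+ dΔ)

    -- While y has bound n q with n > 1 + A + K, one approximation lowers n, since the new bound A +
    -- q′ (K + n) grows with q / p only; below that the descent stops.
    remainder-bound : ℕ
    remainder-bound = suc (A ℕ.+ K) ℕ.* q

    -- The first summand is the least n to which `improve` applies. The second one is the loss in
    -- recovering x from the digits of the leading part, by w and by cancelling Δ.
    solution-bound : ℕ → ℕ
    solution-bound N = (suc (N ℕ.+ size low-form) ℕ.+ (iΔ ℕ.+ W)) ℕ.+ (iΔ ℕ.+ W)

    2≤p : 2 ≤ p
    2≤p = ℕ.nonTrivial⇒n>1 p {{prime⇒nonTrivial p-prime}}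

    1≤q′ : 1 ≤ q′
    1≤q′ = ℕ.m^n>0 p {{prime⇒nonZero p-prime}} D′

    halve : ∀ a N → a ≤ N → a ℕ.* q′ ℕ.+ N ℕ.* q′ ≤ N ℕ.* q
    halve a N a≤N = ℕ.≤-trans (ℕ.+-monoˡ-≤ (N ℕ.* q′) (ℕ.*-monoˡ-≤ q′ a≤N))
      (ℕ.≤-trans (ℕ.≤-reflexive (double N q′)) (ℕ.*-monoʳ-≤ N (ℕ.*-monoˡ-≤ q′ 2≤p)))
      where
      double : ∀ N q → N ℕ.* q ℕ.+ N ℕ.* q ≡ N ℕ.* (2 ℕ.* q)
      double = solve-∀

    ≤*q′ : ∀ n → n ≤ n ℕ.* q′
    ≤*q′ n = ℕ.m≤m*n n q′ {{ℕ.>-nonZero 1≤q′}}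

  -- A single equation equivalent to the system: u^p + z v^p = 0 iff u = v = 0.
  merge : List (Form Var) → Form Var
  merge []       = []
  merge (e ∷ es) = frobᶠ 1 e ++ (X ·ᶠ frobᶠ 1 (merge es))

  collect : ∀ {N} → Form (Fin N) → Fin N → Ore
  collect []               i = []
  collect (mono a j k ∷ φ) i = (if does (i Fin.≟ j) then comp (a ∷ []) P.PR.1# k else []) O.⊕ collect φ i

  -- Denominators σ^N of the variables are cleared by homogenization.
  clear : ℕ → Form Var → Form Var
  clear N φ = let T = proj₁ (max-exp φ) in
    map (λ (mono a i k) → mono (s ^ᴾ (N ℕ.* (p ℕ.^ T ℕ.∸ p ℕ.^ k)) ⊗ a) i k) φ

  digit-form : ∀ {d} → (Fin d → Var) → Form Var
  digit-form {d = d} c = concatMap (λ l → term (X ^ᴾ toℕ l) (c l) 0) (allFin d)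

  -- Unlike `deg`, this yields a nonzero leading coefficient, on which the growth argument of
  -- `avoid-value` relies.
  Ore-top : Ore → Set
  Ore-top f = f O.≈ᴾ [] ⊎ ∃[ d ] (¬ O.coeff f d ≈ᴾ [] × O.Deg< (suc d) f)

  ore-top : ∀ f → Ore-top f
  ore-top [] = inj₁ O.PR.refl
  ore-top (a ∷ f) with ore-top f
  ... | inj₂ (d , a≉0 , deg) = inj₂ (suc d , a≉0 , λ { (suc k) (s≤s le) → deg k le })
  ... | inj₁ f≈0 with a P.≟0
  ...   | yes a≈0 = inj₁ (PolynomialRing.coeffwise λ { zero → a≈0 ; (suc n) → PolynomialRing.at f≈0 n })
  ...   | no  a≉0 = inj₂ (0 , a≉0 , λ { (suc k) le → PolynomialRing.at f≈0 k })

  ore-≟0 : ∀ f → Dec (f O.≈ᴾ [])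
  ore-≟0 f with ore-top f
  ... | inj₁ f≈0 = yes f≈0
  ... | inj₂ (d , a≉0 , _) = no λ f≈0 → a≉0 (PolynomialRing.at f≈0 d)

  -- Conditions and definitions of relations.

  -- Conditions on ring elements η : A → R, which enter only through η a = 0,
  -- and on field elements c : B → F.  The constructor fix prescribes which of
  -- the η a vanish.
  infixr 6 _∧ᵇ_
  infixr 5 _∨ᵇ_
  data Condition (A B : Set) : Set₁ where
    vanishes   : A → Condition A B
    linear     : Form B → Poly → Condition A B
    satisfies  : ∀ {k} → Formula Lp k → (Fin k → B) → Condition A B
    trueᵇ      : Condition A B
    negᵇ       : Condition A B → Condition A B
    _∧ᵇ_ _∨ᵇ_ : Condition A B → Condition A B → Condition A B
    exᵇ        : ∀ {C} → Finite C → Condition A (B ⊎ C) → Condition A B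
    rename     : ∀ {A′ B′} → (A′ → A) → (B′ → B) → Condition A′ B′ → Condition A B
    fix        : ∀ {A′} → (A′ → Bool) → Condition A′ B → Condition A B

  allᵇ : ∀ {A B} n → (Fin n → Condition A B) → Condition A B
  allᵇ zero    β = trueᵇ
  allᵇ (suc n) β = β zero ∧ᵇ allᵇ n (β ∘ suc)

  whenᵇ : ∀ {A B} → Bool → Condition A B → Condition A B
  whenᵇ b β = if b then β else trueᵇ

  -- A definition of a relation on K → R: a total system of linear equations
  -- in auxiliary unknowns, and a condition on its solutions.
  record Definition (K : Set) : Set₁ where
    field
      A B       : Set
      finite-A  : Finite A
      finite-B  : Finite B
      equations : List (Form (K ⊎ (A ⊎ B)))
      condition : Condition A B

  -- Elimination of unknowns.

  -- Equations s^N τ_t = b η_t + Σ_l z^l c_{t,l}, whose solution is unique if τ_t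
  -- is bounded by N, and then η_t = 0.
  module Decomposition (N : ℕ) (1≤N : 1 ≤ N) where
    -- `L` is the strict degree bound for numerators of elements bounded by N, and `width` is the
    -- degree of b, the number of digits of a remainder modulo b.
    L width : ℕ
    L     = N ℕ.* h
    width = ds ℕ.+ L

    1≤L : 1 ≤ L
    1≤L = ℕ.*-mono-≤ 1≤N (s≤s z≤n)

    b : Poly
    b = P.PR.1# ⊕ s ⊗ X ^ᴾ L

    decomposition : ∀ {I : Set} → Form I → I → (Fin width → I) → Form I
    decomposition τ η c = (s ^ᴾ N ·ᶠ τ) ++ (-ᶠ ((b ·ᶠ variable-form η) ++ digit-form c))

  -- Elimination of x, y, c and d from
  --   eK(ρ) + nf(x) + gC(c) + eB(d) = 0,  bound t (x, c) + free t (y) ≠ 0 (J t),  x k = 0 (dummy k),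
  -- where nf has bounded solutions and remainders.
  module NormalElimination {K X₀ B C : Set} {q m : ℕ} (finite-X : Finite X₀) (finite-B : Finite B) (finite-C : Finite C)
    (eK : Form K) (nf : Form (Fin q)) (gC : Form C) (eB : Form B)
    (bound-part : X₀ → Form (Fin q ⊎ C)) (free-part : X₀ → Form (Fin m)) (dummy : Fin q → Bool) (J : X₀ → Bool)
    (Nv : ℕ) (solution-bound : ℕ → ℕ) (side : Condition ⊥ B) where
    open Finite finite-X using (element) renaming (cardinality to NX)

    -- The quantities whose boundedness is tested at the particular solution x₀: a dummy variable
    -- must cancel against a bounded correction, and an inequality can fail only if its part in x₀
    -- is bounded. In `τ` the parameters c are put to 0, since they belong to the correction.
    T : Set
    T = Fin q ⊎ X₀

    finite-T : Finite T
    finite-T = finite-⊎ (finite-Fin q) finite-X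

    τ : T → Form (Fin q)
    τ = [ variable-form , (λ x → sub [ variable-form , (λ _ → []) ]′ (bound-part x)) ]′

    free-zero? : ∀ x → Dec (∀ i → collect (free-part x) i O.≈ᴾ [])
    free-zero? x = Fin.all? λ i → ore-≟0 (collect (free-part x) i)

    bound-of : ∀ {I : Set} → ℕ → Form I → ℕ
    bound-of n φ = size φ ℕ.+ p ℕ.^ proj₁ (max-exp φ) ℕ.* n

    -- For the correction d, `N₁` bounds nf(d), `N₂` then d itself, and `N₃` the bound parts of the
    -- inequalities at (d, c), where 1 + N₂ also covers the constants c. `N` dominates all of them
    -- and is positive, as `Decomposition` demands.
    N₁ N₂ N₃ N : ℕ
    N₁ = Nv ℕ.+ (bound-of 1 eB ℕ.+ bound-of 1 gC)
    N₂ = solution-bound N₁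
    N₃ = proj₁ (Fin-bound NX λ i → bound-of (suc N₂) (bound-part (element i)))
    N  = suc (Nv ℕ.+ (N₂ ℕ.+ N₃))

    open Decomposition N (s≤s z≤n) public

    -- A solution is sought as x = x₀ + d. `A′` holds x₀ and the test values η; `B′` the digits of
    -- the remainder v and of the tested quantities; `Cx`, still to be quantified, the digits of d
    -- and the elements c and b of F. `I` names the elements of R that the conditions are about: d,
    -- the constants, v and the tested quantities.
    A′ B′ Cx I : Set
    A′ = Fin q ⊎ T
    B′ = Fin (Nv ℕ.* h) ⊎ (T × Fin width)
    Cx = (Fin q × Fin width) ⊎ (C ⊎ B)
    I  = (Fin q ⊎ (C ⊎ B)) ⊎ (⊤ ⊎ T)

    -- It says eK(ρ) + nf(x₀) + v = 0 with v bounded by `Nv`, and is solvable for every ρ.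
    -- Subtracted from it, the original equation becomes nf(d) + gC(c) + eB(b) = v, in which all
    -- terms are bounded.
    remainder-equation : Form (K ⊎ (A′ ⊎ B′))
    remainder-equation = (s ^ᴾ Nv ·ᶠ (relabel inj₁ eK ++ relabel (inj₂ ∘ inj₁ ∘ inj₁) nf)) ++ digit-form (inj₂ ∘ inj₂ ∘ inj₁)

    t-equation : T → Form (K ⊎ (A′ ⊎ B′))
    t-equation t = decomposition (relabel (inj₂ ∘ inj₁ ∘ inj₁) (τ t)) (inj₂ (inj₁ (inj₂ t))) (λ l → inj₂ (inj₂ (inj₂ (t , l))))

    -- Numerators over the common denominator s^N, in terms of digits.
    π : I → Form (B′ ⊎ Cx)
    π (inj₁ (inj₁ k))  = digit-form (λ l → inj₂ (inj₁ (k , l)))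
    π (inj₁ (inj₂ c))  = s ^ᴾ N ·ᶠ variable-form (inj₂ (inj₂ c))
    -- The digits of v are taken over s^Nv, so the missing power of s is supplied.
    π (inj₂ (inj₁ tt)) = s ^ᴾ (N ℕ.∸ Nv) ·ᶠ digit-form (λ l → inj₁ (inj₁ l))
    π (inj₂ (inj₂ t))  = digit-form (λ l → inj₁ (inj₂ (t , l)))

    -- With denominators cleared, the equation is one between polynomials in z whose coefficients
    -- are additive in the digits, hence a condition over F.
    holds-at-π : Form I → Condition A′ (B′ ⊎ Cx)
    holds-at-π φ = linear (sub π (clear N φ)) []

    main-form : Form I
    main-form = (relabel (inj₁ ∘ inj₁) nf ++ relabel (inj₁ ∘ inj₂ ∘ inj₁) gC) ++
                (relabel (inj₁ ∘ inj₂ ∘ inj₂) eB ++ (-ᶠ variable-form (inj₂ (inj₁ tt))))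

    dummy-form : Fin q → Form I
    dummy-form k = variable-form (inj₁ (inj₁ k)) ++ variable-form (inj₂ (inj₂ (inj₁ k)))

    inequality-form : X₀ → Form I
    inequality-form x = relabel [ inj₁ ∘ inj₁ , inj₁ ∘ inj₂ ∘ inj₁ ]′ (bound-part x) ++ variable-form (inj₂ (inj₂ (inj₂ x)))

    inner : Condition A′ (B′ ⊎ Cx)
    inner = rename (λ ()) (inj₂ ∘ inj₂ ∘ inj₂) side
         ∧ᵇ holds-at-π main-form
         ∧ᵇ allᵇ q (λ k → whenᵇ (dummy k) (holds-at-π (dummy-form k)))
         -- An inequality with a free part is met by the choice of y. Any other one can fail only if
         -- its part in x₀ is bounded, which `vanishes` detects, and is then tested with the
         -- correction added.
         ∧ᵇ allᵇ NX (λ i → whenᵇ (J (element i) ∧ does (free-zero? (element i)))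
              (negᵇ (vanishes (inj₂ (inj₂ (element i))) ∧ᵇ holds-at-π (inequality-form (element i)))))

    eliminated : Definition K
    eliminated = record
      { A = A′ ; B = B′
      ; finite-A = finite-⊎ (finite-Fin q) finite-T
      ; finite-B = finite-⊎ (finite-Fin _) (finite-× finite-T (finite-Fin width))
      ; equations = remainder-equation ∷ map (t-equation ∘ Finite.element finite-T) (allFin (Finite.cardinality finite-T))
      -- From x₀ k + d k = 0 with bounded d it follows that x₀ k is bounded.
      ; condition = allᵇ q (λ k → whenᵇ (dummy k) (vanishes (inj₂ (inj₁ k))))
                 ∧ᵇ exᵇ (finite-⊎ (finite-× (finite-Fin q) (finite-Fin width)) (finite-⊎ finite-C finite-B)) inner }

  -- Elimination of the unknowns X and B from linear equations, a condition on
  -- the c : B → F, and inequalities η x ≠ 0 for the x in J.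
  module Elimination {K X₀ B : Set} (finite-X : Finite X₀) (finite-B : Finite B)
    (system : List (Form (K ⊎ (X₀ ⊎ B)))) (side : Condition ⊥ B) (J : X₀ → Bool) where
    open Finite finite-X using (element) renaming (cardinality to NX; index to indexX)

    e : Form (K ⊎ (X₀ ⊎ B))
    e = merge system

    eK : Form K
    eK = sub [ variable-form , (λ _ → []) ]′ e

    eX : Form (Fin NX)
    eX = sub [ (λ _ → []) , [ (λ x → variable-form (indexX x)) , (λ _ → []) ]′ ]′ e

    eB : Form B
    eB = sub [ (λ _ → []) , [ (λ _ → []) , variable-form ]′ ]′ e

    tr : Trace (collect eX)
    tr = trace (collect eX)

    open Split (level tr) (last-family tr) (last-bound tr) (last-completion tr) public
      using (q; split-form; normal-form; dummy?; Dummy; remainder-bound; solution-bound)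
    open Reparametrization (substitution tr) public using (C; finite-C) renaming (G to G₀)

    lift-split : (Fin NX ⊎ C) → Form ((Fin q ⊎ Fin NX) ⊎ C)
    lift-split = [ (λ j → relabel inj₁ (split-form j)) , (λ c → variable-form (inj₂ c)) ]′

    G : Fin NX → Form ((Fin q ⊎ Fin NX) ⊎ C)
    G i = sub lift-split (G₀ i)

    constant-part : Fin NX → Form C
    constant-part i = sub [ (λ _ → []) , variable-form ]′ (G i)

    -- By additivity the parameters contribute separately, as the value of the form at the
    -- substitution with all other variables zero.
    gC : Form C
    gC = sub constant-part eX

    free-part : X₀ → Form (Fin NX)
    free-part x = sub [ [ (λ _ → []) , variable-form ]′ , (λ _ → []) ]′ (G (indexX x))

    bound-part : X₀ → Form (Fin q ⊎ C)
    bound-part x = sub [ [ (λ k → variable-form (inj₁ k)) , (λ _ → []) ]′ , (λ c → variable-form (inj₂ c)) ]′ (G (indexX x))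

    eliminated : Definition K
    eliminated = NormalElimination.eliminated finite-X finite-B finite-C eK normal-form gC eB bound-part free-part
      (λ k → does (dummy? k)) J remainder-bound solution-bound side

  open Renaming {Lp} using (rename-formula; rename⁺; rename⁻)

  -- Translation of definitions into formulas and of formulas into definitions.

  -- The embedding `f` of the function symbols lets both languages share these terms.
  module Base {L : Signature} (f : ∀ {k} → FunLp k → Signature.Fun L k) where
    infixl 6 _+ᵗ_
    _+ᵗ_ : ∀ {n} → Term L n → Term L n → Term L n
    t +ᵗ u = app (f add) (t ∷ u ∷ [])

    nilᵗ oneᵗ : ∀ {n} → Term L n
    nilᵗ = app (f nil) []
    oneᵗ = app (f one) []

    frobᵗ : ∀ {n} → ℕ → Term L n → Term L n
    frobᵗ zero    t = t
    frobᵗ (suc k) t = frobᵗ k (app (f frob) (t ∷ []))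

    scaleᵗ : ∀ {n} → ℕ → Term L n → Term L n
    scaleᵗ zero    t = nilᵗ
    scaleᵗ (suc m) t = t +ᵗ scaleᵗ m t

  module BLp  = Base {Lp} (λ f → f)
  module BLpz = Base {Lpzᵉ} base
  module CLp  = Connectives {Lp} BLp.nilᵗ
  module CLpz = Connectives {Lpzᵉ} BLpz.nilᵗ

  -- The coefficient at z^n of φ(c) + b. It is an 𝓛ₚ-term in the elements c of F because the
  -- coefficients of forms lie in 𝔽ₚ[z].
  coefficient-term : ∀ {B : Set} {m} → (B → Fin m) → Form B → Poly → ℕ → Term Lp m
  coefficient-term v []               b n = BLp.scaleᵗ (natural (P.coeff b n)) BLp.oneᵗ
  coefficient-term v (mono a i k ∷ φ) b n = BLp.scaleᵗ (natural (P.coeff a n)) (BLp.frobᵗ k (var (v i))) BLp.+ᵗ coefficient-term v φ b n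

  -- The η are not elements of F. Their vanishing pattern is an argument, so one formula is produced
  -- for each pattern.
  field-formula : ∀ {A B : Set} {m} → Condition A B → (A → Bool) → (B → Fin m) → Formula Lp m
  field-formula (vanishes i)    zeros v = if zeros i then CLp.trueᶠ else CLp.falseᶠ
  -- As z is transcendental, the equation holds coefficientwise, and beyond this number of
  -- coefficients all are zero.
  field-formula (linear φ b)    zeros v = CLp.conj (allFin (size φ ℕ.+ length b)) (λ n → coefficient-term v φ b (toℕ n) ≐ BLp.nilᵗ)
  field-formula (satisfies φ i) zeros v = rename-formula (v ∘ i) φ
  field-formula trueᵇ           zeros v = CLp.trueᶠ
  field-formula (negᵇ β)        zeros v = neg (field-formula β zeros v)
  field-formula (β ∧ᵇ γ)        zeros v = field-formula β zeros v ∧ᶠ field-formula γ zeros v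
  field-formula (β ∨ᵇ γ)        zeros v = field-formula β zeros v ∨ᶠ field-formula γ zeros v
  field-formula {m = m} (exᵇ fin β) zeros v = CLp.exs cardinality (field-formula β zeros [ (λ i → cardinality ↑ʳ v i) , (λ i → index i ↑ˡ m) ]′)
    where open Finite fin
  field-formula (rename f g β)  zeros v = field-formula β (zeros ∘ f) (v ∘ g)
  field-formula (fix zeros′ β)  zeros v = field-formula β zeros′ v

  polynomial-term : ∀ {n} → Poly → Term Lpzᵉ n → Term Lpzᵉ n
  polynomial-term []      t = BLpz.nilᵗ
  polynomial-term (c ∷ a) t = BLpz.scaleᵗ (natural c) t BLpz.+ᵗ app z-mult (polynomial-term a t ∷ [])

  form-term : ∀ {I : Set} {n} → (I → Fin n) → Form I → Term Lpzᵉ n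
  form-term v []               = BLpz.nilᵗ
  form-term v (mono a i k ∷ φ) = polynomial-term a (BLpz.frobᵗ k (var (v i))) BLpz.+ᵗ form-term v φ

  module ToFormula {n} (D : Definition (Fin n)) where
    open Definition D
    module FA = Finite finite-A
    module FB = Finite finite-B
    nA = FA.cardinality
    nB = FB.cardinality

    place : Fin n ⊎ (A ⊎ B) → Fin ((nA ℕ.+ nB) ℕ.+ n)
    place (inj₁ i)        = (nA ℕ.+ nB) ↑ʳ i
    place (inj₂ (inj₁ a)) = (FA.index a ↑ˡ nB) ↑ˡ n
    place (inj₂ (inj₂ b)) = (nA ↑ʳ FB.index b) ↑ˡ n

    literal : Bool → Fin nA → Formula Lpzᵉ ((nA ℕ.+ nB) ℕ.+ n)
    literal b k = if b then var ((k ↑ˡ nB) ↑ˡ n) ≐ BLpz.nilᵗ else neg (var ((k ↑ˡ nB) ↑ˡ n) ≐ BLpz.nilᵗ)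

    case : Vec Bool nA → Formula Lpzᵉ ((nA ℕ.+ nB) ℕ.+ n)
    case bits = CLpz.conj (allFin nA) (λ k → literal (Vec.lookup bits k) k) ∧ᶠ
      -- The predicate also asserts that its arguments lie in F, which restricts the quantified
      -- variables for c.
      rel (P (field-formula condition (Vec.lookup bits ∘ FA.index) FB.index)) (Vec.tabulate λ k → var ((nA ↑ʳ k) ↑ˡ n))

    matrix : Formula Lpzᵉ ((nA ℕ.+ nB) ℕ.+ n)
    matrix = CLpz.conj equations (λ e → form-term place e ≐ BLpz.nilᵗ) ∧ᶠ CLpz.disj (bit-vectors nA) case

    existential-formula : Formula Lpzᵉ n
    existential-formula = CLpz.exs (nA ℕ.+ nB) matrix

    is-existential : Existential existential-formula
    is-existential = CLpz.exs-existential (nA ℕ.+ nB) (qf (QuantifierFree.and (CLpz.conj-qf equations λ _ → QuantifierFree.eq) (CLpz.disj-qf (bit-vectors nA) λ bits →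
      QuantifierFree.and (CLpz.conj-qf (allFin nA) λ k → literal-qf (Vec.lookup bits k) k) rel)))
      where
      literal-qf : ∀ b k → QuantifierFree (literal b k)
      literal-qf true  k = QuantifierFree.eq
      literal-qf false k = neg QuantifierFree.eq

    -- A homogeneous system has the zero solution.
    sentence : Formula Lp 0
    sentence = CLp.exs nB (CLp.conj (allFin nB) (λ k → var (k ↑ˡ 0) ≐ BLp.nilᵗ) ∧ᶠ field-formula condition (λ _ → true) (λ b → FB.index b ↑ˡ 0))

  negation : ∀ {K} → Definition K → Definition K
  negation D = record { Definition D ; condition = negᵇ (Definition.condition D) }

  module Combine {K} (_∙_ : ∀ {A B} → Condition A B → Condition A B → Condition A B) (D E : Definition K) where
    module D = Definition D
    module E = Definition E

    left : K ⊎ (D.A ⊎ D.B) → K ⊎ ((D.A ⊎ E.A) ⊎ (D.B ⊎ E.B))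
    left = [ inj₁ , [ inj₂ ∘ inj₁ ∘ inj₁ , inj₂ ∘ inj₂ ∘ inj₁ ]′ ]′

    right : K ⊎ (E.A ⊎ E.B) → K ⊎ ((D.A ⊎ E.A) ⊎ (D.B ⊎ E.B))
    right = [ inj₁ , [ inj₂ ∘ inj₁ ∘ inj₂ , inj₂ ∘ inj₂ ∘ inj₂ ]′ ]′

    combined : Definition K
    combined = record
      { A = D.A ⊎ E.A ; B = D.B ⊎ E.B
      ; finite-A = finite-⊎ D.finite-A E.finite-A ; finite-B = finite-⊎ D.finite-B E.finite-B
      ; equations = map (relabel left) D.equations ++ map (relabel right) E.equations
      ; condition = rename inj₁ inj₁ D.condition ∙ rename inj₂ inj₂ E.condition }

  module _ {K : Set} where
    _∧ᵈ_ _∨ᵈ_ _⇒ᵈ_ : Definition K → Definition K → Definition K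
    D ∧ᵈ E = Combine.combined _∧ᵇ_ D E
    D ∨ᵈ E = Combine.combined _∨ᵇ_ D E
    D ⇒ᵈ E = Combine.combined (λ β γ → negᵇ β ∨ᵇ γ) D E

    falseᵈ : Definition K
    falseᵈ = record { A = Fin 0 ; B = Fin 0 ; finite-A = finite-Fin 0 ; finite-B = finite-Fin 0 ; equations = [] ; condition = negᵇ trueᵇ }

    disjᵈ : ∀ {I : Set} → List I → (I → Definition K) → Definition K
    disjᵈ []       D = falseᵈ
    disjᵈ (x ∷ xs) D = D x ∨ᵈ disjᵈ xs D

  -- The vanishing pattern of the η is guessed: the vanishing ones give further equations, the
  -- others inequalities, and the condition is left with elements of F alone.
  module Exists {n} (D : Definition (Fin (suc n))) where
    open Definition D
    module FA = Finite finite-A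

    split-variables : Fin (suc n) ⊎ (A ⊎ B) → Fin n ⊎ ((⊤ ⊎ A) ⊎ B)
    split-variables (inj₁ zero)     = inj₂ (inj₁ (inj₁ tt))
    split-variables (inj₁ (suc i))  = inj₁ i
    split-variables (inj₂ (inj₁ a)) = inj₂ (inj₁ (inj₂ a))
    split-variables (inj₂ (inj₂ b)) = inj₂ (inj₂ b)

    vanishing : Vec Bool FA.cardinality → Fin FA.cardinality → Form (Fin n ⊎ ((⊤ ⊎ A) ⊎ B))
    vanishing bits k = if Vec.lookup bits k then variable-form (inj₂ (inj₁ (inj₂ (FA.element k)))) else []

    system : Vec Bool FA.cardinality → List (Form (Fin n ⊎ ((⊤ ⊎ A) ⊎ B)))
    system bits = map (relabel split-variables) equations ++ map (vanishing bits) (allFin FA.cardinality)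

    side : Vec Bool FA.cardinality → Condition ⊥ B
    side bits = fix (Vec.lookup bits ∘ FA.index) condition

    nonvanishing : Vec Bool FA.cardinality → ⊤ ⊎ A → Bool
    nonvanishing bits = [ (λ _ → false) , not ∘ Vec.lookup bits ∘ FA.index ]′

    finite-⊤⊎A : Finite (⊤ ⊎ A)
    finite-⊤⊎A = finite-⊎ (record { cardinality = 1 ; index = λ _ → zero ; element = λ _ → tt ; element-index = λ _ → ≡.refl }) finite-A

    eliminated-case : Vec Bool FA.cardinality → Definition (Fin n)
    eliminated-case bits = Elimination.eliminated finite-⊤⊎A finite-B (system bits) (side bits) (nonvanishing bits)

    exists : Definition (Fin n)
    exists = disjᵈ (bit-vectors FA.cardinality) eliminated-case

  -- The relation: t_i + a_i = c_i for some c_i in F satisfying σ.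
  module Atom {n k : ℕ} (t : Fin k → Form (Fin n)) (a : Fin k → Poly) (σ : Formula Lp k) where
    -- Bounds c - a i for every constant c, so that the atom fails where t i is not bounded by N.
    N : ℕ
    N = suc (proj₁ (Fin-bound k (λ i → length (a i))))
    open Decomposition N (s≤s z≤n) public

    A B : Set
    A = Fin k
    B = Fin k × Fin width

    atom-equation : Fin k → Form (Fin n ⊎ (A ⊎ B))
    atom-equation i = decomposition (relabel inj₁ (t i)) (inj₂ (inj₁ i)) (λ l → inj₂ (inj₂ (i , l)))

    constant-form : Fin k → Form (B ⊎ Fin k)
    constant-form i = digit-form (λ l → inj₁ (i , l)) ++ (-ᶠ (s ^ᴾ N ·ᶠ variable-form (inj₂ i)))

    atom : Definition (Fin n)
    atom = record
      { A = A ; B = B ; finite-A = finite-Fin k ; finite-B = finite-× (finite-Fin k) (finite-Fin width)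
      ; equations = map atom-equation (allFin k)
      ; condition = allᵇ k vanishes ∧ᵇ exᵇ (finite-Fin k) (allᵇ k (λ i → linear (constant-form i) (s ^ᴾ N ⊗ a i)) ∧ᵇ satisfies σ inj₂) }

  -- With addition, Frobenius and multiplication by z, but no product, every term is an additive
  -- form plus a constant from 𝔽ₚ[z].
  term-form    : ∀ {n} → Term Lpzᵉ n → Form (Fin n)
  term-constant  : ∀ {n} → Term Lpzᵉ n → Poly
  term-form   (var i)                       = variable-form i
  term-form   (app (base add) (t ∷ u ∷ [])) = term-form t ++ term-form u
  term-form   (app (base frob) (t ∷ []))    = frobᶠ 1 (term-form t)
  term-form   (app (base nil) [])           = []
  term-form   (app (base one) [])           = []
  term-form   (app z-mult (t ∷ []))         = X ·ᶠ term-form t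
  term-constant (var i)                       = []
  term-constant (app (base add) (t ∷ u ∷ [])) = term-constant t ⊕ term-constant u
  term-constant (app (base frob) (t ∷ []))    = term-constant t PB.P.^p^ 1
  term-constant (app (base nil) [])           = []
  term-constant (app (base one) [])           = P.PR.1#
  term-constant (app z-mult (t ∷ []))         = X ⊗ term-constant t

  atomᵈ : ∀ {n k} → Vec (Term Lpzᵉ n) k → Formula Lp k → Definition (Fin n)
  atomᵈ ts σ = Atom.atom (λ i → term-form (Vec.lookup ts i)) (λ i → term-constant (Vec.lookup ts i)) σ

  defining : ∀ {n} → Formula Lpzᵉ n → Definition (Fin n)
  -- An equation is the atom t - u = c with c = 0.
  defining (t ≐ u)               = Atom.atom {k = 1} (λ _ → term-form t ++ (-ᶠ term-form u)) (λ _ → term-constant t ⊕ ⊝ term-constant u) (var zero ≐ BLp.nilᵗ)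
  defining (rel (base inF) ts)   = atomᵈ ts CLp.trueᶠ
  defining (rel (P σ) ts)        = atomᵈ ts σ
  defining (neg φ)               = negation (defining φ)
  defining (φ ∧ᶠ ψ)              = defining φ ∧ᵈ defining ψ
  defining (φ ∨ᶠ ψ)              = defining φ ∨ᵈ defining ψ
  defining (φ ⇒ᶠ ψ)              = defining φ ⇒ᵈ defining ψ
  defining (all φ)               = negation (Exists.exists (negation (defining φ)))
  defining (ex φ)                = Exists.exists (defining φ)

  -- Bounded elements of R: Frobenius digits, cancellation and division.

  module InModel {a} (M : Model 𝕜 s a) where
    open Model M public using (F; R; ι; κ; z; root; field-F; s⁻¹; s-inverse; em)
    private module M = Model M
    open CommutativeRing R hiding (zero; _-_; ring) public
    open SetoidReasoning setoid
    module Fᵣ = CommutativeRing F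
    module ι = RingHom ι
    module κ = RingHom κ
    module Q where
      open PolynomialRing F public
      open Degree F public
      open FieldPolynomials field-F public
    private
      module EF = Evaluation κ z
      module EP = Evaluation (κ ∘ʰ ι) z
      module S = IntegerSolver R
    open FiniteSums R public

    pol : Q.Poly → Carrier
    pol = EF.ev

    ⟪_⟫ : P.Poly → Carrier
    ⟪_⟫ = EP.ev

    σ : Carrier
    σ = ⟪ s ⟫

    fromℕ-hom : ∀ {b ℓ b′ ℓ′} {A : CommutativeRing b ℓ} {B : CommutativeRing b′ ℓ′} (f : RingHom A B) n →
      CommutativeRing._≈_ B (RingHom.to f (IntegerSolver.fromℕ A n)) (IntegerSolver.fromℕ B n)
    fromℕ-hom f zero = RingHom.to-0 f
    fromℕ-hom {B = B} f (suc n) = B.trans (RingHom.to-+ f _ _) (B.+-cong (RingHom.to-1 f) (fromℕ-hom f n))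
      where module B = CommutativeRing B

    abstract
     charF : IntegerSolver.fromℕ F p Fᵣ.≈ Fᵣ.0#
     charF = Fᵣ.trans (Fᵣ.sym (fromℕ-hom ι p)) (Fᵣ.trans (ι.to-cong char) ι.to-0)

     charR : IntegerSolver.fromℕ R p ≈ 0#
     charR = trans (sym (fromℕ-hom κ p)) (trans (κ.to-cong charF) κ.to-0)

    open Frobenius R p p-prime charR public
    module QB = FrobeniusBasis field-F p p-prime charF

    pol-+ = EF.ev-+
    pol-* = EF.ev-*
    pol-cong : ∀ {f g} → f Q.≈ᴾ g → pol f ≈ pol g
    pol-cong = EF.ev-cong

    ⟪⟫-hom : RingHom P.polynomialRing R
    ⟪⟫-hom = EP.evaluation
    module ⟪⟫ = RingHom ⟪⟫-hom
    module pol = RingHom EF.evaluation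

    private
      constant : RingHom F Q.polynomialRing
      constant = record
        { to = Q.const
        ; to-cong = Q.const-cong
        ; to-+ = λ x y → Q.coeffwise λ where
            zero    → Fᵣ.sym (Q.coeff-⊕ (Q.const x) (Q.const y) 0)
            (suc n) → Fᵣ.sym (Fᵣ.trans (Q.coeff-⊕ (Q.const x) (Q.const y) (suc n)) (Fᵣ.+-identityˡ _))
        ; to-* = λ x y → Q.PR.sym (Q.PR.trans (Q.const-*-≈ x (Q.const y)) (Q.coeffwise λ where
            zero    → Q.coeff-scale x (Q.const y) 0
            (suc n) → Fᵣ.trans (Q.coeff-scale x (Q.const y) (suc n)) (Fᵣ.zeroʳ x)))
        ; to-1 = Q.PR.refl }
      module L = Evaluation (constant ∘ʰ ι) Q.X
    module lift = RingHom L.evaluation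

    lift : P.Poly → Q.Poly
    lift = L.ev

    coeff-lift : ∀ f n → Q.coeff (lift f) n Fᵣ.≈ ι.to (P.coeff f n)
    coeff-lift []      n       = Fᵣ.sym ι.to-0
    coeff-lift (c ∷ f) zero    = Fᵣ.sym (Q.at (Q.∷-≈ (ι.to c) (lift f)) 0)
    coeff-lift (c ∷ f) (suc n) = Fᵣ.trans (Fᵣ.sym (Q.at (Q.∷-≈ (ι.to c) (lift f)) (suc n))) (coeff-lift f n)

    pol-lift : ∀ f → pol (lift f) ≈ ⟪ f ⟫
    pol-lift []      = refl
    pol-lift (c ∷ f) = begin
      pol (Q.const (ι.to c) Q.⊕ Q.X Q.⊗ lift f)           ≈⟨ pol-+ _ _ ⟩
      pol (Q.const (ι.to c)) + pol (Q.X Q.⊗ lift f)       ≈⟨ +-cong (EF.ev-const _) (pol-* _ _) ⟩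
      κ.to (ι.to c) + pol Q.X * pol (lift f)              ≈⟨ +-congˡ (*-cong EF.ev-X (pol-lift f)) ⟩
      κ.to (ι.to c) + z * ⟪ f ⟫                           ∎

    deg-lift : ∀ {n} f → P.Deg< n f → Q.Deg< n (lift f)
    deg-lift f deg k n≤k = Fᵣ.trans (coeff-lift f k) (Fᵣ.trans (ι.to-cong (deg k n≤k)) ι.to-0)

    monic-lift : ∀ {d m} → P.Monic d m → Q.Monic d (lift m)
    monic-lift {d} {m} mm = record
      { leading = Fᵣ.trans (coeff-lift m d) (Fᵣ.trans (ι.to-cong (P.Monic.leading mm)) ι.to-1)
      ; degree  = deg-lift m (P.Monic.degree mm) }

    pol-injective : ∀ {f g} → pol f ≈ pol g → f Q.≈ᴾ g
    pol-injective {f} {g} eq = Q.PR.trans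
      (SQ.solve 2 (λ f g → f SQ.:= (f SQ.:+ SQ.:- g) SQ.:+ g) Q.PR.refl f g)
      (Q.PR.trans (Q.PR.+-congʳ (M.transcendental (f Q.⊕ Q.⊝ g) f-g≈0)) (Q.PR.+-identityˡ g))
      where
      module SQ = IntegerSolver Q.polynomialRing
      f-g≈0 : pol (f Q.⊕ Q.⊝ g) ≈ 0#
      f-g≈0 = trans (pol-+ f _) (trans (+-cong eq (pol.to-neg g)) (-‿inverseʳ _))

    σ≈ : pol (lift s) ≈ σ
    σ≈ = pol-lift s

    pol-σ^ : ∀ n f → σ ^ n * pol f ≈ pol (lift s Q.^ᴾ n Q.⊗ f)
    pol-σ^ n f = sym (trans (pol-* _ f) (*-congʳ (trans (pol.to-^ (lift s) n) (^-congˡ n σ≈))))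

    σ⁻ = s⁻¹

    σ^-cancel : ∀ n x → σ⁻ ^ n * (σ ^ n * x) ≈ x
    σ^-cancel n x = begin
      σ⁻ ^ n * (σ ^ n * x)    ≈⟨ *-assoc _ _ x ⟨
      (σ⁻ ^ n * σ ^ n) * x    ≈⟨ *-congʳ (^-distrib-* σ⁻ σ n) ⟨
      (σ⁻ * σ) ^ n * x        ≈⟨ *-congʳ (trans (^-congˡ n (trans (*-comm _ _) s-inverse)) (1^ n)) ⟩
      1# * x                  ≈⟨ *-identityˡ x ⟩
      x                       ∎
      where
      1^ : ∀ n → 1# ^ n ≈ 1#
      1^ zero    = refl
      1^ (suc n) = trans (*-identityˡ _) (1^ n)

    σ^-injective : ∀ n {x y} → σ ^ n * x ≈ σ ^ n * y → x ≈ y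
    σ^-injective n {x} {y} eq = trans (sym (σ^-cancel n x)) (trans (*-congˡ eq) (σ^-cancel n y))

    σ^-cancel′ : ∀ n x → σ ^ n * (σ⁻ ^ n * x) ≈ x
    σ^-cancel′ n x = trans (S.solve 3 (λ a b x → a S.:* (b S.:* x) S.:= b S.:* (a S.:* x)) refl _ _ _) (σ^-cancel n x)

    -- A filtration of R: poles of order at most N along s and degree at infinity below N. It is
    -- additive at each level, multiplicative across levels, and each level is parametrized by
    -- finitely many elements of F.
    record Bd (N : ℕ) (x : Carrier) : Set a where
      constructor bounded
      field
        numerator  : Q.Poly
        num-degree : Q.Deg< (N ℕ.* h) numerator
        num-≈      : σ ^ N * x ≈ pol numerator
    open Bd public

    Bd-cong : ∀ {N x y} → x ≈ y → Bd N x → Bd N y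
    Bd-cong eq (bounded g deg eq′) = bounded g deg (trans (*-congˡ (sym eq)) eq′)

    Bd-mono : ∀ {M N x} → M ≤ N → Bd M x → Bd N x
    Bd-mono {M} {N} {x} M≤N (bounded g deg eq) = bounded (lift s Q.^ᴾ k Q.⊗ g) (Q.deg-mono (lift s Q.^ᴾ k Q.⊗ g) le (Q.deg-monic g (Q.monic-^ (monic-lift s-monic) k) deg)) (begin
      σ ^ N * x                 ≡⟨ ≡.cong (λ n → σ ^ n * x) (ℕ.m∸n+n≡m M≤N) ⟨
      σ ^ (k ℕ.+ M) * x         ≈⟨ trans (*-congʳ (^-homo-* σ k M)) (*-assoc _ _ x) ⟩
      σ ^ k * (σ ^ M * x)       ≈⟨ *-congˡ eq ⟩
      σ ^ k * pol g             ≈⟨ pol-σ^ k g ⟩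
      pol (lift s Q.^ᴾ k Q.⊗ g) ∎)
      where
      k = N ℕ.∸ M
      le : k ℕ.* ds ℕ.+ M ℕ.* h ≤ N ℕ.* h
      le = ℕ.≤-trans (ℕ.+-monoˡ-≤ (M ℕ.* h) (ℕ.*-monoʳ-≤ k (ℕ.n≤1+n ds)))
        (ℕ.≤-reflexive (≡.trans (≡.sym (ℕ.*-distribʳ-+ h k M)) (≡.cong (ℕ._* h) (ℕ.m∸n+n≡m M≤N))))

    Bd-+ : ∀ {N x y} → Bd N x → Bd N y → Bd N (x + y)
    Bd-+ (bounded f deg eq) (bounded g deg′ eq′) = bounded (f Q.⊕ g) (Q.deg-⊕ f g deg deg′)
      (trans (distribˡ _ _ _) (trans (+-cong eq eq′) (sym (pol-+ f g))))

    Bd-0 : ∀ {N} → Bd N 0#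
    Bd-0 = bounded [] (λ k _ → Fᵣ.refl) (zeroʳ _)

    Bd-neg : ∀ {N x} → Bd N x → Bd N (- x)
    Bd-neg (bounded f deg eq) = bounded (Q.⊝ f) (Q.deg-⊝ f deg) (trans (sym (-‿distribʳ-* _ _)) (trans (-‿cong eq) (sym (pol.to-neg f))))
      where open Algebra.Properties.Ring (CommutativeRing.ring R) using (-‿distribʳ-*)

    Bd-∑ : ∀ {N i} {I : Set i} (xs : List I) {g} → (∀ x → Bd N (g x)) → Bd N (∑ xs g)
    Bd-∑ []       bd = Bd-0
    Bd-∑ (x ∷ xs) bd = Bd-+ (bd x) (Bd-∑ xs bd)

    Bd-* : ∀ {M N x y} → Bd M x → Bd N y → Bd (M ℕ.+ N) (x * y)
    Bd-* {M} {N} {x} {y} (bounded f deg eq) (bounded g deg′ eq′) = bounded (f Q.⊗ g)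
      (Q.deg-mono (f Q.⊗ g) (ℕ.≤-reflexive (≡.sym (ℕ.*-distribʳ-+ h M N))) (Q.deg-⊗ f g deg deg′))
      (begin
        σ ^ (M ℕ.+ N) * (x * y)        ≈⟨ *-congʳ (^-homo-* σ M N) ⟩
        (σ ^ M * σ ^ N) * (x * y)      ≈⟨ S.solve 4 (λ a b x y → (a S.:* b) S.:* (x S.:* y) S.:= (a S.:* x) S.:* (b S.:* y)) refl _ _ _ _ ⟩
        (σ ^ M * x) * (σ ^ N * y)      ≈⟨ *-cong eq eq′ ⟩
        pol f * pol g                  ≈⟨ pol-* f g ⟨
        pol (f Q.⊗ g)                  ∎)

    Bd-pol : ∀ {n} g → Q.Deg< n g → Bd n (pol g)
    Bd-pol {n} g deg = bounded (lift s Q.^ᴾ n Q.⊗ g)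
      (Q.deg-mono (lift s Q.^ᴾ n Q.⊗ g) (ℕ.≤-reflexive (nh n ds)) (Q.deg-monic g (Q.monic-^ (monic-lift s-monic) n) deg))
      (pol-σ^ n g)
      where
      nh : ∀ n d → n ℕ.* d ℕ.+ n ≡ n ℕ.* suc d
      nh = solve-∀

    Bd-⟪⟫ : ∀ {n} f → length f ≤ n → Bd n ⟪ f ⟫
    Bd-⟪⟫ f len = Bd-cong (pol-lift f) (Bd-pol (lift f) (deg-lift f (P.deg-length f len)))

    Bd-κ : ∀ c → Bd 1 (κ.to c)
    Bd-κ c = Bd-cong (EF.ev-const c) (Bd-pol (Q.const c) (Q.deg-length (Q.const c) ℕ.≤-refl))

    Bd-^ : ∀ {N x} n → Bd N x → Bd (suc n ℕ.* N) (x ^ suc n)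
    Bd-^ zero    bd = ≡.subst (λ N → Bd N _) (≡.sym (ℕ.+-identityʳ _)) (Bd-cong (sym (*-identityʳ _)) bd)
    Bd-^ (suc n) bd = Bd-* bd (Bd-^ n bd)

    Bd-φ : ∀ {N x} k → Bd N x → Bd (p ℕ.^ k ℕ.* N) (x ^p^ k)
    Bd-φ {N} {x} zero bd = ≡.subst (λ N → Bd N x) (≡.sym (ℕ.+-identityʳ N)) bd
    Bd-φ {N} {x} (suc k) bd = ≡.subst (λ N → Bd N (x ^p^ suc k)) assoc (Bd-φ k (power p (prime⇒nonZero p-prime) bd))
      where
      assoc : p ℕ.^ k ℕ.* (p ℕ.* N) ≡ p ℕ.^ suc k ℕ.* N
      assoc = ≡.trans (≡.sym (ℕ.*-assoc (p ℕ.^ k) p N)) (≡.cong (ℕ._* N) (ℕ.*-comm (p ℕ.^ k) p))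
      power : ∀ m → ℕ.NonZero m → Bd N x → Bd (m ℕ.* N) (x ^ m)
      power (suc n) _ = Bd-^ n

    -- If k is the length of the numerator over s^N, then k further factors s cost k deg s and leave
    -- an allowance of k for the numerator.
    Bd-exists : ∀ x → ∃[ N ] Bd N x
    Bd-exists x = let N , g , eq = M.generated x ; k = length g in k ℕ.+ N , bounded (lift s Q.^ᴾ k Q.⊗ g)
      (Q.deg-mono (lift s Q.^ᴾ k Q.⊗ g) (ℕ.≤-trans (ℕ.m≤m+n _ (N ℕ.* h)) (ℕ.≤-reflexive (arith k N ds))) (Q.deg-monic g (Q.monic-^ (monic-lift s-monic) k) (Q.deg-length g ℕ.≤-refl)))
      (trans (*-congʳ (^-homo-* σ k N)) (trans (*-assoc _ _ x) (trans (*-congˡ eq) (pol-σ^ k g))))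
      where
      arith : ∀ k N d → k ℕ.* d ℕ.+ k ℕ.+ N ℕ.* suc d ≡ (k ℕ.+ N) ℕ.* suc d
      arith = solve-∀

    common-bound : ∀ n (x : Fin n → Carrier) → ∃[ N ] ∀ i → Bd N (x i)
    common-bound n x = let N , le = Fin-bound n (λ i → proj₁ (Bd-exists (x i)))
      in N , λ i → Bd-mono (le i) (proj₂ (Bd-exists (x i)))

    private
      φ-σ : ∀ N D → (σ ^ N) ^p^ D ≈ σ ^ (N ℕ.* p ℕ.^ D)
      φ-σ N D = trans (φ≈^ D (σ ^ N)) (^-assocʳ σ N (p ℕ.^ D))

      z≈ : ∀ n → pol (Q.X Q.^ᴾ n) ≈ z ^ n
      z≈ n = trans (pol.to-^ Q.X n) (^-congˡ n EF.ev-X)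

      pol-φ : ∀ k f → pol (f QB.P.^p^ k) ≈ pol f ^p^ k
      pol-φ zero    f = refl
      pol-φ (suc k) f = trans (pol-φ k (f QB.P.^ p)) (φ-cong k (pol.to-^ f p))

    frob-∑ : ∀ D → (Fin (p ℕ.^ D) → Carrier) → Carrier
    frob-∑ D x = ∑ (allFin (p ℕ.^ D)) (λ e → z ^ toℕ e * x e ^p^ D)

    private
      pol-basis : ∀ D G → pol (QB.basis-∑ D G) ≈ frob-∑ D (λ e → pol (G e))
      pol-basis D G = trans (pol.to-∑ (allFin (p ℕ.^ D)) _) (∑-cong (allFin (p ℕ.^ D)) λ e →
        trans (pol-* _ _) (*-cong (z≈ (toℕ e)) (pol-φ D (G e))))

      σ-frob : ∀ N D x → σ ^ (N ℕ.* p ℕ.^ D) * frob-∑ D x ≈ frob-∑ D (λ e → σ ^ N * x e)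
      σ-frob N D x = trans (∑-*ˡ _ (allFin (p ℕ.^ D)) _) (∑-cong (allFin (p ℕ.^ D)) λ e → begin
        σ ^ (N ℕ.* p ℕ.^ D) * (z ^ toℕ e * x e ^p^ D)  ≈⟨ *-congʳ (φ-σ N D) ⟨
        (σ ^ N) ^p^ D * (z ^ toℕ e * x e ^p^ D)        ≈⟨ S.solve 3 (λ a b c → a S.:* (b S.:* c) S.:= b S.:* (a S.:* c)) refl _ _ _ ⟩
        z ^ toℕ e * ((σ ^ N) ^p^ D * x e ^p^ D)        ≈⟨ *-congˡ (φ-* D _ _) ⟨
        z ^ toℕ e * (σ ^ N * x e) ^p^ D                ∎)

    frob-cong : ∀ D {x y} → (∀ e → x e ≈ y e) → frob-∑ D x ≈ frob-∑ D y
    frob-cong D eq = ∑-cong (allFin (p ℕ.^ D)) λ e → *-congˡ (φ-cong D (eq e))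

    -- A common denominator s^N of the x e appears outside the sum as s^(N p^D); after clearing it,
    -- independence over F[z] applies.
    frob-independent : ∀ D x → frob-∑ D x ≈ 0# → ∀ e → x e ≈ 0#
    frob-independent D x eq e = σ^-injective N (begin
        σ ^ N * x e       ≈⟨ num-≈ (bd e) ⟩
        pol (G e)         ≈⟨ pol-cong (QB.basis-independent D G G≈0 e) ⟩
        0#                ≈⟨ zeroʳ _ ⟨
        σ ^ N * 0#        ∎)
      where
      N = proj₁ (common-bound _ x)
      bd = proj₂ (common-bound _ x)
      G = λ e → numerator (bd e)
      G≈0 : QB.basis-∑ D G Q.≈ᴾ []
      G≈0 = M.transcendental _ (begin
        pol (QB.basis-∑ D G)                  ≈⟨ pol-basis D G ⟩
        frob-∑ D (λ e → pol (G e))            ≈⟨ frob-cong D (λ e → num-≈ (bd e)) ⟨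
        frob-∑ D (λ e → σ ^ N * x e)          ≈⟨ σ-frob N D x ⟨
        σ ^ (N ℕ.* p ℕ.^ D) * frob-∑ D x      ≈⟨ trans (*-congˡ eq) (zeroʳ _) ⟩
        0#                                    ∎)

    -- A degree below N p^D h amounts to N h blocks of p^D coefficients, so the digits inherit the
    -- bound N without loss.
    digits : ∀ D N {w} → Bd (N ℕ.* p ℕ.^ D) w → Σ[ x ∈ (Fin (p ℕ.^ D) → Carrier) ] (∀ e → Bd N (x e)) × w ≈ frob-∑ D x
    digits D N {w} (bounded g deg eq) = x , (λ e → bounded (G e) (degG e) (σ^-cancel′ N (pol (G e)))) , σ^-injective (N ℕ.* p ℕ.^ D) (begin
        σ ^ (N ℕ.* p ℕ.^ D) * w               ≈⟨ eq ⟩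
        pol g                                 ≈⟨ pol-cong g≈ ⟩
        pol (QB.basis-∑ D G)                  ≈⟨ pol-basis D G ⟩
        frob-∑ D (λ e → pol (G e))            ≈⟨ frob-cong D (λ e → σ^-cancel′ N (pol (G e))) ⟨
        frob-∑ D (λ e → σ ^ N * x e)          ≈⟨ σ-frob N D x ⟨
        σ ^ (N ℕ.* p ℕ.^ D) * frob-∑ D x      ∎)
      where
      spans = QB.basis-spans root D (N ℕ.* h) g (Q.deg-mono g (ℕ.≤-reflexive (swap N (p ℕ.^ D) h)) deg)
        where
        swap : ∀ a b c → a ℕ.* b ℕ.* c ≡ a ℕ.* c ℕ.* b
        swap = solve-∀
      G = proj₁ spans
      degG = proj₁ (proj₂ spans)
      g≈ = proj₂ (proj₂ spans)
      x = λ e → σ⁻ ^ N * pol (G e)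

    -- If (1 - s t) y is a polynomial then y has no poles: y ≡ (1 - s t) y modulo s y.
    pole-free : ∀ t f y → y ≈ σ * (pol t * y) + pol f → ∃[ G ] y ≈ pol G
    pole-free t f y eq = let M , g , eq′ = M.generated y in go M g eq′
      where
      go : ∀ M g → σ ^ M * y ≈ pol g → ∃[ G ] y ≈ pol G
      go zero    g eq′ = g , trans (sym (*-identityˡ y)) eq′
      go (suc M) g eq′ = go M (t Q.⊗ g Q.⊕ lift s Q.^ᴾ M Q.⊗ f) (begin
        σ ^ M * y                                         ≈⟨ *-congˡ eq ⟩
        σ ^ M * (σ * (pol t * y) + pol f)                 ≈⟨ S.solve 5 (λ a b t y f → a S.:* (b S.:* (t S.:* y) S.:+ f) S.:= t S.:* ((b S.:* a) S.:* y) S.:+ a S.:* f) refl (σ ^ M) σ (pol t) y (pol f) ⟩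
        pol t * (σ ^ suc M * y) + σ ^ M * pol f           ≈⟨ +-cong (*-congˡ eq′) (pol-σ^ M f) ⟩
        pol t * pol g + pol (lift s Q.^ᴾ M Q.⊗ f)         ≈⟨ +-congʳ (pol-* t g) ⟨
        pol (t Q.⊗ g) + pol (lift s Q.^ᴾ M Q.⊗ f)         ≈⟨ pol-+ _ _ ⟨
        pol (t Q.⊗ g Q.⊕ lift s Q.^ᴾ M Q.⊗ f)             ∎)

    module _ {Δ : P.Poly} (mod : Modulus Δ) where
      open Modulus mod using (d; i; m; t; u; v; m-monic; uv≈1; Δ≈um; periodic) renaming (Q to Q′)

      private
        periodicᴿ : σ ^ i ≈ σ ^ i * (σ * ⟪ t ⟫) + ⟪ Q′ ⟫ * ⟪ Δ ⟫
        periodicᴿ = begin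
          σ ^ i                                               ≈⟨ ⟪⟫.to-^ s i ⟨
          ⟪ s P.^ᴾ i ⟫                                        ≈⟨ ⟪⟫.to-cong periodic ⟩
          ⟪ (s P.^ᴾ i) P.⊗ (s P.⊗ t) P.⊕ Q′ P.⊗ Δ ⟫           ≈⟨ trans (⟪⟫.to-+ _ _) (+-cong (⟪⟫.to-* _ _) (⟪⟫.to-* Q′ Δ)) ⟩
          ⟪ s P.^ᴾ i ⟫ * ⟪ s P.⊗ t ⟫ + ⟪ Q′ ⟫ * ⟪ Δ ⟫         ≈⟨ +-congʳ (*-cong (⟪⟫.to-^ s i) (⟪⟫.to-* s t)) ⟩
          σ ^ i * (σ * ⟪ t ⟫) + ⟪ Q′ ⟫ * ⟪ Δ ⟫                ∎

        u≉0 : ¬ ι.to u Fᵣ.≈ Fᵣ.0#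
        u≉0 u≈0 = DecidableField.1≉0 field-F (Fᵣ.trans (Fᵣ.sym ι.to-1) (Fᵣ.trans (Fᵣ.sym (ι.to-cong uv≈1))
          (Fᵣ.trans (ι.to-* u v) (Fᵣ.trans (Fᵣ.*-congʳ u≈0) (Fᵣ.zeroˡ _)))))

        lift-const : ∀ c → lift (P.const c) Q.≈ᴾ Q.const (ι.to c)
        lift-const c = Q.PR.trans (Q.PR.+-congˡ (Q.PR.zeroʳ Q.X)) (Q.PR.+-identityʳ _)

        liftΔ≈ : lift Δ Q.≈ᴾ Q.const (ι.to u) Q.⊗ lift m
        liftΔ≈ = Q.PR.trans (lift.to-cong Δ≈um) (Q.PR.trans (lift.to-* (P.const u) m) (Q.PR.*-congʳ (lift-const u)))

      cancel-degree : ∀ L G → Q.Deg< (d ℕ.+ L) (lift Δ Q.⊗ G) → Q.Deg< L G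
      cancel-degree L G = Q.deg-cancel-≉0 L G (monic-lift m-monic) u≉0 liftΔ≈

      -- Periodicity gives σ^i y = σ t (σ^i y) + Q′ (Δ y), whose last summand is a polynomial: the
      -- situation of `pole-free`.
      cancel-pole : ∀ f y → ⟪ Δ ⟫ * y ≈ pol f → ∃[ G ] σ ^ i * y ≈ pol G
      cancel-pole f y eq = pole-free (lift t) (lift Q′ Q.⊗ f) (σ ^ i * y) (begin
        σ ^ i * y                                           ≈⟨ *-congʳ periodicᴿ ⟩
        (σ ^ i * (σ * ⟪ t ⟫) + ⟪ Q′ ⟫ * ⟪ Δ ⟫) * y          ≈⟨ S.solve 6 (λ a b t q e y → (a S.:* (b S.:* t) S.:+ q S.:* e) S.:* y S.:= b S.:* (t S.:* (a S.:* y)) S.:+ q S.:* (e S.:* y)) refl (σ ^ i) σ ⟪ t ⟫ ⟪ Q′ ⟫ ⟪ Δ ⟫ y ⟩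
        σ * (⟪ t ⟫ * (σ ^ i * y)) + ⟪ Q′ ⟫ * (⟪ Δ ⟫ * y)    ≈⟨ +-cong (*-congˡ (*-congʳ (pol-lift t))) (trans (*-congʳ (pol-lift Q′)) (*-congˡ (sym eq))) ⟨
        σ * (pol (lift t) * (σ ^ i * y)) + pol (lift Q′) * pol f  ≈⟨ +-congˡ (pol-* _ _) ⟨
        σ * (pol (lift t) * (σ ^ i * y)) + pol (lift Q′ Q.⊗ f)    ∎)

      -- Δ may share factors with s, and `i` pays for the poles of x that it can hide. At infinity
      -- nothing is lost, as multiplication by Δ does not lower degrees.
      Bd-cancel : ∀ {N x} → Bd N (⟪ Δ ⟫ * x) → Bd (i ℕ.+ N) x
      Bd-cancel {N} {x} (bounded g deg eq) = bounded G (cancel-degree ((i ℕ.+ N) ℕ.* h) G (Q.deg-cong (Q.PR.sym ΔG≈) ig-degree)) (trans (*-congʳ (^-homo-* σ i N)) (trans (*-assoc _ _ x) G≈))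
        where
        pole = cancel-pole g (σ ^ N * x) (trans (S.solve 3 (λ a b c → a S.:* (b S.:* c) S.:= b S.:* (a S.:* c)) refl _ _ _) eq)
        G = proj₁ pole
        G≈ = proj₂ pole
        ΔG≈ : lift Δ Q.⊗ G Q.≈ᴾ lift s Q.^ᴾ i Q.⊗ g
        ΔG≈ = pol-injective (begin
          pol (lift Δ Q.⊗ G)                  ≈⟨ trans (pol-* _ G) (*-cong (pol-lift Δ) (sym G≈)) ⟩
          ⟪ Δ ⟫ * (σ ^ i * (σ ^ N * x))       ≈⟨ S.solve 4 (λ a b c x → a S.:* (b S.:* (c S.:* x)) S.:= b S.:* (c S.:* (a S.:* x))) refl _ _ _ _ ⟩
          σ ^ i * (σ ^ N * (⟪ Δ ⟫ * x))       ≈⟨ *-congˡ eq ⟩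
          σ ^ i * pol g                       ≈⟨ pol-σ^ i g ⟩
          pol (lift s Q.^ᴾ i Q.⊗ g)           ∎)
        ig-degree : Q.Deg< (d ℕ.+ (i ℕ.+ N) ℕ.* h) (lift s Q.^ᴾ i Q.⊗ g)
        ig-degree = Q.deg-mono (lift s Q.^ᴾ i Q.⊗ g) (ℕ.≤-trans
            (ℕ.≤-trans (ℕ.+-monoˡ-≤ (N ℕ.* h) (ℕ.*-monoʳ-≤ i (ℕ.n≤1+n ds))) (ℕ.≤-reflexive (≡.sym (ℕ.*-distribʳ-+ h i N))))
            (ℕ.m≤n+m _ d))
          (Q.deg-monic g (Q.monic-^ (monic-lift s-monic) i) deg)

      -- Induction on the order of the pole: modulo Δ the element x equals t (σ x), and σ x has a
      -- smaller pole. The polynomial that remains in the end is divided by the monic m.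
      division : ∀ x → ∃[ x′ ] Σ[ r ∈ Q.Poly ] length r ≤ d × x ≈ ⟪ Δ ⟫ * x′ + pol r
      division x = let N , g , eq = M.generated x
                       y , G , eq′ = go N x g eq
                       D = Q.divide (monic-lift m-monic) G
                       open Q.Division D
                   in y + ⟪ P.const v ⟫ * pol quotient , remainder , remainder-degree , (begin
                     x                                                    ≈⟨ eq′ ⟩
                     ⟪ Δ ⟫ * y + pol G                                    ≈⟨ +-congˡ (trans (pol-cong (Q.Division.division D)) (trans (pol-+ _ _) (+-congʳ (trans (pol-* _ _) (*-congˡ (trans (pol-lift m) m≈)))))) ⟩
                     ⟪ Δ ⟫ * y + (pol quotient * (⟪ P.const v ⟫ * ⟪ Δ ⟫) + pol remainder)
                                                                          ≈⟨ S.solve 5 (λ e y q v r → e S.:* y S.:+ (q S.:* (v S.:* e) S.:+ r) S.:= e S.:* (y S.:+ v S.:* q) S.:+ r) refl ⟪ Δ ⟫ y (pol quotient) ⟪ P.const v ⟫ (pol remainder) ⟩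
                     ⟪ Δ ⟫ * (y + ⟪ P.const v ⟫ * pol quotient) + pol remainder ∎)
        where
        m≈ : ⟪ m ⟫ ≈ ⟪ P.const v ⟫ * ⟪ Δ ⟫
        m≈ = begin
          ⟪ m ⟫                                            ≈⟨ trans (*-congʳ (trans (EP.ev-const _) (trans (κ.to-cong (Fᵣ.trans (ι.to-cong vu≈1) ι.to-1)) κ.to-1))) (*-identityˡ _) ⟨
          ⟪ P.const (v Fₚ.* u) ⟫ * ⟪ m ⟫                   ≈⟨ *-congʳ (trans (EP.ev-const _) (trans (trans (κ.to-cong (ι.to-* v u)) (κ.to-* _ _)) (sym (*-cong (EP.ev-const v) (EP.ev-const u))))) ⟩
          (⟪ P.const v ⟫ * ⟪ P.const u ⟫) * ⟪ m ⟫          ≈⟨ *-assoc _ _ _ ⟩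
          ⟪ P.const v ⟫ * (⟪ P.const u ⟫ * ⟪ m ⟫)          ≈⟨ *-congˡ (trans (⟪⟫.to-cong Δ≈um) (⟪⟫.to-* _ m)) ⟨
          ⟪ P.const v ⟫ * ⟪ Δ ⟫                            ∎
          where
          module Fₚ = CommutativeRing 𝔽ₚ
          vu≈1 = Fₚ.trans (Fₚ.*-comm v u) uv≈1
        go : ∀ N x g → σ ^ N * x ≈ pol g → ∃[ y ] ∃[ G ] x ≈ ⟪ Δ ⟫ * y + pol G
        go zero    x g eq = 0# , g , trans (sym (*-identityˡ x)) (trans eq (sym (trans (+-congʳ (zeroʳ _)) (+-identityˡ _))))
        go (suc N) x g eq =
          let y , G , eq′ = go N (σ * x) g (trans (S.solve 3 (λ a b c → a S.:* (b S.:* c) S.:= (b S.:* a) S.:* c) refl (σ ^ N) σ x) eq)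
          in σ⁻ ^ i * (⟪ Q′ ⟫ * x) + ⟪ t ⟫ * y , lift t Q.⊗ G , (begin
            x                                                                    ≈⟨ σ^-cancel i x ⟨
            σ⁻ ^ i * (σ ^ i * x)                                                 ≈⟨ *-congˡ (*-congʳ periodicᴿ) ⟩
            σ⁻ ^ i * ((σ ^ i * (σ * ⟪ t ⟫) + ⟪ Q′ ⟫ * ⟪ Δ ⟫) * x)                ≈⟨ S.solve 7 (λ j a b t q e x → j S.:* ((a S.:* (b S.:* t) S.:+ q S.:* e) S.:* x) S.:= j S.:* (a S.:* (t S.:* (b S.:* x))) S.:+ e S.:* (j S.:* (q S.:* x))) refl (σ⁻ ^ i) (σ ^ i) σ ⟪ t ⟫ ⟪ Q′ ⟫ ⟪ Δ ⟫ x ⟩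
            σ⁻ ^ i * (σ ^ i * (⟪ t ⟫ * (σ * x))) + ⟪ Δ ⟫ * (σ⁻ ^ i * (⟪ Q′ ⟫ * x)) ≈⟨ +-congʳ (trans (σ^-cancel i _) (*-congˡ eq′)) ⟩
            ⟪ t ⟫ * (⟪ Δ ⟫ * y + pol G) + ⟪ Δ ⟫ * (σ⁻ ^ i * (⟪ Q′ ⟫ * x))        ≈⟨ S.solve 5 (λ t e y g w → t S.:* (e S.:* y S.:+ g) S.:+ e S.:* w S.:= e S.:* (w S.:+ t S.:* y) S.:+ t S.:* g) refl ⟪ t ⟫ ⟪ Δ ⟫ y (pol G) _ ⟩
            ⟪ Δ ⟫ * (σ⁻ ^ i * (⟪ Q′ ⟫ * x) + ⟪ t ⟫ * y) + ⟪ t ⟫ * pol G          ≈⟨ +-congˡ (trans (*-congʳ (sym (pol-lift t))) (sym (pol-* _ G))) ⟩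
            ⟪ Δ ⟫ * (σ⁻ ^ i * (⟪ Q′ ⟫ * x) + ⟪ t ⟫ * y) + pol (lift t Q.⊗ G)     ∎)

    digit-∑ : ∀ {d} → (Fin d → Fᵣ.Carrier) → Carrier
    digit-∑ {d} c = ∑ (allFin d) (λ k → z ^ toℕ k * κ.to (c k))

    digit-∑≈pol : ∀ {d} (c : Fin d → Fᵣ.Carrier) → digit-∑ c ≈ pol (tabulate c)
    digit-∑≈pol {d} c = sym (begin
      pol (tabulate c)                                                         ≡⟨ ≡.cong pol (++-identityʳ (tabulate c)) ⟨
      pol (tabulate c ++ [])                                                   ≈⟨ pol-cong (Q.tabulate-++-≈ d c []) ⟩
      pol (q∑ Q.⊕ Q.X Q.^ᴾ d Q.⊗ [])                                           ≈⟨ trans (pol-+ _ _) (trans (+-congˡ (pol-cong (Q.PR.zeroʳ _))) (+-identityʳ _)) ⟩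
      pol q∑                                                                   ≈⟨ pol.to-∑ (allFin d) _ ⟩
      ∑ (allFin d) (λ k → pol (Q.X Q.^ᴾ toℕ k Q.⊗ Q.const (c k)))              ≈⟨ ∑-cong (allFin d) (λ k → trans (pol-* _ _) (*-cong (z≈ (toℕ k)) (EF.ev-const (c k)))) ⟩
      digit-∑ c                                                                ∎)
      where q∑ = FiniteSums.∑ Q.polynomialRing (allFin d) (λ k → Q.X Q.^ᴾ toℕ k Q.⊗ Q.const (c k))

    deg-tabulate : ∀ {d} (c : Fin d → Fᵣ.Carrier) → Q.Deg< d (tabulate c)
    deg-tabulate c = Q.deg-length (tabulate c) (ℕ.≤-reflexive (length-tabulate c))

    pol≈digit-∑ : ∀ {d} g → Q.Deg< d g → pol g ≈ digit-∑ {d} (λ k → Q.coeff g (toℕ k))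
    pol≈digit-∑ {d} g deg = trans (pol-cong (Q.PR.sym (Q.tabulate-≈ d g deg))) (sym (digit-∑≈pol {d} _))

    -- The product of b with η is a polynomial, and so is η, since b is prime to s and `cancel-pole`
    -- holds with i = 0. The degree of that product is below deg b, so η = 0.
    decomposition-unique : ∀ N L (1≤L : 1 ≤ L) {x η r} → N ℕ.* h ≤ ds ℕ.+ L → Bd N x →
      Q.Deg< (ds ℕ.+ L) r → σ ^ N * x ≈ ⟪ P.PR.1# P.⊕ s P.⊗ P.X P.^ᴾ L ⟫ * η + pol r → η ≈ 0#
    decomposition-unique N L 1≤L {x} {η} {r} Nh≤ (bounded g deg eq) deg-r eq′ = begin
      η              ≈⟨ trans (sym (*-identityˡ η)) η≈ ⟩
      pol G          ≈⟨ pol-cong {G} {[]} (Q.deg-0 (cancel-degree mod 0 G (Q.deg-cong (pol-injective {f} {lift b Q.⊗ G} bη≈) deg-f))) ⟩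
      0#             ∎
      where
      mod = coprime-modulus L 1≤L
      b = P.PR.1# P.⊕ s P.⊗ P.X P.^ᴾ L
      f = g Q.⊕ Q.⊝ r
      deg-f : Q.Deg< (ds ℕ.+ L ℕ.+ 0) f
      deg-f = Q.deg-mono f (ℕ.≤-reflexive (≡.sym (ℕ.+-identityʳ _))) (Q.deg-⊕ g (Q.⊝ r) (Q.deg-mono g Nh≤ deg) (Q.deg-⊝ r deg-r))
      bη : ⟪ b ⟫ * η ≈ pol f
      bη = begin
        ⟪ b ⟫ * η                            ≈⟨ S.solve 2 (λ e r → e S.:= (e S.:+ r) S.:+ S.:- r) refl (⟪ b ⟫ * η) (pol r) ⟩
        (⟪ b ⟫ * η + pol r) + - pol r        ≈⟨ +-cong (trans (sym eq′) eq) (sym (pol.to-neg r)) ⟩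
        pol g + pol (Q.⊝ r)                  ≈⟨ pol-+ g _ ⟨
        pol f                                ∎
      pole = cancel-pole mod f η bη
      G = proj₁ pole
      η≈ = proj₂ pole
      bη≈ : pol f ≈ pol (lift b Q.⊗ G)
      bη≈ = sym (trans (pol-* _ G) (trans (*-cong (pol-lift b) (trans (sym η≈) (*-identityˡ η))) bη))

    -- Values of forms and of additive polynomials.

    abstract
      ⟦_⟧ : Form Var → (Var → Carrier) → Carrier
      ⟦ φ ⟧ ρ = ∑ φ (λ (mono a i k) → ⟪ a ⟫ * ρ i ^p^ k)

      ⟪φ⟫ : ∀ k f → ⟪ f PB.P.^p^ k ⟫ ≈ ⟪ f ⟫ ^p^ k
      ⟪φ⟫ zero    f = refl
      ⟪φ⟫ (suc k) f = trans (⟪φ⟫ k (f PB.P.^ p)) (φ-cong k (⟪⟫.to-^ f p))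

      ⟪X⟫ : ∀ n → ⟪ X ^ᴾ n ⟫ ≈ z ^ n
      ⟪X⟫ n = trans (⟪⟫.to-^ X n) (^-congˡ n (Evaluation.ev-X (κ ∘ʰ ι) z))

      ⟦⟧-cong : ∀ (φ : Form Var) {ρ ρ′} → (∀ i → ρ i ≈ ρ′ i) → ⟦ φ ⟧ ρ ≈ ⟦ φ ⟧ ρ′
      ⟦⟧-cong φ eq = ∑-cong φ λ (mono a i k) → *-congˡ (φ-cong k (eq i))

      ⟦⟧-++ : ∀ (φ ψ : Form Var) ρ → ⟦ φ ++ ψ ⟧ ρ ≈ ⟦ φ ⟧ ρ + ⟦ ψ ⟧ ρ
      ⟦⟧-++ φ ψ ρ = ∑-++ φ ψ _

      ⟦⟧-concatMap : ∀ {i} {K : Set i} (f : K → Form Var) xs ρ → ⟦ concatMap f xs ⟧ ρ ≈ ∑ xs (λ x → ⟦ f x ⟧ ρ)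
      ⟦⟧-concatMap f xs ρ = ∑-concatMap f xs _

      ⟦term⟧ : ∀ a (i : Var) k ρ → ⟦ term a i k ⟧ ρ ≈ ⟪ a ⟫ * ρ i ^p^ k
      ⟦term⟧ a i k ρ = +-identityʳ _

      ⟦variable⟧ : ∀ (i : Var) ρ → ⟦ variable-form i ⟧ ρ ≈ ρ i
      ⟦variable⟧ i ρ = trans (⟦term⟧ P.PR.1# i 0 ρ) (trans (*-congʳ ⟪⟫.to-1) (*-identityˡ _))

      ⟦·⟧ : ∀ b (φ : Form Var) ρ → ⟦ b ·ᶠ φ ⟧ ρ ≈ ⟪ b ⟫ * ⟦ φ ⟧ ρ
      ⟦·⟧ b φ ρ = trans (∑-map _ φ _) (trans (∑-cong φ λ (mono a i k) → trans (*-congʳ (⟪⟫.to-* b a)) (*-assoc _ _ _)) (sym (∑-*ˡ _ φ _)))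

      ⟦-⟧ : ∀ (φ : Form Var) ρ → ⟦ -ᶠ φ ⟧ ρ ≈ - ⟦ φ ⟧ ρ
      ⟦-⟧ φ ρ = trans (∑-map _ φ _) (trans (∑-cong φ λ (mono a i k) → trans (*-congʳ (⟪⟫.to-neg a)) (sym (-‿distribˡ-* _ _))) (sym (∑-neg φ _)))
        where open Algebra.Properties.Ring (CommutativeRing.ring R) using (-‿distribˡ-*)

      ⟦frob⟧ : ∀ k (φ : Form Var) ρ → ⟦ frobᶠ k φ ⟧ ρ ≈ ⟦ φ ⟧ ρ ^p^ k
      ⟦frob⟧ k φ ρ = trans (∑-map _ φ _) (trans
        (∑-cong φ λ (mono a i j) → trans (*-cong (⟪φ⟫ k a) (sym (φ-φ j k (ρ i)))) (sym (φ-* k _ _))) (sym (φ-∑ k φ _)))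

      ⟦sub⟧ : ∀ (θ : Var → Form Var′) φ ρ → ⟦ sub θ φ ⟧ ρ ≈ ⟦ φ ⟧ (λ i → ⟦ θ i ⟧ ρ)
      ⟦sub⟧ θ φ ρ = trans (⟦⟧-concatMap _ φ ρ) (∑-cong φ λ (mono a i k) → trans (⟦·⟧ a (frobᶠ k (θ i)) ρ) (*-congˡ (⟦frob⟧ k (θ i) ρ)))

      ⟦relabel⟧ : ∀ (f : Var → Var′) φ ρ → ⟦ relabel f φ ⟧ ρ ≈ ⟦ φ ⟧ (ρ ∘ f)
      ⟦relabel⟧ f φ ρ = ∑-map _ φ _

      ⟦⟧-+ : ∀ (φ : Form Var) ρ ρ′ → ⟦ φ ⟧ (λ i → ρ i + ρ′ i) ≈ ⟦ φ ⟧ ρ + ⟦ φ ⟧ ρ′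
      ⟦⟧-+ φ ρ ρ′ = trans (∑-cong φ λ (mono a i k) → trans (*-congˡ (φ-+ k _ _)) (distribˡ _ _ _)) (∑-+ φ _ _)

      ⟦⟧-0 : ∀ (φ : Form Var) {ρ} → (∀ i → ρ i ≈ 0#) → ⟦ φ ⟧ ρ ≈ 0#
      ⟦⟧-0 φ eq = ∑-zero φ λ (mono a i k) → trans (*-congˡ (trans (φ-cong k (eq i)) (φ-0 k))) (zeroʳ _)

      ⟦⟧-neg : ∀ (φ : Form Var) ρ → ⟦ φ ⟧ (λ i → - ρ i) ≈ - ⟦ φ ⟧ ρ
      ⟦⟧-neg φ ρ = trans (∑-cong φ λ (mono a i k) → trans (*-congˡ (φ-neg k _)) (sym (-‿distribʳ-* _ _))) (sym (∑-neg φ _))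
        where open Algebra.Properties.Ring (CommutativeRing.ring R) using (-‿distribʳ-*)

      Bd-⟦⟧ : ∀ T (φ : Form Var) {N ρ} → Exp≤ T φ → (∀ i → Bd N (ρ i)) → Bd (size φ ℕ.+ p ℕ.^ T ℕ.* N) (⟦ φ ⟧ ρ)
      Bd-⟦⟧ T []               []         bd = Bd-0
      Bd-⟦⟧ T (mono a i k ∷ φ) {N} (k≤T ∷ le) bd = Bd-+
        (Bd-mono (ℕ.+-mono-≤ (ℕ.m≤m+n (length a) (size φ)) (ℕ.*-monoˡ-≤ N (ℕ.^-monoʳ-≤ p {{prime⇒nonZero p-prime}} k≤T)))
          (Bd-* (Bd-⟪⟫ a ℕ.≤-refl) (Bd-φ k (bd i))))
        (Bd-mono (ℕ.+-monoˡ-≤ _ (ℕ.m≤n+m (size φ) (length a))) (Bd-⟦⟧ T φ le bd))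

      ⟦_⟧ᵒ : Ore → Carrier → Carrier
      ⟦ [] ⟧ᵒ    x = 0#
      ⟦ a ∷ f ⟧ᵒ x = ⟪ a ⟫ * x + ⟦ f ⟧ᵒ (x ^ p)

      ⟦∷⟧ᵒ : ∀ b f x → ⟦ b ∷ f ⟧ᵒ x ≈ ⟪ b ⟫ * x + ⟦ f ⟧ᵒ (x ^ p)
      ⟦∷⟧ᵒ b f x = refl

      ⟦⟧-[] : ∀ (ρ : Var → Carrier) → ⟦ [] ⟧ ρ ≈ 0#
      ⟦⟧-[] ρ = refl

      ⟦[]⟧ᵒ : ∀ x → ⟦ [] ⟧ᵒ x ≈ 0#
      ⟦[]⟧ᵒ x = refl

      ⟦ore-form⟧ : ∀ f (i : Var) ρ → ⟦ ore-form f i ⟧ ρ ≈ ⟦ f ⟧ᵒ (ρ i)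
      ⟦ore-form⟧ []      i ρ = refl
      ⟦ore-form⟧ (a ∷ f) i ρ = +-congˡ (trans (shift f) (⟦ore-form⟧ f i (λ i → ρ i ^ p)))
        where
        shift : ∀ f → ⟦ map (λ (mono a i k) → mono a i (suc k)) (ore-form f i) ⟧ ρ ≈ ⟦ ore-form f i ⟧ (λ i → ρ i ^ p)
        shift f = ∑-map _ (ore-form f i) _

      ⟦⟧ᵒ-cong : ∀ f {x y} → x ≈ y → ⟦ f ⟧ᵒ x ≈ ⟦ f ⟧ᵒ y
      ⟦⟧ᵒ-cong []      eq = refl
      ⟦⟧ᵒ-cong (a ∷ f) eq = +-cong (*-congˡ eq) (⟦⟧ᵒ-cong f (^-congˡ p eq))

      ⟦⟧ᵒ-+ : ∀ f x y → ⟦ f ⟧ᵒ (x + y) ≈ ⟦ f ⟧ᵒ x + ⟦ f ⟧ᵒ y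
      ⟦⟧ᵒ-+ []      x y = sym (+-identityˡ 0#)
      ⟦⟧ᵒ-+ (a ∷ f) x y = begin
        ⟪ a ⟫ * (x + y) + ⟦ f ⟧ᵒ ((x + y) ^ p)                      ≈⟨ +-congˡ (trans (⟦⟧ᵒ-cong f (frobenius-+ x y)) (⟦⟧ᵒ-+ f _ _)) ⟩
        ⟪ a ⟫ * (x + y) + (⟦ f ⟧ᵒ (x ^ p) + ⟦ f ⟧ᵒ (y ^ p))         ≈⟨ S.solve 5 (λ a x y f g → a S.:* (x S.:+ y) S.:+ (f S.:+ g) S.:= (a S.:* x S.:+ f) S.:+ (a S.:* y S.:+ g)) refl _ x y _ _ ⟩
        (⟪ a ⟫ * x + ⟦ f ⟧ᵒ (x ^ p)) + (⟪ a ⟫ * y + ⟦ f ⟧ᵒ (y ^ p)) ∎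

      ⟦⟧ᵒ-0 : ∀ f → ⟦ f ⟧ᵒ 0# ≈ 0#
      ⟦⟧ᵒ-0 []      = refl
      ⟦⟧ᵒ-0 (a ∷ f) = trans (+-cong (zeroʳ _) (trans (⟦⟧ᵒ-cong f 0^p≈0) (⟦⟧ᵒ-0 f))) (+-identityˡ 0#)

      ⟦⟧ᵒ-∑ : ∀ f {i} {K : Set i} (xs : List K) g → ⟦ f ⟧ᵒ (∑ xs g) ≈ ∑ xs (λ x → ⟦ f ⟧ᵒ (g x))
      ⟦⟧ᵒ-∑ f []       g = ⟦⟧ᵒ-0 f
      ⟦⟧ᵒ-∑ f (x ∷ xs) g = trans (⟦⟧ᵒ-+ f _ _) (+-congˡ (⟦⟧ᵒ-∑ f xs g))

      ⟦⊕⟧ᵒ : ∀ f g x → ⟦ f O.⊕ g ⟧ᵒ x ≈ ⟦ f ⟧ᵒ x + ⟦ g ⟧ᵒ x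
      ⟦⊕⟧ᵒ f g x = trans (reflexive (≡.cong (λ h → ⟦ h ⟧ᵒ x) (O.⊕≡+ᴾ f g))) (go f g x)
        where
        go : ∀ f g x → ⟦ f O.+ᴾ g ⟧ᵒ x ≈ ⟦ f ⟧ᵒ x + ⟦ g ⟧ᵒ x
        go []      g       x = sym (+-identityˡ _)
        go (a ∷ f) []      x = sym (+-identityʳ _)
        go (a ∷ f) (b ∷ g) x = trans (+-cong (trans (*-congʳ (⟪⟫.to-+ a b)) (distribʳ x _ _)) (go f g (x ^ p)))
          (S.solve 4 (λ a b f g → (a S.:+ b) S.:+ (f S.:+ g) S.:= (a S.:+ f) S.:+ (b S.:+ g)) refl _ _ _ _)

      ⟦≈⟧ᵒ : ∀ {f g} x → f O.≈ᴾ g → ⟦ f ⟧ᵒ x ≈ ⟦ g ⟧ᵒ x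
      ⟦≈⟧ᵒ {f} {g} x eq = go f g (PolynomialRing.at eq) x
        where
        vanish : ∀ f → (∀ n → O.coeff f n ≈ᴾ []) → ∀ x → ⟦ f ⟧ᵒ x ≈ 0#
        vanish []      eq x = refl
        vanish (a ∷ f) eq x = trans (+-cong (trans (*-congʳ (⟪⟫.to-cong (eq 0))) (zeroˡ x)) (vanish f (λ n → eq (suc n)) (x ^ p))) (+-identityˡ 0#)
        go : ∀ f g → (∀ n → O.coeff f n ≈ᴾ O.coeff g n) → ∀ x → ⟦ f ⟧ᵒ x ≈ ⟦ g ⟧ᵒ x
        go []      g       eq x = sym (vanish g (λ n → P.PR.sym (eq n)) x)
        go (a ∷ f) []      eq x = vanish (a ∷ f) eq x
        go (a ∷ f) (b ∷ g) eq x = +-cong (*-congʳ (⟪⟫.to-cong (eq 0))) (go f g (λ n → eq (suc n)) (x ^ p))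

      ⟦∑⟧ᵒ : ∀ {i} {K : Set i} (xs : List K) g x → ⟦ FiniteSums.∑ O.polynomialRing xs g ⟧ᵒ x ≈ ∑ xs (λ k → ⟦ g k ⟧ᵒ x)
      ⟦∑⟧ᵒ []       g x = refl
      ⟦∑⟧ᵒ (k ∷ xs) g x = trans (⟦⊕⟧ᵒ (g k) _ x) (+-congˡ (⟦∑⟧ᵒ xs g x))

      ⟦⟨⟩⟧ᵒ : ∀ f b x → ⟦ f ⟨ b ⟩ ⟧ᵒ x ≈ ⟦ f ⟧ᵒ (⟪ b ⟫ * x)
      ⟦⟨⟩⟧ᵒ []      b x = refl
      ⟦⟨⟩⟧ᵒ (a ∷ f) b x = +-cong (trans (*-congʳ (⟪⟫.to-* a b)) (*-assoc _ _ x))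
        (trans (⟦⟨⟩⟧ᵒ f (b PB.P.^ p) (x ^ p)) (⟦⟧ᵒ-cong f (trans (*-congʳ (⟪⟫.to-^ b p)) (sym (^-distrib-* _ _ p)))))

      ⟦comp⟧ᵒ : ∀ f b t x → ⟦ comp f b t ⟧ᵒ x ≈ ⟦ f ⟧ᵒ (⟪ b ⟫ * x ^p^ t)
      ⟦comp⟧ᵒ f b zero    x = ⟦⟨⟩⟧ᵒ f b x
      ⟦comp⟧ᵒ f b (suc t) x = trans (+-cong (zeroˡ x) (⟦comp⟧ᵒ f b t (x ^ p))) (+-identityˡ _)

      ⟦last⟧ᵒ : ∀ d f → length f ≡ suc d → ∀ x → ⟦ f ⟧ᵒ x ≈ ⟦ take d f ⟧ᵒ x + ⟪ O.coeff f d ⟫ * x ^p^ d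
      ⟦last⟧ᵒ zero    (a ∷ []) eq x = S.solve 1 (λ y → y S.:+ S.:0 S.:= S.:0 S.:+ y) refl _
      ⟦last⟧ᵒ (suc d) (a ∷ f)  eq x = trans (+-congˡ (⟦last⟧ᵒ d f (ℕ.suc-injective eq) (x ^ p))) (sym (+-assoc _ _ _))

    -- Correctness of the reduction.

    -- The identity is asked for with parameters zero, since their contribution splits off by
    -- additivity; `onto` has to account for them.
    record Valid {N} (f f′ : Fin N → Ore) (rep : Reparametrization N) : Set a where
      open Reparametrization rep
      field
        onto     : ∀ (X : Fin N → Carrier) → Σ[ X′ ∈ (Fin N → Carrier) ] Σ[ c ∈ (C → Fᵣ.Carrier) ]
                     (∀ i → X i ≈ ⟦ G i ⟧ [ X′ , κ.to ∘ c ]′)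
        identity : ∀ (X′ : Fin N → Carrier) →
                   ∑ (allFin N) (λ i → ⟦ f i ⟧ᵒ (⟦ G i ⟧ [ X′ , (λ _ → 0#) ]′)) ≈ ∑ (allFin N) (λ i → ⟦ f′ i ⟧ᵒ (X′ i))

    identical-valid : ∀ {N} (f : Fin N → Ore) → Valid f f identical
    identical-valid f = record
      { onto = λ X → X , (λ ()) , λ i → sym (⟦variable⟧ (inj₁ i) [ X , κ.to ∘ (λ ()) ]′)
      ; identity = λ X → ∑-cong (allFin _) λ i → ⟦⟧ᵒ-cong (f i) (⟦variable⟧ (inj₁ i) [ X , (λ _ → 0#) ]′) }

    module _ {N} {f f′ f″ : Fin N → Ore} {A B : Reparametrization N} (VA : Valid f f′ A) (VB : Valid f′ f″ B) where
      open Compose A B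
      private
        module VA = Valid VA
        module VB = Valid VB

        ⟦θ⟧ : ∀ (X″ : Fin N → Carrier) (c : A.C → Carrier) (d : B.C → Carrier) φ →
              ⟦ sub θ φ ⟧ [ X″ , [ c , d ]′ ]′ ≈ ⟦ φ ⟧ [ (λ j → ⟦ B.G j ⟧ [ X″ , d ]′) , c ]′
        ⟦θ⟧ X″ c d φ = trans (⟦sub⟧ θ φ [ X″ , [ c , d ]′ ]′) (⟦⟧-cong φ λ where
          (inj₁ j) → trans (⟦relabel⟧ right (B.G j) [ X″ , [ c , d ]′ ]′)
                       (⟦⟧-cong (B.G j) λ { (inj₁ _) → refl ; (inj₂ _) → refl })
          (inj₂ l) → ⟦variable⟧ (inj₂ (inj₁ l)) [ X″ , [ c , d ]′ ]′)

      compose-valid : Valid f f″ composite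
      compose-valid = record
        { onto = λ X →
            let X′ , c , eq  = VA.onto X
                X″ , d , eq′ = VB.onto X′
            in X″ , [ c , d ]′ , λ i → trans (eq i) (trans
                 (⟦⟧-cong (A.G i) λ { (inj₁ j) → eq′ j ; (inj₂ l) → refl })
                 (trans (sym (⟦θ⟧ X″ (κ.to ∘ c) (κ.to ∘ d) (A.G i)))
                   (⟦⟧-cong (sub θ (A.G i)) λ { (inj₁ _) → refl ; (inj₂ (inj₁ _)) → refl ; (inj₂ (inj₂ _)) → refl })))
        ; identity = λ X″ → trans (∑-cong (allFin N) λ i → ⟦⟧ᵒ-cong (f i) (trans
              (⟦⟧-cong (sub θ (A.G i)) λ { (inj₁ _) → refl ; (inj₂ (inj₁ _)) → refl ; (inj₂ (inj₂ _)) → refl })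
              (⟦θ⟧ X″ (λ _ → 0#) (λ _ → 0#) (A.G i))))
            (trans (VA.identity (λ j → ⟦ B.G j ⟧ [ X″ , (λ _ → 0#) ]′)) (VB.identity X″)) }

    module _ (D : ℕ) {N} (f : Fin N → Ore) (f≤D : ∀ i → length (f i) ≤ D)
      (dependence : Dependent (Family.vectors D f f≤D)) where
      open Reduce D f f≤D dependence

      ⟦initial⟧ : ∀ i (x : Carrier) (ρ : Fin N ⊎ Fin dᵐ → Carrier) → (i ≡ i₀ → x ≈ ⟦ remainder-form ⟧ ρ) → (¬ i ≡ i₀ → x ≈ ρ (inj₁ i)) → x ≈ ⟦ initial i ⟧ ρ
      ⟦initial⟧ i x ρ yes-case no-case with i Fin.≟ i₀
      ... | yes eq = yes-case eq
      ... | no neq = trans (no-case neq) (sym (⟦variable⟧ (inj₁ i) ρ))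

      ⟦remainder⟧ : ∀ ρ → ⟦ remainder-form ⟧ ρ ≈ ∑ (allFin dᵐ) (λ l → z ^ toℕ l * ρ (inj₂ l))
      ⟦remainder⟧ ρ = trans (⟦⟧-concatMap _ (allFin dᵐ) ρ) (∑-cong (allFin dᵐ) λ l → trans (⟦term⟧ (X ^ᴾ toℕ l) (inj₂ l) 0 ρ) (*-congʳ (⟪X⟫ (toℕ l))))

      -- The new variable x′ is the quotient of X₀ i₀ by `B i₀`; the other variables absorb the
      -- terms `y i` that x′ brings along.
      onto : ∀ (X₀ : Fin N → Carrier) → Σ[ X′ ∈ (Fin N → Carrier) ] Σ[ k ∈ (Fin dᵐ → Fᵣ.Carrier) ]
               (∀ i → X₀ i ≈ ⟦ initial i ++ term (B i) (inj₁ i₀) (shift i) ⟧ [ X′ , κ.to ∘ k ]′)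
      onto X₀ = X′ , k , λ i → trans (trans (≈-split (X₀ i) (y i)) (+-cong
            (⟦initial⟧ i (X₀ i + - y i) [ X′ , κ.to ∘ k ]′
              (λ { ≡.refl → trans (+-congʳ x≈) (trans (cancel-y (y₀≈)) (trans (pol≈digit-∑ r r-degree) (sym (⟦remainder⟧ [ X′ , κ.to ∘ k ]′)))) })
              (λ neq → sym (X′-other i neq)))
            (trans (*-congˡ (φ-cong (shift i) (sym X′-i₀))) (sym (⟦term⟧ (B i) (inj₁ i₀) (shift i) [ X′ , κ.to ∘ k ]′)))))
          (sym (⟦⟧-++ (initial i) (term (B i) (inj₁ i₀) (shift i)) [ X′ , κ.to ∘ k ]′))
        where
        div = division mod (X₀ i₀)
        x′ = proj₁ div
        r = proj₁ (proj₂ div)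
        x≈ = proj₂ (proj₂ (proj₂ div))
        r-degree : Q.Deg< dᵐ r
        r-degree = Q.deg-length r (proj₁ (proj₂ (proj₂ div)))
        k : Fin dᵐ → Fᵣ.Carrier
        k l = Q.coeff r (toℕ l)
        y : Fin N → Carrier
        y i = ⟪ B i ⟫ * x′ ^p^ shift i
        X′ : Fin N → Carrier
        X′ i = if does (i Fin.≟ i₀) then x′ else X₀ i + - y i
        X′-i₀ : X′ i₀ ≈ x′
        X′-i₀ with i₀ Fin.≟ i₀
        ... | yes _ = refl
        ... | no  ≢ = ⊥-elim (≢ ≡.refl)
        X′-other : ∀ i → ¬ i ≡ i₀ → X′ i ≈ X₀ i + - y i
        X′-other i neq with i Fin.≟ i₀
        ... | yes eq = ⊥-elim (neq eq)
        ... | no  _  = refl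
        ≈-split : ∀ x y → x ≈ (x + - y) + y
        ≈-split x y = S.solve 2 (λ x y → x S.:= (x S.:+ S.:- y) S.:+ y) refl x y
          
        y₀≈ : y i₀ ≈ ⟪ B i₀ ⟫ * x′
        y₀≈ = trans (reflexive (≡.cong (λ n → ⟪ B i₀ ⟫ * x′ ^p^ n) (ℕ.n∸n≡0 (length (f i₀))))) refl
        cancel-y : ∀ {u v w} → v ≈ u → (u + w) + - v ≈ w
        cancel-y {u} {v} {w} eq = trans (+-congˡ (-‿cong eq)) (S.solve 2 (λ u w → (u S.:+ w) S.:+ S.:- u S.:= w) refl u w)
          

      -- Away from i₀ the terms in X′ i are unchanged. The terms in X′ i₀ add up to `C₀`, and
      -- cutting off its vanishing leading coefficient gives `f₀`.
      identity : ∀ (X′ : Fin N → Carrier) →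
        ∑ (allFin N) (λ i → ⟦ f i ⟧ᵒ (⟦ initial i ++ term (B i) (inj₁ i₀) (shift i) ⟧ [ X′ , (λ _ → 0#) ]′)) ≈ ∑ (allFin N) (λ i → ⟦ f′ i ⟧ᵒ (X′ i))
      identity X′ = trans (∑-cong (allFin N) expand) (trans (∑-+ (allFin N) rest _) (trans (+-congˡ gather)
          (trans (+-congˡ (sym (∑-only i₀ (λ _ → ⟦ f₀ ⟧ᵒ (X′ i₀))))) (trans (sym (∑-+ (allFin N) rest _)) (∑-cong (allFin N) pointwise)))))
        where
        ρ = [ X′ , (λ _ → 0#) ]′
        rest : Fin N → Carrier
        rest i = if does (i Fin.≟ i₀) then 0# else ⟦ f i ⟧ᵒ (X′ i)
        ⟦f-initial⟧ : ∀ i → ⟦ f i ⟧ᵒ (⟦ initial i ⟧ ρ) ≈ rest i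
        ⟦f-initial⟧ i with i Fin.≟ i₀
        ... | yes _ = trans (⟦⟧ᵒ-cong (f i) (trans (⟦remainder⟧ ρ) (∑-zero (allFin dᵐ) λ l → zeroʳ _))) (⟦⟧ᵒ-0 (f i))
        ... | no  _ = ⟦⟧ᵒ-cong (f i) (⟦variable⟧ (inj₁ i) ρ)
        expand : ∀ i → ⟦ f i ⟧ᵒ (⟦ initial i ++ term (B i) (inj₁ i₀) (shift i) ⟧ ρ) ≈ rest i + ⟦ f i ⟧ᵒ (⟪ B i ⟫ * X′ i₀ ^p^ shift i)
        expand i = trans (⟦⟧ᵒ-cong (f i) (⟦⟧-++ (initial i) (term (B i) (inj₁ i₀) (shift i)) ρ)) (trans (⟦⟧ᵒ-+ (f i) _ _)
          (+-cong (⟦f-initial⟧ i) (⟦⟧ᵒ-cong (f i) (⟦term⟧ (B i) (inj₁ i₀) (shift i) ρ))))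
        ⟦c⟧ : ∀ i x → ⟦ c i ⟧ᵒ x ≈ ⟦ f i ⟧ᵒ (⟪ B i ⟫ * x ^p^ shift i)
        ⟦c⟧ i x with B i P.≟0
        ... | yes B≈0 = trans (⟦[]⟧ᵒ x) (sym (trans (⟦⟧ᵒ-cong (f i) (trans (*-congʳ (⟪⟫.to-cong B≈0)) (zeroˡ _))) (⟦⟧ᵒ-0 (f i))))
        ... | no  _   = ⟦comp⟧ᵒ (f i) (B i) (shift i) x
        gather : ∑ (allFin N) (λ i → ⟦ f i ⟧ᵒ (⟪ B i ⟫ * X′ i₀ ^p^ shift i)) ≈ ⟦ f₀ ⟧ᵒ (X′ i₀)
        gather = trans (∑-cong (allFin N) λ i → sym (⟦c⟧ i (X′ i₀))) (trans (sym (⟦∑⟧ᵒ (allFin N) c (X′ i₀)))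
          (⟦≈⟧ᵒ (X′ i₀) (O.PR.sym (O.take-≈ d₀ C₀ C₀-degree))))
        pointwise : ∀ i → rest i + only (i Fin.≟ i₀) (⟦ f₀ ⟧ᵒ (X′ i₀)) ≈ ⟦ f′ i ⟧ᵒ (X′ i)
        pointwise i with i Fin.≟ i₀
        ... | yes ≡.refl = +-identityˡ _
        ... | no  _      = +-identityʳ _

      reduce-valid : Valid f f′ reparametrization
      reduce-valid = record { onto = onto ; identity = identity }

    trace-valid : ∀ {N} {f : Fin N → Ore} (t : Trace f) → Valid f (last-family t) (substitution t)
    trace-valid {f = f} (complete _ _ _)     = identical-valid f
    trace-valid {f = f} (reduce D f≤D dep t) = compose-valid (reduce-valid D f f≤D dep) (trace-valid t)

    frob-∑-∑ : ∀ D {i} {I : Set i} (xs : List I) (g : I → Fin (p ℕ.^ D) → Carrier) →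
               ∑ xs (λ x → frob-∑ D (g x)) ≈ frob-∑ D (λ e → ∑ xs (λ x → g x e))
    frob-∑-∑ D xs g = trans (∑-swap xs (allFin (p ℕ.^ D)) (λ x e → z ^ toℕ e * g x e ^p^ D))
      (∑-cong (allFin (p ℕ.^ D)) λ e → trans (sym (∑-*ˡ _ xs _)) (*-congˡ (sym (φ-∑ D xs _))))

    frob-+ : ∀ D x y → frob-∑ D (λ e → x e + y e) ≈ frob-∑ D x + frob-∑ D y
    frob-+ D x y = trans (∑-cong (allFin (p ℕ.^ D)) λ e → trans (*-congˡ (φ-+ D _ _)) (distribˡ _ _ _)) (∑-+ (allFin (p ℕ.^ D)) _ _)

    frob-neg : ∀ D x → frob-∑ D (λ e → - x e) ≈ - frob-∑ D x
    frob-neg D x = trans (∑-cong (allFin (p ℕ.^ D)) λ e → trans (*-congˡ (φ-neg D _)) (S.solve 2 (λ a b → a S.:* (S.:- b) S.:= S.:- (a S.:* b)) refl _ _)) (sym (∑-neg (allFin (p ℕ.^ D)) _))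

    frob-* : ∀ D x y → frob-∑ D x * y ^p^ D ≈ frob-∑ D (λ e → x e * y)
    frob-* D x y = trans (∑-*ʳ _ (allFin (p ℕ.^ D)) _) (∑-cong (allFin (p ℕ.^ D)) λ e → trans (*-assoc _ _ _) (*-congˡ (sym (φ-* D _ _))))

    ⟪basis⟫ : ∀ D v → ⟪ PB.basis-∑ D v ⟫ ≈ frob-∑ D (λ e → ⟪ v e ⟫)
    ⟪basis⟫ D v = trans (⟪⟫.to-∑ (allFin (p ℕ.^ D)) _) (∑-cong (allFin (p ℕ.^ D)) λ e →
      trans (⟪⟫.to-* _ _) (*-cong (⟪X⟫ (toℕ e)) (⟪φ⟫ D (v e))))

    frob-spans : ∀ D x → Σ[ y ∈ (Fin (p ℕ.^ D) → Carrier) ] x ≈ frob-∑ D y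
    frob-spans D x = let N , bd = Bd-exists x
                         y , _ , eq = digits D N (Bd-mono (ℕ.m≤m*n N (p ℕ.^ D) {{ℕ.m^n≢0 p D {{prime⇒nonZero p-prime}}}}) bd)
                     in y , eq

    -- Correctness of the normal form and its bounds.

    module SplitCorrect (D′ : ℕ) {N} (f : Fin N → Ore) (f≤D : ∀ i → length (f i) ≤ suc D′)
      (completion : Completion (Family.vectors (suc D′) f f≤D)) where
      open Split D′ f f≤D completion

      combined : (Fin q → Carrier) → Fin q → Carrier
      combined x e = ∑ (allFin q) (λ k → ⟪ u k e ⟫ * x k)

      ⟦lead⟧ : ∀ x → ⟦ lead-form ⟧ x ≈ frob-∑ D (combined x)
      ⟦lead⟧ x = begin
        ⟦ lead-form ⟧ x
          ≈⟨ ⟦⟧-concatMap _ (allFin q) x ⟩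
        ∑ (allFin q) (λ k → ⟦ term (PB.basis-∑ D (u k)) k D ⟧ x)
          ≈⟨ ∑-cong (allFin q) (λ k → trans (⟦term⟧ _ k D x) (trans (*-congʳ (⟪basis⟫ D (u k))) (frob-* D _ (x k)))) ⟩
        ∑ (allFin q) (λ k → frob-∑ D (λ e → ⟪ u k e ⟫ * x k))
          ≈⟨ frob-∑-∑ D (allFin q) (λ k e → ⟪ u k e ⟫ * x k) ⟩
        frob-∑ D (combined x) ∎

      child : ∀ g → Fin (count g) → Carrier → Carrier
      child g l y = z ^ toℕ l * y ^p^ (D ℕ.∸ deg g)

      ⟦low⟧ : ∀ x → ⟦ low-form ⟧ x ≈ ∑ (allFin N) (λ i → ∑ (allFin (counts i)) λ l → ⟦ take (deg (f i)) (f i) ⟧ᵒ (child (f i) l (x (slot i l))))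
      ⟦low⟧ x = trans (⟦⟧-concatMap _ (allFin N) x) (∑-cong (allFin N) λ i → trans (⟦⟧-concatMap _ (allFin (counts i)) x)
        (∑-cong (allFin (counts i)) λ l → ⟦low-term⟧ (f i) l (slot i l)))
        where
        ⟦low-term⟧ : ∀ g l k → ⟦ low-term g l k ⟧ x ≈ ⟦ take (deg g) g ⟧ᵒ (child g l (x k))
        ⟦low-term⟧ g l k = trans (⟦sub⟧ θ (ore-form (take (deg g) g) tt) x) (trans (⟦ore-form⟧ (take (deg g) g) tt (λ i → ⟦ θ i ⟧ x))
          (⟦⟧ᵒ-cong (take (deg g) g) (trans (⟦term⟧ (X ^ᴾ toℕ l) k (D ℕ.∸ deg g) x) (*-congʳ (⟪X⟫ (toℕ l))))))
          where
          θ : ⊤ → Form (Fin q)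
          θ _ = term (X ^ᴾ toℕ l) k (D ℕ.∸ deg g)

      private
        lead-child : ∀ g → length g ≤ D → ∀ l y → ⟪ lead g ⟫ * child g l y ^p^ deg g ≈ frob-∑ D (λ e → ⟪ lead-vector g l e ⟫ * y)
        lead-child g le l y = begin
          ⟪ lead g ⟫ * (z ^ toℕ l * y ^p^ (D ℕ.∸ deg g)) ^p^ deg g
            ≈⟨ *-congˡ (trans (φ-* (deg g) _ _) (*-cong (trans (φ≈^ (deg g) _) (^-assocʳ z (toℕ l) _)) (trans (φ-φ (D ℕ.∸ deg g) (deg g) y) (reflexive (≡.cong (y ^p^_) (t+d≡D g le)))))) ⟩
          ⟪ lead g ⟫ * (z ^ (toℕ l ℕ.* p ℕ.^ deg g) * y ^p^ D)
            ≈⟨ *-assoc _ _ _ ⟨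
          (⟪ lead g ⟫ * z ^ (toℕ l ℕ.* p ℕ.^ deg g)) * y ^p^ D
            ≈⟨ *-congʳ (trans (*-congˡ (sym (⟪X⟫ m))) (trans (sym (⟪⟫.to-* (lead g) (X ^ᴾ m))) (trans (⟪⟫.to-cong (coords-≈ D (lead g ⊗ X ^ᴾ m))) (⟪basis⟫ D (lead-vector g l))))) ⟩
          frob-∑ D (λ e → ⟪ lead-vector g l e ⟫) * y ^p^ D
            ≈⟨ frob-* D _ y ⟩
          frob-∑ D (λ e → ⟪ lead-vector g l e ⟫ * y) ∎
          where
          m = toℕ l ℕ.* p ℕ.^ deg g

        ⟦split⟧ : ∀ g → length g ≤ D → ∀ pos i x xf →
          ⟦ g ⟧ᵒ (⟦ split g pos i ⟧ [ x , xf ]′) ≈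
          ∑ (allFin (count g)) (λ l → ⟦ take (deg g) g ⟧ᵒ (child g l (x (pos l))) + frob-∑ D (λ e → ⟪ lead-vector g l e ⟫ * x (pos l)))
        ⟦split⟧ []        le pos i x xf = ⟦[]⟧ᵒ _
        ⟦split⟧ g@(_ ∷ _) le pos i x xf = trans (⟦⟧ᵒ-cong g (trans (⟦⟧-concatMap _ (allFin (count g)) [ x , xf ]′)
            (∑-cong (allFin (count g)) λ l → trans (⟦term⟧ _ (inj₁ (pos l)) _ [ x , xf ]′) (*-congʳ (⟪X⟫ (toℕ l))))))
          (trans (⟦⟧ᵒ-∑ g (allFin (count g)) (λ l → child g l (x (pos l)))) (∑-cong (allFin (count g)) λ l →
            trans (⟦last⟧ᵒ (deg g) g ≡.refl (child g l (x (pos l)))) (+-congˡ (lead-child g le l (x (pos l))))))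

      -- Leading and lower terms are collected separately. The leading ones are the occupied rows of
      -- u; the unit rows add nothing, as their variables vanish.
      split-identity : ∀ x xf → (∀ k → Dummy k → x k ≈ 0#) →
        ∑ (allFin N) (λ i → ⟦ f i ⟧ᵒ (⟦ split-form i ⟧ [ x , xf ]′)) ≈ ⟦ normal-form ⟧ x
      split-identity x xf dummies = begin
        ∑ (allFin N) (λ i → ⟦ f i ⟧ᵒ (⟦ split-form i ⟧ [ x , xf ]′))
          ≈⟨ ∑-cong (allFin N) (λ i → trans (⟦split⟧ (f i) (f≤D i) (slot i) i x xf) (∑-+ (allFin (counts i)) _ _)) ⟩
        ∑ (allFin N) (λ i → lows i + leads i)
          ≈⟨ trans (∑-+ (allFin N) lows leads) (+-comm _ _) ⟩
        ∑ (allFin N) leads + ∑ (allFin N) lows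
          ≈⟨ +-cong all-leads (⟦low⟧ x) ⟨
        ⟦ lead-form ⟧ x + ⟦ low-form ⟧ x
          ≈⟨ ⟦⟧-++ lead-form low-form x ⟨
        ⟦ normal-form ⟧ x ∎
        where
        lows leads : Fin N → Carrier
        lows i = ∑ (allFin (counts i)) λ l → ⟦ take (deg (f i)) (f i) ⟧ᵒ (child (f i) l (x (slot i l)))
        leads i = ∑ (allFin (counts i)) λ l → frob-∑ D (λ e → ⟪ lead-vector (f i) l e ⟫ * x (slot i l))
        all-leads : ⟦ lead-form ⟧ x ≈ ∑ (allFin N) leads
        all-leads = begin
          ⟦ lead-form ⟧ x
            ≈⟨ ⟦lead⟧ x ⟩
          frob-∑ D (combined x)
            ≈⟨ frob-cong D (λ e → trans (∑-injection position injective (λ k → ⟪ u k e ⟫ * x k) (λ k off → trans (*-congˡ (dummies k off)) (zeroʳ _)))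
                 (∑-cong (allFin (total counts)) λ j → *-congʳ (⟪⟫.to-cong (u-position j e)))) ⟩
          frob-∑ D (λ e → ∑ (allFin (total counts)) λ j → ⟪ vectors j e ⟫ * x (position j))
            ≈⟨ frob-∑-∑ D (allFin (total counts)) (λ j e → ⟪ vectors j e ⟫ * x (position j)) ⟨
          ∑ (allFin (total counts)) (λ j → frob-∑ D (λ e → ⟪ vectors j e ⟫ * x (position j)))
            ≈⟨ ∑-total R counts _ ⟩
          ∑ (allFin N) (λ i → ∑ (allFin (counts i)) λ l → frob-∑ D (λ e → ⟪ vectors (encode counts i l) e ⟫ * x (slot i l)))
            ≈⟨ ∑-cong (allFin N) (λ i → ∑-cong (allFin (counts i)) λ l → reflexive
                 (≡.cong (λ v → frob-∑ D (λ e → ⟪ vector-at v e ⟫ * x (slot i l))) (uncode-encode counts i l))) ⟩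
          ∑ (allFin N) leads ∎

      split-onto : ∀ (X : Fin N → Carrier) → Σ[ x ∈ (Fin q → Carrier) ] Σ[ xf ∈ (Fin N → Carrier) ]
        (∀ k → Dummy k → x k ≈ 0#) × (∀ i → X i ≈ ⟦ split-form i ⟧ [ x , xf ]′)
      split-onto X₀ = x , X₀ , (λ k dummy → ∑-zero (allFin (total counts)) λ j → only-no (position j Fin.≟ k) (value j) (dummy j))
                    , λ i → covers i (f i) (slot i) (X₀ i) refl λ l → trans (x-position (encode counts i l))
                        (reflexive (≡.cong (λ (i , l) → part (f i) (X₀ i) l) (uncode-encode counts i l)))
        where
        part : ∀ g → Carrier → Fin (count g) → Carrier
        part g@(_ ∷ _) y = proj₁ (frob-spans (D ℕ.∸ deg g) y)
        value : Fin (total counts) → Carrier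
        value j = let i , l = uncode counts j in part (f i) (X₀ i) l
        x : Fin q → Carrier
        x k = ∑ (allFin (total counts)) (λ j → only (position j Fin.≟ k) (value j))
        x-position : ∀ j → x (position j) ≈ value j
        x-position j = trans (∑-single j (λ j′ → only (position j′ Fin.≟ position j) (value j′)) λ j′ neq → only-no (position j′ Fin.≟ position j) (value j′) λ eq → neq (injective eq))
          (only-yes (position j Fin.≟ position j) (value j) ≡.refl)
        -- Generalized from f i to g so that g can be matched on, since `count`, `split` and `part`
        -- depend on it.
        covers : ∀ i g (pos : Fin (count g) → Fin q) y → y ≈ X₀ i → (∀ l → x (pos l) ≈ part g y l) → y ≈ ⟦ split g pos i ⟧ [ x , X₀ ]′
        covers i []        pos y y≈ eq = trans y≈ (sym (⟦variable⟧ (inj₂ i) [ x , X₀ ]′))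
        covers i g@(_ ∷ _) pos y y≈ eq = trans (proj₂ (frob-spans (D ℕ.∸ deg g) y)) (sym (trans (⟦⟧-concatMap _ (allFin (count g)) [ x , X₀ ]′)
          (∑-cong (allFin (count g)) λ l → trans (⟦term⟧ _ (inj₁ (pos l)) _ [ x , X₀ ]′) (*-cong (⟪X⟫ (toℕ l)) (φ-cong (D ℕ.∸ deg g) (eq l))))))

      ⟪w⟫-bound : ∀ {m} k (y : Fin q → Carrier) → (∀ e → Bd m (y e)) → Bd (W ℕ.+ m) (∑ (allFin q) (λ e → ⟪ w k e ⟫ * y e))
      ⟪w⟫-bound k y bd = Bd-∑ (allFin q) λ e → Bd-* (Bd-⟪⟫ (w k e) (w≤W k e)) (bd e)

      frob-bound : ∀ {m} (y : Fin q → Carrier) → (∀ e → Bd m (y e)) → Bd (Z ℕ.+ q ℕ.* m) (frob-∑ D y)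
      frob-bound y bd = Bd-∑ (allFin q) λ e → Bd-* (Bd-cong (⟪X⟫ (toℕ e)) (Bd-⟪⟫ (X ^ᴾ toℕ e) (proj₂ (Fin-bound q (λ e → length (X ^ᴾ toℕ e))) e))) (Bd-φ D (bd e))

      ⟪only⟫ : ∀ {A : Set} (d : Dec A) c → ⟪ FiniteSums.only P.polynomialRing d c ⟫ ≈ only d ⟪ c ⟫
      ⟪only⟫ (yes _) c = refl
      ⟪only⟫ (no _)  c = refl

      only-*ʳ : ∀ {A : Set} (d : Dec A) c y → only d c * y ≈ only d (c * y)
      only-*ʳ (yes _) c y = refl
      only-*ʳ (no _)  c y = zeroˡ y

      -- Cramer's rule: at x = w μ the leading part of the form has the digits Δ μ.
      spanningᴿ : ∀ (μ : Fin q → Carrier) e → combined (λ k → ∑ (allFin q) λ e′ → ⟪ w k e′ ⟫ * μ e′) e ≈ ⟪ Δ ⟫ * μ e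
      spanningᴿ μ e = begin
        ∑ (allFin q) (λ k → ⟪ u k e ⟫ * ∑ (allFin q) λ e′ → ⟪ w k e′ ⟫ * μ e′)
          ≈⟨ ∑-cong (allFin q) (λ k → trans (∑-*ˡ _ (allFin q) _) (∑-cong (allFin q) λ e′ → S.solve 3 (λ u w m → u S.:* (w S.:* m) S.:= (w S.:* u) S.:* m) refl _ _ _)) ⟩
        ∑ (allFin q) (λ k → ∑ (allFin q) λ e′ → (⟪ w k e′ ⟫ * ⟪ u k e ⟫) * μ e′)
          ≈⟨ ∑-swap (allFin q) (allFin q) (λ k e′ → (⟪ w k e′ ⟫ * ⟪ u k e ⟫) * μ e′) ⟩
        ∑ (allFin q) (λ e′ → ∑ (allFin q) λ k → (⟪ w k e′ ⟫ * ⟪ u k e ⟫) * μ e′)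
          ≈⟨ ∑-cong (allFin q) (λ e′ → trans (sym (∑-*ʳ (μ e′) (allFin q) _)) (trans (*-congʳ (trans (∑-cong (allFin q) λ k → sym (⟪⟫.to-* (w k e′) (u k e)))
               (trans (sym (⟪⟫.to-∑ (allFin q) _)) (trans (⟪⟫.to-cong (spanning e′ e)) (⟪only⟫ (e′ Fin.≟ e) Δ))))) (only-*ʳ (e′ Fin.≟ e) ⟪ Δ ⟫ (μ e′)))) ⟩
        ∑ (allFin q) (λ e′ → only (e′ Fin.≟ e) (⟪ Δ ⟫ * μ e′))
          ≈⟨ ∑-only e (λ e′ → ⟪ Δ ⟫ * μ e′) ⟩
        ⟪ Δ ⟫ * μ e ∎

      -- Cramer's rule in the other direction: the digits of the leading part determine Δ x, which
      -- transfers their bound to x.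
      dualᴿ : ∀ x k → ∑ (allFin q) (λ e → ⟪ w k e ⟫ * combined x e) ≈ ⟪ Δ ⟫ * x k
      dualᴿ x k = begin
        ∑ (allFin q) (λ e → ⟪ w k e ⟫ * ∑ (allFin q) λ l → ⟪ u l e ⟫ * x l)
          ≈⟨ ∑-cong (allFin q) (λ e → trans (∑-*ˡ _ (allFin q) _) (∑-cong (allFin q) λ l → sym (*-assoc _ _ _))) ⟩
        ∑ (allFin q) (λ e → ∑ (allFin q) λ l → (⟪ w k e ⟫ * ⟪ u l e ⟫) * x l)
          ≈⟨ ∑-swap (allFin q) (allFin q) (λ e l → (⟪ w k e ⟫ * ⟪ u l e ⟫) * x l) ⟩
        ∑ (allFin q) (λ l → ∑ (allFin q) λ e → (⟪ w k e ⟫ * ⟪ u l e ⟫) * x l)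
          ≈⟨ ∑-cong (allFin q) (λ l → trans (sym (∑-*ʳ (x l) (allFin q) _)) (trans (*-congʳ (trans (∑-cong (allFin q) λ e → sym (⟪⟫.to-* (w k e) (u l e)))
               (trans (sym (⟪⟫.to-∑ (allFin q) _)) (trans (⟪⟫.to-cong (dual k l)) (⟪only⟫ (k Fin.≟ l) Δ))))) (trans (only-*ʳ (k Fin.≟ l) ⟪ Δ ⟫ (x l)) (flip l)))) ⟩
        ∑ (allFin q) (λ l → only (l Fin.≟ k) (⟪ Δ ⟫ * x l))
          ≈⟨ ∑-only k (λ l → ⟪ Δ ⟫ * x l) ⟩
        ⟪ Δ ⟫ * x k ∎
        where
        flip : ∀ l → only (k Fin.≟ l) (⟪ Δ ⟫ * x l) ≈ only (l Fin.≟ k) (⟪ Δ ⟫ * x l)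
        flip l with k Fin.≟ l
        ... | yes ≡.refl = sym (only-yes (k Fin.≟ k) (⟪ Δ ⟫ * x k) ≡.refl)
        ... | no  neq    = sym (only-no (l Fin.≟ k) (⟪ Δ ⟫ * x l) λ eq → neq (≡.sym eq))

      ⟦normal⟧ : ∀ x → ⟦ normal-form ⟧ x ≈ frob-∑ D (combined x) + ⟦ low-form ⟧ x
      ⟦normal⟧ x = trans (⟦⟧-++ lead-form low-form x) (+-congʳ (⟦lead⟧ x))

      private
        -- The digits of y are divided by Δ, and Cramer's rule turns the quotients into x. The error
        -- consists of the remainders modulo Δ and of the low form at x.
        approximate : ∀ n y → Bd (n ℕ.* q) y → Σ[ x ∈ (Fin q → Carrier) ] Bd (A ℕ.+ q′ ℕ.* (K ℕ.+ n)) (y + - ⟦ normal-form ⟧ x)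
        approximate n y bd = x , Bd-cong (sym difference) (Bd-mono total-bound (Bd-+
            (Bd-mono (ℕ.m≤m+n _ _) (frob-bound (λ e → pol (r e)) λ e → Bd-pol (r e) (Q.deg-length (r e) (r≤ e))))
            (Bd-mono (ℕ.m≤n+m _ (Z ℕ.+ q ℕ.* dΔ)) (Bd-neg (Bd-⟦⟧ D′ low-form low-exp x-bound)))))
          where
          dig = digits D n bd
          lam : Fin q → Carrier
          lam = proj₁ dig
          div = λ e → division mod-Δ (lam e)
          μ : Fin q → Carrier
          μ e = proj₁ (div e)
          r = λ e → proj₁ (proj₂ (div e))
          r≤ : ∀ e → length (r e) ≤ dΔ
          r≤ e = proj₁ (proj₂ (proj₂ (div e)))
          lam≈ : ∀ e → lam e ≈ ⟪ Δ ⟫ * μ e + pol (r e)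
          lam≈ e = proj₂ (proj₂ (proj₂ (div e)))
          x : Fin q → Carrier
          x k = ∑ (allFin q) λ e → ⟪ w k e ⟫ * μ e
          Δμ : ∀ e → ⟪ Δ ⟫ * μ e ≈ lam e + - pol (r e)
          Δμ e = trans (S.solve 2 (λ a b → a S.:= (a S.:+ b) S.:+ S.:- b) refl _ (pol (r e))) (+-congʳ (sym (lam≈ e)))
          μ-bound : ∀ e → Bd (iΔ ℕ.+ (dΔ ℕ.+ n)) (μ e)
          μ-bound e = Bd-cancel mod-Δ (Bd-cong (sym (Δμ e)) (Bd-+ (Bd-mono (ℕ.m≤n+m n dΔ) (proj₁ (proj₂ dig) e))
            (Bd-neg (Bd-mono (ℕ.m≤m+n dΔ n) (Bd-pol (r e) (Q.deg-length (r e) (r≤ e)))))))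
          x-bound : ∀ k → Bd (K ℕ.+ n) (x k)
          x-bound k = ≡.subst (λ b → Bd b (x k)) (assoc W iΔ dΔ n) (⟪w⟫-bound k μ μ-bound)
            where
            assoc : ∀ a b c d → a ℕ.+ (b ℕ.+ (c ℕ.+ d)) ≡ a ℕ.+ (b ℕ.+ c) ℕ.+ d
            assoc = solve-∀
          difference : y + - ⟦ normal-form ⟧ x ≈ frob-∑ D (λ e → pol (r e)) + - ⟦ low-form ⟧ x
          difference = begin
            y + - ⟦ normal-form ⟧ x
              ≈⟨ +-cong (proj₂ (proj₂ dig)) (-‿cong (trans (⟦normal⟧ x) (+-congʳ (frob-cong D (spanningᴿ μ))))) ⟩
            frob-∑ D lam + - (frob-∑ D (λ e → ⟪ Δ ⟫ * μ e) + ⟦ low-form ⟧ x)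
              ≈⟨ +-congʳ (trans (frob-cong D lam≈) (frob-+ D _ _)) ⟩
            (frob-∑ D (λ e → ⟪ Δ ⟫ * μ e) + frob-∑ D (λ e → pol (r e))) + - (frob-∑ D (λ e → ⟪ Δ ⟫ * μ e) + ⟦ low-form ⟧ x)
              ≈⟨ S.solve 3 (λ a b c → (a S.:+ b) S.:+ S.:- (a S.:+ c) S.:= b S.:+ S.:- c) refl _ _ _ ⟩
            frob-∑ D (λ e → pol (r e)) + - ⟦ low-form ⟧ x ∎
          total-bound : ((Z ℕ.+ q ℕ.* dΔ) ℕ.+ (size low-form ℕ.+ q′ ℕ.* (K ℕ.+ n))) ≤ A ℕ.+ q′ ℕ.* (K ℕ.+ n)
          total-bound = ℕ.≤-reflexive (≡.sym (ℕ.+-assoc (Z ℕ.+ q ℕ.* dΔ) (size low-form) _))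

        -- The left side is at most (1 + A + K) q′ + n q′, hence at most 2 n q′, and q is at least 2
        -- q′.
        smaller : ∀ n → suc (A ℕ.+ K) ≤ n → A ℕ.+ q′ ℕ.* (K ℕ.+ suc n) ≤ n ℕ.* q
        smaller n le = ℕ.≤-trans (ℕ.+-monoˡ-≤ _ (≤*q′ A)) (ℕ.≤-trans (ℕ.≤-reflexive (rearrange A K n q′)) (halve (suc (A ℕ.+ K)) n le))
          where
          rearrange : ∀ a k n q → a ℕ.* q ℕ.+ q ℕ.* (k ℕ.+ suc n) ≡ suc (a ℕ.+ k) ℕ.* q ℕ.+ n ℕ.* q
          rearrange = solve-∀

      -- The approximation is repeated on its own error until n is at most 1 + A + K; by additivity
      -- the successive x add up.
      remainder : ∀ y → Σ[ x ∈ (Fin q → Carrier) ] Bd remainder-bound (y + - ⟦ normal-form ⟧ x)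
      remainder y = let n , bd = Bd-exists y in go n y (Bd-mono (ℕ.m≤m*n n q {{ℕ.m^n≢0 p D {{prime⇒nonZero p-prime}}}}) bd)
        where
        trivial : ∀ n y → Bd (n ℕ.* q) y → n ≤ suc (A ℕ.+ K) → Σ[ x ∈ (Fin q → Carrier) ] Bd remainder-bound (y + - ⟦ normal-form ⟧ x)
        trivial n y bd le = (λ _ → 0#) , Bd-cong (sym (trans (+-congˡ (-‿cong (⟦⟧-0 normal-form {λ _ → 0#} λ _ → refl))) (S.solve 1 (λ y → y S.:+ S.:- S.:0 S.:= y) refl y)))
          (Bd-mono (ℕ.*-monoˡ-≤ q le) bd)
        go : ∀ n y → Bd (n ℕ.* q) y → Σ[ x ∈ (Fin q → Carrier) ] Bd remainder-bound (y + - ⟦ normal-form ⟧ x)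
        go zero    y bd = trivial zero y bd z≤n
        go (suc n) y bd with suc n ℕ.≤? suc (A ℕ.+ K)
        ... | yes le = trivial (suc n) y bd le
        ... | no  ≰  =
          let x₁ , bd₁ = approximate (suc n) y bd
              x₂ , bd₂ = go n (y + - ⟦ normal-form ⟧ x₁) (Bd-mono (smaller n (ℕ.≤-pred (ℕ.≰⇒> ≰))) bd₁)
          in (λ k → x₁ k + x₂ k) , Bd-cong (trans (S.solve 3 (λ y a b → (y S.:+ S.:- a) S.:+ S.:- b S.:= y S.:+ S.:- (a S.:+ b)) refl y _ _)
               (+-congˡ (-‿cong (sym (⟦⟧-+ normal-form x₁ x₂))))) bd₂

      private
        -- The assumed bound on x makes the low form at x so small that the leading part has bound n
        -- q. Its digits then have bound n, and recovering x from them costs iΔ + W, which is one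
        -- better than assumed.
        improve : ∀ N₁ n (x : Fin q → Carrier) → Bd N₁ (⟦ normal-form ⟧ x) → suc (N₁ ℕ.+ size low-form) ℕ.+ (iΔ ℕ.+ W) ≤ n →
                  (∀ k → Bd (suc (n ℕ.+ (iΔ ℕ.+ W))) (x k)) → ∀ k → Bd (n ℕ.+ (iΔ ℕ.+ W)) (x k)
        improve N₁ n x bd le x-bd k = ≡.subst (λ b → Bd b (x k)) (reorder iΔ W n) (Bd-cancel mod-Δ (Bd-cong
            (trans (∑-cong (allFin q) λ e → *-congˡ (lam≈ e)) (dualᴿ x k)) (⟪w⟫-bound k lam (proj₁ (proj₂ dig)))))
          where
          reorder : ∀ a b c → a ℕ.+ (b ℕ.+ c) ≡ c ℕ.+ (a ℕ.+ b)
          reorder = solve-∀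
          lead-bound : Bd (n ℕ.* q) (frob-∑ D (combined x))
          lead-bound = Bd-cong (trans (+-congʳ (⟦normal⟧ x)) (S.solve 2 (λ a b → (a S.:+ b) S.:+ S.:- b S.:= a) refl _ _)) (Bd-mono fits
            (Bd-+ (Bd-mono (ℕ.m≤m+n N₁ _) bd) (Bd-neg (Bd-mono (ℕ.m≤n+m _ N₁) (Bd-⟦⟧ D′ low-form low-exp x-bd)))))
            where
            fits : N₁ ℕ.+ (size low-form ℕ.+ q′ ℕ.* suc (n ℕ.+ (iΔ ℕ.+ W))) ≤ n ℕ.* q
            fits = ℕ.≤-trans (ℕ.≤-reflexive (≡.sym (ℕ.+-assoc N₁ _ _))) (ℕ.≤-trans (ℕ.+-monoˡ-≤ _ (≤*q′ (N₁ ℕ.+ size low-form)))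
              (ℕ.≤-trans (ℕ.≤-reflexive (rearrange (N₁ ℕ.+ size low-form) (iΔ ℕ.+ W) n q′)) (halve (suc (N₁ ℕ.+ size low-form) ℕ.+ (iΔ ℕ.+ W)) n le)))
              where
              rearrange : ∀ a k n q → a ℕ.* q ℕ.+ q ℕ.* suc (n ℕ.+ k) ≡ (suc a ℕ.+ k) ℕ.* q ℕ.+ n ℕ.* q
              rearrange = solve-∀
          dig = digits D n lead-bound
          lam : Fin q → Carrier
          lam = proj₁ dig
          lam≈ : ∀ e → lam e ≈ combined x e
          lam≈ e = trans (S.solve 2 (λ a b → a S.:= (a S.:+ S.:- b) S.:+ b) refl (lam e) (combined x e))
            (trans (+-congʳ (frob-independent D (λ e → lam e + - combined x e)
              (trans (frob-+ D lam (λ e → - combined x e)) (trans (+-cong (sym (proj₂ (proj₂ dig))) (frob-neg D (combined x))) (-‿inverseʳ _))) e)) (+-identityˡ _))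

      -- Some bound on x exists, of unknown size; `improve` lowers it step by step to one depending
      -- on N₁ alone.
      bounded-solution : ∀ N₁ (x : Fin q → Carrier) → Bd N₁ (⟦ normal-form ⟧ x) → ∀ k → Bd (solution-bound N₁) (x k)
      bounded-solution N₁ x bd = let m , x-bd = common-bound q x in
        go m (λ k → Bd-mono (ℕ.m≤m+n m (solution-bound N₁)) (x-bd k))
        where
        go : ∀ m → (∀ k → Bd (m ℕ.+ solution-bound N₁) (x k)) → ∀ k → Bd (solution-bound N₁) (x k)
        go zero    x-bd = x-bd
        go (suc m) x-bd = go m λ k → ≡.subst (λ b → Bd b (x k)) (shift m c (iΔ ℕ.+ W))
          (improve N₁ (m ℕ.+ c) x bd (ℕ.m≤n+m c m)
            (λ k → ≡.subst (λ b → Bd b (x k)) (≡.cong suc (≡.sym (shift m c (iΔ ℕ.+ W)))) (x-bd k)) k)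
          where
          c = suc (N₁ ℕ.+ size low-form) ℕ.+ (iΔ ℕ.+ W)
          shift : ∀ m c d → m ℕ.+ c ℕ.+ d ≡ m ℕ.+ (c ℕ.+ d)
          shift = solve-∀

    -- Merging equations, collecting coefficients, clearing denominators.

    private
      two-terms : ∀ m (g : Fin m → Carrier) (2≤m : 2 ≤ m) → (∀ k → 2 ≤ toℕ k → g k ≈ 0#) →
                  ∑ (allFin m) g ≈ g (Fin.fromℕ< (ℕ.<⇒≤ 2≤m)) + g (Fin.fromℕ< 2≤m)
      two-terms (suc (suc m)) g (s≤s (s≤s z≤n)) g≈0 = trans (∑-allFin-suc (suc m) g) (+-congˡ (trans (∑-allFin-suc m (λ k → g (suc k)))
        (trans (+-congˡ (∑-zero (allFin m) λ k → g≈0 (suc (suc k)) (s≤s (s≤s z≤n)))) (+-identityʳ _))))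

      2≤p¹ : 2 ≤ p ℕ.^ 1
      2≤p¹ = ≡.subst (2 ≤_) (≡.sym (ℕ.^-identityʳ p)) (ℕ.nonTrivial⇒n>1 p {{prime⇒nonTrivial p-prime}})

    -- Since p is at least 2, both 1 and z belong to the basis of R over its p-th powers.
    independent-pair : ∀ u v → u ^p^ 1 + z * v ^p^ 1 ≈ 0# → (u ≈ 0#) × (v ≈ 0#)
    independent-pair u v eq = trans (sym y₀) (all-zero k₀) , trans (sym y₁) (all-zero k₁)
      where
      y : Fin (p ℕ.^ 1) → Carrier
      y k = [u,v] (toℕ k)
        where
        [u,v] : ℕ → Carrier
        [u,v] 0             = u
        [u,v] 1             = v
        [u,v] (suc (suc _)) = 0#
      k₀ = Fin.fromℕ< (ℕ.<⇒≤ 2≤p¹)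
      k₁ = Fin.fromℕ< 2≤p¹
      y₀ : y k₀ ≈ u
      y₀ rewrite Fin.toℕ-fromℕ< (ℕ.<⇒≤ 2≤p¹) = refl
      y₁ : y k₁ ≈ v
      y₁ rewrite Fin.toℕ-fromℕ< 2≤p¹ = refl
      y-≥2 : ∀ k → 2 ≤ toℕ k → y k ≈ 0#
      y-≥2 k le with toℕ k
      y-≥2 k (s≤s (s≤s le)) | suc (suc _) = refl
      all-zero : ∀ k → y k ≈ 0#
      all-zero = frob-independent 1 y (trans (two-terms (p ℕ.^ 1) _ 2≤p¹ λ k le → trans (*-congˡ (trans (φ-cong 1 (y-≥2 k le)) (φ-0 1))) (zeroʳ _))
        (trans (+-cong (*-cong (reflexive (≡.cong (z ^_) (Fin.toℕ-fromℕ< (ℕ.<⇒≤ 2≤p¹)))) (φ-cong 1 y₀)) (*-cong (reflexive (≡.cong (z ^_) (Fin.toℕ-fromℕ< 2≤p¹))) (φ-cong 1 y₁)))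
          (trans (+-cong (*-identityˡ _) (*-congʳ (*-identityʳ z))) eq)))

    private
      ⟦merge-∷⟧ : ∀ (e : Form Var) es ρ → ⟦ merge (e ∷ es) ⟧ ρ ≈ ⟦ e ⟧ ρ ^p^ 1 + z * ⟦ merge es ⟧ ρ ^p^ 1
      ⟦merge-∷⟧ e es ρ = trans (⟦⟧-++ (frobᶠ 1 e) (X ·ᶠ frobᶠ 1 (merge es)) ρ) (+-cong (⟦frob⟧ 1 e ρ)
        (trans (⟦·⟧ X (frobᶠ 1 (merge es)) ρ) (*-cong (Evaluation.ev-X (κ ∘ʰ ι) z) (⟦frob⟧ 1 (merge es) ρ))))

    merge-all : ∀ (es : List (Form Var)) ρ → ⟦ merge es ⟧ ρ ≈ 0# → All (λ e → ⟦ e ⟧ ρ ≈ 0#) es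
    merge-all []       ρ eq = []
    merge-all (e ∷ es) ρ eq = let u , v = independent-pair _ _ (trans (sym (⟦merge-∷⟧ e es ρ)) eq) in u ∷ merge-all es ρ v

    all-merge : ∀ (es : List (Form Var)) ρ → All (λ e → ⟦ e ⟧ ρ ≈ 0#) es → ⟦ merge es ⟧ ρ ≈ 0#
    all-merge []       ρ []          = ⟦⟧-[] ρ
    all-merge (e ∷ es) ρ (eq ∷ eqs) = trans (⟦merge-∷⟧ e es ρ) (trans (+-cong (trans (φ-cong 1 eq) (φ-0 1))
      (trans (*-congˡ (trans (φ-cong 1 (all-merge es ρ eqs)) (φ-0 1))) (zeroʳ z))) (+-identityˡ 0#))

    ⟦collect⟧ : ∀ {N} (φ : Form (Fin N)) x → ⟦ φ ⟧ x ≈ ∑ (allFin N) (λ i → ⟦ collect φ i ⟧ᵒ (x i))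
    ⟦collect⟧ {N} []               x = trans (⟦⟧-[] x) (sym (∑-zero (allFin N) λ i → ⟦[]⟧ᵒ (x i)))
    ⟦collect⟧ {N} (mono a j k ∷ φ) x = trans (⟦⟧-++ (term a j k) φ x) (trans (+-cong (trans (⟦term⟧ a j k x) (sym first)) (⟦collect⟧ φ x))
      (trans (sym (∑-+ (allFin N) _ _)) (∑-cong (allFin N) λ i → sym (⟦⊕⟧ᵒ _ (collect φ i) (x i)))))
      where
      ⟦if⟧ : ∀ i → ⟦ (if does (i Fin.≟ j) then comp (a ∷ []) P.PR.1# k else []) ⟧ᵒ (x i) ≈ only (i Fin.≟ j) (⟪ a ⟫ * x i ^p^ k)
      ⟦if⟧ i with i Fin.≟ j
      ... | yes _ = trans (⟦comp⟧ᵒ (a ∷ []) P.PR.1# k (x i)) (trans (⟦∷⟧ᵒ a [] _) (trans (+-cong (*-congˡ (trans (*-congʳ ⟪⟫.to-1) (*-identityˡ _))) (⟦[]⟧ᵒ _)) (+-identityʳ _)))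
      ... | no  _ = ⟦[]⟧ᵒ (x i)
      first : ∑ (allFin N) (λ i → ⟦ (if does (i Fin.≟ j) then comp (a ∷ []) P.PR.1# k else []) ⟧ᵒ (x i)) ≈ ⟪ a ⟫ * x j ^p^ k
      first = trans (∑-cong (allFin N) ⟦if⟧) (∑-only j (λ i → ⟪ a ⟫ * x i ^p^ k))

    ⟦clear⟧ : ∀ N (φ : Form Var) ρ → ⟦ clear N φ ⟧ (λ i → σ ^ N * ρ i) ≈ σ ^ (N ℕ.* p ℕ.^ proj₁ (max-exp φ)) * ⟦ φ ⟧ ρ
    ⟦clear⟧ N φ ρ = go φ (proj₂ (max-exp φ))
      where
      T = proj₁ (max-exp φ)
      c : Monomial _ → Monomial _
      c (mono a i k) = mono (s ^ᴾ (N ℕ.* (p ℕ.^ T ℕ.∸ p ℕ.^ k)) ⊗ a) i k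
      go : ∀ ψ → Exp≤ T ψ → ⟦ map c ψ ⟧ (λ i → σ ^ N * ρ i) ≈ σ ^ (N ℕ.* p ℕ.^ T) * ⟦ ψ ⟧ ρ
      go []               []         = trans (⟦⟧-[] _) (sym (trans (*-congˡ (⟦⟧-[] ρ)) (zeroʳ _)))
      go (mono a i k ∷ ψ) (le ∷ les) = begin
        ⟦ c (mono a i k) ∷ map c ψ ⟧ (λ i → σ ^ N * ρ i)
          ≈⟨ ⟦⟧-++ (term _ i k) (map c ψ) _ ⟩
        ⟦ term (s ^ᴾ e ⊗ a) i k ⟧ (λ i → σ ^ N * ρ i) + ⟦ map c ψ ⟧ (λ i → σ ^ N * ρ i)
          ≈⟨ +-cong (trans (⟦term⟧ _ i k _) (*-cong (trans (⟪⟫.to-* (s ^ᴾ e) a) (*-congʳ (⟪⟫.to-^ s e))) (trans (φ-* k _ _) (*-congʳ (trans (φ≈^ k _) (^-assocʳ σ N _)))))) (go ψ les) ⟩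
        (σ ^ e * ⟪ a ⟫) * (σ ^ (N ℕ.* p ℕ.^ k) * ρ i ^p^ k) + σ ^ (N ℕ.* p ℕ.^ T) * ⟦ ψ ⟧ ρ
          ≈⟨ +-congʳ (trans (S.solve 4 (λ a b c d → (a S.:* b) S.:* (c S.:* d) S.:= (a S.:* c) S.:* (b S.:* d)) refl _ _ _ _) (*-congʳ (trans (sym (^-homo-* σ e _)) (reflexive (≡.cong (σ ^_) exponent))))) ⟩
        σ ^ (N ℕ.* p ℕ.^ T) * (⟪ a ⟫ * ρ i ^p^ k) + σ ^ (N ℕ.* p ℕ.^ T) * ⟦ ψ ⟧ ρ
          ≈⟨ distribˡ _ _ _ ⟨
        σ ^ (N ℕ.* p ℕ.^ T) * (⟪ a ⟫ * ρ i ^p^ k + ⟦ ψ ⟧ ρ)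
          ≈⟨ *-congˡ (trans (⟦⟧-++ (term a i k) ψ ρ) (+-congʳ (⟦term⟧ a i k ρ))) ⟨
        σ ^ (N ℕ.* p ℕ.^ T) * ⟦ mono a i k ∷ ψ ⟧ ρ ∎
        where
        e = N ℕ.* (p ℕ.^ T ℕ.∸ p ℕ.^ k)
        exponent : e ℕ.+ N ℕ.* p ℕ.^ k ≡ N ℕ.* p ℕ.^ T
        exponent = ≡.trans (≡.sym (ℕ.*-distribˡ-+ N _ _)) (≡.cong (N ℕ.*_) (ℕ.m∸n+n≡m (ℕ.^-monoʳ-≤ p {{prime⇒nonZero p-prime}} le)))

    ⟦digit⟧ : ∀ {d} (c : Fin d → Var) ρ → ⟦ digit-form c ⟧ ρ ≈ ∑ (allFin d) (λ l → z ^ toℕ l * ρ (c l))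
    ⟦digit⟧ {d = d} c ρ = trans (⟦⟧-concatMap _ (allFin d) ρ) (∑-cong (allFin d) λ l → trans (⟦term⟧ _ (c l) 0 ρ) (*-congʳ (⟪X⟫ (toℕ l))))

    -- Avoiding values of additive polynomials.

    private
      empty : ∀ f → length f ≤ 0 → ∀ x → ⟦ f ⟧ᵒ x ≈ 0#
      empty [] z≤n = ⟦[]⟧ᵒ

      -- At z^M an exponent k ≤ j contributes at most M p^j to the degree, and the coefficient less
      -- than B.
      low-degree : ∀ f B j M → (∀ k → length (O.coeff f k) ≤ B) → length f ≤ suc j →
                   Σ[ g ∈ Q.Poly ] (Q.Deg< (B ℕ.+ M ℕ.* p ℕ.^ j) g × ⟦ f ⟧ᵒ (z ^ M) ≈ pol g)
      low-degree []      B j M le len = [] , (λ _ _ → Fᵣ.refl) , ⟦[]⟧ᵒ _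
      low-degree (a ∷ f) B j M le (s≤s len) with tail-degree j len
        where
        tail-degree : ∀ j → length f ≤ j → Σ[ g ∈ Q.Poly ] (Q.Deg< (B ℕ.+ M ℕ.* p ℕ.^ j) g × ⟦ f ⟧ᵒ ((z ^ M) ^ p) ≈ pol g)
        tail-degree zero    len = [] , (λ _ _ → Fᵣ.refl) , empty f len _
        tail-degree (suc j) len = let g , deg , eq = low-degree f B j (M ℕ.* p) (λ k → le (suc k)) len in
          g , ≡.subst (λ n → Q.Deg< (B ℕ.+ n) g) (ℕ.*-assoc M p (p ℕ.^ j)) deg , trans (⟦⟧ᵒ-cong f (^-assocʳ z M p)) eq
      ... | g , deg , eq = Q.X Q.^ᴾ M Q.⊗ lift a Q.⊕ g
        , Q.deg-⊕ (Q.X Q.^ᴾ M Q.⊗ lift a) g (Q.deg-mono (Q.X Q.^ᴾ M Q.⊗ lift a) head-le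
            (Q.deg-monic (lift a) (Q.monic-^ Q.monic-X M) (deg-lift a (P.deg-length a (le 0))))) deg
        , trans (⟦∷⟧ᵒ a f _) (trans (+-cong (trans (*-comm _ _) (sym (trans (pol-* _ _) (*-cong (trans (pol.to-^ Q.X M) (^-congˡ M (Evaluation.ev-X κ z))) (pol-lift a))))) eq) (sym (pol-+ _ g)))
        where
        head-le : M ℕ.* 1 ℕ.+ B ≤ B ℕ.+ M ℕ.* p ℕ.^ j
        head-le = ℕ.≤-trans (ℕ.≤-reflexive (ℕ.+-comm (M ℕ.* 1) B)) (ℕ.+-monoʳ-≤ B (ℕ.*-monoʳ-≤ M (ℕ.m^n>0 p {{prime⇒nonZero p-prime}} j)))

      coeff-bound : ∀ f → ∃[ B ] ∀ k → length (O.coeff f k) ≤ B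
      coeff-bound []      = 0 , λ k → z≤n
      coeff-bound (a ∷ f) = let B , le = coeff-bound f in length a ℕ.⊔ B , λ where
        zero    → ℕ.m≤m⊔n _ _
        (suc k) → ℕ.≤-trans (le k) (ℕ.m≤n⊔m (length a) B)

      z^φ : ∀ M d → (z ^ M) ^p^ d ≈ pol (Q.X Q.^ᴾ (M ℕ.* p ℕ.^ d))
      z^φ M d = trans (φ≈^ d (z ^ M)) (trans (^-assocʳ z M (p ℕ.^ d)) (sym (trans (pol.to-^ Q.X (M ℕ.* p ℕ.^ d)) (^-congˡ (M ℕ.* p ℕ.^ d) (Evaluation.ev-X κ z)))))

      -- The left side is z^(M p^d) b s^N. From position M p^d on it has the coefficients of b s^N,
      -- which the degree bound would make zero.
      leading-term : ∀ N d M b g → ¬ b ≈ᴾ [] → Q.Deg< (M ℕ.* p ℕ.^ d) g → ¬ σ ^ N * (⟪ b ⟫ * (z ^ M) ^p^ d) ≈ pol g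
      leading-term N d M b g b≉0 deg eq = Q.monic-≉0 (Q.monic-^ (monic-lift s-monic) N) (Q.deg-0 (cancel-degree (modulus b b≉0) 0 (lift s Q.^ᴾ N) (Q.deg-[] product≈0)))
        where
        m = M ℕ.* p ℕ.^ d
        shifted : Q.X Q.^ᴾ m Q.⊗ (lift b Q.⊗ lift s Q.^ᴾ N) Q.≈ᴾ g
        shifted = pol-injective {Q.X Q.^ᴾ m Q.⊗ (lift b Q.⊗ lift s Q.^ᴾ N)} {g} (begin
          pol (Q.X Q.^ᴾ m Q.⊗ (lift b Q.⊗ lift s Q.^ᴾ N))     ≈⟨ trans (pol-* _ _) (*-congˡ (trans (pol-* _ _) (*-cong (pol-lift b) (trans (pol.to-^ (lift s) N) (^-congˡ N σ≈))))) ⟩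
          pol (Q.X Q.^ᴾ m) * (⟪ b ⟫ * σ ^ N)                  ≈⟨ *-congʳ (z^φ M d) ⟨
          (z ^ M) ^p^ d * (⟪ b ⟫ * σ ^ N)                     ≈⟨ S.solve 3 (λ x b s → x S.:* (b S.:* s) S.:= s S.:* (b S.:* x)) refl _ _ _ ⟩
          σ ^ N * (⟪ b ⟫ * (z ^ M) ^p^ d)                     ≈⟨ eq ⟩
          pol g                                               ∎)
        product≈0 : lift b Q.⊗ lift s Q.^ᴾ N Q.≈ᴾ []
        product≈0 = Q.coeffwise λ n → Fᵣ.trans (Fᵣ.sym (Q.coeff-X^* m (lift b Q.⊗ lift s Q.^ᴾ N) n)) (Fᵣ.trans (Q.at shifted (m ℕ.+ n)) (deg (m ℕ.+ n) (ℕ.m≤m+n m n)))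

    -- The degree of the leading term of f(z^M) is at least M p^d, while the other terms stay within
    -- a constant of M p^(d-1); for large M it exceeds these and the degree of t.
    avoid-value : ∀ f t → ¬ f O.≈ᴾ [] → ∃[ M₀ ] ∀ M → M₀ ≤ M → ¬ ⟦ f ⟧ᵒ (z ^ M) ≈ t
    avoid-value f t f≉0 with ore-top f
    ... | inj₁ f≈0 = ⊥-elim (f≉0 f≈0)
    ... | inj₂ (d , b≉0 , deg) = M₀ , λ M le eq → leading-term N d M (O.coeff f d) (g M le) b≉0 (g-degree M le) (equation M le eq)
      where
      N = proj₁ (Bd-exists t)
      t-bound = proj₂ (Bd-exists t)
      low = take d f
      B = proj₁ (coeff-bound low)
      -- The first summand bounds the numerator of t. The second is the excess of s^N times the
      -- lower terms over M p^(d-1), which the difference of the two powers must cover.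
      M₀ = N ℕ.* h ℕ.+ (N ℕ.* ds ℕ.+ B)
      low-length : length low ≤ d
      low-length = ℕ.≤-trans (ℕ.≤-reflexive (length-take d f)) (ℕ.m⊓n≤m d (length f))
      low-part : ∀ d → length low ≤ d → ∀ M → M₀ ≤ M → Σ[ g ∈ Q.Poly ] (Q.Deg< (M ℕ.* p ℕ.^ d) (lift s Q.^ᴾ N Q.⊗ g) × ⟦ low ⟧ᵒ (z ^ M) ≈ pol g)
      low-part zero    len M le = [] , Q.deg-[] (Q.PR.zeroʳ _) , empty low len _
      low-part (suc d) len M le = let g , deg , eq = low-degree low B d M (proj₂ (coeff-bound low)) len in
        g , Q.deg-mono (lift s Q.^ᴾ N Q.⊗ g) fits (Q.deg-monic g (Q.monic-^ (monic-lift s-monic) N) deg) , eq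
        where
        1≤p^d : 1 ≤ p ℕ.^ d
        1≤p^d = ℕ.m^n>0 p {{prime⇒nonZero p-prime}} d
        fits : N ℕ.* ds ℕ.+ (B ℕ.+ M ℕ.* p ℕ.^ d) ≤ M ℕ.* p ℕ.^ suc d
        fits = ℕ.≤-trans (ℕ.≤-reflexive (≡.sym (ℕ.+-assoc (N ℕ.* ds) B _)))
          (ℕ.≤-trans (ℕ.+-monoˡ-≤ (M ℕ.* p ℕ.^ d) (ℕ.≤-trans (ℕ.≤-trans (ℕ.m≤n+m _ (N ℕ.* h)) le) (ℕ.m≤m*n M (p ℕ.^ d) {{ℕ.>-nonZero 1≤p^d}})))
          (ℕ.≤-trans (ℕ.≤-reflexive (double M (p ℕ.^ d))) (ℕ.*-monoʳ-≤ M (ℕ.*-monoˡ-≤ (p ℕ.^ d) (ℕ.nonTrivial⇒n>1 p {{prime⇒nonTrivial p-prime}})))))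
          where
          double : ∀ M x → M ℕ.* x ℕ.+ M ℕ.* x ≡ M ℕ.* (2 ℕ.* x)
          double = solve-∀
      top-degree : ∀ M → M₀ ≤ M → Q.Deg< (M ℕ.* p ℕ.^ d) (numerator t-bound)
      top-degree M le = Q.deg-mono (numerator t-bound) (ℕ.≤-trans (ℕ.≤-trans (ℕ.m≤m+n _ (N ℕ.* ds ℕ.+ B)) le)
        (ℕ.m≤m*n M (p ℕ.^ d) {{ℕ.>-nonZero (ℕ.m^n>0 p {{prime⇒nonZero p-prime}} d)}})) (num-degree t-bound)
      low-poly : ∀ M → M₀ ≤ M → Q.Poly
      low-poly M le = proj₁ (low-part d low-length M le)
      g : ∀ M → M₀ ≤ M → Q.Poly
      g M le = numerator t-bound Q.⊕ Q.⊝ (lift s Q.^ᴾ N Q.⊗ low-poly M le)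
      g-degree : ∀ M le → Q.Deg< (M ℕ.* p ℕ.^ d) (g M le)
      g-degree M le = Q.deg-⊕ (numerator t-bound) _ (top-degree M le)
        (Q.deg-⊝ (lift s Q.^ᴾ N Q.⊗ low-poly M le) (proj₁ (proj₂ (low-part d low-length M le))))
      d<length : d ℕ.< length f
      d<length with length f ℕ.≤? d
      ... | yes le = ⊥-elim (b≉0 (P.PR.reflexive (PolynomialRing.coeff-≥ P.polynomialRing f d le)))
      ... | no  ≰  = ℕ.≰⇒> ≰
      split-top : ∀ x → ⟦ f ⟧ᵒ x ≈ ⟦ low ⟧ᵒ x + ⟪ O.coeff f d ⟫ * x ^p^ d
      split-top x = trans (⟦≈⟧ᵒ x (O.PR.sym (O.take-≈ (suc d) f deg))) (trans (⟦last⟧ᵒ d (take (suc d) f) len x)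
          (+-cong (reflexive (≡.cong (λ g → ⟦ g ⟧ᵒ x) (take-take d f))) (*-congʳ (⟪⟫.to-cong (PolynomialRing.at (O.take-≈ (suc d) f deg) d)))))
        where
        len : length (take (suc d) f) ≡ suc d
        len = ≡.trans (length-take (suc d) f) (ℕ.m≤n⇒m⊓n≡m d<length)
        take-take : ∀ d (f : Ore) → take d (take (suc d) f) ≡ take d f
        take-take zero    f       = ≡.refl
        take-take (suc d) []      = ≡.refl
        take-take (suc d) (a ∷ f) = ≡.cong (a ∷_) (take-take d f)
      equation : ∀ M le → ⟦ f ⟧ᵒ (z ^ M) ≈ t → σ ^ N * (⟪ O.coeff f d ⟫ * (z ^ M) ^p^ d) ≈ pol (g M le)
      equation M le eq = begin
        σ ^ N * y                                                      ≈⟨ S.solve 3 (λ s l y → s S.:* y S.:= s S.:* (l S.:+ y) S.:+ S.:- (s S.:* l)) refl (σ ^ N) (⟦ low ⟧ᵒ (z ^ M)) y ⟩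
        σ ^ N * (⟦ low ⟧ᵒ (z ^ M) + y) + - (σ ^ N * ⟦ low ⟧ᵒ (z ^ M))  ≈⟨ +-cong (trans (*-congˡ (trans (sym (split-top (z ^ M))) eq)) (num-≈ t-bound))
                                                                            (-‿cong (trans (*-congˡ (proj₂ (proj₂ (low-part d low-length M le)))) (pol-σ^ N (low-poly M le)))) ⟩
        pol (numerator t-bound) + - pol (lift s Q.^ᴾ N Q.⊗ low-poly M le)
                                                                       ≈⟨ trans (pol-+ _ _) (+-congˡ (pol.to-neg _)) ⟨
        pol (g M le)                                                   ∎
        where
        y = ⟪ O.coeff f d ⟫ * (z ^ M) ^p^ d

    -- Coordinates are chosen one after another. The first is a power of z large enough for all
    -- forms in which it occurs; forms that involve later coordinates pass on with the target
    -- shifted by its contribution.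
    avoid-values : ∀ N m (ν : Fin m → Fin N → Ore) (t : Fin m → Carrier) →
      Σ[ x ∈ (Fin N → Carrier) ] (∀ j → (∃[ i ] ¬ ν j i O.≈ᴾ []) → ¬ ∑ (allFin N) (λ i → ⟦ ν j i ⟧ᵒ (x i)) ≈ t j)
    avoid-values zero    m ν t = (λ ()) , λ { j (() , _) }
    avoid-values (suc N) m ν t = x , avoids
      where
      threshold : Fin m → ℕ
      threshold j with ore-≟0 (ν j zero)
      ... | yes _  = 0
      ... | no  ≉0 = proj₁ (avoid-value (ν j zero) (t j) ≉0)
      M₀ = proj₁ (Fin-bound m threshold)
      x₀ = z ^ M₀
      head-avoids : ∀ j → ¬ ν j zero O.≈ᴾ [] → ¬ ⟦ ν j zero ⟧ᵒ x₀ ≈ t j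
      head-avoids j ≉0 with ore-≟0 (ν j zero) | proj₂ (Fin-bound m threshold) j
      ... | yes ≈0 | _  = ⊥-elim (≉0 ≈0)
      ... | no  ≉0 | le = proj₂ (avoid-value (ν j zero) (t j) ≉0) M₀ le
      rest = avoid-values N m (λ j i → ν j (suc i)) (λ j → t j + - ⟦ ν j zero ⟧ᵒ x₀)
      x : Fin (suc N) → Carrier
      x zero    = x₀
      x (suc i) = proj₁ rest i
      avoids : ∀ j → (∃[ i ] ¬ ν j i O.≈ᴾ []) → ¬ ∑ (allFin (suc N)) (λ i → ⟦ ν j i ⟧ᵒ (x i)) ≈ t j
      avoids j (i , νi≉0) eq with Fin.any? (λ i → ¬? (ore-≟0 (ν j (suc i))))
      ... | yes nz = proj₂ rest j nz (trans (S.solve 2 (λ a b → b S.:= (a S.:+ b) S.:+ S.:- a) refl (⟦ ν j zero ⟧ᵒ x₀) _)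
                       (+-congʳ (trans (sym (∑-allFin-suc N _)) eq)))
      ... | no none = head-avoids j (head≉0 i νi≉0) (trans (sym (+-identityʳ _)) (trans (+-congˡ (sym (∑-zero (allFin N) λ i →
                        trans (⟦≈⟧ᵒ _ (tail≈0 i)) (⟦[]⟧ᵒ _)))) (trans (sym (∑-allFin-suc N (λ i → ⟦ ν j i ⟧ᵒ (x i)))) eq)))
        where
        tail≈0 : ∀ i → ν j (suc i) O.≈ᴾ []
        tail≈0 i = decidable-stable (ore-≟0 (ν j (suc i))) λ ≉0 → none (i , ≉0)
        head≉0 : ∀ i → ¬ ν j i O.≈ᴾ [] → ¬ ν j zero O.≈ᴾ []
        head≉0 zero    ≉0 = ≉0
        head≉0 (suc i) ≉0 = ⊥-elim (none (i , ≉0))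

    -- Meaning of conditions and definitions.

    fieldF : Field a
    fieldF = record { commutativeRing = F ; 1≉0 = DecidableField.1≉0 field-F ; inverse = DecidableField.inverse field-F }

    Holds : ∀ {A B : Set} → Condition A B → (A → Carrier) → (B → Fᵣ.Carrier) → Set a
    Holds (vanishes i)       η c = η i ≈ 0#
    Holds (linear φ b)       η c = ⟦ φ ⟧ (κ.to ∘ c) + ⟪ b ⟫ ≈ 0#
    Holds (satisfies φ i)    η c = fieldStructure p fieldF ⊨ φ [ Vec.tabulate (c ∘ i) ]
    Holds trueᵇ              η c = Lift a ⊤
    Holds (negᵇ β)           η c = ¬ Holds β η c
    Holds (β ∧ᵇ γ)           η c = Holds β η c × Holds γ η c
    Holds (β ∨ᵇ γ)           η c = Holds β η c ⊎ Holds γ η c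
    Holds (exᵇ {C} _ β)      η c = Σ[ d ∈ (C → Fᵣ.Carrier) ] Holds β η [ c , d ]′
    Holds (rename f g β)     η c = Holds β (η ∘ f) (c ∘ g)
    -- Only the vanishing of η matters, so 0 and 1 represent the two cases.
    Holds (fix zeros β)      η c = Holds β (λ i → if zeros i then 0# else 1#) c

    allᵇ⁻ : ∀ {A B : Set} n {β : Fin n → Condition A B} {η c} → Holds (allᵇ n β) η c → ∀ k → Holds (β k) η c
    allᵇ⁻ (suc n) (hd , tl) zero    = hd
    allᵇ⁻ (suc n) (hd , tl) (suc k) = allᵇ⁻ n tl k

    allᵇ⁺ : ∀ {A B : Set} n {β : Fin n → Condition A B} {η c} → (∀ k → Holds (β k) η c) → Holds (allᵇ n β) η c
    allᵇ⁺ zero    hs = Level.lift tt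
    allᵇ⁺ (suc n) hs = hs zero , allᵇ⁺ n (hs ∘ suc)

    whenᵇ⁺ : ∀ {A B : Set} b {β : Condition A B} {η c} → (b ≡ true → Holds β η c) → Holds (whenᵇ b β) η c
    whenᵇ⁺ true  holds = holds ≡.refl
    whenᵇ⁺ false holds = Level.lift tt

    whenᵇ⁻ : ∀ {A B : Set} b {β : Condition A B} {η c} → Holds (whenᵇ b β) η c → b ≡ true → Holds β η c
    whenᵇ⁻ true holds _ = holds

    holds-ext : ∀ {A B : Set} (β : Condition A B) {η η′ c c′} → (∀ i → η i ≈ 0# → η′ i ≈ 0#) → (∀ i → η′ i ≈ 0# → η i ≈ 0#) →
                (∀ i → c i ≡ c′ i) → Holds β η c → Holds β η′ c′
    holds-ext (vanishes i)    f g eq h = f i h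
    holds-ext (linear φ b)    f g eq h = trans (+-congʳ (⟦⟧-cong φ λ i → reflexive (≡.cong κ.to (≡.sym (eq i))))) h
    holds-ext (satisfies φ i) f g eq h = ≡.subst (λ v → fieldStructure p fieldF ⊨ φ [ v ]) (Vec.tabulate-cong λ k → eq (i k)) h
    holds-ext trueᵇ           f g eq h = h
    holds-ext (negᵇ β)        f g eq h h′ = h (holds-ext β g f (λ i → ≡.sym (eq i)) h′)
    holds-ext (β ∧ᵇ γ)        f g eq (h , h′) = holds-ext β f g eq h , holds-ext γ f g eq h′
    holds-ext (β ∨ᵇ γ)        f g eq (inj₁ h) = inj₁ (holds-ext β f g eq h)
    holds-ext (β ∨ᵇ γ)        f g eq (inj₂ h) = inj₂ (holds-ext γ f g eq h)
    holds-ext (exᵇ _ β)       f g eq (d , h) = d , holds-ext β f g (λ { (inj₁ i) → eq i ; (inj₂ i) → ≡.refl }) h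
    holds-ext (rename f′ g′ β) f g eq h = holds-ext β (λ i → f (f′ i)) (λ i → g (f′ i)) (λ i → eq (g′ i)) h
    holds-ext (fix zeros β)   f g eq h = holds-ext β (λ _ → id) (λ _ → id) eq h

    environment : ∀ {K A B : Set} → (K → Carrier) → (A → Carrier) → (B → Fᵣ.Carrier) → K ⊎ (A ⊎ B) → Carrier
    environment ρ η c = [ ρ , [ η , κ.to ∘ c ]′ ]′

    Solves : ∀ {K A B : Set} → List (Form (K ⊎ (A ⊎ B))) → (K → Carrier) → (A → Carrier) → (B → Fᵣ.Carrier) → Set a
    Solves es ρ η c = All (λ e → ⟦ e ⟧ (environment ρ η c) ≈ 0#) es

    -- `necessary` and `sufficient` speak of every solution, not of some solution;
    -- `negation-defines` rests on this symmetry.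
    record Defines {K : Set} (D : Definition K) (θ : (K → Carrier) → Set a) : Set a where
      open Definition D
      field
        solvable   : ∀ ρ → Σ[ η ∈ (A → Carrier) ] Σ[ c ∈ (B → Fᵣ.Carrier) ] Solves equations ρ η c
        necessary  : ∀ ρ η c → Solves equations ρ η c → θ ρ → Holds condition η c
        sufficient : ∀ ρ η c → Solves equations ρ η c → Holds condition η c → θ ρ

    ⟦⟧-split : ∀ {I : Set} (φ : Form I) {ρ ρ₁ ρ₂} → (∀ i → ρ i ≈ ρ₁ i + ρ₂ i) → ⟦ φ ⟧ ρ ≈ ⟦ φ ⟧ ρ₁ + ⟦ φ ⟧ ρ₂
    ⟦⟧-split φ {ρ} {ρ₁} {ρ₂} eq = trans (⟦⟧-cong φ eq) (⟦⟧-+ φ ρ₁ ρ₂)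

    ⟦digit⟧κ : ∀ {I : Set} {d} (l : Fin d → I) (c : I → Fᵣ.Carrier) → ⟦ digit-form l ⟧ (κ.to ∘ c) ≈ digit-∑ (c ∘ l)
    ⟦digit⟧κ l c = ⟦digit⟧ l (κ.to ∘ c)

    module DecompositionMeaning (N : ℕ) (1≤N : 1 ≤ N) where
      open Decomposition N 1≤N

      Decomposes : Carrier → Carrier → (Fin width → Fᵣ.Carrier) → Set a
      Decomposes w η c = σ ^ N * w ≈ ⟪ b ⟫ * η + digit-∑ c

      ⟦decomposition⟧ : ∀ {I : Set} (τ : Form I) η (c : Fin width → I) ρ →
        ⟦ decomposition τ η c ⟧ ρ ≈ σ ^ N * ⟦ τ ⟧ ρ + - (⟪ b ⟫ * ρ η + ∑ (allFin width) (λ l → z ^ toℕ l * ρ (c l)))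
      ⟦decomposition⟧ τ η c ρ = trans (⟦⟧-++ (s ^ᴾ N ·ᶠ τ) _ ρ) (+-cong (trans (⟦·⟧ (s ^ᴾ N) τ ρ) (*-congʳ (⟪⟫.to-^ s N)))
        (trans (⟦-⟧ ((b ·ᶠ variable-form η) ++ digit-form c) ρ) (-‿cong (trans (⟦⟧-++ (b ·ᶠ variable-form η) (digit-form c) ρ)
          (+-cong (trans (⟦·⟧ b (variable-form η) ρ) (*-congˡ (⟦variable⟧ η ρ))) (⟦digit⟧ c ρ))))))

      decompose : ∀ w → Σ[ η ∈ Carrier ] Σ[ c ∈ (Fin width → Fᵣ.Carrier) ] Decomposes w η c
      decompose w = let η , r , len , eq = division (coprime-modulus L 1≤L) (σ ^ N * w) in
        η , (λ l → Q.coeff r (toℕ l)) , trans eq (+-congˡ (pol≈digit-∑ r (Q.deg-length r len)))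

      bounded-vanishes : ∀ {w η c} → Bd N w → Decomposes w η c → η ≈ 0#
      bounded-vanishes {w} {η} {c} bd eq = decomposition-unique N L 1≤L {r = tabulate c} (ℕ.m≤n+m L ds) bd (deg-tabulate c)
        (trans eq (+-congˡ (digit-∑≈pol c)))

      digit-value : (Fin width → Fᵣ.Carrier) → Carrier
      digit-value c = σ⁻ ^ N * digit-∑ c

      digit-value-≈ : ∀ {w η c} → Decomposes w η c → η ≈ 0# → digit-value c ≈ w
      digit-value-≈ {w} eq η≈0 = σ^-injective N (trans (σ^-cancel′ N _) (sym (trans eq (trans (+-congʳ (trans (*-congˡ η≈0) (zeroʳ _))) (+-identityˡ _)))))

      bounded-digits : ∀ {w} → Bd N w → Σ[ c ∈ (Fin width → Fᵣ.Carrier) ] digit-value c ≈ w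
      bounded-digits (bounded g deg eq) = (λ l → Q.coeff g (toℕ l)) , σ^-injective N (trans (σ^-cancel′ N _)
        (trans (sym (pol≈digit-∑ {width} g (Q.deg-mono g (ℕ.m≤n+m L ds) deg))) (sym eq)))

    does-true : ∀ {ℓ} {P : Set ℓ} (P? : Dec P) → does P? ≡ true → P
    does-true (yes p) _ = p

    true-does : ∀ {ℓ} {P : Set ℓ} (P? : Dec P) → P → does P? ≡ true
    true-does (yes _) _ = ≡.refl
    true-does (no ¬p) p = ⊥-elim (¬p p)

    ∧-true : ∀ {x y} → x ∧ y ≡ true → (x ≡ true) × (y ≡ true)
    ∧-true {true} {true} _ = ≡.refl , ≡.refl

    -- Correctness of the elimination.

    NormalSolvable : ∀ {K X₀ B C : Set} {q m : ℕ} (eK : Form K) (nf : Form (Fin q)) (gC : Form C) (eB : Form B)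
      (bound-part : X₀ → Form (Fin q ⊎ C)) (free-part : X₀ → Form (Fin m)) (dummy : Fin q → Bool) (J : X₀ → Bool)
      (side : Condition ⊥ B) → (K → Carrier) → Set a
    NormalSolvable {B = B} {C} {q} {m} eK nf gC eB bound-part free-part dummy J side ρ =
      Σ[ x ∈ (Fin q → Carrier) ] Σ[ y ∈ (Fin m → Carrier) ] Σ[ c ∈ (C → Fᵣ.Carrier) ] Σ[ d ∈ (B → Fᵣ.Carrier) ]
        (∀ k → dummy k ≡ true → x k ≈ 0#) ×
        (⟦ eK ⟧ ρ + (⟦ nf ⟧ x + ⟦ gC ⟧ (κ.to ∘ c))) + ⟦ eB ⟧ (κ.to ∘ d) ≈ 0# ×
        Holds side (λ ()) d ×
        (∀ t → J t ≡ true → ¬ ⟦ bound-part t ⟧ [ x , κ.to ∘ c ]′ + ⟦ free-part t ⟧ y ≈ 0#)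

    module NormalEliminationMeaning {K X₀ B C : Set} {q m : ℕ} (finite-X : Finite X₀) (finite-B : Finite B) (finite-C : Finite C)
      (eK : Form K) (nf : Form (Fin q)) (gC : Form C) (eB : Form B)
      (bound-part : X₀ → Form (Fin q ⊎ C)) (free-part : X₀ → Form (Fin m)) (dummy : Fin q → Bool) (J : X₀ → Bool)
      (Nv : ℕ) (solution-bound : ℕ → ℕ) (side : Condition ⊥ B)
      (remainder : ∀ y → Σ[ x ∈ (Fin q → Carrier) ] Bd Nv (y + - ⟦ nf ⟧ x))
      (bounded-solution : ∀ N₁ (x : Fin q → Carrier) → Bd N₁ (⟦ nf ⟧ x) → ∀ k → Bd (solution-bound N₁) (x k)) where
      open NormalElimination finite-X finite-B finite-C eK nf gC eB bound-part free-part dummy J Nv solution-bound side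
      open Finite finite-X using (element; element-index) renaming (cardinality to NX; index to indexX)
      open DecompositionMeaning N (s≤s z≤n)

      Normal : (K → Carrier) → Set a
      Normal = NormalSolvable eK nf gC eB bound-part free-part dummy J side

      ⟦τ⟧ : ∀ x (y : Fin q → Carrier) → ⟦ τ (inj₂ x) ⟧ y ≈ ⟦ bound-part x ⟧ [ y , (λ _ → 0#) ]′
      ⟦τ⟧ x y = trans (⟦sub⟧ _ (bound-part x) y) (⟦⟧-cong (bound-part x) λ { (inj₁ k) → ⟦variable⟧ k y ; (inj₂ _) → ⟦⟧-[] y })

      bound-part-+ : ∀ x (x₀ d : Fin q → Carrier) c → ⟦ bound-part x ⟧ [ (λ k → x₀ k + d k) , c ]′ ≈ ⟦ bound-part x ⟧ [ d , c ]′ + ⟦ τ (inj₂ x) ⟧ x₀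
      bound-part-+ x x₀ d c = trans (⟦⟧-split (bound-part x) {ρ₁ = [ d , c ]′} {ρ₂ = [ x₀ , (λ _ → 0#) ]′} λ where
          (inj₁ k) → +-comm _ _
          (inj₂ l) → sym (+-identityʳ _))
        (+-congˡ (sym (⟦τ⟧ x x₀)))

      bound-of-≤ : ∀ {I : Set} n (φ : Form I) {ρ} → (∀ i → Bd n (ρ i)) → Bd (bound-of n φ) (⟦ φ ⟧ ρ)
      bound-of-≤ n φ = Bd-⟦⟧ (proj₁ (max-exp φ)) φ (proj₂ (max-exp φ))

      value : (B′ ⊎ Cx → Fᵣ.Carrier) → I → Carrier
      value c i = σ⁻ ^ N * ⟦ π i ⟧ (κ.to ∘ c)

      holds-at-π⁻ : ∀ φ η c → Holds (holds-at-π φ) η c → ⟦ φ ⟧ (value c) ≈ 0#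
      holds-at-π⁻ φ η c h = σ^-injective (N ℕ.* p ℕ.^ proj₁ (max-exp φ)) (trans (sym (⟦clear⟧ N φ (value c)))
        (trans (⟦⟧-cong (clear N φ) λ i → σ^-cancel′ N _) (trans (sym (⟦sub⟧ π (clear N φ) (κ.to ∘ c))) (trans (trans (sym (+-identityʳ _)) h) (sym (zeroʳ _))))))

      holds-at-π⁺ : ∀ φ η c → ⟦ φ ⟧ (value c) ≈ 0# → Holds (holds-at-π φ) η c
      holds-at-π⁺ φ η c eq = trans (+-identityʳ _) (trans (⟦sub⟧ π (clear N φ) (κ.to ∘ c)) (trans (⟦⟧-cong (clear N φ) λ i → sym (σ^-cancel′ N _))
        (trans (⟦clear⟧ N φ (value c)) (trans (*-congˡ eq) (zeroʳ _)))))

      Nv≤N : Nv ≤ N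
      Nv≤N = ℕ.m≤n⇒m≤1+n (ℕ.m≤m+n Nv (N₂ ℕ.+ N₃))

      N₂≤N : N₂ ≤ N
      N₂≤N = ℕ.m≤n⇒m≤1+n (ℕ.≤-trans (ℕ.m≤m+n N₂ N₃) (ℕ.m≤n+m (N₂ ℕ.+ N₃) Nv))

      N₃≤N : N₃ ≤ N
      N₃≤N = ℕ.m≤n⇒m≤1+n (ℕ.≤-trans (ℕ.m≤n+m N₃ N₂) (ℕ.m≤n+m (N₂ ℕ.+ N₃) Nv))

      module Solution (ρ : K → Carrier) (η : A′ → Carrier) (c : B′ → Fᵣ.Carrier) (solves : Solves (Definition.equations eliminated) ρ η c) where
        x₀ : Fin q → Carrier
        x₀ k = η (inj₁ k)

        v : Carrier
        v = σ⁻ ^ Nv * digit-∑ (λ l → c (inj₁ l))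

        v-bound : Bd Nv v
        v-bound = bounded (tabulate (λ l → c (inj₁ l))) (deg-tabulate (λ l → c (inj₁ l))) (trans (σ^-cancel′ Nv _) (digit-∑≈pol (λ l → c (inj₁ l))))

        remainder-≈ : (⟦ eK ⟧ ρ + ⟦ nf ⟧ x₀) + v ≈ 0#
        remainder-≈ = σ^-injective Nv (trans (distribˡ _ _ _) (trans (+-congˡ (σ^-cancel′ Nv _)) (trans (sym equation) (trans (All.head solves) (sym (zeroʳ _))))))
          where
          ρ′ = environment ρ η c
          equation : ⟦ remainder-equation ⟧ ρ′ ≈ σ ^ Nv * (⟦ eK ⟧ ρ + ⟦ nf ⟧ x₀) + digit-∑ (λ l → c (inj₁ l))
          equation = trans (⟦⟧-++ (s ^ᴾ Nv ·ᶠ (relabel inj₁ eK ++ relabel (inj₂ ∘ inj₁ ∘ inj₁) nf)) (digit-form (inj₂ ∘ inj₂ ∘ inj₁)) ρ′)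
            (+-cong (trans (⟦·⟧ (s ^ᴾ Nv) (relabel inj₁ eK ++ relabel (inj₂ ∘ inj₁ ∘ inj₁) nf) ρ′) (*-cong (⟪⟫.to-^ s Nv) (trans (⟦⟧-++ (relabel inj₁ eK) (relabel (inj₂ ∘ inj₁ ∘ inj₁) nf) ρ′)
              (+-cong (⟦relabel⟧ inj₁ eK ρ′) (⟦relabel⟧ (inj₂ ∘ inj₁ ∘ inj₁) nf ρ′))))) (⟦digit⟧ (inj₂ ∘ inj₂ ∘ inj₁) ρ′))

        decomposes : ∀ t → Decomposes (⟦ τ t ⟧ x₀) (η (inj₂ t)) (λ l → c (inj₂ (t , l)))
        decomposes t = trans (S.solve 2 (λ a b → a S.:= (a S.:+ S.:- b) S.:+ b) refl _ (⟪ b ⟫ * η (inj₂ t) + digit-∑ (λ l → c (inj₂ (t , l)))))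
          (trans (+-congʳ (trans (sym equation) zero′)) (+-identityˡ _))
          where
          open Finite finite-T renaming (element to elementT; index to indexT; element-index to elementT-indexT)
          ρ′ = environment ρ η c
          zero′ : ⟦ t-equation t ⟧ ρ′ ≈ 0#
          zero′ = ≡.subst (λ t → ⟦ t-equation t ⟧ ρ′ ≈ 0#) (elementT-indexT t)
            (∀-finite (Finite.cardinality finite-T) (t-equation ∘ elementT) (All.tail solves) (indexT t))
          equation : ⟦ t-equation t ⟧ ρ′ ≈ σ ^ N * ⟦ τ t ⟧ x₀ + - (⟪ b ⟫ * η (inj₂ t) + digit-∑ (λ l → c (inj₂ (t , l))))
          equation = trans (⟦decomposition⟧ (relabel (inj₂ ∘ inj₁ ∘ inj₁) (τ t)) (inj₂ (inj₁ (inj₂ t))) (λ l → inj₂ (inj₂ (inj₂ (t , l)))) ρ′)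
            (+-congʳ (*-congˡ (⟦relabel⟧ (inj₂ ∘ inj₁ ∘ inj₁) (τ t) ρ′)))

        module WithDigits (cx : Cx → Fᵣ.Carrier) where
          c″ : B′ ⊎ Cx → Fᵣ.Carrier
          c″ = [ c , cx ]′

          d : Fin q → Carrier
          d k = value c″ (inj₁ (inj₁ k))

          cC : C → Fᵣ.Carrier
          cC i = cx (inj₂ (inj₁ i))

          cB : B → Fᵣ.Carrier
          cB i = cx (inj₂ (inj₂ i))

          value-d : ∀ k → d k ≈ digit-value (λ l → cx (inj₁ (k , l)))
          value-d k = *-congˡ (⟦digit⟧κ (λ l → inj₂ (inj₁ (k , l))) c″)

          value-c : ∀ i → value c″ (inj₁ (inj₂ i)) ≈ κ.to (cx (inj₂ i))
          value-c i = trans (*-congˡ (trans (⟦·⟧ (s ^ᴾ N) (variable-form (inj₂ (inj₂ i))) (κ.to ∘ c″)) (*-cong (⟪⟫.to-^ s N) (⟦variable⟧ (inj₂ (inj₂ i)) (κ.to ∘ c″))))) (σ^-cancel N _)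

          value-v : value c″ (inj₂ (inj₁ tt)) ≈ v
          value-v = σ^-injective N (begin
            σ ^ N * value c″ (inj₂ (inj₁ tt))                                  ≈⟨ σ^-cancel′ N _ ⟩
            ⟦ s ^ᴾ (N ℕ.∸ Nv) ·ᶠ digit-form (λ l → inj₁ (inj₁ l)) ⟧ (κ.to ∘ c″)  ≈⟨ trans (⟦·⟧ (s ^ᴾ (N ℕ.∸ Nv)) (digit-form (λ l → inj₁ (inj₁ l))) (κ.to ∘ c″)) (*-cong (⟪⟫.to-^ s (N ℕ.∸ Nv)) (⟦digit⟧κ (λ l → inj₁ (inj₁ l)) c″)) ⟩
            σ ^ (N ℕ.∸ Nv) * digit-∑ (λ l → c (inj₁ l))                        ≈⟨ *-congˡ (σ^-cancel′ Nv _) ⟨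
            σ ^ (N ℕ.∸ Nv) * (σ ^ Nv * v)                                      ≈⟨ *-assoc _ _ _ ⟨
            (σ ^ (N ℕ.∸ Nv) * σ ^ Nv) * v                                      ≈⟨ *-congʳ (trans (sym (^-homo-* σ (N ℕ.∸ Nv) Nv)) (reflexive (≡.cong (σ ^_) (ℕ.m∸n+n≡m Nv≤N)))) ⟩
            σ ^ N * v                                                          ∎)

          value-t : ∀ t → η (inj₂ t) ≈ 0# → value c″ (inj₂ (inj₂ t)) ≈ ⟦ τ t ⟧ x₀
          value-t t η≈0 = trans (*-congˡ (⟦digit⟧κ (λ l → inj₁ (inj₂ (t , l))) c″)) (digit-value-≈ (decomposes t) η≈0)

          ⟦main⟧ : ⟦ main-form ⟧ (value c″) ≈ (⟦ nf ⟧ d + ⟦ gC ⟧ (κ.to ∘ cC)) + (⟦ eB ⟧ (κ.to ∘ cB) + - v)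
          ⟦main⟧ = trans (⟦⟧-++ (n′ ++ g′) (b′ ++ v′) w) (+-cong
            (trans (⟦⟧-++ n′ g′ w) (+-cong (⟦relabel⟧ (inj₁ ∘ inj₁) nf w)
              (trans (⟦relabel⟧ (inj₁ ∘ inj₂ ∘ inj₁) gC w) (⟦⟧-cong gC λ i → value-c (inj₁ i)))))
            (trans (⟦⟧-++ b′ v′ w) (+-cong (trans (⟦relabel⟧ (inj₁ ∘ inj₂ ∘ inj₂) eB w) (⟦⟧-cong eB λ i → value-c (inj₂ i)))
              (trans (⟦-⟧ (variable-form (inj₂ (inj₁ tt))) w) (-‿cong (trans (⟦variable⟧ (inj₂ (inj₁ tt)) w) value-v))))))
            where
            w : I → Carrier
            w = value c″
            n′ g′ b′ v′ : Form I
            n′ = relabel (inj₁ ∘ inj₁) nf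
            g′ = relabel (inj₁ ∘ inj₂ ∘ inj₁) gC
            b′ = relabel (inj₁ ∘ inj₂ ∘ inj₂) eB
            v′ = -ᶠ variable-form (inj₂ (inj₁ tt))

          ⟦dummy⟧ : ∀ k → ⟦ dummy-form k ⟧ (value c″) ≈ d k + value c″ (inj₂ (inj₂ (inj₁ k)))
          ⟦dummy⟧ k = trans (⟦⟧-++ (variable-form (inj₁ (inj₁ k))) (variable-form (inj₂ (inj₂ (inj₁ k)))) (value c″))
            (+-cong (⟦variable⟧ (inj₁ (inj₁ k)) (value c″)) (⟦variable⟧ (inj₂ (inj₂ (inj₁ k))) (value c″)))

          ⟦inequality⟧ : ∀ x → ⟦ inequality-form x ⟧ (value c″) ≈ ⟦ bound-part x ⟧ [ d , κ.to ∘ cC ]′ + value c″ (inj₂ (inj₂ (inj₂ x)))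
          ⟦inequality⟧ x = trans (⟦⟧-++ (relabel f (bound-part x)) (variable-form (inj₂ (inj₂ (inj₂ x)))) (value c″)) (+-cong
            (trans (⟦relabel⟧ f (bound-part x) (value c″)) (⟦⟧-cong (bound-part x) λ { (inj₁ k) → refl ; (inj₂ i) → value-c (inj₁ i) }))
            (⟦variable⟧ (inj₂ (inj₂ (inj₂ x))) (value c″)))
            where
            f : Fin q ⊎ C → I
            f = [ inj₁ ∘ inj₁ , inj₁ ∘ inj₂ ∘ inj₁ ]′

          normal-bound : ⟦ nf ⟧ d ≈ v + (- ⟦ gC ⟧ (κ.to ∘ cC) + - ⟦ eB ⟧ (κ.to ∘ cB)) → Bd N₁ (⟦ nf ⟧ d)
          normal-bound eq = Bd-cong (sym eq) (Bd-+ (Bd-mono (ℕ.m≤m+n Nv _) v-bound) (Bd-mono (ℕ.m≤n+m _ Nv)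
            (Bd-+ (Bd-neg (Bd-mono (ℕ.m≤n+m (bound-of 1 gC) (bound-of 1 eB)) (bound-of-≤ 1 gC λ i → Bd-κ (cC i))))
                  (Bd-neg (Bd-mono (ℕ.m≤m+n (bound-of 1 eB) (bound-of 1 gC)) (bound-of-≤ 1 eB λ i → Bd-κ (cB i)))))))

          bound-part-bound : (∀ k → Bd N₂ (d k)) → ∀ x → Bd N (⟦ bound-part x ⟧ [ d , κ.to ∘ cC ]′)
          bound-part-bound d-bd x = ≡.subst (λ x → Bd N (⟦ bound-part x ⟧ [ d , κ.to ∘ cC ]′)) (element-index x)
            (Bd-mono (ℕ.≤-trans (proj₂ (Fin-bound NX λ i → bound-of (suc N₂) (bound-part (element i))) (indexX x)) N₃≤N)
              (bound-of-≤ (suc N₂) (bound-part (element (indexX x))) {[ d , κ.to ∘ cC ]′} λ { (inj₁ k) → Bd-mono (ℕ.n≤1+n N₂) (d-bd k) ; (inj₂ i) → Bd-mono (s≤s z≤n) (Bd-κ (cC i)) }))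

      free-vanishes : ∀ x → (∀ i → collect (free-part x) i O.≈ᴾ []) → ∀ xf → ⟦ free-part x ⟧ xf ≈ 0#
      free-vanishes x z xf = trans (⟦collect⟧ (free-part x) xf) (∑-zero (allFin m) λ i → trans (⟦≈⟧ᵒ (xf i) (z i)) (⟦[]⟧ᵒ (xf i)))

      -- A true solution x₁ is compared with the particular x₀. The value of nf at their difference
      -- is v up to the contributions of constants, so the difference is bounded and given by
      -- digits.
      eliminated-necessary : ∀ ρ η c → Solves (Definition.equations eliminated) ρ η c → Normal ρ → Holds (Definition.condition eliminated) η c
      eliminated-necessary ρ η′ c solves (x₁ , xf , cC₀ , cB₀ , dummies , equation , side-holds , nonzero) =
        allᵇ⁺ q (λ k → whenᵇ⁺ (dummy k) (dummy-vanishes k)) , cx , holds-ext side (λ ()) (λ ()) (λ _ → ≡.refl) side-holds ,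
        holds-at-π⁺ main-form η′ c″ (trans ⟦main⟧ main≈0) ,
        allᵇ⁺ q (λ k → whenᵇ⁺ (dummy k) λ eq →
          holds-at-π⁺ (dummy-form k) η′ c″ (trans (⟦dummy⟧ k) (trans (+-cong (value≈d k) (trans (value-t (inj₁ k) (dummy-vanishes k eq)) (⟦variable⟧ k x₀)))
            (trans (S.solve 2 (λ a b → (a S.:+ S.:- b) S.:+ b S.:= a) refl (x₁ k) (x₀ k)) (dummies k eq))))) ,
        allᵇ⁺ NX (λ i → whenᵇ⁺ (J (element i) ∧ does (free-zero? (element i))) λ eq (vanish , holds) →
          inequality (element i) (proj₁ (∧-true eq)) (does-true (free-zero? (element i)) (proj₂ (∧-true {J (element i)} eq))) vanish (holds-at-π⁻ (inequality-form (element i)) η′ c″ holds))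
        where
        open Solution ρ η′ c solves
        d₁ : Fin q → Carrier
        d₁ k = x₁ k + - x₀ k
        normal-d₁ : ⟦ nf ⟧ d₁ ≈ v + (- ⟦ gC ⟧ (κ.to ∘ cC₀) + - ⟦ eB ⟧ (κ.to ∘ cB₀))
        normal-d₁ = begin
          ⟦ nf ⟧ d₁
            ≈⟨ trans (⟦⟧-+ nf x₁ (λ k → - x₀ k)) (+-congˡ (⟦⟧-neg nf x₀)) ⟩
          n₁ + - n₀
            -- The added bracket is the equation for x₁ minus the remainder equation for x₀.
            ≈⟨ S.solve 6 (λ k n₀ n₁ g b v → n₁ S.:+ S.:- n₀ S.:= (v S.:+ (S.:- g S.:+ S.:- b)) S.:+ (((k S.:+ (n₁ S.:+ g)) S.:+ b) S.:+ S.:- ((k S.:+ n₀) S.:+ v))) refl (⟦ eK ⟧ ρ) n₀ n₁ g bb v ⟩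
          (v + (- g + - bb)) + (((⟦ eK ⟧ ρ + (n₁ + g)) + bb) + - ((⟦ eK ⟧ ρ + n₀) + v))
            ≈⟨ +-congˡ (trans (+-cong equation (-‿cong remainder-≈)) (-‿inverseʳ 0#)) ⟩
          (v + (- g + - bb)) + 0#
            ≈⟨ +-identityʳ _ ⟩
          v + (- g + - bb) ∎
          where
          n₀ = ⟦ nf ⟧ x₀
          n₁ = ⟦ nf ⟧ x₁
          g = ⟦ gC ⟧ (κ.to ∘ cC₀)
          bb = ⟦ eB ⟧ (κ.to ∘ cB₀)
        d₁-bound : ∀ k → Bd N₂ (d₁ k)
        d₁-bound = bounded-solution N₁ d₁ (Bd-cong (sym normal-d₁) (Bd-+ (Bd-mono (ℕ.m≤m+n Nv _) v-bound) (Bd-mono (ℕ.m≤n+m _ Nv)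
            (Bd-+ (Bd-neg (Bd-mono (ℕ.m≤n+m (bound-of 1 gC) (bound-of 1 eB)) (bound-of-≤ 1 gC λ i → Bd-κ (cC₀ i))))
                  (Bd-neg (Bd-mono (ℕ.m≤m+n (bound-of 1 eB) (bound-of 1 gC)) (bound-of-≤ 1 eB λ i → Bd-κ (cB₀ i))))))))
        digits-d : ∀ k → Σ[ c ∈ (Fin width → Fᵣ.Carrier) ] digit-value c ≈ d₁ k
        digits-d k = bounded-digits (Bd-mono N₂≤N (d₁-bound k))
        cx : Cx → Fᵣ.Carrier
        cx = [ (λ (k , l) → proj₁ (digits-d k) l) , [ cC₀ , cB₀ ]′ ]′
        open WithDigits cx
        value≈d : ∀ k → d k ≈ d₁ k
        value≈d k = trans (value-d k) (proj₂ (digits-d k))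
        main≈0 : (⟦ nf ⟧ d + ⟦ gC ⟧ (κ.to ∘ cC)) + (⟦ eB ⟧ (κ.to ∘ cB) + - v) ≈ 0#
        main≈0 = trans (+-congʳ (+-congʳ (trans (⟦⟧-cong nf value≈d) normal-d₁)))
          (S.solve 3 (λ v g b → ((v S.:+ (S.:- g S.:+ S.:- b)) S.:+ g) S.:+ (b S.:+ S.:- v) S.:= S.:0) refl v (⟦ gC ⟧ (κ.to ∘ cC₀)) (⟦ eB ⟧ (κ.to ∘ cB₀)))
        dummy-vanishes : ∀ k → dummy k ≡ true → η′ (inj₂ (inj₁ k)) ≈ 0#
        dummy-vanishes k is-dummy = bounded-vanishes (Bd-cong (sym (trans (⟦variable⟧ k x₀) x₀≈)) (Bd-neg (Bd-mono N₂≤N (d₁-bound k)))) (decomposes (inj₁ k))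
          where
          x₀≈ : x₀ k ≈ - d₁ k
          x₀≈ = trans (S.solve 2 (λ a b → b S.:= S.:- (a S.:+ S.:- b) S.:+ a) refl (x₁ k) (x₀ k)) (trans (+-congˡ (dummies k is-dummy)) (+-identityʳ _))
        inequality : ∀ x → J x ≡ true → (∀ i → collect (free-part x) i O.≈ᴾ []) → η′ (inj₂ (inj₂ x)) ≈ 0# → ¬ ⟦ inequality-form x ⟧ (value c″) ≈ 0#
        inequality x Jx free vanish eq = nonzero x Jx (begin
          ⟦ bound-part x ⟧ [ x₁ , κ.to ∘ cC₀ ]′ + ⟦ free-part x ⟧ xf            ≈⟨ trans (+-congˡ (free-vanishes x free xf)) (+-identityʳ _) ⟩
          ⟦ bound-part x ⟧ [ x₁ , κ.to ∘ cC₀ ]′                                 ≈⟨ ⟦⟧-cong (bound-part x) (λ { (inj₁ k) → trans (S.solve 2 (λ a b → a S.:= b S.:+ (a S.:+ S.:- b)) refl (x₁ k) (x₀ k)) (+-congˡ (sym (value≈d k))) ; (inj₂ i) → refl }) ⟩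
          ⟦ bound-part x ⟧ [ (λ k → x₀ k + d k) , κ.to ∘ cC ]′                  ≈⟨ bound-part-+ x x₀ d (κ.to ∘ cC) ⟩
          ⟦ bound-part x ⟧ [ d , κ.to ∘ cC ]′ + ⟦ τ (inj₂ x) ⟧ x₀               ≈⟨ +-congˡ (value-t (inj₂ x) vanish) ⟨
          ⟦ bound-part x ⟧ [ d , κ.to ∘ cC ]′ + value c″ (inj₂ (inj₂ (inj₂ x))) ≈⟨ ⟦inequality⟧ x ⟨
          ⟦ inequality-form x ⟧ (value c″)                                      ≈⟨ eq ⟩
          0#                                                                    ∎)

      -- The sum x₀ + d solves the equation, and the free variables are chosen by `avoid-values` to
      -- meet all inequalities with a nonzero free part.
      eliminated-sufficient : ∀ ρ η c → Solves (Definition.equations eliminated) ρ η c → Holds (Definition.condition eliminated) η c → Normal ρ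
      eliminated-sufficient ρ η′ c solves (dummy-conditions , cx , side-holds , main-holds , dummy-holds , inequalities) =
        x₁ , xf , cC , cB , dummies , system≈0 , holds-ext side (λ ()) (λ ()) (λ i → ≡.refl) side-holds , nonzero
        where
        open Solution ρ η′ c solves
        open WithDigits cx
        x₁ : Fin q → Carrier
        x₁ k = x₀ k + d k
        dummies : ∀ k → dummy k ≡ true → x₁ k ≈ 0#
        dummies k is-dummy = trans (+-comm _ _) (trans (+-congˡ (sym (trans (value-t (inj₁ k) (whenᵇ⁻ (dummy k) (allᵇ⁻ q dummy-conditions k) is-dummy)) (⟦variable⟧ k x₀))))
          (trans (sym (⟦dummy⟧ k)) (holds-at-π⁻ (dummy-form k) η′ c″ (whenᵇ⁻ (dummy k) (allᵇ⁻ q dummy-holds k) is-dummy))))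
        main≈0 : (⟦ nf ⟧ d + ⟦ gC ⟧ (κ.to ∘ cC)) + (⟦ eB ⟧ (κ.to ∘ cB) + - v) ≈ 0#
        main≈0 = trans (sym ⟦main⟧) (holds-at-π⁻ main-form η′ c″ main-holds)
        d-bound : ∀ k → Bd N₂ (d k)
        d-bound = bounded-solution N₁ d (normal-bound (trans (S.solve 4 (λ n g b v → n S.:= (v S.:+ (S.:- g S.:+ S.:- b)) S.:+ ((n S.:+ g) S.:+ (b S.:+ S.:- v))) refl
          (⟦ nf ⟧ d) (⟦ gC ⟧ (κ.to ∘ cC)) (⟦ eB ⟧ (κ.to ∘ cB)) v) (trans (+-congˡ main≈0) (+-identityʳ _))))
        avoiding = avoid-values m NX (λ j → collect (free-part (element j))) (λ j → - ⟦ bound-part (element j) ⟧ [ x₁ , κ.to ∘ cC ]′)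
        xf = proj₁ avoiding
        system≈0 : (⟦ eK ⟧ ρ + (⟦ nf ⟧ x₁ + ⟦ gC ⟧ (κ.to ∘ cC))) + ⟦ eB ⟧ (κ.to ∘ cB) ≈ 0#
        system≈0 = begin
          (⟦ eK ⟧ ρ + (⟦ nf ⟧ x₁ + ⟦ gC ⟧ (κ.to ∘ cC))) + ⟦ eB ⟧ (κ.to ∘ cB)
            ≈⟨ +-congʳ (+-congˡ (+-congʳ (⟦⟧-+ nf x₀ d))) ⟩
          (⟦ eK ⟧ ρ + ((⟦ nf ⟧ x₀ + ⟦ nf ⟧ d) + ⟦ gC ⟧ (κ.to ∘ cC))) + ⟦ eB ⟧ (κ.to ∘ cB)
            ≈⟨ S.solve 6 (λ k a n g b v → (k S.:+ ((a S.:+ n) S.:+ g)) S.:+ b S.:= ((k S.:+ a) S.:+ v) S.:+ ((n S.:+ g) S.:+ (b S.:+ S.:- v))) refl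
                 (⟦ eK ⟧ ρ) (⟦ nf ⟧ x₀) (⟦ nf ⟧ d) (⟦ gC ⟧ (κ.to ∘ cC)) (⟦ eB ⟧ (κ.to ∘ cB)) v ⟩
          ((⟦ eK ⟧ ρ + ⟦ nf ⟧ x₀) + v) + ((⟦ nf ⟧ d + ⟦ gC ⟧ (κ.to ∘ cC)) + (⟦ eB ⟧ (κ.to ∘ cB) + - v))
            ≈⟨ trans (+-cong remainder-≈ main≈0) (+-identityˡ 0#) ⟩
          0# ∎
        nonzero : ∀ x → J x ≡ true → ¬ ⟦ bound-part x ⟧ [ x₁ , κ.to ∘ cC ]′ + ⟦ free-part x ⟧ xf ≈ 0#
        nonzero x Jx y≈0 with free-zero? x in free-eq
        ... | no not-free = proj₂ avoiding (indexX x) (i , ≡.subst (λ x → ¬ collect (free-part x) i O.≈ᴾ []) (≡.sym (element-index x)) νi≉0)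
            (≡.subst (λ x → ∑ (allFin m) (λ i → ⟦ collect (free-part x) i ⟧ᵒ (xf i)) ≈ - ⟦ bound-part x ⟧ [ x₁ , κ.to ∘ cC ]′) (≡.sym (element-index x))
              (trans (sym (⟦collect⟧ (free-part x) xf)) (trans (S.solve 2 (λ a b → b S.:= S.:- a S.:+ (a S.:+ b)) refl _ (⟦ free-part x ⟧ xf))
                (trans (+-congˡ y≈0) (+-identityʳ _)))))
          where
          some = Fin.¬∀⟶∃¬ m (λ i → collect (free-part x) i O.≈ᴾ []) (λ i → ore-≟0 (collect (free-part x) i)) not-free
          i = proj₁ some
          νi≉0 = proj₂ some
        ... | yes free = whenᵇ⁻ (J (element j) ∧ does (free-zero? (element j))) (allᵇ⁻ NX inequalities j)
              (≡.subst (λ x → J x ∧ does (free-zero? x) ≡ true) (≡.sym (element-index x)) (≡.cong₂ _∧_ Jx (≡.cong does free-eq)))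
              (≡.subst (λ x → η′ (inj₂ (inj₂ x)) ≈ 0#) (≡.sym (element-index x)) vanish
              , holds-at-π⁺ (inequality-form (element j)) η′ c″ (≡.subst (λ x → ⟦ inequality-form x ⟧ (value c″) ≈ 0#) (≡.sym (element-index x))
                  (trans (⟦inequality⟧ x) (trans (+-congˡ (value-t (inj₂ x) vanish)) sum≈0))))
          where
          j = indexX x
          sum≈0 : ⟦ bound-part x ⟧ [ d , κ.to ∘ cC ]′ + ⟦ τ (inj₂ x) ⟧ x₀ ≈ 0#
          sum≈0 = trans (sym (bound-part-+ x x₀ d (κ.to ∘ cC))) (trans (sym (+-identityʳ _)) (trans (+-congˡ (sym (free-vanishes x free xf))) y≈0))
          -- If the sum is zero, the part in x₀ is the negative of a bounded element; hence its η
          -- vanishes, and the condition excludes the equation.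
          vanish : η′ (inj₂ (inj₂ x)) ≈ 0#
          vanish = bounded-vanishes (Bd-cong (trans (S.solve 2 (λ a b → S.:- a S.:= b S.:+ S.:- (a S.:+ b)) refl (⟦ bound-part x ⟧ [ d , κ.to ∘ cC ]′) (⟦ τ (inj₂ x) ⟧ x₀))
            (trans (+-congˡ (trans (-‿cong sum≈0) (trans (sym (+-identityˡ _)) (-‿inverseʳ 0#)))) (+-identityʳ _))) (Bd-neg (bound-part-bound d-bound x))) (decomposes (inj₂ x))

      -- Here x₀ approximates -eK(ρ), v is the bounded error, and the tested quantities are
      -- decomposed at this x₀.
      eliminated-solvable : ∀ ρ → Σ[ η ∈ (A′ → Carrier) ] Σ[ c ∈ (B′ → Fᵣ.Carrier) ] Solves (Definition.equations eliminated) ρ η c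
      eliminated-solvable ρ = η , c , first ∷ finite-∀ (Finite.cardinality finite-T) (t-equation ∘ Finite.element finite-T) λ k → others (Finite.element finite-T k)
        where
        rem = remainder (- ⟦ eK ⟧ ρ)
        x₀ = proj₁ rem
        dec : ∀ t → _
        dec t = decompose (⟦ τ t ⟧ x₀)
        g = numerator (proj₂ rem)
        η : A′ → Carrier
        η = [ x₀ , (λ t → proj₁ (dec t)) ]′
        c : B′ → Fᵣ.Carrier
        c = [ (λ l → Q.coeff g (toℕ l)) , (λ (t , l) → proj₁ (proj₂ (dec t)) l) ]′
        ρ′ = environment ρ η c
        first : ⟦ remainder-equation ⟧ ρ′ ≈ 0#
        first = trans (⟦⟧-++ (s ^ᴾ Nv ·ᶠ (relabel inj₁ eK ++ relabel (inj₂ ∘ inj₁ ∘ inj₁) nf)) (digit-form (inj₂ ∘ inj₂ ∘ inj₁)) ρ′)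
          (trans (+-cong (trans (⟦·⟧ (s ^ᴾ Nv) (relabel inj₁ eK ++ relabel (inj₂ ∘ inj₁ ∘ inj₁) nf) ρ′) (*-cong (⟪⟫.to-^ s Nv) (trans (⟦⟧-++ (relabel inj₁ eK) (relabel (inj₂ ∘ inj₁ ∘ inj₁) nf) ρ′)
              (+-cong (⟦relabel⟧ inj₁ eK ρ′) (⟦relabel⟧ (inj₂ ∘ inj₁ ∘ inj₁) nf ρ′)))))
            (trans (⟦digit⟧ (inj₂ ∘ inj₂ ∘ inj₁) ρ′) (trans (sym (pol≈digit-∑ g (num-degree (proj₂ rem)))) (sym (num-≈ (proj₂ rem))))))
          (S.solve 3 (λ a k n → a S.:* (k S.:+ n) S.:+ a S.:* (S.:- k S.:+ S.:- n) S.:= S.:0) refl (σ ^ Nv) (⟦ eK ⟧ ρ) (⟦ nf ⟧ x₀)))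
        others : ∀ t → ⟦ t-equation t ⟧ ρ′ ≈ 0#
        others t = trans (⟦decomposition⟧ (relabel (inj₂ ∘ inj₁ ∘ inj₁) (τ t)) (inj₂ (inj₁ (inj₂ t))) (λ l → inj₂ (inj₂ (inj₂ (t , l)))) ρ′)
          (trans (+-congʳ (trans (*-congˡ (⟦relabel⟧ (inj₂ ∘ inj₁ ∘ inj₁) (τ t) ρ′)) (proj₂ (proj₂ (dec t))))) (-‿inverseʳ _))

      eliminated-defines : Defines eliminated Normal
      eliminated-defines = record { solvable = eliminated-solvable ; necessary = eliminated-necessary ; sufficient = eliminated-sufficient }

    module EliminationMeaning {K X₀ B : Set} (finite-X : Finite X₀) (finite-B : Finite B)
      (system : List (Form (K ⊎ (X₀ ⊎ B)))) (side : Condition ⊥ B) (J : X₀ → Bool) where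
      open Elimination finite-X finite-B system side J
      open Finite finite-X using (element; element-index) renaming (cardinality to NX; index to indexX)
      open SplitCorrect (level tr) (last-family tr) (last-bound tr) (last-completion tr)
      private module V = Valid (trace-valid tr)

      Eliminable : (K → Carrier) → Set a
      Eliminable ρ = Σ[ η ∈ (X₀ → Carrier) ] Σ[ c ∈ (B → Fᵣ.Carrier) ]
        Solves system ρ η c × Holds side (λ ()) c × (∀ x → J x ≡ true → ¬ η x ≈ 0#)

      ⟦e⟧ : ∀ ρ (y : Fin NX → Carrier) c → ⟦ e ⟧ [ ρ , [ y ∘ indexX , κ.to ∘ c ]′ ]′ ≈ (⟦ eK ⟧ ρ + ⟦ eX ⟧ y) + ⟦ eB ⟧ (κ.to ∘ c)
      ⟦e⟧ ρ y c = trans (⟦⟧-split e {ρ₁ = [ ρ , [ y ∘ indexX , (λ _ → 0#) ]′ ]′} {ρ₂ = [ (λ _ → 0#) , [ (λ _ → 0#) , κ.to ∘ c ]′ ]′} λ where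
            (inj₁ k)        → sym (+-identityʳ _)
            (inj₂ (inj₁ x)) → sym (+-identityʳ _)
            (inj₂ (inj₂ i)) → sym (+-identityˡ _))
          (+-cong (trans (⟦⟧-split e {ρ₁ = [ ρ , (λ _ → 0#) ]′} {ρ₂ = [ (λ _ → 0#) , [ y ∘ indexX , (λ _ → 0#) ]′ ]′} λ where
            (inj₁ k)        → sym (+-identityʳ _)
            (inj₂ (inj₁ x)) → sym (+-identityˡ _)
            (inj₂ (inj₂ i)) → sym (+-identityˡ _))
          (+-cong (sym (trans (⟦sub⟧ _ e ρ) (⟦⟧-cong e λ { (inj₁ k) → ⟦variable⟧ k ρ ; (inj₂ _) → ⟦⟧-[] ρ })))
                  (sym (trans (⟦sub⟧ _ e y) (⟦⟧-cong e λ { (inj₁ _) → ⟦⟧-[] y ; (inj₂ (inj₁ x)) → ⟦variable⟧ (indexX x) y ; (inj₂ (inj₂ _)) → ⟦⟧-[] y })))))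
          (sym (trans (⟦sub⟧ _ e (κ.to ∘ c)) (⟦⟧-cong e λ { (inj₁ _) → ⟦⟧-[] _ ; (inj₂ (inj₁ _)) → ⟦⟧-[] _ ; (inj₂ (inj₂ i)) → ⟦variable⟧ i (κ.to ∘ c) }))))

      ⟦G⟧ : ∀ i (x : Fin q → Carrier) (xf : Fin NX → Carrier) (c : C → Carrier) → ⟦ G i ⟧ [ [ x , xf ]′ , c ]′ ≈ ⟦ G₀ i ⟧ [ (λ j → ⟦ split-form j ⟧ [ x , xf ]′) , c ]′
      ⟦G⟧ i x xf c = trans (⟦sub⟧ lift-split (G₀ i) [ [ x , xf ]′ , c ]′) (⟦⟧-cong (G₀ i) λ where
        (inj₁ j) → ⟦relabel⟧ inj₁ (split-form j) [ [ x , xf ]′ , c ]′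
        (inj₂ l) → ⟦variable⟧ (inj₂ l) [ [ x , xf ]′ , c ]′)

      ⟦constant-part⟧ : ∀ i (c : C → Carrier) → ⟦ constant-part i ⟧ c ≈ ⟦ G i ⟧ [ (λ _ → 0#) , c ]′
      ⟦constant-part⟧ i c = trans (⟦sub⟧ _ (G i) c) (⟦⟧-cong (G i) λ { (inj₁ _) → ⟦⟧-[] c ; (inj₂ l) → ⟦variable⟧ l c })

      ⟦free-part⟧ : ∀ x (xf : Fin NX → Carrier) → ⟦ free-part x ⟧ xf ≈ ⟦ G (indexX x) ⟧ [ [ (λ _ → 0#) , xf ]′ , (λ _ → 0#) ]′
      ⟦free-part⟧ x xf = trans (⟦sub⟧ _ (G (indexX x)) xf) (⟦⟧-cong (G (indexX x)) λ where
        (inj₁ (inj₁ _)) → ⟦⟧-[] xf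
        (inj₁ (inj₂ i)) → ⟦variable⟧ i xf
        (inj₂ _)        → ⟦⟧-[] xf)

      ⟦bound-part⟧ : ∀ x (y : Fin q → Carrier) (c : C → Carrier) → ⟦ bound-part x ⟧ [ y , c ]′ ≈ ⟦ G (indexX x) ⟧ [ [ y , (λ _ → 0#) ]′ , c ]′
      ⟦bound-part⟧ x y c = trans (⟦sub⟧ _ (G (indexX x)) [ y , c ]′) (⟦⟧-cong (G (indexX x)) λ where
        (inj₁ (inj₁ k)) → ⟦variable⟧ (inj₁ k) [ y , c ]′
        (inj₁ (inj₂ _)) → ⟦⟧-[] [ y , c ]′
        (inj₂ l)        → ⟦variable⟧ (inj₂ l) [ y , c ]′)

      ⟦G⟧-split : ∀ x y xf c → ⟦ G (indexX x) ⟧ [ [ y , xf ]′ , c ]′ ≈ ⟦ bound-part x ⟧ [ y , c ]′ + ⟦ free-part x ⟧ xf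
      ⟦G⟧-split x y xf c = trans (⟦⟧-split (G (indexX x)) {ρ₁ = [ [ y , (λ _ → 0#) ]′ , c ]′} {ρ₂ = [ [ (λ _ → 0#) , xf ]′ , (λ _ → 0#) ]′} λ where
          (inj₁ (inj₁ k)) → sym (+-identityʳ _)
          (inj₁ (inj₂ i)) → sym (+-identityˡ _)
          (inj₂ l)        → sym (+-identityʳ _))
        (+-cong (sym (⟦bound-part⟧ x y c)) (sym (⟦free-part⟧ x xf)))

      -- Additivity separates the parameters. What is left becomes the reduced family by
      -- `V.identity` and the normal form by `split-identity`, where the free variables drop out.
      ⟦eX⟧-G : ∀ x xf (c : C → Carrier) → (∀ k → Dummy k → x k ≈ 0#) → ⟦ eX ⟧ (λ i → ⟦ G i ⟧ [ [ x , xf ]′ , c ]′) ≈ ⟦ normal-form ⟧ x + ⟦ gC ⟧ c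
      ⟦eX⟧-G x xf c dummies = trans (⟦⟧-split eX λ i → ⟦⟧-split (G i) {ρ₁ = [ [ x , xf ]′ , (λ _ → 0#) ]′} {ρ₂ = [ (λ _ → 0#) , c ]′} λ where
            (inj₁ (inj₁ k)) → sym (+-identityʳ _)
            (inj₁ (inj₂ i)) → sym (+-identityʳ _)
            (inj₂ l)        → sym (+-identityˡ _))
        (+-cong
          (trans (⟦collect⟧ eX _) (trans (∑-cong (allFin NX) λ i → ⟦⟧ᵒ-cong (collect eX i) (⟦G⟧ i x xf (λ _ → 0#)))
            (trans (V.identity (λ j → ⟦ split-form j ⟧ [ x , xf ]′)) (split-identity x xf dummies))))
          (trans (⟦⟧-cong eX λ i → sym (⟦constant-part⟧ i c)) (sym (⟦sub⟧ constant-part eX c))))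

      G-onto : ∀ (y : Fin NX → Carrier) → Σ[ x ∈ (Fin q → Carrier) ] Σ[ xf ∈ (Fin NX → Carrier) ] Σ[ c ∈ (C → Fᵣ.Carrier) ]
        (∀ k → Dummy k → x k ≈ 0#) × (∀ i → y i ≈ ⟦ G i ⟧ [ [ x , xf ]′ , κ.to ∘ c ]′)
      G-onto y =
        let y′ , c , eq = V.onto y
            x , xf , dummies , eq′ = split-onto y′
        in x , xf , c , dummies , λ i → trans (eq i) (trans (⟦⟧-cong (G₀ i) λ { (inj₁ j) → eq′ j ; (inj₂ l) → refl }) (sym (⟦G⟧ i x xf (κ.to ∘ c))))

      Normal : (K → Carrier) → Set a
      Normal = NormalSolvable {C = C} {q = q} {m = NX} eK normal-form gC eB bound-part free-part (λ k → does (dummy? k)) J side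

      eliminable⇒normal : ∀ ρ → Eliminable ρ → Normal ρ
      eliminable⇒normal ρ (η , c , solved , side-holds , nonzero) =
        let x , xf , cC , dummies , y≈ = G-onto y in
        x , xf , cC , c , (λ k eq → dummies k (does-true (dummy? k) eq)) ,
        trans (sym (trans (⟦e⟧ ρ y c) (+-congʳ (+-congˡ (trans (⟦⟧-cong eX y≈) (⟦eX⟧-G x xf (κ.to ∘ cC) dummies))))))
          (trans (⟦⟧-cong e λ where
            (inj₁ k)        → refl
            (inj₂ (inj₁ t)) → reflexive (≡.cong η (element-index t))
            (inj₂ (inj₂ i)) → refl) (all-merge system _ solved)) ,
        side-holds , λ t Jt eq → nonzero t Jt (trans (reflexive (≡.cong η (≡.sym (element-index t))))
          (trans (y≈ (indexX t)) (trans (⟦G⟧-split t x xf (κ.to ∘ cC)) eq)))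
        where
        y : Fin NX → Carrier
        y = η ∘ element

      normal⇒eliminable : ∀ ρ → Normal ρ → Eliminable ρ
      normal⇒eliminable ρ (x , xf , cC , cB , dummies , equation , side-holds , nonzero) =
        (y ∘ indexX) , cB ,
        merge-all system _ (trans (⟦e⟧ ρ y cB) (trans (+-congʳ (+-congˡ (⟦eX⟧-G x xf (κ.to ∘ cC) λ k d → dummies k (true-does (dummy? k) d)))) equation)) ,
        side-holds , λ t Jt eq → nonzero t Jt (trans (sym (⟦G⟧-split t x xf (κ.to ∘ cC))) eq)
        where
        y : Fin NX → Carrier
        y i = ⟦ G i ⟧ [ [ x , xf ]′ , κ.to ∘ cC ]′

      eliminated-defines : Defines eliminated Eliminable
      eliminated-defines = record { solvable = N.solvable ; necessary = λ ρ η c solves θ → N.necessary ρ η c solves (eliminable⇒normal ρ θ)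
                                  ; sufficient = λ ρ η c solves holds → normal⇒eliminable ρ (N.sufficient ρ η c solves holds) }
        where
        module N = Defines (NormalEliminationMeaning.eliminated-defines finite-X finite-B finite-C eK normal-form gC eB bound-part free-part
          (λ k → does (dummy? k)) J remainder-bound solution-bound side remainder bounded-solution)

    -- Correctness of the 𝓛ₚ-formulas for conditions.

    private
      module FF = Frobenius F p p-prime charF

    𝓕 : Structure Lp a
    𝓕 = fieldStructure p fieldF

    module 𝓕-Truth = CLp.Truth 𝓕 Fᵣ.refl

    ι-natural : ∀ x → IntegerSolver.fromℕ F (natural x) Fᵣ.≈ ι.to x
    ι-natural x = Fᵣ.trans (Fᵣ.sym (fromℕ-hom ι (natural x))) (ι.to-cong (natural-≈ x))

    1≉0 : ¬ 1# ≈ 0#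
    1≉0 1≈0 = DecidableField.1≉0 field-F (Q.at (Model.transcendental M Q.PR.1# (trans pol.to-1 1≈0)) 0)

    eval-scale : ∀ {n} (v : Vec Fᵣ.Carrier n) m t → eval 𝓕 v (BLp.scaleᵗ m t) Fᵣ.≈ IntegerSolver.fromℕ F m Fᵣ.* eval 𝓕 v t
    eval-scale v zero    t = Fᵣ.sym (Fᵣ.zeroˡ _)
    eval-scale v (suc m) t = Fᵣ.trans (Fᵣ.+-cong (Fᵣ.sym (Fᵣ.*-identityˡ _)) (eval-scale v m t)) (Fᵣ.sym (Fᵣ.distribʳ _ _ _))

    eval-frob : ∀ {n} (v : Vec Fᵣ.Carrier n) k t → eval 𝓕 v (BLp.frobᵗ k t) ≡ eval 𝓕 v t FF.^p^ k
    eval-frob v zero    t = ≡.refl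
    eval-frob v (suc k) t = eval-frob v k (app frob (t ∷ []))

    private
      κ-φ : ∀ k x → κ.to (x FF.^p^ k) ≈ κ.to x ^p^ k
      κ-φ zero    x = refl
      κ-φ (suc k) x = trans (κ-φ k (x FF.^ p)) (φ-cong k (κ.to-^ x p))

      pol-const : ∀ x → pol (Q.const x) ≈ κ.to x
      pol-const x = Evaluation.ev-const κ z x

    -- The preimage in F[z] of the left side of a `linear` condition; the terms `coefficient-term`
    -- denote its coefficients.
    value-polynomial : ∀ {B : Set} → (B → Fᵣ.Carrier) → Form B → Poly → Q.Poly
    value-polynomial c []               b = lift b
    value-polynomial c (mono a i k ∷ φ) b = (Q.const (c i FF.^p^ k) Q.⊗ lift a) Q.⊕ value-polynomial c φ b

    pol-value : ∀ {B : Set} (c : B → Fᵣ.Carrier) φ b → pol (value-polynomial c φ b) ≈ ⟦ φ ⟧ (κ.to ∘ c) + ⟪ b ⟫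
    pol-value c []               b = trans (pol-lift b) (sym (trans (+-congʳ (⟦⟧-[] _)) (+-identityˡ _)))
    pol-value c (mono a i k ∷ φ) b = trans (pol-+ _ _) (trans (+-cong
        (trans (pol-* _ _) (trans (*-cong (trans (pol-const _) (κ-φ k (c i))) (pol-lift a)) (trans (*-comm _ _) (sym (⟦term⟧ a i k (κ.to ∘ c))))))
        (pol-value c φ b))
      (trans (sym (+-assoc _ _ _)) (+-congʳ (sym (⟦⟧-++ (term a i k) φ (κ.to ∘ c))))))

    value-degree : ∀ {B : Set} (c : B → Fᵣ.Carrier) φ b → Q.Deg< (size φ ℕ.+ length b) (value-polynomial c φ b)
    value-degree c []               b = deg-lift b (P.deg-length b ℕ.≤-refl)
    value-degree c (mono a i k ∷ φ) b = Q.deg-⊕ (Q.const (c i FF.^p^ k) Q.⊗ lift a) (value-polynomial c φ b)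
      (Q.deg-cong (Q.PR.sym (Q.const-*-≈ (c i FF.^p^ k) (lift a))) (Q.deg-scale (c i FF.^p^ k) (lift a)
        (Q.deg-mono (lift a) (ℕ.≤-trans (ℕ.m≤m+n (length a) (size φ)) (ℕ.m≤m+n _ (length b))) (deg-lift a (P.deg-length a ℕ.≤-refl)))))
      (Q.deg-mono (value-polynomial c φ b) (ℕ.+-monoˡ-≤ (length b) (ℕ.m≤n+m (size φ) (length a))) (value-degree c φ b))

    eval-coefficient : ∀ {B : Set} {m} (v : B → Fin m) (w : Vec Fᵣ.Carrier m) (c : B → Fᵣ.Carrier) → (∀ i → c i ≡ Vec.lookup w (v i)) → ∀ φ b n →
      eval 𝓕 w (coefficient-term v φ b n) Fᵣ.≈ Q.coeff (value-polynomial c φ b) n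
    eval-coefficient v w c eq [] b n = Fᵣ.trans (eval-scale w (natural (P.coeff b n)) BLp.oneᵗ)
      (Fᵣ.trans (Fᵣ.*-identityʳ _) (Fᵣ.trans (ι-natural _) (Fᵣ.sym (coeff-lift b n))))
    eval-coefficient v w c eq (mono a i k ∷ φ) b n = Fᵣ.trans (Fᵣ.+-cong
        (Fᵣ.trans (eval-scale w (natural (P.coeff a n)) (BLp.frobᵗ k (var (v i)))) (Fᵣ.trans (Fᵣ.*-cong (Fᵣ.trans (ι-natural _) (Fᵣ.sym (coeff-lift a n)))
          (Fᵣ.reflexive (≡.trans (eval-frob w k (var (v i))) (≡.cong (FF._^p^ k) (≡.sym (eq i)))))) (Fᵣ.trans (Fᵣ.*-comm _ _)
          (Fᵣ.sym (Fᵣ.trans (Q.at (Q.const-*-≈ (c i FF.^p^ k) (lift a)) n) (Q.coeff-scale (c i FF.^p^ k) (lift a) n))))))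
        (eval-coefficient v w c eq φ b n))
      (Fᵣ.sym (Q.coeff-⊕ (Q.const (c i FF.^p^ k) Q.⊗ lift a) (value-polynomial c φ b) n))

    record Matches {A : Set} (η : A → Carrier) (zeros : A → Bool) : Set a where
      field
        to-zero   : ∀ i → zeros i ≡ true → η i ≈ 0#
        from-zero : ∀ i → η i ≈ 0# → zeros i ≡ true
    open Matches

    fix-matches : ∀ {A : Set} (zeros : A → Bool) → Matches (λ i → if zeros i then 0# else 1#) zeros
    fix-matches zeros = record { to-zero = to ; from-zero = from }
      where
      to : ∀ i → zeros i ≡ true → (if zeros i then 0# else 1#) ≈ 0#
      to i eq rewrite eq = refl
      from : ∀ i → (if zeros i then 0# else 1#) ≈ 0# → zeros i ≡ true
      from i eq with zeros i
      ... | true  = ≡.refl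
      ... | false = ⊥-elim (1≉0 eq)

    module _ where
      private
        linear⁺ : ∀ {B : Set} {m} (v : B → Fin m) w (c : B → Fᵣ.Carrier) → (∀ i → c i ≡ Vec.lookup w (v i)) → ∀ φ b →
          ⟦ φ ⟧ (κ.to ∘ c) + ⟪ b ⟫ ≈ 0# → 𝓕 ⊨ CLp.conj (allFin (size φ ℕ.+ length b)) (λ n → coefficient-term v φ b (toℕ n) ≐ BLp.nilᵗ) [ w ]
        linear⁺ v w c eq φ b h = 𝓕-Truth.conj⁺ (allFin (size φ ℕ.+ length b)) {λ n → coefficient-term v φ b (toℕ n) ≐ BLp.nilᵗ} {w} (All.tabulate⁺ λ n → Fᵣ.trans (eval-coefficient v w c eq φ b (toℕ n))
          (Q.at (Model.transcendental M (value-polynomial c φ b) (trans (pol-value c φ b) h)) (toℕ n)))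

        linear⁻ : ∀ {B : Set} {m} (v : B → Fin m) w (c : B → Fᵣ.Carrier) → (∀ i → c i ≡ Vec.lookup w (v i)) → ∀ φ b →
          𝓕 ⊨ CLp.conj (allFin (size φ ℕ.+ length b)) (λ n → coefficient-term v φ b (toℕ n) ≐ BLp.nilᵗ) [ w ] → ⟦ φ ⟧ (κ.to ∘ c) + ⟪ b ⟫ ≈ 0#
        linear⁻ v w c eq φ b h = trans (sym (pol-value c φ b)) (pol-cong {value-polynomial c φ b} {[]} (Q.coeffwise coefficient))
          where
          bound = size φ ℕ.+ length b
          coefficient : ∀ n → Q.coeff (value-polynomial c φ b) n Fᵣ.≈ Fᵣ.0#
          coefficient n with n ℕ.<? bound
          ... | yes n<b = ≡.subst (λ n → Q.coeff (value-polynomial c φ b) n Fᵣ.≈ Fᵣ.0#) (Fin.toℕ-fromℕ< n<b)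
                (Fᵣ.trans (Fᵣ.sym (eval-coefficient v w c eq φ b (toℕ (Fin.fromℕ< n<b)))) (All.tabulate⁻ (𝓕-Truth.conj⁻ (allFin bound) {λ n → coefficient-term v φ b (toℕ n) ≐ BLp.nilᵗ} {w} h) (Fin.fromℕ< n<b)))
          ... | no  n≮b = value-degree c φ b n (ℕ.≮⇒≥ n≮b)

        extend : ∀ {B C : Set} {m} (fin : Finite C) (v : B → Fin m) (w : Vec Fᵣ.Carrier m) (c : B → Fᵣ.Carrier) (w′ : Vec Fᵣ.Carrier (Finite.cardinality fin)) (d : C → Fᵣ.Carrier) →
          (∀ i → c i ≡ Vec.lookup w (v i)) → (∀ i → d i ≡ Vec.lookup w′ (Finite.index fin i)) →
          ∀ i → [ c , d ]′ i ≡ Vec.lookup (w′ Vec.++ w) ([ (λ i → Finite.cardinality fin ↑ʳ v i) , (λ i → Finite.index fin i ↑ˡ m) ]′ i)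
        extend fin v w c w′ d eq eq′ (inj₁ i) = ≡.trans (eq i) (≡.sym (Vec.lookup-++ʳ w′ w (v i)))
        extend fin v w c w′ d eq eq′ (inj₂ i) = ≡.trans (eq′ i) (≡.sym (Vec.lookup-++ˡ w′ w (Finite.index fin i)))

      -- Both directions are proved together, because negation exchanges them.
      formula⁺ : ∀ {A B : Set} {m} (β : Condition A B) {zeros} {v : B → Fin m} {w η c} → Matches η zeros → (∀ i → c i ≡ Vec.lookup w (v i)) →
        Holds β η c → 𝓕 ⊨ field-formula β zeros v [ w ]
      formula⁻ : ∀ {A B : Set} {m} (β : Condition A B) {zeros} {v : B → Fin m} {w η c} → Matches η zeros → (∀ i → c i ≡ Vec.lookup w (v i)) →
        𝓕 ⊨ field-formula β zeros v [ w ] → Holds β η c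
      formula⁺ (vanishes i)    mt eq h rewrite from-zero mt i h = Fᵣ.refl
      formula⁺ (linear φ b)    {v = v} {w} {η} {c} mt eq h = linear⁺ v w c eq φ b h
      formula⁺ (satisfies φ i) {v = v} {w} mt eq h = rename⁺ 𝓕 (v ∘ i) φ w (≡.subst (λ u → 𝓕 ⊨ φ [ u ]) (Vec.tabulate-cong λ k → eq (i k)) h)
      formula⁺ trueᵇ           mt eq h = Fᵣ.refl
      formula⁺ (negᵇ β)        mt eq h = λ h′ → h (formula⁻ β mt eq h′)
      formula⁺ (β ∧ᵇ γ)        mt eq (h , h′) = formula⁺ β mt eq h , formula⁺ γ mt eq h′
      formula⁺ (β ∨ᵇ γ)        mt eq (inj₁ h) = inj₁ (formula⁺ β mt eq h)
      formula⁺ (β ∨ᵇ γ)        mt eq (inj₂ h) = inj₂ (formula⁺ γ mt eq h)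
      formula⁺ (exᵇ fin β)     {v = v} {w} {η} {c} mt eq (d , h) = 𝓕-Truth.exs⁺ (Finite.cardinality fin) w′ (formula⁺ β mt
        (extend fin v w c w′ d eq λ i → ≡.sym (≡.trans (Vec.lookup∘tabulate (d ∘ Finite.element fin) (Finite.index fin i)) (≡.cong d (Finite.element-index fin i)))) h)
        where w′ = Vec.tabulate (d ∘ Finite.element fin)
      formula⁺ (rename f g β)  mt eq h = formula⁺ β (record { to-zero = λ i → to-zero mt (f i) ; from-zero = λ i → from-zero mt (f i) }) (λ i → eq (g i)) h
      formula⁺ (fix zeros β)   mt eq h = formula⁺ β (fix-matches zeros) eq h
      formula⁻ (vanishes i)    {zeros} mt eq h with zeros i in zi
      ... | true  = to-zero mt i zi
      ... | false = ⊥-elim (h Fᵣ.refl)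
      formula⁻ (linear φ b)    {v = v} {w} {η} {c} mt eq h = linear⁻ v w c eq φ b h
      formula⁻ (satisfies φ i) {v = v} {w} mt eq h = ≡.subst (λ u → 𝓕 ⊨ φ [ u ]) (Vec.tabulate-cong λ k → ≡.sym (eq (i k))) (rename⁻ 𝓕 (v ∘ i) φ w h)
      formula⁻ trueᵇ           mt eq h = Level.lift tt
      formula⁻ (negᵇ β)        mt eq h = λ h′ → h (formula⁺ β mt eq h′)
      formula⁻ (β ∧ᵇ γ)        mt eq (h , h′) = formula⁻ β mt eq h , formula⁻ γ mt eq h′
      formula⁻ (β ∨ᵇ γ)        mt eq (inj₁ h) = inj₁ (formula⁻ β mt eq h)
      formula⁻ (β ∨ᵇ γ)        mt eq (inj₂ h) = inj₂ (formula⁻ γ mt eq h)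
      formula⁻ (exᵇ fin β)     {v = v} {w} {η} {c} mt eq h = let w′ , h′ = 𝓕-Truth.exs⁻ (Finite.cardinality fin) h in
        Vec.lookup w′ ∘ Finite.index fin , formula⁻ β mt (extend fin v w c w′ (Vec.lookup w′ ∘ Finite.index fin) eq λ i → ≡.refl) h′
      formula⁻ (rename f g β)  mt eq h = formula⁻ β (record { to-zero = λ i → to-zero mt (f i) ; from-zero = λ i → from-zero mt (f i) }) (λ i → eq (g i)) h
      formula⁻ (fix zeros β)   mt eq h = formula⁻ β (fix-matches zeros) eq h

    -- Closure of definitions under connectives and quantifiers; atoms.

    private
      Rel : Set → Set (Level.suc a)
      Rel K = (K → Carrier) → Set a

    defines-⇔ : ∀ {K : Set} {D : Definition K} {θ θ′ : Rel K} → (∀ ρ → θ ρ → θ′ ρ) → (∀ ρ → θ′ ρ → θ ρ) → Defines D θ → Defines D θ′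
    defines-⇔ f g def = record { solvable = solvable ; necessary = λ ρ η c sol t → necessary ρ η c sol (g ρ t) ; sufficient = λ ρ η c sol h → f ρ (sufficient ρ η c sol h) }
      where open Defines def

    negation-defines : ∀ {K : Set} {D : Definition K} {θ : Rel K} → Defines D θ → Defines (negation D) (λ ρ → ¬ θ ρ)
    negation-defines def = record { solvable = solvable ; necessary = λ ρ η c sol ¬t h → ¬t (sufficient ρ η c sol h) ; sufficient = λ ρ η c sol ¬h t → ¬h (necessary ρ η c sol t) }
      where open Defines def

    -- One proof for all binary connectives. `•-map` takes maps both ways, since implication is
    -- contravariant in its first argument.
    module _ {K : Set} (_∙_ : ∀ {A B : Set} → Condition A B → Condition A B → Condition A B) (_•_ : Set a → Set a → Set a)
      (combine⁺ : ∀ {A B : Set} (β γ : Condition A B) {η c} → (Holds β η c • Holds γ η c) → Holds (β ∙ γ) η c)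
      (combine⁻ : ∀ {A B : Set} (β γ : Condition A B) {η c} → Holds (β ∙ γ) η c → Holds β η c • Holds γ η c)
      (•-map : ∀ {Q Q′ T T′ : Set a} → (Q → Q′) → (Q′ → Q) → (T → T′) → (T′ → T) → Q • T → Q′ • T′)
      {D E : Definition K} {θ ψ : Rel K} (defD : Defines D θ) (defE : Defines E ψ) where
      open Combine _∙_ D E
      private
        module DD = Defines defD
        module DE = Defines defE

        left-solves : ∀ {ρ η c} → Solves (map (relabel left) D.equations) ρ η c → Solves D.equations ρ (η ∘ inj₁) (c ∘ inj₁)
        left-solves {ρ} {η} {c} sol = All.map (λ {e} eq → trans (trans (⟦⟧-cong e λ { (inj₁ _) → refl ; (inj₂ (inj₁ _)) → refl ; (inj₂ (inj₂ _)) → refl })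
          (sym (⟦relabel⟧ left e (environment ρ η c)))) eq) (All.map⁻ sol)

        right-solves : ∀ {ρ η c} → Solves (map (relabel right) E.equations) ρ η c → Solves E.equations ρ (η ∘ inj₂) (c ∘ inj₂)
        right-solves {ρ} {η} {c} sol = All.map (λ {e} eq → trans (trans (⟦⟧-cong e λ { (inj₁ _) → refl ; (inj₂ (inj₁ _)) → refl ; (inj₂ (inj₂ _)) → refl })
          (sym (⟦relabel⟧ right e (environment ρ η c)))) eq) (All.map⁻ sol)

      combined-defines : Defines combined (λ ρ → θ ρ • ψ ρ)
      combined-defines = record
        { solvable = λ ρ →
            let η , c , sol = DD.solvable ρ
                η′ , c′ , sol′ = DE.solvable ρ
            in [ η , η′ ]′ , [ c , c′ ]′ , All.++⁺
              (All.map⁺ (All.map (λ {e} eq → trans (⟦relabel⟧ left e (environment ρ [ η , η′ ]′ [ c , c′ ]′)) (trans (⟦⟧-cong e λ { (inj₁ _) → refl ; (inj₂ (inj₁ _)) → refl ; (inj₂ (inj₂ _)) → refl }) eq)) sol))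
              (All.map⁺ (All.map (λ {e} eq → trans (⟦relabel⟧ right e (environment ρ [ η , η′ ]′ [ c , c′ ]′)) (trans (⟦⟧-cong e λ { (inj₁ _) → refl ; (inj₂ (inj₁ _)) → refl ; (inj₂ (inj₂ _)) → refl }) eq)) sol′))
        ; necessary = λ ρ η c sol t → let l = left-solves (All.++⁻ˡ (map (relabel left) D.equations) sol) ; r = right-solves (All.++⁻ʳ (map (relabel left) D.equations) sol) in
            combine⁺ (rename inj₁ inj₁ D.condition) (rename inj₂ inj₂ E.condition) (•-map
              (DD.necessary ρ _ _ l) (DD.sufficient ρ _ _ l) (DE.necessary ρ _ _ r) (DE.sufficient ρ _ _ r) t)
        ; sufficient = λ ρ η c sol h → let l = left-solves (All.++⁻ˡ (map (relabel left) D.equations) sol) ; r = right-solves (All.++⁻ʳ (map (relabel left) D.equations) sol) in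
            •-map (DD.sufficient ρ _ _ l) (DD.necessary ρ _ _ l) (DE.sufficient ρ _ _ r) (DE.necessary ρ _ _ r)
              (combine⁻ (rename inj₁ inj₁ D.condition) (rename inj₂ inj₂ E.condition) h) }

    module _ {K : Set} {D E : Definition K} {θ ψ : Rel K} (defD : Defines D θ) (defE : Defines E ψ) where
      ∧-defines : Defines (D ∧ᵈ E) (λ ρ → θ ρ × ψ ρ)
      ∧-defines = combined-defines _∧ᵇ_ _×_ (λ _ _ h → h) (λ _ _ h → h) (λ f _ g _ (x , y) → f x , g y) defD defE

      ∨-defines : Defines (D ∨ᵈ E) (λ ρ → θ ρ ⊎ ψ ρ)
      ∨-defines = combined-defines _∨ᵇ_ _⊎_ (λ _ _ h → h) (λ _ _ h → h) (λ f _ g _ → [ (λ x → inj₁ (f x)) , (λ y → inj₂ (g y)) ]′) defD defE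

      ⇒-defines : Defines (D ⇒ᵈ E) (λ ρ → θ ρ → ψ ρ)
      ⇒-defines = combined-defines (λ β γ → negᵇ β ∨ᵇ γ) (λ Q T → Q → T) implication⁺
        (λ _ _ → λ { (inj₁ ¬h) h → ⊥-elim (¬h h) ; (inj₂ h) _ → h }) (λ _ f g _ h x → g (h (f x))) defD defE
        where
        -- Conditions have no implication, and replacing it by a disjunction takes excluded middle.
        implication⁺ : ∀ {A B : Set} (β γ : Condition A B) {η c} → (Holds β η c → Holds γ η c) → Holds (negᵇ β ∨ᵇ γ) η c
        implication⁺ β γ {η} {c} h with em (Holds β η c)
        ... | yes hβ = inj₂ (h hβ)
        ... | no ¬hβ = inj₁ ¬hβ

    disj-defines : ∀ {K I : Set} (xs : List I) {D : I → Definition K} {θ : I → Rel K} → (∀ x → Defines (D x) (θ x)) → Defines (disjᵈ xs D) (λ ρ → Any (λ x → θ x ρ) xs)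
    disj-defines []       def = record { solvable = λ ρ → (λ ()) , (λ ()) , [] ; necessary = λ { ρ η c sol () } ; sufficient = λ ρ η c sol h → ⊥-elim (h (Level.lift tt)) }
    disj-defines (x ∷ xs) def = defines-⇔ (λ ρ → [ here , there ]′) (λ ρ → λ { (here h) → inj₁ h ; (there h) → inj₂ h }) (∨-defines (def x) (disj-defines xs def))

    zero-pattern : ∀ {A : Set} (fin : Finite A) → (A → Carrier) → Vec Bool (Finite.cardinality fin)
    zero-pattern fin η = Vec.tabulate (λ k → does (em (η (Finite.element fin k) ≈ 0#)))

    zero-pattern-lookup : ∀ {A : Set} (fin : Finite A) η i → Vec.lookup (zero-pattern fin η) (Finite.index fin i) ≡ does (em (η i ≈ 0#))
    zero-pattern-lookup fin η i = ≡.trans (Vec.lookup∘tabulate _ (Finite.index fin i)) (≡.cong (λ i → does (em (η i ≈ 0#))) (Finite.element-index fin i))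

    zero-pattern-matches : ∀ {A : Set} (fin : Finite A) η → Matches η (Vec.lookup (zero-pattern fin η) ∘ Finite.index fin)
    zero-pattern-matches fin η = record
      { to-zero   = λ i eq → does-true (em (η i ≈ 0#)) (≡.trans (≡.sym (zero-pattern-lookup fin η i)) eq)
      ; from-zero = λ i eq → ≡.trans (zero-pattern-lookup fin η i) (true-does (em (η i ≈ 0#)) eq) }

    cons : ∀ {n} → Carrier → (Fin n → Carrier) → Fin (suc n) → Carrier
    cons x ρ zero    = x
    cons x ρ (suc i) = ρ i

    module _ {n} {D : Definition (Fin (suc n))} {θ : Rel (Fin (suc n))} (def : Defines D θ) where
      open Exists D
      open Definition D
      open Defines def
      private
        Case : Vec Bool FA.cardinality → Rel (Fin n)
        Case bits = EliminationMeaning.Eliminable finite-⊤⊎A finite-B (system bits) (side bits) (nonvanishing bits)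

        case-defines : ∀ bits → Defines (eliminated-case bits) (Case bits)
        case-defines bits = EliminationMeaning.eliminated-defines finite-⊤⊎A finite-B (system bits) (side bits) (nonvanishing bits)

        split-env : ∀ e ρ x (η : A → Carrier) (c : B → Fᵣ.Carrier) → ⟦ relabel split-variables e ⟧ (environment ρ [ (λ _ → x) , η ]′ c) ≈ ⟦ e ⟧ (environment (cons x ρ) η c)
        split-env e ρ x η c = trans (⟦relabel⟧ split-variables e (environment ρ [ (λ _ → x) , η ]′ c)) (⟦⟧-cong e λ where
          (inj₁ zero)     → refl
          (inj₁ (suc i))  → refl
          (inj₂ (inj₁ _)) → refl
          (inj₂ (inj₂ _)) → refl)

        -- The case is the actual vanishing pattern of a solution η. Excluded middle may be used to
        -- find it, as the disjunction already contains every pattern.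
        to-case : ∀ ρ → Σ[ x ∈ Carrier ] θ (cons x ρ) → Any (λ bits → Case bits ρ) (bit-vectors FA.cardinality)
        to-case ρ (x , t) = any-bit-vector bits ([ (λ _ → x) , η ]′ , c , All.++⁺ (All.map⁺ (All.map (λ {e} eq → trans (split-env e ρ x η c) eq) sol)) (finite-∀ FA.cardinality (vanishing bits) vanish)
            , holds-ext condition (λ i η≈0 → to-zero (fix-matches (Vec.lookup bits ∘ FA.index)) i (from-zero matches i η≈0)) (λ i fix≈0 → to-zero matches i (from-zero (fix-matches (Vec.lookup bits ∘ FA.index)) i fix≈0)) (λ _ → ≡.refl) (necessary (cons x ρ) η c sol t)
            , λ { (inj₂ i) eq η≈0 → not-true (from-zero matches i η≈0) eq })
          where
          η = proj₁ (solvable (cons x ρ))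
          c = proj₁ (proj₂ (solvable (cons x ρ)))
          sol = proj₂ (proj₂ (solvable (cons x ρ)))
          bits = zero-pattern finite-A η
          matches = zero-pattern-matches finite-A η
          not-true : ∀ {b} → b ≡ true → ¬ not b ≡ true
          not-true ≡.refl ()
          vanish : ∀ k → ⟦ vanishing bits k ⟧ (environment ρ [ (λ _ → x) , η ]′ c) ≈ 0#
          vanish k with Vec.lookup bits k in eq
          ... | false = ⟦⟧-[] _
          ... | true  = trans (⟦variable⟧ (inj₂ (inj₁ (inj₂ (FA.element k)))) (environment ρ [ (λ _ → x) , η ]′ c))
            (does-true (em (η (FA.element k) ≈ 0#)) (≡.trans (≡.sym (Vec.lookup∘tabulate _ k)) eq))

        from-case : ∀ ρ bits → Case bits ρ → Σ[ x ∈ Carrier ] θ (cons x ρ)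
        from-case ρ bits (η′ , c , sol , side-holds , nonzero) = x , sufficient (cons x ρ) η c
            (All.map (λ {e} eq → trans (sym (split-env e ρ x η c)) (trans (⟦⟧-cong (relabel split-variables e) λ { (inj₁ _) → refl ; (inj₂ (inj₁ (inj₁ _))) → refl ; (inj₂ (inj₁ (inj₂ _))) → refl ; (inj₂ (inj₂ _)) → refl }) eq))
              (All.map⁻ (All.++⁻ˡ (map (relabel split-variables) equations) sol)))
            (holds-ext condition {c = c} (λ i fix≈0 → to i (from-zero (fix-matches (Vec.lookup bits ∘ FA.index)) i fix≈0)) (λ i η≈0 → to-zero (fix-matches (Vec.lookup bits ∘ FA.index)) i (from i η≈0)) (λ _ → ≡.refl) side-holds)
          where
          x = η′ (inj₁ tt)
          η = η′ ∘ inj₂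
          vanish : ∀ k → ⟦ vanishing bits k ⟧ (environment ρ η′ c) ≈ 0#
          vanish = ∀-finite FA.cardinality (vanishing bits) (All.++⁻ʳ (map (relabel split-variables) equations) sol)
          to : ∀ i → Vec.lookup bits (FA.index i) ≡ true → η i ≈ 0#
          to i eq = ≡.subst (λ i → η i ≈ 0#) (FA.element-index i) (zero-at (FA.index i) eq)
            where
            zero-at : ∀ k → Vec.lookup bits k ≡ true → η (FA.element k) ≈ 0#
            zero-at k eq with Vec.lookup bits k | vanish k
            ... | true | h = trans (sym (⟦variable⟧ (inj₂ (inj₁ (inj₂ (FA.element k)))) (environment ρ η′ c))) h
          from : ∀ i → η i ≈ 0# → Vec.lookup bits (FA.index i) ≡ true
          from i η≈0 with Vec.lookup bits (FA.index i) in eq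
          ... | true  = ≡.refl
          ... | false = ⊥-elim (nonzero (inj₂ i) (≡.cong not eq) η≈0)

      exists-defines : Defines exists (λ ρ → Σ[ x ∈ Carrier ] θ (cons x ρ))
      exists-defines = defines-⇔ (λ ρ any → let bits , case = Any.satisfied any in from-case ρ bits case) to-case
        (disj-defines (bit-vectors FA.cardinality) case-defines)

    module _ {n k : ℕ} (t : Fin k → Form (Fin n)) (e : Fin k → Poly) (φ : Formula Lp k) where
      open Atom t e φ
      open DecompositionMeaning N (s≤s z≤n)

      AtomHolds : Rel (Fin n)
      AtomHolds ρ = Σ[ c ∈ (Fin k → Fᵣ.Carrier) ] (∀ i → ⟦ t i ⟧ ρ + ⟪ e i ⟫ ≈ κ.to (c i)) × 𝓕 ⊨ φ [ Vec.tabulate c ]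

      private
        ⟦atom-equation⟧ : ∀ i ρ η c → ⟦ atom-equation i ⟧ (environment ρ η c) ≈ σ ^ N * ⟦ t i ⟧ ρ + - (⟪ Decomposition.b N (s≤s z≤n) ⟫ * η i + digit-∑ (λ l → c (i , l)))
        ⟦atom-equation⟧ i ρ η c = trans (⟦decomposition⟧ (relabel inj₁ (t i)) (inj₂ (inj₁ i)) (λ l → inj₂ (inj₂ (i , l))) (environment ρ η c))
          (+-congʳ (*-congˡ (⟦relabel⟧ inj₁ (t i) (environment ρ η c))))

        solves⁻ : ∀ {ρ η c} → Solves (map atom-equation (allFin k)) ρ η c → ∀ i → Decomposes (⟦ t i ⟧ ρ) (η i) (λ l → c (i , l))
        solves⁻ {ρ} {η} {c} sol i = trans (S.solve 2 (λ x y → x S.:= (x S.:+ S.:- y) S.:+ y) refl (σ ^ N * ⟦ t i ⟧ ρ) (⟪ Decomposition.b N (s≤s z≤n) ⟫ * η i + digit-∑ (λ l → c (i , l))))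
          (trans (+-congʳ (trans (sym (⟦atom-equation⟧ i ρ η c)) (∀-finite k atom-equation sol i))) (+-identityˡ _))

        ⟦constant-form⟧ : ∀ i (c : Fin k × Fin width → Fᵣ.Carrier) (d : Fin k → Fᵣ.Carrier) →
          ⟦ constant-form i ⟧ (κ.to ∘ [ c , d ]′) + ⟪ s ^ᴾ N ⊗ e i ⟫ ≈ (digit-∑ (λ l → c (i , l)) + - (σ ^ N * κ.to (d i))) + σ ^ N * ⟪ e i ⟫
        ⟦constant-form⟧ i c d = +-cong (trans (⟦⟧-++ (digit-form (λ l → inj₁ (i , l))) _ _) (+-cong (⟦digit⟧κ (λ l → inj₁ (i , l)) [ c , d ]′)
            (trans (⟦-⟧ (s ^ᴾ N ·ᶠ variable-form (inj₂ i)) _) (-‿cong (trans (⟦·⟧ (s ^ᴾ N) (variable-form (inj₂ i)) _) (*-cong (⟪⟫.to-^ s N) (⟦variable⟧ (inj₂ i) _)))))))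
          (trans (⟪⟫.to-* (s ^ᴾ N) (e i)) (*-congʳ (⟪⟫.to-^ s N)))

        atom-necessary : ∀ ρ η c → Solves (map atom-equation (allFin k)) ρ η c → AtomHolds ρ → Holds (Definition.condition atom) η c
        atom-necessary ρ η c sol (d , eq , h) = allᵇ⁺ k η≈0 , d , allᵇ⁺ k constants , h
          where
          bound : ∀ i → Bd N (⟦ t i ⟧ ρ)
          bound i = Bd-cong (trans (+-congʳ (sym (eq i))) (S.solve 2 (λ x y → (x S.:+ y) S.:+ S.:- y S.:= x) refl (⟦ t i ⟧ ρ) ⟪ e i ⟫))
            (Bd-+ (Bd-mono (s≤s z≤n) (Bd-κ (d i))) (Bd-neg (Bd-⟪⟫ (e i) (ℕ.m≤n⇒m≤1+n (proj₂ (Fin-bound k (λ i → length (e i))) i)))))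
          η≈0 : ∀ i → η i ≈ 0#
          η≈0 i = bounded-vanishes (bound i) (solves⁻ sol i)
          constants : ∀ i → ⟦ constant-form i ⟧ (κ.to ∘ [ c , d ]′) + ⟪ s ^ᴾ N ⊗ e i ⟫ ≈ 0#
          constants i = trans (⟦constant-form⟧ i c d) (trans (+-congʳ (+-cong digits≈ (-‿cong (*-congˡ (sym (eq i))))))
            (S.solve 3 (λ s x y → (s S.:* x S.:+ S.:- (s S.:* (x S.:+ y))) S.:+ s S.:* y S.:= S.:0) refl (σ ^ N) (⟦ t i ⟧ ρ) ⟪ e i ⟫))
            where
            digits≈ : digit-∑ (λ l → c (i , l)) ≈ σ ^ N * ⟦ t i ⟧ ρ
            digits≈ = sym (trans (solves⁻ sol i) (trans (+-congʳ (trans (*-congˡ (η≈0 i)) (zeroʳ _))) (+-identityˡ _)))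

        atom-sufficient : ∀ ρ η c → Solves (map atom-equation (allFin k)) ρ η c → Holds (Definition.condition atom) η c → AtomHolds ρ
        atom-sufficient ρ η c sol (η≈0 , d , constants , h) = d , (λ i → σ^-injective N (begin
            σ ^ N * (⟦ t i ⟧ ρ + ⟪ e i ⟫)
              ≈⟨ trans (distribˡ _ _ _) (+-congʳ (trans (solves⁻ sol i) (trans (+-congʳ (trans (*-congˡ (allᵇ⁻ k η≈0 i)) (zeroʳ _))) (+-identityˡ _)))) ⟩
            digit-∑ (λ l → c (i , l)) + σ ^ N * ⟪ e i ⟫
              ≈⟨ S.solve 3 (λ g y x → g S.:+ y S.:= x S.:+ ((g S.:+ S.:- x) S.:+ y)) refl (digit-∑ (λ l → c (i , l))) (σ ^ N * ⟪ e i ⟫) (σ ^ N * κ.to (d i)) ⟩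
            σ ^ N * κ.to (d i) + ((digit-∑ (λ l → c (i , l)) + - (σ ^ N * κ.to (d i))) + σ ^ N * ⟪ e i ⟫)
              ≈⟨ +-congˡ (trans (sym (⟦constant-form⟧ i c d)) (allᵇ⁻ k constants i)) ⟩
            σ ^ N * κ.to (d i) + 0#
              ≈⟨ +-identityʳ _ ⟩
            σ ^ N * κ.to (d i) ∎)) , h

      atom-defines : Defines atom AtomHolds
      atom-defines = record
        { solvable = λ ρ → (λ i → proj₁ (decompose (⟦ t i ⟧ ρ))) , (λ (i , l) → proj₁ (proj₂ (decompose (⟦ t i ⟧ ρ))) l) ,
            finite-∀ k atom-equation λ i → trans (⟦atom-equation⟧ i ρ _ _) (trans (+-congʳ (proj₂ (proj₂ (decompose (⟦ t i ⟧ ρ))))) (-‿inverseʳ _))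
        ; necessary = atom-necessary ; sufficient = atom-sufficient }

    -- Correctness of the existential formulas and of the sentences over F.

    -- The interpretation of the symbols is a parameter with the properties `Interpreted`, so that
    -- the structure of the statement can be inserted as it stands.
    module Correct
      (fun : ∀ {k} → FunLpz k → Vec Carrier k → Carrier)
      (relation : ∀ {k} → RelLpzᵉ k → Vec Carrier k → Set a) where

      𝓜 : Structure Lpzᵉ a
      𝓜 = record { Carrier = Carrier ; _≈_ = _≈_ ; ⟦_⟧ᶠ = fun ; ⟦_⟧ʳ = relation }

      IsConstant : Carrier → Fᵣ.Carrier → Set a
      IsConstant x c = x ≈ κ.to c

      record Interpreted : Set a where
        field
          base-fun   : ∀ {k} (f : FunLp k) v → fun (base f) v ≈ ⟦ f ⟧Lp p (RawRing.rawSemiring (CommutativeRing.rawRing R)) v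
          z-mult-fun : ∀ x → fun z-mult (x ∷ []) ≈ z * x
          inF⁺       : ∀ x → Σ[ c ∈ Fᵣ.Carrier ] IsConstant x c → relation (base inF) (x ∷ [])
          inF⁻       : ∀ x → relation (base inF) (x ∷ []) → Σ[ c ∈ Fᵣ.Carrier ] IsConstant x c
          P⁺         : ∀ {k} (σ : Formula Lp k) v → Σ[ c ∈ Vec Fᵣ.Carrier k ] Pointwise IsConstant v c × 𝓕 ⊨ σ [ c ] → relation (P σ) v
          P⁻         : ∀ {k} (σ : Formula Lp k) v → relation (P σ) v → Σ[ c ∈ Vec Fᵣ.Carrier k ] Pointwise IsConstant v c × 𝓕 ⊨ σ [ c ]

      module _ (interpreted : Interpreted) where
        open Interpreted interpreted
        private
          module 𝓜-Truth = CLpz.Truth 𝓜 refl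

        eval-linear : ∀ {n} (v : Vec Carrier n) t → eval 𝓜 v t ≈ ⟦ term-form t ⟧ (Vec.lookup v) + ⟪ term-constant t ⟫
        eval-linear v (var i) = sym (trans (+-identityʳ _) (⟦variable⟧ i (Vec.lookup v)))
        eval-linear v (app (base add) (t ∷ u ∷ [])) = trans (base-fun add _) (trans (+-cong (eval-linear v t) (eval-linear v u))
          (trans (S.solve 4 (λ a b c d → (a S.:+ b) S.:+ (c S.:+ d) S.:= (a S.:+ c) S.:+ (b S.:+ d)) refl
            (⟦ term-form t ⟧ (Vec.lookup v)) ⟪ term-constant t ⟫ (⟦ term-form u ⟧ (Vec.lookup v)) ⟪ term-constant u ⟫)
            (sym (+-cong (⟦⟧-++ (term-form t) (term-form u) (Vec.lookup v)) (⟪⟫.to-+ (term-constant t) (term-constant u))))))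
        eval-linear v (app (base frob) (t ∷ [])) = trans (base-fun frob _) (trans (φ-cong 1 (eval-linear v t))
          (trans (φ-+ 1 _ _) (sym (+-cong (⟦frob⟧ 1 (term-form t) (Vec.lookup v)) (⟪φ⟫ 1 (term-constant t))))))
        eval-linear v (app (base nil) []) = trans (base-fun nil []) (sym (trans (+-cong (⟦⟧-[] _) refl) (+-identityˡ _)))
        eval-linear v (app (base one) []) = trans (base-fun one []) (sym (trans (+-cong (⟦⟧-[] _) ⟪⟫.to-1) (+-identityˡ _)))
        eval-linear v (app z-mult (t ∷ [])) = trans (z-mult-fun _) (trans (*-congˡ (eval-linear v t)) (trans (distribˡ _ _ _)
          (sym (+-cong (trans (⟦·⟧ X (term-form t) (Vec.lookup v)) (*-congʳ (Evaluation.ev-X (κ ∘ʰ ι) z)))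
            (trans (⟪⟫.to-* X (term-constant t)) (*-congʳ (Evaluation.ev-X (κ ∘ʰ ι) z)))))))

        eval-nil : ∀ {n} (v : Vec Carrier n) → eval 𝓜 v BLpz.nilᵗ ≈ 0#
        eval-nil v = base-fun nil []

        eval-scaleᵗ : ∀ {n} (v : Vec Carrier n) m t → eval 𝓜 v (BLpz.scaleᵗ m t) ≈ S.fromℕ m * eval 𝓜 v t
        eval-scaleᵗ v zero    t = trans (eval-nil v) (sym (zeroˡ _))
        eval-scaleᵗ v (suc m) t = trans (base-fun add _) (trans (+-cong (sym (*-identityˡ _)) (eval-scaleᵗ v m t)) (sym (distribʳ _ _ _)))

        eval-frobᵗ : ∀ {n} (v : Vec Carrier n) k t → eval 𝓜 v (BLpz.frobᵗ k t) ≈ eval 𝓜 v t ^p^ k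
        eval-frobᵗ v zero    t = refl
        eval-frobᵗ v (suc k) t = trans (eval-frobᵗ v k (app (base frob) (t ∷ []))) (φ-cong k (base-fun frob _))

        eval-polynomial-term : ∀ {n} (v : Vec Carrier n) a t → eval 𝓜 v (polynomial-term a t) ≈ ⟪ a ⟫ * eval 𝓜 v t
        eval-polynomial-term v []      t = trans (eval-nil v) (sym (zeroˡ _))
        eval-polynomial-term v (c ∷ a) t = trans (base-fun add _) (trans (+-cong
            (trans (eval-scaleᵗ v (natural c) t) (*-congʳ (trans (sym (fromℕ-hom κ (natural c))) (κ.to-cong (ι-natural c)))))
            (trans (z-mult-fun _) (trans (*-congˡ (eval-polynomial-term v a t)) (sym (*-assoc _ _ _)))))
          (sym (distribʳ _ _ _)))

        eval-form-term : ∀ {I : Set} {n} (v : Vec Carrier n) (f : I → Fin n) φ → eval 𝓜 v (form-term f φ) ≈ ⟦ φ ⟧ (Vec.lookup v ∘ f)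
        eval-form-term v f []               = trans (eval-nil v) (sym (⟦⟧-[] _))
        eval-form-term v f (mono a i k ∷ φ) = trans (base-fun add _) (trans (+-cong
            (trans (eval-polynomial-term v a (BLpz.frobᵗ k (var (f i)))) (trans (*-congˡ (eval-frobᵗ v k (var (f i)))) (sym (⟦term⟧ a i k (Vec.lookup v ∘ f)))))
            (eval-form-term v f φ))
          (sym (⟦⟧-++ (term a i k) φ (Vec.lookup v ∘ f))))

        pointwise⁺ : ∀ {n k} (v : Vec Carrier n) (ts : Vec (Term Lpzᵉ n) k) c →
          (∀ i → IsConstant (eval 𝓜 v (Vec.lookup ts i)) (Vec.lookup c i)) → Pointwise IsConstant (evals 𝓜 v ts) c
        pointwise⁺ v []       []      h = []
        pointwise⁺ v (t ∷ ts) (c ∷ cs) h = h zero ∷ pointwise⁺ v ts cs (λ i → h (suc i))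

        pointwise⁻ : ∀ {n k} (v : Vec Carrier n) (ts : Vec (Term Lpzᵉ n) k) {c} →
          Pointwise IsConstant (evals 𝓜 v ts) c → ∀ i → IsConstant (eval 𝓜 v (Vec.lookup ts i)) (Vec.lookup c i)
        pointwise⁻ v (t ∷ ts) (h ∷ hs) zero    = h
        pointwise⁻ v (t ∷ ts) (h ∷ hs) (suc i) = pointwise⁻ v ts hs i

        module _ {n} {D : Definition (Fin n)} {θ : (Fin n → Carrier) → Set a} (def : Defines D θ) where
          open ToFormula D
          open Definition D
          open Defines def

          private
            variables : Vec (Term Lpzᵉ ((nA ℕ.+ nB) ℕ.+ n)) nB
            variables = Vec.tabulate λ k → var ((nA ↑ʳ k) ↑ˡ n)

            lookup-variables : ∀ v k → eval 𝓜 v (Vec.lookup variables k) ≡ Vec.lookup v ((nA ↑ʳ k) ↑ˡ n)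
            lookup-variables v k = ≡.cong (eval 𝓜 v) (Vec.lookup∘tabulate (λ k → var ((nA ↑ʳ k) ↑ˡ n)) k)

            literal⁻ : ∀ b k v → 𝓜 ⊨ literal b k [ v ] → (b ≡ true → Vec.lookup v ((k ↑ˡ nB) ↑ˡ n) ≈ 0#) × (Vec.lookup v ((k ↑ˡ nB) ↑ˡ n) ≈ 0# → b ≡ true)
            literal⁻ true  k v h = (λ _ → trans h (eval-nil v)) , λ _ → ≡.refl
            literal⁻ false k v h = (λ ()) , λ eq → ⊥-elim (h (trans eq (sym (eval-nil v))))

            literal⁺ : ∀ {x} (d : Dec (x ≈ 0#)) k v → Vec.lookup v ((k ↑ˡ nB) ↑ˡ n) ≈ x → 𝓜 ⊨ literal (does d) k [ v ]
            literal⁺ (yes x≈0) k v eq = trans eq (trans x≈0 (sym (eval-nil v)))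
            literal⁺ (no  x≉0) k v eq h = x≉0 (trans (sym eq) (trans h (eval-nil v)))

            case⁻ : ∀ (w : Vec Carrier (nA ℕ.+ nB)) v bits → All (λ e → ⟦ e ⟧ (Vec.lookup (w Vec.++ v) ∘ place) ≈ 0#) equations →
              𝓜 ⊨ case bits [ w Vec.++ v ] → θ (Vec.lookup v)
            case⁻ w v bits sol (lits , holds) = sufficient (Vec.lookup v) η c′ (All.map (λ {e} eq → trans (⟦⟧-cong e env) eq) sol)
                (formula⁻ condition {Vec.lookup bits ∘ FA.index} {FB.index} {c} {η} {c′} matches (λ i → ≡.refl) (proj₂ (proj₂ (P⁻ _ _ holds))))
              where
              u = w Vec.++ v
              c = proj₁ (P⁻ _ _ holds)
              c′ : B → Fᵣ.Carrier
              c′ b = Vec.lookup c (FB.index b)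
              η : A → Carrier
              η i = Vec.lookup u (place (inj₂ (inj₁ i)))
              env : ∀ i → environment (Vec.lookup v) η c′ i ≈ Vec.lookup u (place i)
              env (inj₁ i)        = reflexive (≡.sym (Vec.lookup-++ʳ w v i))
              env (inj₂ (inj₁ i)) = refl
              env (inj₂ (inj₂ b)) = trans (sym (pointwise⁻ u variables (proj₁ (proj₂ (P⁻ _ _ holds))) (FB.index b))) (reflexive (lookup-variables u (FB.index b)))
              literals : ∀ k → 𝓜 ⊨ literal (Vec.lookup bits k) k [ u ]
              literals = All.tabulate⁻ (𝓜-Truth.conj⁻ (allFin nA) {λ k → literal (Vec.lookup bits k) k} {u} lits)
              matches : Matches η (Vec.lookup bits ∘ FA.index)
              matches = record
                { to-zero   = λ i → proj₁ (literal⁻ (Vec.lookup bits (FA.index i)) (FA.index i) u (literals (FA.index i)))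
                ; from-zero = λ i → proj₂ (literal⁻ (Vec.lookup bits (FA.index i)) (FA.index i) u (literals (FA.index i))) }

            module Witness (v : Vec Carrier n) (η : A → Carrier) (c : B → Fᵣ.Carrier) where
              w₁ : Vec Carrier nA
              w₁ = Vec.tabulate (η ∘ FA.element)
              c′ : Vec Fᵣ.Carrier nB
              c′ = Vec.tabulate (c ∘ FB.element)
              w₂ : Vec Carrier nB
              w₂ = Vec.tabulate (κ.to ∘ c ∘ FB.element)
              u : Vec Carrier ((nA ℕ.+ nB) ℕ.+ n)
              u = (w₁ Vec.++ w₂) Vec.++ v
              at-A : ∀ k → Vec.lookup u ((k ↑ˡ nB) ↑ˡ n) ≡ η (FA.element k)
              at-A k = ≡.trans (Vec.lookup-++ˡ (w₁ Vec.++ w₂) v _) (≡.trans (Vec.lookup-++ˡ w₁ w₂ k) (Vec.lookup∘tabulate _ k))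
              at-B : ∀ k → Vec.lookup u ((nA ↑ʳ k) ↑ˡ n) ≡ κ.to (c (FB.element k))
              at-B k = ≡.trans (Vec.lookup-++ˡ (w₁ Vec.++ w₂) v _) (≡.trans (Vec.lookup-++ʳ w₁ w₂ k) (Vec.lookup∘tabulate _ k))
              env : ∀ i → Vec.lookup u (place i) ≈ environment (Vec.lookup v) η c i
              env (inj₁ i)        = reflexive (Vec.lookup-++ʳ (w₁ Vec.++ w₂) v i)
              env (inj₂ (inj₁ i)) = reflexive (≡.trans (at-A (FA.index i)) (≡.cong η (FA.element-index i)))
              env (inj₂ (inj₂ b)) = reflexive (≡.trans (at-B (FB.index b)) (≡.cong (κ.to ∘ c) (FB.element-index b)))
              bits = zero-pattern finite-A η
              holds : Holds condition η c → relation (P (field-formula condition (Vec.lookup bits ∘ FA.index) FB.index)) (evals 𝓜 u variables)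
              holds h = P⁺ _ _ (c′ , pointwise⁺ u variables c′ (λ k → reflexive (≡.trans (lookup-variables u k) (≡.trans (at-B k)
                  (≡.cong κ.to (≡.sym (Vec.lookup∘tabulate (c ∘ FB.element) k))))))
                , formula⁺ condition (zero-pattern-matches finite-A η)
                    (λ b → ≡.sym (≡.trans (Vec.lookup∘tabulate (c ∘ FB.element) (FB.index b)) (≡.cong c (FB.element-index b)))) h)
              literals : ∀ k → 𝓜 ⊨ literal (Vec.lookup bits k) k [ u ]
              literals k = ≡.subst (λ b → 𝓜 ⊨ literal b k [ u ]) (≡.sym (Vec.lookup∘tabulate (λ k → does (em (η (FA.element k) ≈ 0#))) k))
                (literal⁺ (em (η (FA.element k) ≈ 0#)) k u (reflexive (at-A k)))

          existential⁻ : ∀ v → 𝓜 ⊨ existential-formula [ v ] → θ (Vec.lookup v)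
          existential⁻ v h =
            let w , eqs , cases = 𝓜-Truth.exs⁻ (nA ℕ.+ nB) {matrix} {v} h
                bits , case-holds = Any.satisfied (𝓜-Truth.disj⁻ (bit-vectors nA) {case} {w Vec.++ v} cases)
                u = w Vec.++ v
            in case⁻ w v bits (All.map (λ {e} eq → trans (sym (eval-form-term u place e)) (trans eq (eval-nil u)))
                 (𝓜-Truth.conj⁻ equations {λ e → form-term place e ≐ BLpz.nilᵗ} {u} eqs)) case-holds

          existential⁺ : ∀ v → θ (Vec.lookup v) → 𝓜 ⊨ existential-formula [ v ]
          existential⁺ v t = 𝓜-Truth.exs⁺ (nA ℕ.+ nB) {matrix} {v} (w₁ Vec.++ w₂)
              ( 𝓜-Truth.conj⁺ equations {λ e → form-term place e ≐ BLpz.nilᵗ} {u}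
                  (All.map (λ {e} eq → trans (eval-form-term u place e) (trans (⟦⟧-cong e env) (trans eq (sym (eval-nil u))))) sol)
              , 𝓜-Truth.disj⁺ (bit-vectors nA) {case} {u} (any-bit-vector bits
                  ( 𝓜-Truth.conj⁺ (allFin nA) {λ k → literal (Vec.lookup bits k) k} {u} (All.tabulate⁺ literals)
                  , holds (necessary (Vec.lookup v) η c sol t))))
            where
            η = proj₁ (solvable (Vec.lookup v))
            c = proj₁ (proj₂ (solvable (Vec.lookup v)))
            sol = proj₂ (proj₂ (solvable (Vec.lookup v)))
            open Witness v η c

        module _ {D : Definition (Fin 0)} {θ : (Fin 0 → Carrier) → Set a} (def : Defines D θ) where
          open ToFormula D
          open Definition D
          open Defines def

          private
            zero-solves : ∀ ρ (c : B → Fᵣ.Carrier) → (∀ b → c b Fᵣ.≈ Fᵣ.0#) → Solves equations ρ (λ _ → 0#) c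
            zero-solves ρ c c≈0 = All.universal (λ e → ⟦⟧-0 e λ { (inj₁ ()) ; (inj₂ (inj₁ _)) → refl ; (inj₂ (inj₂ b)) → trans (κ.to-cong (c≈0 b)) κ.to-0 }) equations

            matches : Matches {A} (λ _ → 0#) (λ _ → true)
            matches = record { to-zero = λ _ _ → refl ; from-zero = λ _ _ → ≡.refl }

          sentence⁻ : ∀ ρ → 𝓕 ⊨ sentence [ [] ] → θ ρ
          sentence⁻ ρ h =
            let w , zeros , holds = 𝓕-Truth.exs⁻ nB {v = []} h
                c = λ b → Vec.lookup (w Vec.++ []) (FB.index b ↑ˡ 0)
            in sufficient ρ (λ _ → 0#) c
                 (zero-solves ρ c λ b → All.tabulate⁻ (𝓕-Truth.conj⁻ (allFin nB) {λ k → var (k ↑ˡ 0) ≐ BLp.nilᵗ} {w Vec.++ []} zeros) (FB.index b))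
                 (formula⁻ condition {λ _ → true} {λ b → FB.index b ↑ˡ 0} {w Vec.++ []} {λ _ → 0#} {c} matches (λ _ → ≡.refl) holds)

          sentence⁺ : ∀ ρ → θ ρ → 𝓕 ⊨ sentence [ [] ]
          sentence⁺ ρ t = 𝓕-Truth.exs⁺ nB {v = []} w
              ( 𝓕-Truth.conj⁺ (allFin nB) {λ k → var (k ↑ˡ 0) ≐ BLp.nilᵗ} {w Vec.++ []} (All.tabulate⁺ zeros)
              , formula⁺ condition {λ _ → true} {λ b → FB.index b ↑ˡ 0} {w Vec.++ []} {λ _ → 0#} {c} matches (λ _ → ≡.refl)
                  (necessary ρ (λ _ → 0#) c (zero-solves ρ c (λ b → zeros (FB.index b))) t))
            where
            w = Vec.replicate nB Fᵣ.0#
            zeros : ∀ k → Vec.lookup (w Vec.++ []) (k ↑ˡ 0) Fᵣ.≈ Fᵣ.0#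
            zeros k = Fᵣ.reflexive (≡.trans (Vec.lookup-++ˡ w [] k) (Vec.lookup-replicate k Fᵣ.0#))
            c : B → Fᵣ.Carrier
            c b = Vec.lookup (w Vec.++ []) (FB.index b ↑ˡ 0)

        private
          eval-tabulate : ∀ {n} (ρ : Fin n → Carrier) t → eval 𝓜 (Vec.tabulate ρ) t ≈ ⟦ term-form t ⟧ ρ + ⟪ term-constant t ⟫
          eval-tabulate ρ t = trans (eval-linear (Vec.tabulate ρ) t) (+-congʳ (⟦⟧-cong (term-form t) λ i → reflexive (Vec.lookup∘tabulate ρ i)))

          equation-defines : ∀ {n} (t u : Term Lpzᵉ n) → Defines (defining (t ≐ u)) (λ ρ → 𝓜 ⊨ t ≐ u [ Vec.tabulate ρ ])
          equation-defines {n} t u = defines-⇔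
              (λ ρ (c , eq , c≈0) → trans (S.solve 2 (λ x y → x S.:= (x S.:+ S.:- y) S.:+ y) refl (eval 𝓜 (Vec.tabulate ρ) t) (eval 𝓜 (Vec.tabulate ρ) u))
                (trans (+-congʳ (trans (sym (difference ρ)) (trans (eq zero) (trans (κ.to-cong c≈0) κ.to-0)))) (+-identityˡ _)))
              (λ ρ eq → (λ _ → Fᵣ.0#) , (λ _ → trans (difference ρ) (trans (+-congʳ eq) (trans (-‿inverseʳ _) (sym κ.to-0)))) , Fᵣ.refl)
              (atom-defines {n} {1} (λ _ → form) (λ _ → polynomial) (var zero ≐ BLp.nilᵗ))
            where
            form = term-form t ++ (-ᶠ term-form u)
            polynomial = term-constant t ⊕ ⊝ term-constant u
            difference : ∀ ρ → ⟦ form ⟧ ρ + ⟪ polynomial ⟫ ≈ eval 𝓜 (Vec.tabulate ρ) t + - eval 𝓜 (Vec.tabulate ρ) u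
            difference ρ = trans (+-cong (trans (⟦⟧-++ (term-form t) (-ᶠ term-form u) ρ) (+-congˡ (⟦-⟧ (term-form u) ρ)))
                (trans (⟪⟫.to-+ (term-constant t) (⊝ term-constant u)) (+-congˡ (⟪⟫.to-neg (term-constant u)))))
              (trans (S.solve 4 (λ a b c d → (a S.:+ S.:- b) S.:+ (c S.:+ S.:- d) S.:= (a S.:+ c) S.:+ S.:- (b S.:+ d)) refl
                  (⟦ term-form t ⟧ ρ) (⟦ term-form u ⟧ ρ) ⟪ term-constant t ⟫ ⟪ term-constant u ⟫)
                (sym (+-cong (eval-tabulate ρ t) (-‿cong (eval-tabulate ρ u)))))

          relation-defines : ∀ {n k} (ts : Vec (Term Lpzᵉ n) k) σ → Defines (atomᵈ ts σ)
            (λ ρ → Σ[ c ∈ Vec Fᵣ.Carrier k ] Pointwise IsConstant (evals 𝓜 (Vec.tabulate ρ) ts) c × 𝓕 ⊨ σ [ c ])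
          relation-defines {n} {k} ts σ = defines-⇔
            (λ ρ (c , eq , h) → Vec.tabulate c , pointwise⁺ (Vec.tabulate ρ) ts (Vec.tabulate c) (λ i → trans (eval-tabulate ρ (Vec.lookup ts i))
              (trans (eq i) (reflexive (≡.cong κ.to (≡.sym (Vec.lookup∘tabulate c i)))))) , h)
            (λ ρ (c , eq , h) → Vec.lookup c , (λ i → trans (sym (eval-tabulate ρ (Vec.lookup ts i))) (pointwise⁻ (Vec.tabulate ρ) ts eq i))
              , ≡.subst (λ c → 𝓕 ⊨ σ [ c ]) (≡.sym (Vec.tabulate∘lookup c)) h)
            (atom-defines (λ i → term-form (Vec.lookup ts i)) (λ i → term-constant (Vec.lookup ts i)) σ)

        defining-defines : ∀ {n} (φ : Formula Lpzᵉ n) → Defines (defining φ) (λ ρ → 𝓜 ⊨ φ [ Vec.tabulate ρ ])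
        defining-defines (t ≐ u)                     = equation-defines t u
        defining-defines (rel (base inF) (t ∷ []))   = defines-⇔
          (λ { ρ (c ∷ [] , eq ∷ [] , _) → inF⁺ _ (c , eq) }) (λ ρ h → let c , eq = inF⁻ _ h in c ∷ [] , eq ∷ [] , Fᵣ.refl) (relation-defines (t ∷ []) CLp.trueᶠ)
        defining-defines (rel (P σ) ts)              = defines-⇔ (λ ρ → P⁺ σ _) (λ ρ → P⁻ σ _) (relation-defines ts σ)
        defining-defines (neg φ)                     = negation-defines (defining-defines φ)
        defining-defines (φ ∧ᶠ ψ)                    = ∧-defines (defining-defines φ) (defining-defines ψ)
        defining-defines (φ ∨ᶠ ψ)                    = ∨-defines (defining-defines φ) (defining-defines ψ)
        defining-defines (φ ⇒ᶠ ψ)                    = ⇒-defines (defining-defines φ) (defining-defines ψ)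
        defining-defines (all φ)                     = defines-⇔ (λ ρ ¬∃¬ x → stable (em (𝓜 ⊨ φ [ x ∷ Vec.tabulate ρ ])) (λ ¬h → ¬∃¬ (x , ¬h)))
          (λ ρ ∀h (x , ¬h) → ¬h (∀h x)) (negation-defines (exists-defines (negation-defines (defining-defines φ))))
          where
          stable : ∀ {Q : Set a} → Dec Q → ¬ ¬ Q → Q
          stable (yes q) _   = q
          stable (no ¬q) ¬¬q = ⊥-elim (¬¬q ¬q)
        defining-defines (ex φ)                      = exists-defines (defining-defines φ)

        module _ {n} (φ : Formula Lpzᵉ n) where
          existential-equivalent⁺ : ∀ v → 𝓜 ⊨ φ [ v ] → 𝓜 ⊨ ToFormula.existential-formula (defining φ) [ v ]
          existential-equivalent⁺ v h = existential⁺ (defining-defines φ) v (≡.subst (λ v → 𝓜 ⊨ φ [ v ]) (≡.sym (Vec.tabulate∘lookup v)) h)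

          existential-equivalent⁻ : ∀ v → 𝓜 ⊨ ToFormula.existential-formula (defining φ) [ v ] → 𝓜 ⊨ φ [ v ]
          existential-equivalent⁻ v h = ≡.subst (λ v → 𝓜 ⊨ φ [ v ]) (Vec.tabulate∘lookup v) (existential⁻ (defining-defines φ) v h)

        module _ (φ : Formula Lpzᵉ 0) where
          sentence-equivalent⁺ : 𝓜 ⊨ φ [ [] ] → 𝓕 ⊨ ToFormula.sentence (defining φ) [ [] ]
          sentence-equivalent⁺ = sentence⁺ (defining-defines φ) (λ ())

          sentence-equivalent⁻ : 𝓕 ⊨ ToFormula.sentence (defining φ) [ [] ] → 𝓜 ⊨ φ [ [] ]
          sentence-equivalent⁻ = sentence⁻ (defining-defines φ) (λ ())

-- The given field and the theorem.

open import Defs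
open import Algebra.Morphism.Structures using (module RingMorphisms)
open import Axiom.ExcludedMiddle using (ExcludedMiddle)
open import Function.Bundles using (_⇔_; mk⇔)

module Instance (p : ℕ) (p-prime : Prime p) (S : List (Polynomial.Poly (𝔽 p))) (irreducible : All (Polynomial.IrreduciblePoly (𝔽 p)) S) where
  private
    module PF = PrimeField p p-prime

  𝕜 : PrimeCoefficients p-prime
  𝕜 = record { field-𝔽ₚ = PF.field-𝔽ₚ ; char = PF.char ; fermat = PF.fermat ; natural = PF.natural ; natural-≈ = PF.natural-≈ ; repetition = PF.repetition }

  private
    module P where
      open PolynomialRing PF.𝔽ₚ public
      open Degree PF.𝔽ₚ public
      open FieldPolynomials PF.field-𝔽ₚ public

    product : P.Poly
    product = foldr P._⊗_ P.PR.1# S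

    unwrap : ∀ f → f P.≈ᴾ [] → RawRing._≈_ (Polynomial.polyRing (𝔽 p)) f []
    unwrap f f≈0 n = PF.divisible (≡.subst (PF._≈ ℤ.0ℤ) (same-coefficient f n) (P.at f≈0 n))
      where
      same-coefficient : ∀ f n → P.coeff f n ≡ Polynomial.coeff (𝔽 p) f n
      same-coefficient []      n       = ≡.refl
      same-coefficient (c ∷ f) zero    = ≡.refl
      same-coefficient (c ∷ f) (suc n) = same-coefficient f n

    nonzero : ∀ {f} → Polynomial.IrreduciblePoly (𝔽 p) f → ¬ f P.≈ᴾ []
    nonzero {f} irr f≈0 = irreducible-≉0 (𝔽 p) (λ 0≈1 → DecidableField.1≉0 PF.field-𝔽ₚ (CommutativeRing.sym PF.𝔽ₚ (PF.congruent 0≈1))) irr (unwrap f f≈0)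

    product-≉0 : ∀ {S} → All (Polynomial.IrreduciblePoly (𝔽 p)) S → ¬ foldr P._⊗_ P.PR.1# S P.≈ᴾ []
    product-≉0 []           = λ 1≈0 → DecidableField.1≉0 PF.field-𝔽ₚ (P.at 1≈0 0)
    product-≉0 (irr ∷ irrs) = P.⊗-≉0 (nonzero irr) (product-≉0 irrs)

  -- Inverting the product inverts every element of S, so a single polynomial s represents S; the
  -- unit `u` makes it monic.
  record MonicProduct : Set where
    field
      degree     : ℕ
      s          : P.Poly
      u          : ℤ.ℤ
      monic      : P.Monic degree s
      u≉0        : ¬ u PF.≈ ℤ.0ℤ
      normalized : product P.≈ᴾ (P.const u P.⊗ s)

  monic-product : MonicProduct
  monic-product with P.leading? product
  ... | P.vanishes product≈0 = ⊥-elim (product-≉0 irreducible product≈0)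
  ... | P.has-leading d s u monic u≉0 product≈ = record { degree = d ; s = s ; u = u ; monic = monic ; u≉0 = u≉0 ; normalized = product≈ }

  open MonicProduct monic-product public

  setup : Setup
  setup = record { p = p ; p-prime = p-prime ; 𝕜 = 𝕜 ; s = s ; ds = degree ; s-monic = monic }

  definition : ∀ {n} → Formula Lpzᵉ n → QuantifierElimination.Definition setup (Fin n)
  definition = QuantifierElimination.defining setup

  existential : ∀ {n} → Formula Lpzᵉ n → Formula Lpzᵉ n
  existential φ = QuantifierElimination.ToFormula.existential-formula setup (definition φ)

  existential-existential : ∀ {n} (φ : Formula Lpzᵉ n) → Existential (existential φ)
  existential-existential φ = QuantifierElimination.ToFormula.is-existential setup (definition φ)

  field-sentence : Formula Lpzᵉ 0 → Formula Lp 0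
  field-sentence φ = QuantifierElimination.ToFormula.sentence setup (definition φ)

  module Interpretation {a} (F : Field a) (E : AlgebraicExtension p F)
    (irreducible-F : All (Polynomial.IrreduciblePoly (Field.rawRing F)) (map (AlgebraicExtension.extend E) S)) (em : ExcludedMiddle a) where
    open AlgebraicExtension E renaming (ι to ι₀)
    private
      module F = Field F
      module ι₀ = RingMorphisms.IsRingHomomorphism ι-homo

    ι : RingHom PF.𝔽ₚ F.commutativeRing
    ι = record { to = ι₀ ; to-cong = λ x≈y → ι₀.⟦⟧-cong (PF.divisible x≈y) ; to-+ = ι₀.+-homo ; to-* = ι₀.*-homo ; to-1 = ι₀.1#-homo }

    private
      algebraic′ : ∀ x → Σ[ f ∈ P.Poly ] (¬ f P.≈ᴾ [] × Evaluation.ev ι x f F.≈ F.0#)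
      algebraic′ x = let f , f≉0 , fx≈0 = algebraic x in
        f , (λ f≈0 → f≉0 (unwrap f f≈0)) , ≡.subst (F._≈ F.0#) (evaluate-ev f) fx≈0
        where
        evaluate-ev : ∀ f → Polynomial.evaluate F.rawRing (map ι₀ f) x ≡ Evaluation.ev ι x f
        evaluate-ev []      = ≡.refl
        evaluate-ev (c ∷ f) = ≡.cong (λ y → ι₀ c F.+ x F.* y) (evaluate-ev f)

    model : Model 𝕜 s a
    model = FractionModel.model 𝕜 F (λ x y → em) ι S
      (All.map⁻ (All.map (λ irr → irreducible-≉0 F.rawRing (λ 0≈1 → F.1≉0 (F.sym 0≈1)) irr) irreducible-F)) (λ Q → em) algebraic′ {s} {u} u≉0 normalized

    private
      R = Model.R model
      𝓜 = 𝓡 p F (map extend S)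
      functions = λ {k} → funR p F (map extend S) {k}
      relations = λ {k} → relR p F (map extend S) {k}

    interpreted : QuantifierElimination.InModel.Correct.Interpreted setup model functions relations
    interpreted = record
      { base-fun   = λ f v → CommutativeRing.refl R {⟦ f ⟧Lp p (RawRing.rawSemiring (CommutativeRing.rawRing R)) v}
      ; z-mult-fun = λ x → CommutativeRing.refl R {CommutativeRing._*_ R (Model.z model) x}
      ; inF⁺ = λ x h → h ; inF⁻ = λ x h → h ; P⁺ = λ σ v h → h ; P⁻ = λ σ v h → h }

    existential-equivalent : ∀ {n} (φ : Formula Lpzᵉ n) v → (𝓜 ⊨ φ [ v ]) ⇔ (𝓜 ⊨ existential φ [ v ])
    existential-equivalent φ v = mk⇔
      (QuantifierElimination.InModel.Correct.existential-equivalent⁺ setup model functions relations interpreted φ v)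
      (QuantifierElimination.InModel.Correct.existential-equivalent⁻ setup model functions relations interpreted φ v)

    sentence-equivalent : ∀ (φ : Formula Lpzᵉ 0) v → (𝓜 ⊨ φ [ v ]) ⇔ (𝓜 ⊨ P-sentence (field-sentence φ) [ v ])
    sentence-equivalent φ [] = mk⇔
      (λ h → [] , [] , QuantifierElimination.InModel.Correct.sentence-equivalent⁺ setup model functions relations interpreted φ h)
      (λ { ([] , [] , h) → QuantifierElimination.InModel.Correct.sentence-equivalent⁻ setup model functions relations interpreted φ h })

theorem1p1 :
  ∀ {a} (p : ℕ) → Prime p →
  (F : Field a) (E : AlgebraicExtension p F) →
  let open AlgebraicExtension E using (extend) in
  (S : List (Polynomial.Poly (𝔽 p))) →
  All (Polynomial.IrreduciblePoly (𝔽 p)) S →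
  All (Polynomial.IrreduciblePoly (Field.rawRing F)) (map extend S) →
  EffectivelyModelComplete (𝓡 p F (map extend S)) ×
  ((φ : Sentence Lpzᵉ) → Σ[ σ ∈ Sentence Lp ] Equivalent (𝓡 p F (map extend S)) φ (P-sentence σ))
theorem1p1 p p-prime F E S irreducible irreducible-F =
  -- The algorithm is given by p and S; the field and excluded middle enter the proofs of
  -- equivalence.
  ( Instance.existential p p-prime S irreducible
  , λ φ → Instance.existential-existential p p-prime S irreducible φ
        , λ em v → Instance.Interpretation.existential-equivalent p p-prime S irreducible F E irreducible-F em φ v ) ,
  λ φ → Instance.field-sentence p p-prime S irreducible φ
      , λ em v → Instance.Interpretation.sentence-equivalent p p-prime S irreducible F E irreducible-F em φ v
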